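{- For even $n\ge 4$ let $\mu_{\min}(n)$ denote the minimum of the algebraic connectivity $\mu(G)$ over all connected cubic (i.e. $3$-regular) simple graphs $G$ on $n$ vertices. Then, as $n\to\infty$ through even integers, $$\mu_{\min}(n)=(1+o(1))\frac{2\pi^2}{n^2}.$$
   Context: All graphs are simple (undirected, without loops or multiple edges) and finite. For a graph $G$ with adjacency matrix $A$ and diagonal degree matrix $D$, the Laplacian matrix is $L(G)=D-A$, and the algebraic connectivity $\mu(G)$ is the second smallest eigenvalue of $L(G)$ (eigenvalues counted with multiplicity). For a regular graph $\mu(G)$ equals the spectral gap, i.e. the difference between the two largest eigenvalues of $A$. -}

module Defs where

open import Algebra.Bundles.Raw using (RawRing)
import Algebra.Definitions.RawSemiring as RawSemiringDefs
open import Data.Bool using (Bool; false; T; if_then_else_)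
open import Data.Fin using (Fin; zero; suc; toℕ; punchIn)
import Data.Fin as Fin
import Data.Fin.Properties as Fin
open import Data.Fin.Subset using (∣_∣)
open import Data.Integer using (ℤ; +_; +[1+_])
import Data.Integer as ℤ
import Data.Integer.Properties as ℤ
open import Data.Nat using (ℕ; zero; suc; z≤n; s≤s)
import Data.Nat as ℕ
import Data.Nat.Properties as ℕ
open import Data.Nat.Divisibility using (_∣_)
open import Data.Product using (∃; Σ-syntax; _×_; _,_; proj₁; proj₂)
open import Data.Rational using (ℚ; mkℚ; 0ℚ; 1ℚ; ½; _+_; _*_; _-_; -_; _≤_; _<_; _/_; 1/_; toℚᵘ; fromℚᵘ; positive; nonNegative)
import Data.Rational as ℚ
open import Data.Rational.Properties
open import Data.Rational.Solver using (module +-*-Solver)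
open import Data.Rational.Unnormalised using (mkℚᵘ; *≤*)
open import Data.Vec using (tabulate)
open import Data.Vec.Functional using (Vector)
open import Level using (0ℓ)
open import Relation.Binary.Construct.Closure.ReflexiveTransitive using (Star)
open import Relation.Binary.PropositionalEquality using (_≡_; refl; sym; trans; cong; cong₂; subst)
open import Relation.Nullary.Decidable using (does)

open +-*-Solver using (solve; _:+_; _:-_; :-_; _:=_)

-- A real number is a Cauchy sequence of rationals; equality of reals is
-- the relation _≈_, not _≡_.

Cauchy : (ℕ → ℚ) → Set
Cauchy f = ∀ ε → 0ℚ < ε → ∃ λ N → ∀ m n → N ℕ.≤ m → N ℕ.≤ n → ℚ.∣ f m - f n ∣ ≤ ε

record ℝ : Set where
  constructor mkℝ
  field
    seq    : ℕ → ℚ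
    cauchy : Cauchy seq

open ℝ public

infix 4 _≈_ _≤ᴿ_

_≈_ : ℝ → ℝ → Set
x ≈ y = ∀ ε → 0ℚ < ε → ∃ λ N → ∀ n → N ℕ.≤ n → ℚ.∣ seq x n - seq y n ∣ ≤ ε

_≤ᴿ_ : ℝ → ℝ → Set
x ≤ᴿ y = ∀ ε → 0ℚ < ε → ∃ λ N → ∀ n → N ℕ.≤ n → seq x n ≤ seq y n + ε

private
  half : ∀ {ε} → 0ℚ < ε → 0ℚ < ε * ½
  half {ε} 0<ε = subst (_< ε * ½) (*-zeroˡ ½) (*-monoˡ-<-pos ½ 0<ε)

  halves : ∀ ε → ε * ½ + ε * ½ ≡ ε
  halves ε = trans (sym (*-distribˡ-+ ε ½ ½)) (*-identityʳ ε)

  distance-sym : ∀ p q → ℚ.∣ p - q ∣ ≡ ℚ.∣ q - p ∣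
  distance-sym p q = trans (cong ℚ.∣_∣ (solve 2 (λ p q → p :- q := :- (q :- p)) refl p q)) (∣-p∣≡∣p∣ (q - p))

  triangle : ∀ p q r {a b} → ℚ.∣ p - q ∣ ≤ a → ℚ.∣ q - r ∣ ≤ b → ℚ.∣ p - r ∣ ≤ a + b
  triangle p q r p~q q~r =
    ≤-trans
      (≤-reflexive (cong ℚ.∣_∣ (solve 3 (λ p q r → p :- r := (p :- q) :+ (q :- r)) refl p q r)))
      (≤-trans (∣p+q∣≤∣p∣+∣q∣ (p - q) (q - r)) (+-mono-≤ p~q q~r))

  *-distribˡ-- : ∀ p q r → p * (q - r) ≡ p * q - p * r
  *-distribˡ-- p q r = trans (*-distribˡ-+ p q (- r)) (cong (λ z → p * q + z) (sym (neg-distribʳ-* p r)))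

  cauchy-const : ∀ q → Cauchy (λ _ → q)
  cauchy-const q ε 0<ε = 0 , λ _ _ _ _ →
    ≤-trans (≤-reflexive (cong ℚ.∣_∣ (+-inverseʳ q))) (<⇒≤ 0<ε)

  cauchy-+ : ∀ f g → Cauchy f → Cauchy g → Cauchy (λ n → f n + g n)
  cauchy-+ f g cf cg ε 0<ε with cf (ε * ½) (half 0<ε) | cg (ε * ½) (half 0<ε)
  ... | M , f-close | N , g-close = M ℕ.⊔ N , λ m n ≤m ≤n →
    subst (ℚ.∣ (f m + g m) - (f n + g n) ∣ ≤_) (halves ε)
      (≤-trans
        (≤-reflexive (cong ℚ.∣_∣ (solve 4 (λ a b c d → (a :+ b) :- (c :+ d) := (a :- c) :+ (b :- d)) refl (f m) (g m) (f n) (g n))))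
        (≤-trans (∣p+q∣≤∣p∣+∣q∣ (f m - f n) (g m - g n))
          (+-mono-≤
            (f-close m n (ℕ.≤-trans (ℕ.m≤m⊔n M N) ≤m) (ℕ.≤-trans (ℕ.m≤m⊔n M N) ≤n))
            (g-close m n (ℕ.≤-trans (ℕ.m≤n⊔m M N) ≤m) (ℕ.≤-trans (ℕ.m≤n⊔m M N) ≤n)))))

  cauchy-neg : ∀ f → Cauchy f → Cauchy (λ n → - f n)
  cauchy-neg f cf ε 0<ε with cf ε 0<ε
  ... | N , close = N , λ m n ≤m ≤n →
    ≤-trans
      (≤-reflexive (cong ℚ.∣_∣ (solve 2 (λ p q → (:- p) :- (:- q) := q :- p) refl (f m) (f n))))
      (close n m ≤n ≤m)

  bounded : ∀ f → Cauchy f → ∃ λ B → 0ℚ < B × ∃ λ N → ∀ n → N ℕ.≤ n → ℚ.∣ f n ∣ ≤ B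
  bounded f cf with cf 1ℚ (positive⁻¹ 1ℚ)
  ... | N , close = B , 0<B , N , λ n N≤n →
    ≤-trans
      (≤-reflexive (cong ℚ.∣_∣ (solve 2 (λ p q → p := q :+ (p :- q)) refl (f n) (f N))))
      (≤-trans (∣p+q∣≤∣p∣+∣q∣ (f N) (f n - f N))
        (+-monoʳ-≤ ℚ.∣ f N ∣ (close n N N≤n ℕ.≤-refl)))
    where
    B   = ℚ.∣ f N ∣ + 1ℚ
    0<B = +-mono-≤-< (0≤∣p∣ (f N)) (positive⁻¹ 1ℚ)

  -- δ is chosen with B * δ = ε / 2
  shrink : ∀ B ε → 0ℚ < B → 0ℚ < ε → ∃ λ δ → 0ℚ < δ × B * δ ≡ ε * ½
  shrink B ε 0<B 0<ε = 1/B * (ε * ½) , 0<δ , eq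
    where
    instance
      B-pos = positive 0<B
      B≢0   = pos⇒nonZero B
    1/B = 1/ B
    instance
      1/B-pos = 1/pos⇒pos B
    0<δ : 0ℚ < 1/B * (ε * ½)
    0<δ = subst (_< 1/B * (ε * ½)) (*-zeroʳ 1/B) (*-monoʳ-<-pos 1/B (half 0<ε))
    eq : B * (1/B * (ε * ½)) ≡ ε * ½
    eq = trans (sym (*-assoc B 1/B (ε * ½)))
               (trans (cong (_* (ε * ½)) (*-inverseʳ B)) (*-identityˡ (ε * ½)))

  product-≤ : ∀ {a b} p q → 0ℚ ≤ a → ℚ.∣ p ∣ ≤ a → ℚ.∣ q ∣ ≤ b → ℚ.∣ p * q ∣ ≤ a * b
  product-≤ {a} {b} p q 0≤a p≤a q≤b =
    ≤-trans (≤-reflexive (∣p*q∣≡∣p∣*∣q∣ p q))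
      (≤-trans (*-monoʳ-≤-nonNeg ℚ.∣ q ∣ {{∣-∣-nonNeg q}} p≤a)
               (*-monoˡ-≤-nonNeg a {{nonNegative 0≤a}} q≤b))

  product-close : ∀ a b c d {B C δ η} → 0ℚ < B → 0ℚ < C →
    ℚ.∣ a ∣ ≤ B → ℚ.∣ b - d ∣ ≤ δ → ℚ.∣ d ∣ ≤ C → ℚ.∣ a - c ∣ ≤ η →
    ℚ.∣ a * b - c * d ∣ ≤ B * δ + C * η
  product-close a b c d {B} {C} {δ} {η} 0<B 0<C a≤B b~d d≤C a~c =
    triangle (a * b) (a * d) (c * d)
      (subst (λ z → ℚ.∣ z ∣ ≤ B * δ) (*-distribˡ-- a b d) (product-≤ a (b - d) (<⇒≤ 0<B) a≤B b~d))
      (subst (λ z → ℚ.∣ z ∣ ≤ C * η)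
        (trans (*-distribˡ-- d a c) (cong₂ _-_ (*-comm d a) (*-comm d c)))
        (product-≤ d (a - c) (<⇒≤ 0<C) d≤C a~c))

  cauchy-* : ∀ f g → Cauchy f → Cauchy g → Cauchy (λ n → f n * g n)
  cauchy-* f g cf cg ε 0<ε =
    let B , 0<B , K , f≤B = bounded f cf
        C , 0<C , L , g≤C = bounded g cg
        δ , 0<δ , Bδ = shrink B ε 0<B 0<ε
        η , 0<η , Cη = shrink C ε 0<C 0<ε
        M , f-close = cf η 0<η
        N , g-close = cg δ 0<δ
        K≤ = ℕ.≤-trans (ℕ.m≤m⊔n K L) (ℕ.m≤m⊔n (K ℕ.⊔ L) (M ℕ.⊔ N))
        L≤ = ℕ.≤-trans (ℕ.m≤n⊔m K L) (ℕ.m≤m⊔n (K ℕ.⊔ L) (M ℕ.⊔ N))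
        M≤ = ℕ.≤-trans (ℕ.m≤m⊔n M N) (ℕ.m≤n⊔m (K ℕ.⊔ L) (M ℕ.⊔ N))
        N≤ = ℕ.≤-trans (ℕ.m≤n⊔m M N) (ℕ.m≤n⊔m (K ℕ.⊔ L) (M ℕ.⊔ N))
    in (K ℕ.⊔ L) ℕ.⊔ (M ℕ.⊔ N) , λ m n ≤m ≤n →
      ≤-trans
        (product-close (f m) (g m) (f n) (g n) 0<B 0<C (f≤B m (ℕ.≤-trans K≤ ≤m)) (g-close m n (ℕ.≤-trans N≤ ≤m) (ℕ.≤-trans N≤ ≤n))
                               (g≤C n (ℕ.≤-trans L≤ ≤n)) (f-close m n (ℕ.≤-trans M≤ ≤m) (ℕ.≤-trans M≤ ≤n)))
        (≤-reflexive (trans (cong₂ _+_ Bδ Cη) (halves ε)))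

fromℚ : ℚ → ℝ
fromℚ q = mkℝ (λ _ → q) (cauchy-const q)

fromℤ : ℤ → ℝ
fromℤ z = fromℚ (z / 1)

infixl 6 _+ᴿ_
infixl 7 _*ᴿ_
infix  8 -ᴿ_

_+ᴿ_ : ℝ → ℝ → ℝ
x +ᴿ y = mkℝ (λ n → seq x n + seq y n) (cauchy-+ (seq x) (seq y) (cauchy x) (cauchy y))

_*ᴿ_ : ℝ → ℝ → ℝ
x *ᴿ y = mkℝ (λ n → seq x n * seq y n) (cauchy-* (seq x) (seq y) (cauchy x) (cauchy y))

-ᴿ_ : ℝ → ℝ
-ᴿ x = mkℝ (λ n → - seq x n) (cauchy-neg (seq x) (cauchy x))

0ᴿ 1ᴿ : ℝ
0ᴿ = fromℚ 0ℚ
1ᴿ = fromℚ 1ℚ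

ℝ-rawRing : RawRing 0ℓ 0ℓ
ℝ-rawRing = record
  { Carrier = ℝ
  ; _≈_     = _≈_
  ; _+_     = _+ᴿ_
  ; _*_     = _*ᴿ_
  ; -_      = -ᴿ_
  ; 0#      = 0ᴿ
  ; 1#      = 1ᴿ
  }

-- π is the sum of the Leibniz series 4 - 4/3 + 4/5 - 4/7 + ⋯

leibnizSign : ℕ → ℚ
leibnizSign zero    = 1ℚ
leibnizSign (suc k) = - leibnizSign k

leibnizTerm : ℕ → ℚ
leibnizTerm k = + 4 / suc (2 ℕ.* k)

leibnizSum : ℕ → ℚ
leibnizSum zero    = 0ℚ
leibnizSum (suc n) = leibnizSum n + leibnizSign n * leibnizTerm n

private
  term-antitone : ∀ {a b} → a ℕ.≤ b → + 4 / suc b ≤ + 4 / suc a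
  term-antitone {a} {b} a≤b = toℚᵘ-cancel-≤ (ℚᵘ.≤-respʳ-≃ (ℚᵘ.≃-sym (toℚᵘ-fromℚᵘ (mkℚᵘ (+ 4) a)))
    (ℚᵘ.≤-respˡ-≃ (ℚᵘ.≃-sym (toℚᵘ-fromℚᵘ (mkℚᵘ (+ 4) b)))
      (*≤* (ℤ.*-monoˡ-≤-nonNeg (+ 4) (ℤ.+≤+ (s≤s a≤b))))))
    where import Data.Rational.Unnormalised.Properties as ℚᵘ

  term-nonNeg : ∀ k → 0ℚ ≤ leibnizTerm k
  term-nonNeg k = toℚᵘ-cancel-≤ (ℚᵘ.≤-respʳ-≃ (ℚᵘ.≃-sym (toℚᵘ-fromℚᵘ (mkℚᵘ (+ 4) (2 ℕ.* k))))
    (*≤* (ℤ.+≤+ z≤n)))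
    where import Data.Rational.Unnormalised.Properties as ℚᵘ

  -- tail n d = aₙ - aₙ₊₁ + ⋯ ± aₙ₊d₋₁
  tail : ℕ → ℕ → ℚ
  tail n zero    = 0ℚ
  tail n (suc d) = leibnizTerm n - tail (suc n) d

  tail-bounds : ∀ n d → 0ℚ ≤ tail n d × tail n d ≤ leibnizTerm n
  tail-bounds n zero    = ≤-refl , term-nonNeg n
  tail-bounds n (suc d) with tail-bounds (suc n) d
  ... | 0≤t , t≤a =
      ≤-trans (≤-reflexive (sym (+-inverseʳ t)))
        (+-monoˡ-≤ (- t) (≤-trans t≤a (term-antitone (ℕ.*-monoʳ-≤ 2 (ℕ.n≤1+n n)))))
    , ≤-trans (+-monoʳ-≤ (leibnizTerm n) (neg-antimono-≤ 0≤t)) (≤-reflexive (+-identityʳ (leibnizTerm n)))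
    where t = tail (suc n) d

  sum-split : ∀ n d → leibnizSum (n ℕ.+ d) ≡ leibnizSum n + leibnizSign n * tail n d
  sum-split n zero = trans (cong leibnizSum (ℕ.+-identityʳ n))
    (sym (trans (cong (λ z → leibnizSum n + z) (*-zeroʳ (leibnizSign n))) (+-identityʳ (leibnizSum n))))
  sum-split n (suc d) = trans (cong leibnizSum (ℕ.+-suc n d)) (trans (sum-split (suc n) d)
    (trans (+-assoc S (s * a) (- s * t))
      (cong (λ z → S + z) (trans (cong (λ z → s * a + z) (sym (neg-distribˡ-* s t))) (sym (*-distribˡ-- s a t))))))
    where
    S = leibnizSum n
    s = leibnizSign n
    a = leibnizTerm n
    t = tail (suc n) d

  ∣sign∣≡1 : ∀ n → ℚ.∣ leibnizSign n ∣ ≡ 1ℚ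
  ∣sign∣≡1 zero    = refl
  ∣sign∣≡1 (suc n) = trans (∣-p∣≡∣p∣ (leibnizSign n)) (∣sign∣≡1 n)

  sum-close : ∀ N n → N ℕ.≤ n → ℚ.∣ leibnizSum n - leibnizSum N ∣ ≤ leibnizTerm N
  sum-close N n N≤n with ℕ.m≤n⇒∃[o]m+o≡n N≤n
  ... | d , refl = begin
    ℚ.∣ leibnizSum (N ℕ.+ d) - leibnizSum N ∣
      ≡⟨ cong (λ z → ℚ.∣ z - leibnizSum N ∣) (sum-split N d) ⟩
    ℚ.∣ (leibnizSum N + leibnizSign N * tail N d) - leibnizSum N ∣
      ≡⟨ cong ℚ.∣_∣ (solve 2 (λ S x → (S :+ x) :- S := x) refl (leibnizSum N) (leibnizSign N * tail N d)) ⟩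
    ℚ.∣ leibnizSign N * tail N d ∣
      ≡⟨ ∣p*q∣≡∣p∣*∣q∣ (leibnizSign N) (tail N d) ⟩
    ℚ.∣ leibnizSign N ∣ * ℚ.∣ tail N d ∣
      ≡⟨ cong₂ _*_ (∣sign∣≡1 N) (0≤p⇒∣p∣≡p (proj₁ (tail-bounds N d))) ⟩
    1ℚ * tail N d
      ≡⟨ *-identityˡ (tail N d) ⟩
    tail N d
      ≤⟨ proj₂ (tail-bounds N d) ⟩
    leibnizTerm N ∎
    where open ≤-Reasoning

  term-small : ∀ ε → 0ℚ < ε → ∃ λ N → leibnizTerm N ≤ ε
  term-small ε@(mkℚ +[1+ p ] d _) _ = 2 ℕ.* suc d ,
    toℚᵘ-cancel-≤ (ℚᵘ.≤-respˡ-≃ (ℚᵘ.≃-sym (toℚᵘ-fromℚᵘ (mkℚᵘ (+ 4) (2 ℕ.* (2 ℕ.* suc d)))))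
      (*≤* (ℤ.+≤+ bound)))
    where
    import Data.Rational.Unnormalised.Properties as ℚᵘ
    bound : 4 ℕ.* suc d ℕ.≤ suc p ℕ.* suc (2 ℕ.* (2 ℕ.* suc d))
    bound = ℕ.≤-trans (ℕ.≤-reflexive (ℕ.*-assoc 2 2 (suc d)))
      (ℕ.≤-trans (ℕ.n≤1+n _) (ℕ.m≤n*m (suc (2 ℕ.* (2 ℕ.* suc d))) (suc p)))
  term-small (mkℚ (+ 0)      _ _) (ℚ.*<* (ℤ.+<+ ()))
  term-small (mkℚ ℤ.-[1+ _ ] _ _) (ℚ.*<* ())

  cauchy-leibniz : Cauchy leibnizSum
  cauchy-leibniz ε 0<ε with term-small (ε * ½) (half 0<ε)
  ... | N , aN≤ = N , λ m n N≤m N≤n → subst (ℚ.∣ leibnizSum m - leibnizSum n ∣ ≤_) (halves ε)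
    (triangle (leibnizSum m) (leibnizSum N) (leibnizSum n)
      (≤-trans (sum-close N m N≤m) aN≤)
      (≤-trans (≤-reflexive (distance-sym (leibnizSum N) (leibnizSum n))) (≤-trans (sum-close N n N≤n) aN≤)))

π : ℝ
π = mkℝ leibnizSum cauchy-leibniz

Matrix : Set → ℕ → Set
Matrix A n = Fin n → Fin n → A

module _ (R : RawRing 0ℓ 0ℓ) where
  open RawRing R using (Carrier; rawSemiring) renaming (_*_ to _·_; -_ to ⊖_; 1# to 1R)
  open RawSemiringDefs rawSemiring using (sum; _^_)

  -- Laplace expansion along the first row
  det : ∀ {n} → Matrix Carrier n → Carrier
  det {zero}  M = 1R
  det {suc n} M = sum λ j → (⊖ 1R) ^ toℕ j · M zero j · det (λ i k → M (suc i) (punchIn j k))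

open RawSemiringDefs (RawRing.rawSemiring ℝ-rawRing) using (product)

scalar : ∀ {n} → ℝ → Matrix ℝ n
scalar x i j = if does (i Fin.≟ j) then x else 0ᴿ

-- The characteristic polynomial det (x I - M), as a function of x : ℝ.
charPoly : ∀ {n} → Matrix ℝ n → ℝ → ℝ
charPoly M x = det ℝ-rawRing (λ i j → scalar x i j +ᴿ -ᴿ M i j)

-- The eigenvalues are repeated according to multiplicity, as the roots of
-- the characteristic polynomial: det (x I - M) = ∏ᵢ (x - λᵢ).
IsSpectrum : ∀ {n} → Matrix ℝ n → Vector ℝ n → Set
IsSpectrum M eigenvalue =
  (∀ i j → i Fin.≤ j → eigenvalue i ≤ᴿ eigenvalue j) ×
  (∀ x → charPoly M x ≈ product (λ i → x +ᴿ -ᴿ eigenvalue i))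

record Graph (n : ℕ) : Set where
  field
    adjacent  : Matrix Bool n
    symmetric : ∀ i j → adjacent i j ≡ adjacent j i
    loopless  : ∀ i → adjacent i i ≡ false

  degree : Fin n → ℕ
  degree i = ∣ tabulate (adjacent i) ∣

  Connected : Set
  Connected = ∀ i j → Star (λ u v → T (adjacent u v)) i j

  Cubic : Set
  Cubic = ∀ i → degree i ≡ 3

  adjacencyMatrix : Matrix ℤ n
  adjacencyMatrix i j = if adjacent i j then + 1 else + 0

  degreeMatrix : Matrix ℤ n
  degreeMatrix i j = if does (i Fin.≟ j) then + degree i else + 0

  laplacian : Matrix ℤ n
  laplacian i j = degreeMatrix i j ℤ.- adjacencyMatrix i j

open Graph public using (Connected; Cubic; laplacian)

-- The entry with index 1 of the (0-indexed) increasing list of eigenvalues.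
IsAlgebraicConnectivity : ∀ {n} → Graph n → ℝ → Set
IsAlgebraicConnectivity {n} G μ =
  Σ[ eigenvalue ∈ Vector ℝ n ]
    IsSpectrum (λ i j → fromℤ (laplacian G i j)) eigenvalue ×
    Σ[ i ∈ Fin n ] toℕ i ≡ 1 × μ ≈ eigenvalue i

CubicConnectivity : ℕ → ℝ → Set
CubicConnectivity n μ = Σ[ G ∈ Graph n ] Connected G × Cubic G × IsAlgebraicConnectivity G μ

IsMinimum : (ℝ → Set) → ℝ → Set
IsMinimum P m = P m × (∀ x → P x → m ≤ᴿ x)

VanishesAlongEven : (ℕ → ℝ) → Set
VanishesAlongEven r = ∀ ε → 0ℚ < ε →
  ∃ λ N → ∀ n → 2 ∣ n → N ℕ.≤ n → fromℚ (- ε) ≤ᴿ r n × r n ≤ᴿ fromℚ ε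

2π²/[_]² : (n : ℕ) → .{{ℕ.NonZero n}} → ℝ
2π²/[ n ]² = fromℚ (+ 2 / (n ℕ.* n)) *ᴿ (π *ᴿ π)
  where instance _ = ℕ.m*n≢0 n n

{-# OPTIONS --safe #-}

-- Both bounds come from comparing G with a path. Order the vertices of a connected cubic graph by the entries
-- of f with Σ f = 0. Counting the edges across the n − 1 cuts (their sizes c k ≥ 1 satisfy:
-- c k + c (k + 1) is odd, c k + c (k + 2) ≥ 4) shows that the energy of f is at least that of a path on n / 2 vertices, so a
-- positive solution of s (k + 1) + s (k − 1) = (2 − ℓ) s k on that path gives μ ≥ 2 ℓ / (4 + ℓ). Conversely, a chain
-- of diamonds (K₄ minus an edge) closed by two small ends admits test functions built from two bumps of such a
-- solution, and μ ≤ 2 ℓ / (4 − ℓ). For ℓ = 4 t² / (1 + t²) the solution is s k = sin (2 k arctan t), with rational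
-- values for rational t; how long it stays positive is read off the partial sums of the Leibniz series,
-- arctan 1 = π / 4, and t = π / n balances both bounds at 2 π² / n².
-- The eigenvalues of the upper bound exist constructively as limits of sorted diagonals in the Jacobi algorithm.

module Submission where

open import Defs
open import Algebra.Bundles using (CommutativeRing)
open import Data.Bool using (Bool; true; false; if_then_else_; not; _xor_)
import Data.Bool as Bool
open import Data.Bool.Properties using () renaming (_≟_ to _≟ᵇ_)
open import Data.Empty using (⊥; ⊥-elim)
open import Data.Fin using (Fin; zero; suc; toℕ; punchIn; punchOut; inject₁)
import Data.Fin as Fin
open import Data.Fin.Subset using (∣_∣)
import Data.Fin.Properties as Fin
open import Data.Fin.Permutation using (Permutation′; _⟨$⟩ʳ_; _⟨$⟩ˡ_)
import Data.Fin.Permutation as Perm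
open import Data.Integer using (+_)
import Data.Integer as ℤ
import Data.Integer.Properties as ℤ
open import Data.Nat using (ℕ; zero; suc; NonZero; z≤n; s≤s)
import Data.Nat as ℕ
import Data.Nat.Properties as ℕ
open import Data.Nat.Divisibility using (_∣_; divides)
open import Data.Product using (∃; ∃₂; Σ; Σ-syntax; _×_; _,_; proj₁; proj₂)
open import Data.Rational using (ℚ; mkℚ; 0ℚ; 1ℚ; ½; _+_; _*_; _-_; -_; _≤_; _<_; _/_; 1/_; Positive; positive; nonNegative; toℚᵘ)
import Data.Rational as ℚ
open import Data.Rational.Properties
import Data.Rational.Unnormalised as ℚᵘ
import Data.Rational.Unnormalised.Properties as ℚᵘ
open import Data.Sum using (_⊎_; inj₁; inj₂; [_,_]′)
open import Data.Unit using (tt)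
open import Data.Vec using (Vec; []; _∷_; lookup; tabulate)
open import Data.Vec.Functional using (Vector)
open import Function using (_∘_; id)
open import Relation.Binary.Construct.Closure.ReflexiveTransitive using (Star; _◅_; _◅◅_)
import Relation.Binary.Construct.Closure.ReflexiveTransitive as Star
open import Relation.Binary.Definitions using (tri<; tri≈; tri>)
open import Relation.Binary.PropositionalEquality using (_≡_; _≢_; refl; sym; trans; cong; cong₂; subst; subst₂; module ≡-Reasoning)
open import Relation.Nullary using (¬_; Dec; yes; no)
open import Relation.Nullary.Decidable using (does; dec⇒maybe; dec-true; dec-false; toWitness; _×-dec_)
open import Relation.Nullary.Negation using (contradiction)
open import Tactic.RingSolver using (solve-∀)
open import Tactic.RingSolver.Core.AlmostCommutativeRing using (AlmostCommutativeRing; fromCommutativeRing)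
open import Level using (0ℓ)
open import Algebra.Properties.Semiring.Sum (CommutativeRing.semiring +-*-commutativeRing)
  using (sum; sum-cong-≗; sum-replicate-zero; ∑-distrib-+; ∑-comm; sum-permute; *-distribˡ-sum; *-distribʳ-sum)
open import Algebra.Definitions.RawSemiring +-*-rawSemiring using (product; _^_)
open import Algebra.Properties.CommutativeMonoid.Sum *-1-commutativeMonoid using () renaming (sum-permute to product-permute)
import Algebra.Definitions.RawSemiring as RawSemiringDefs
import Algebra.Bundles.Raw as Raw
import Algebra.Properties.Semiring.Sum ℕ.+-*-semiring as ℕΣ
open import Data.Nat.Tactic.RingSolver using () renaming (solve-∀ to solve-ℕ)

-- A real is a bare Cauchy sequence, so the proof avoids square roots, sines and eigenvectors: it
-- computes with rational matrices and rational rotations. A spectrum is known only through its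
-- characteristic polynomial, and the lower bound must hold for every spectrum, so the spectral gap
-- is carried over by determinants. With J the all-ones matrix, det (x I - L - J) stays away from 0
-- for x below the gap, and x times it equals (x - n) det (x I - L); hence at most one root can lie
-- there. The path has n / 2 vertices by parity. Pair the vertices as (2j, 2j + 1): a cut between
-- pairs is even, hence at least 2, while a cut inside a pair may be a bridge. The midpoints of the
-- pairs then behave like a path of unit edges; the part of the norm of f that they miss is bounded
-- by the energy itself, whence 4 + ℓ. Conversely a diamond with its middle vertices averaged acts
-- as one unit edge although it has four vertices, and the averaging loss is the source of 4 - ℓ. A
-- path on N = n / 2 vertices has ℓ close to π² / N², and both bounds are close to ℓ / 2.

-- Arithmetic and order of the rationals.

ringℚ : AlmostCommutativeRing 0ℓ 0ℓ
ringℚ = fromCommutativeRing +-*-commutativeRing (λ x → dec⇒maybe (0ℚ ≟ x))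

-- Defined by recursion so that `ι (suc n)` unfolds to `1ℚ + ι n` inside ring identities, whereas
-- `+ n / 1` would first normalise a fraction.
ι : ℕ → ℚ
ι zero    = 0ℚ
ι (suc n) = 1ℚ + ι n

2ℚ 3ℚ 4ℚ : ℚ
2ℚ = ι 2
3ℚ = ι 3
4ℚ = ι 4

-- The standard way to prove an inequality below: r is a certificate, a combination of visibly
-- nonnegative terms, and the identity q - p ≡ r is left to the ring solver.
from-diff : ∀ {p q r} → 0ℚ ≤ r → q - p ≡ r → p ≤ q
from-diff {p} {q} {r} 0≤r eq = begin
  p             ≡⟨ +-identityʳ p ⟨
  p + 0ℚ        ≤⟨ +-monoʳ-≤ p 0≤r ⟩
  p + r         ≡⟨ cong (λ z → p + z) eq ⟨
  p + (q - p)   ≡⟨ cancel p q ⟩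
  q             ∎
  where
  open ≤-Reasoning
  cancel : ∀ p q → p + (q - p) ≡ q
  cancel = solve-∀ ringℚ

from-diff-< : ∀ {p q r} → 0ℚ < r → q - p ≡ r → p < q
from-diff-< {p} {q} {r} 0<r eq = begin-strict
  p             ≡⟨ +-identityʳ p ⟨
  p + 0ℚ        <⟨ +-monoʳ-< p 0<r ⟩
  p + r         ≡⟨ cong (λ z → p + z) eq ⟨
  p + (q - p)   ≡⟨ cancel p q ⟩
  q             ∎
  where
  open ≤-Reasoning
  cancel : ∀ p q → p + (q - p) ≡ q
  cancel = solve-∀ ringℚ

diff : ∀ {p q} → p ≤ q → 0ℚ ≤ q - p
diff {p} p≤q = ≤-trans (≤-reflexive (sym (+-inverseʳ p))) (+-monoˡ-≤ (- p) p≤q)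

diff-< : ∀ {p q} → p < q → 0ℚ < q - p
diff-< {p} p<q = ≤-<-trans (≤-reflexive (sym (+-inverseʳ p))) (+-monoˡ-< (- p) p<q)

0≤+ : ∀ {p q} → 0ℚ ≤ p → 0ℚ ≤ q → 0ℚ ≤ p + q
0≤+ = +-mono-≤

0≤* : ∀ {p q} → 0ℚ ≤ p → 0ℚ ≤ q → 0ℚ ≤ p * q
0≤* {p} {q} 0≤p 0≤q = ≤-trans (≤-reflexive (sym (*-zeroʳ p))) (*-monoˡ-≤-nonNeg p {{nonNegative 0≤p}} 0≤q)

0<* : ∀ {p q} → 0ℚ < p → 0ℚ < q → 0ℚ < p * q
0<* {p} {q} 0<p 0<q = ≤-<-trans (≤-reflexive (sym (*-zeroʳ p))) (*-monoʳ-<-pos p {{positive 0<p}} 0<q)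

0≤sq : ∀ p → 0ℚ ≤ p * p
0≤sq p with ≤-total 0ℚ p
... | inj₁ 0≤p = 0≤* 0≤p 0≤p
... | inj₂ p≤0 = subst (0ℚ ≤_) (square p) (0≤* (neg-antimono-≤ p≤0) (neg-antimono-≤ p≤0))
  where
  square : ∀ p → (- p) * (- p) ≡ p * p
  square = solve-∀ ringℚ

0<sq : ∀ {p} → p ≢ 0ℚ → 0ℚ < p * p
0<sq {p} p≢0 with <-cmp 0ℚ p
... | tri< 0<p _ _ = 0<* 0<p 0<p
... | tri≈ _ 0≡p _ = contradiction (sym 0≡p) p≢0
... | tri> _ _ p<0 = subst (0ℚ <_) (square p) (0<* (neg-antimono-< p<0) (neg-antimono-< p<0))
  where
  square : ∀ p → (- p) * (- p) ≡ p * p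
  square = solve-∀ ringℚ

*-mono-≤ : ∀ {p q r s} → 0ℚ ≤ r → 0ℚ ≤ q → p ≤ q → r ≤ s → p * r ≤ q * s
*-mono-≤ {p} {q} {r} 0≤r 0≤q p≤q r≤s =
  ≤-trans (*-monoʳ-≤-nonNeg r {{nonNegative 0≤r}} p≤q) (*-monoˡ-≤-nonNeg q {{nonNegative 0≤q}} r≤s)

*-monoˡ : ∀ {p q r} → 0ℚ ≤ r → p ≤ q → r * p ≤ r * q
*-monoˡ {r = r} 0≤r = *-monoˡ-≤-nonNeg r {{nonNegative 0≤r}}

*-cancelˡ : ∀ {p q r} → 0ℚ < r → r * p ≤ r * q → p ≤ q
*-cancelˡ {r = r} 0<r = *-cancelˡ-≤-pos r {{positive 0<r}}

abs-≤ : ∀ {p q} → p ≤ q → - q ≤ p → ℚ.∣ p ∣ ≤ q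
abs-≤ {p} {q} p≤q -q≤p with ∣p∣≡p∨∣p∣≡-p p
... | inj₁ eq = ≤-trans (≤-reflexive eq) p≤q
... | inj₂ eq = ≤-trans (≤-reflexive eq) (≤-trans (neg-antimono-≤ -q≤p) (≤-reflexive (neg-involutive q)))
  where
  neg-involutive : ∀ q → - (- q) ≡ q
  neg-involutive = solve-∀ ringℚ

p≤∣p∣ : ∀ p → p ≤ ℚ.∣ p ∣
p≤∣p∣ p with ≤-total 0ℚ p
... | inj₁ 0≤p = ≤-reflexive (sym (0≤p⇒∣p∣≡p 0≤p))
... | inj₂ p≤0 = ≤-trans p≤0 (0≤∣p∣ p)

-∣p∣≤p : ∀ p → - ℚ.∣ p ∣ ≤ p
-∣p∣≤p p = subst (_≤ p) (cong -_ (∣-p∣≡∣p∣ p)) (≤-trans (neg-antimono-≤ (p≤∣p∣ (- p))) (≤-reflexive (neg-involutive p)))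
  where
  neg-involutive : ∀ q → - (- q) ≡ q
  neg-involutive = solve-∀ ringℚ

∣p∣²≡p² : ∀ p → ℚ.∣ p ∣ * ℚ.∣ p ∣ ≡ p * p
∣p∣²≡p² p = trans (sym (∣p*q∣≡∣p∣*∣q∣ p p)) (0≤p⇒∣p∣≡p (0≤sq p))

≤-≮ : ∀ {p q} → p ≤ q → ¬ (q < p)
≤-≮ p≤q q<p = <-irrefl refl (≤-<-trans p≤q q<p)

sq-cancel-≤ : ∀ {p q} → 0ℚ ≤ q → p * p ≤ q * q → p ≤ q
sq-cancel-≤ {p} {q} 0≤q pp≤qq with p ≤? q
... | yes p≤q = p≤q
... | no p≰q = contradiction (from-diff-< (0<* (diff-< q<p) (+-mono-≤-< 0≤q (≤-<-trans 0≤q q<p))) (factor p q)) (≤-≮ pp≤qq)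
  where
  q<p = ≰⇒> p≰q
  factor : ∀ p q → p * p - q * q ≡ (p - q) * (q + p)
  factor = solve-∀ ringℚ

abs-sq-≤ : ∀ {p q} → 0ℚ ≤ q → p * p ≤ q * q → ℚ.∣ p ∣ ≤ q
abs-sq-≤ {p} 0≤q pp≤qq = sq-cancel-≤ 0≤q (≤-trans (≤-reflexive (∣p∣²≡p² p)) pp≤qq)

abs-triangle : ∀ p q r → ℚ.∣ p - r ∣ ≤ ℚ.∣ p - q ∣ + ℚ.∣ q - r ∣
abs-triangle p q r = ≤-trans (≤-reflexive (cong ℚ.∣_∣ (split p q r))) (∣p+q∣≤∣p∣+∣q∣ (p - q) (q - r))
  where
  split : ∀ p q r → p - r ≡ (p - q) + (q - r)
  split = solve-∀ ringℚ

abs-swap : ∀ p q → ℚ.∣ p - q ∣ ≡ ℚ.∣ q - p ∣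
abs-swap p q = trans (cong ℚ.∣_∣ (swap p q)) (∣-p∣≡∣p∣ (q - p))
  where
  swap : ∀ p q → p - q ≡ - (q - p)
  swap = solve-∀ ringℚ

abs*-≤ : ∀ {p q a b} → ℚ.∣ p ∣ ≤ a → ℚ.∣ q ∣ ≤ b → ℚ.∣ p * q ∣ ≤ a * b
abs*-≤ {p} {q} p≤a q≤b = ≤-trans (≤-reflexive (∣p*q∣≡∣p∣*∣q∣ p q))
  (*-mono-≤ (0≤∣p∣ q) (≤-trans (0≤∣p∣ p) p≤a) p≤a q≤b)

abs+-≤ : ∀ {p q a b} → ℚ.∣ p ∣ ≤ a → ℚ.∣ q ∣ ≤ b → ℚ.∣ p + q ∣ ≤ a + b
abs+-≤ {p} {q} p≤a q≤b = ≤-trans (∣p+q∣≤∣p∣+∣q∣ p q) (+-mono-≤ p≤a q≤b)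

recip : ∀ {p} → 0ℚ < p → ℚ
recip {p} 0<p = (1/ p) {{pos⇒nonZero p {{positive 0<p}}}}

recip-inverse : ∀ {p} (0<p : 0ℚ < p) → p * recip 0<p ≡ 1ℚ
recip-inverse {p} 0<p = *-inverseʳ p {{pos⇒nonZero p {{positive 0<p}}}}

recip-pos : ∀ {p} (0<p : 0ℚ < p) → 0ℚ < recip 0<p
recip-pos {p} 0<p = positive⁻¹ (recip 0<p) {{1/pos⇒pos p {{positive 0<p}}}}

ι-+ : ∀ m n → ι (m ℕ.+ n) ≡ ι m + ι n
ι-+ zero    n = sym (+-identityˡ (ι n))
ι-+ (suc m) n = trans (cong (λ z → 1ℚ + z) (ι-+ m n)) (sym (+-assoc 1ℚ (ι m) (ι n)))

ι-* : ∀ m n → ι (m ℕ.* n) ≡ ι m * ι n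
ι-* zero    n = sym (*-zeroˡ (ι n))
ι-* (suc m) n = trans (ι-+ n (m ℕ.* n)) (trans (cong (λ z → ι n + z) (ι-* m n)) (step (ι m) (ι n)))
  where
  step : ∀ x y → y + x * y ≡ (1ℚ + x) * y
  step = solve-∀ ringℚ

0≤ι : ∀ n → 0ℚ ≤ ι n
0≤ι zero    = ≤-refl
0≤ι (suc n) = +-mono-≤ (nonNegative⁻¹ 1ℚ) (0≤ι n)

ι-mono-≤ : ∀ {m n} → m ℕ.≤ n → ι m ≤ ι n
ι-mono-≤ {n = n} z≤n = 0≤ι n
ι-mono-≤ (s≤s m≤n)   = +-monoʳ-≤ 1ℚ (ι-mono-≤ m≤n)

0<ι : ∀ n → 0ℚ < ι (suc n)
0<ι n = +-mono-<-≤ (positive⁻¹ 1ℚ) (0≤ι n)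

ι-toℚᵘ : ∀ n → toℚᵘ (ι n) ℚᵘ.≃ ℚᵘ.mkℚᵘ (+ n) 0
ι-toℚᵘ zero    = ℚᵘ.*≡* refl
ι-toℚᵘ (suc n) = ℚᵘ.≃-trans (toℚᵘ-homo-+ 1ℚ (ι n)) (ℚᵘ.≃-trans (ℚᵘ.+-congʳ (toℚᵘ 1ℚ) (ι-toℚᵘ n))
  (ℚᵘ.*≡* (cong (ℤ._* + 1) (cong₂ ℤ._+_ (ℤ.*-identityʳ (+ 1)) (ℤ.*-identityʳ (+ n))))))

ι≡/ : ∀ n → ι n ≡ + n / 1
ι≡/ n = toℚᵘ-injective (ℚᵘ.≃-trans (ι-toℚᵘ n) (ℚᵘ.≃-sym (toℚᵘ-fromℚᵘ (ℚᵘ.mkℚᵘ (+ n) 0))))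

archimedean : ∀ p → ∃ λ n → p ≤ ι n
archimedean p@(mkℚ (+ a) d _) = a , toℚᵘ-cancel-≤ (ℚᵘ.≤-respʳ-≃ (ℚᵘ.≃-sym (ι-toℚᵘ a))
  (ℚᵘ.*≤* (subst (λ z → + a ℤ.* + 1 ℤ.≤ z) (ℤ.pos-* a (suc d)) (subst (ℤ._≤ + (a ℕ.* suc d)) (sym (ℤ.*-identityʳ (+ a))) (ℤ.+≤+ (ℕ.m≤m*n a (suc d)))))))
archimedean p@(mkℚ ℤ.-[1+ a ] d _) = 0 , <⇒≤ (negative⁻¹ p)

-- c / n becomes small: the form in which all limits in n are taken.
eventually-small : ∀ c {δ} → 0ℚ < δ → ∃ λ n₀ → ∀ n → n₀ ℕ.≤ n → c ≤ δ * ι n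
eventually-small c {δ} 0<δ with archimedean (recip 0<δ * c)
... | n₀ , bound = n₀ , λ n n₀≤n → begin
  c                       ≡⟨ *-identityˡ c ⟨
  1ℚ * c                  ≡⟨ cong (_* c) (recip-inverse 0<δ) ⟨
  δ * recip 0<δ * c       ≡⟨ *-assoc δ (recip 0<δ) c ⟩
  δ * (recip 0<δ * c)     ≤⟨ *-monoˡ (<⇒≤ 0<δ) (≤-trans bound (ι-mono-≤ n₀≤n)) ⟩
  δ * ι n                 ∎
  where open ≤-Reasoning

-- Finite sums.

sum-cong : ∀ {n} {f g : Vector ℚ n} → (∀ i → f i ≡ g i) → sum f ≡ sum g
sum-cong = sum-cong-≗

sum-mono : ∀ {n} {f g : Vector ℚ n} → (∀ i → f i ≤ g i) → sum f ≤ sum g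
sum-mono {zero}  f≤g = ≤-refl
sum-mono {suc n} f≤g = +-mono-≤ (f≤g zero) (sum-mono (f≤g ∘ suc))

sum-nonneg : ∀ {n} {f : Vector ℚ n} → (∀ i → 0ℚ ≤ f i) → 0ℚ ≤ sum f
sum-nonneg {n} 0≤f = ≤-trans (≤-reflexive (sym (sum-replicate-zero n))) (sum-mono 0≤f)

sum-zero : ∀ {n} {f : Vector ℚ n} → (∀ i → f i ≡ 0ℚ) → sum f ≡ 0ℚ
sum-zero {n} f≡0 = trans (sum-cong f≡0) (sum-replicate-zero n)

sum-+ : ∀ {n} (f g : Vector ℚ n) → sum (λ i → f i + g i) ≡ sum f + sum g
sum-+ = ∑-distrib-+

sum-*ˡ : ∀ {n} c (f : Vector ℚ n) → sum (λ i → c * f i) ≡ c * sum f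
sum-*ˡ c f = sym (*-distribˡ-sum c f)

sum-*ʳ : ∀ {n} c (f : Vector ℚ n) → sum (λ i → f i * c) ≡ sum f * c
sum-*ʳ c f = sym (*-distribʳ-sum c f)

sum-linear : ∀ {n} a b (f g : Vector ℚ n) → sum (λ i → a * f i + b * g i) ≡ a * sum f + b * sum g
sum-linear a b f g = trans (sum-+ (λ i → a * f i) (λ i → b * g i)) (cong₂ _+_ (sum-*ˡ a f) (sum-*ˡ b g))

sum-neg : ∀ {n} (f : Vector ℚ n) → sum (λ i → - f i) ≡ - sum f
sum-neg {zero}  f = refl
sum-neg {suc n} f = trans (cong (λ z → - f zero + z) (sum-neg (f ∘ suc))) (sym (neg-distrib-+ (f zero) (sum (f ∘ suc))))

sum-const : ∀ n c → sum {n} (λ _ → c) ≡ ι n * c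
sum-const zero    c = sym (*-zeroˡ c)
sum-const (suc n) c = trans (cong (λ z → c + z) (sum-const n c)) (trans (step c (ι n)) refl)
  where
  step : ∀ c k → c + k * c ≡ (1ℚ + k) * c
  step = solve-∀ ringℚ

abs-sum-≤ : ∀ {n} (f : Vector ℚ n) → ℚ.∣ sum f ∣ ≤ sum (λ i → ℚ.∣ f i ∣)
abs-sum-≤ {zero}  f = ≤-refl
abs-sum-≤ {suc n} f = ≤-trans (∣p+q∣≤∣p∣+∣q∣ (f zero) (sum (f ∘ suc))) (+-monoʳ-≤ ℚ.∣ f zero ∣ (abs-sum-≤ (f ∘ suc)))

entry≤sum : ∀ {n} {f : Vector ℚ n} → (∀ i → 0ℚ ≤ f i) → ∀ i → f i ≤ sum f
entry≤sum {suc n} {f} 0≤f zero    = ≤-trans (≤-reflexive (sym (+-identityʳ (f zero)))) (+-monoʳ-≤ (f zero) (sum-nonneg (0≤f ∘ suc)))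
entry≤sum {suc n} {f} 0≤f (suc i) = ≤-trans (≤-reflexive (sym (+-identityˡ (f (suc i))))) (+-mono-≤ (0≤f zero) (entry≤sum (0≤f ∘ suc) i))

δ : ∀ {n} → Fin n → Fin n → ℚ
δ i j = if does (i Fin.≟ j) then 1ℚ else 0ℚ

δ-same : ∀ {n} (i : Fin n) → δ i i ≡ 1ℚ
δ-same i = cong (if_then 1ℚ else 0ℚ) (dec-true (i Fin.≟ i) refl)

δ-diff : ∀ {n} {i j : Fin n} → i ≢ j → δ i j ≡ 0ℚ
δ-diff {i = i} {j} i≢j = cong (if_then 1ℚ else 0ℚ) (dec-false (i Fin.≟ j) i≢j)

sum-δ : ∀ {n} (i : Fin n) (f : Vector ℚ n) → sum (λ j → δ i j * f j) ≡ f i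
sum-δ zero f = trans (cong₂ _+_ (*-identityˡ (f zero)) (sum-zero (λ j → *-zeroˡ (f (suc j))))) (+-identityʳ (f zero))
sum-δ (suc i) f = trans (cong₂ _+_ (*-zeroˡ (f zero)) (sum-δ i (f ∘ suc))) (+-identityˡ (f (suc i)))

-- Determinants of rational matrices.

detℚ : ∀ {n} → Matrix ℚ n → ℚ
detℚ = det +-*-rawRing

sgn : ∀ {n} → Fin n → ℚ
sgn j = (- 1ℚ) ^ toℕ j

minor : ∀ {n} → Matrix ℚ (suc n) → Fin (suc n) → Matrix ℚ n
minor M j i k = M (suc i) (punchIn j k)

det-cong : ∀ {n} {M N : Matrix ℚ n} → (∀ i j → M i j ≡ N i j) → detℚ M ≡ detℚ N
det-cong {zero}  eq = refl
det-cong {suc n} eq = sum-cong λ j → cong₂ _*_ (cong (sgn j *_) (eq zero j)) (det-cong λ i k → eq (suc i) (punchIn j k))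

-- Induction on the size. In the expansion along row 0 the term of column j is linear through its
-- entry, every other term through its minor, in which column j has become column `punchOut l≢j`.
det-linear : ∀ {n} (j : Fin n) a b {M U V : Matrix ℚ n} →
  (∀ i → M i j ≡ a * U i j + b * V i j) →
  (∀ i k → k ≢ j → M i k ≡ U i k) → (∀ i k → k ≢ j → M i k ≡ V i k) →
  detℚ M ≡ a * detℚ U + b * detℚ V
det-linear {suc n} j a b {M} {U} {V} at-j M≡U M≡V =
  trans (sum-cong term) (sum-linear a b (λ l → sgn l * U zero l * detℚ (minor U l)) (λ l → sgn l * V zero l * detℚ (minor V l)))
  where
  column : ∀ s u v d → s * (a * u + b * v) * d ≡ a * (s * u * d) + b * (s * v * d)
  column = linear a b
    where
    linear : ∀ a b s u v d → s * (a * u + b * v) * d ≡ a * (s * u * d) + b * (s * v * d)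
    linear = solve-∀ ringℚ
  rest : ∀ s m d e → s * m * (a * d + b * e) ≡ a * (s * m * d) + b * (s * m * e)
  rest = linear a b
    where
    linear : ∀ a b s m d e → s * m * (a * d + b * e) ≡ a * (s * m * d) + b * (s * m * e)
    linear = solve-∀ ringℚ
  term : ∀ l → sgn l * M zero l * detℚ (minor M l) ≡ a * (sgn l * U zero l * detℚ (minor U l)) + b * (sgn l * V zero l * detℚ (minor V l))
  term l with l Fin.≟ j
  ... | yes refl = trans (cong₂ (λ m d → sgn l * m * d) (at-j zero) refl)
          (trans (column (sgn l) (U zero l) (V zero l) (detℚ (minor M l)))
            (cong₂ (λ d e → a * (sgn l * U zero l * d) + b * (sgn l * V zero l * e))
              (det-cong λ i k → M≡U (suc i) (punchIn l k) (Fin.punchInᵢ≢i l k))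
              (det-cong λ i k → M≡V (suc i) (punchIn l k) (Fin.punchInᵢ≢i l k))))
  ... | no l≢j = trans (cong (sgn l * M zero l *_) (det-linear (punchOut l≢j) a b {minor M l} {minor U l} {minor V l}
            (λ i → subst (λ c → M (suc i) c ≡ a * U (suc i) c + b * V (suc i) c) (sym (Fin.punchIn-punchOut l≢j)) (at-j (suc i)))
            (λ i k k≢ → M≡U (suc i) (punchIn l k) (off k k≢))
            (λ i k k≢ → M≡V (suc i) (punchIn l k) (off k k≢))))
          (trans (rest (sgn l) (M zero l) (detℚ (minor U l)) (detℚ (minor V l)))
            (cong₂ (λ u v → a * (sgn l * u * detℚ (minor U l)) + b * (sgn l * v * detℚ (minor V l)))
              (M≡U zero l l≢j) (M≡V zero l l≢j)))
    where
    off : ∀ k → k ≢ punchOut l≢j → punchIn l k ≢ j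
    off k k≢ eq = k≢ (Fin.punchIn-injective l k (punchOut l≢j) (trans eq (sym (Fin.punchIn-punchOut l≢j))))

sum-two-cancel : ∀ {n} (a b : Fin n) (g : Vector ℚ n) → a ≢ b → g a + g b ≡ 0ℚ →
  (∀ l → l ≢ a → l ≢ b → g l ≡ 0ℚ) → sum g ≡ 0ℚ
sum-two-cancel a b g a≢b ga+gb others =
  trans (sum-cong term) (trans (sum-+ (λ l → δ a l * g l) (λ l → δ b l * g l)) (trans (cong₂ _+_ (sum-δ a g) (sum-δ b g)) ga+gb))
  where
  10x : ∀ x → x ≡ 1ℚ * x + 0ℚ * x
  10x = solve-∀ ringℚ
  01x : ∀ x → x ≡ 0ℚ * x + 1ℚ * x
  01x = solve-∀ ringℚ
  term : ∀ l → g l ≡ δ a l * g l + δ b l * g l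
  term l with l Fin.≟ a
  ... | yes refl = trans (10x (g l)) (cong₂ (λ d e → d * g l + e * g l) (sym (δ-same l)) (sym (δ-diff (a≢b ∘ sym))))
  ... | no l≢a with l Fin.≟ b
  ...   | yes refl = trans (01x (g l)) (cong₂ (λ d e → d * g l + e * g l) (sym (δ-diff a≢b)) (sym (δ-same l)))
  ...   | no l≢b rewrite others l l≢a l≢b = sym (trans (cong₂ _+_ (*-zeroʳ (δ a l)) (*-zeroʳ (δ b l))) refl)

-- Deleting a third column leaves two neighbouring columns neighbours. This is why the alternating
-- property is first proved for adjacent columns.
punchIn-adjacent : ∀ {m} (l : Fin (suc (suc m))) (j : Fin (suc m)) → l ≢ inject₁ j → l ≢ suc j →
  ∃ λ j′ → punchIn l (inject₁ j′) ≡ inject₁ j × punchIn l (suc j′) ≡ suc j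
punchIn-adjacent zero zero l≢ _ = contradiction refl l≢
punchIn-adjacent zero (suc j) _ _ = j , refl , refl
punchIn-adjacent (suc zero) zero _ l≢ = contradiction refl l≢
punchIn-adjacent {suc m} (suc (suc l)) zero _ _ = zero , refl , refl
punchIn-adjacent {suc m} (suc l) (suc j) l≢ l≢′ with punchIn-adjacent l j (l≢ ∘ cong suc) (l≢′ ∘ cong suc)
... | j′ , eq , eq′ = suc j′ , cong suc eq , cong suc eq′

-- Whichever of two neighbouring columns is deleted, the same columns remain, except that the
-- survivor of the pair is a different one.
punchIn-twins : ∀ {m} (j : Fin (suc m)) k → punchIn (inject₁ j) k ≡ punchIn (suc j) k ⊎
  (punchIn (inject₁ j) k ≡ suc j × punchIn (suc j) k ≡ inject₁ j)
punchIn-twins zero zero = inj₂ (refl , refl)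
punchIn-twins zero (suc k) = inj₁ refl
punchIn-twins {suc m} (suc j) zero = inj₁ refl
punchIn-twins {suc m} (suc j) (suc k) with punchIn-twins j k
... | inj₁ eq = inj₁ (cong suc eq)
... | inj₂ (eq , eq′) = inj₂ (cong suc eq , cong suc eq′)

inject₁≢suc : ∀ {n} (j : Fin n) → inject₁ j ≢ suc j
inject₁≢suc j eq = ℕ.1+n≢n (trans (cong toℕ (sym eq)) (Fin.toℕ-inject₁ j))

-- The minors belonging to the two equal columns coincide and enter with opposite signs; every other
-- minor again has two equal adjacent columns.
det-adjacent : ∀ {n} (j : Fin n) (M : Matrix ℚ (suc n)) → (∀ i → M i (inject₁ j) ≡ M i (suc j)) → detℚ M ≡ 0ℚ
det-adjacent {suc m} j M eq = sum-two-cancel (inject₁ j) (suc j) term (inject₁≢suc j) cancel vanish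
  where
  term = λ l → sgn l * M zero l * detℚ (minor M l)
  opposite : ∀ s m d → s * m * d + - 1ℚ * s * m * d ≡ 0ℚ
  opposite = solve-∀ ringℚ
  minors : ∀ i k → minor M (suc j) i k ≡ minor M (inject₁ j) i k
  minors i k with punchIn-twins j k
  ... | inj₁ same = cong (M (suc i)) (sym same)
  ... | inj₂ (p , q) = trans (cong (M (suc i)) q) (trans (eq (suc i)) (cong (M (suc i)) (sym p)))
  cancel : term (inject₁ j) + term (suc j) ≡ 0ℚ
  cancel = trans (cong₂ _+_
      (cong (λ s → (- 1ℚ) ^ s * M zero (inject₁ j) * detℚ (minor M (inject₁ j))) (Fin.toℕ-inject₁ j))
      (cong₂ (λ m d → sgn (suc j) * m * d) (sym (eq zero)) (det-cong minors)))
    (opposite (sgn j) (M zero (inject₁ j)) (detℚ (minor M (inject₁ j))))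
  vanish : ∀ l → l ≢ inject₁ j → l ≢ suc j → term l ≡ 0ℚ
  vanish l l≢ l≢′ with punchIn-adjacent l j l≢ l≢′
  ... | j′ , p , q = trans (cong (sgn l * M zero l *_) (det-adjacent j′ (minor M l)
      (λ i → trans (cong (M (suc i)) p) (trans (eq (suc i)) (cong (M (suc i)) (sym q)))))) (*-zeroʳ (sgn l * M zero l))

put : ∀ {n} → Fin n → Vector ℚ n → Matrix ℚ n → Matrix ℚ n
put p x M i k = if does (k Fin.≟ p) then x i else M i k

put-at : ∀ {n} (p : Fin n) x M i → put p x M i p ≡ x i
put-at p x M i = cong (if_then x i else M i p) (dec-true (p Fin.≟ p) refl)

put-off : ∀ {n} {p k : Fin n} x M i → k ≢ p → put p x M i k ≡ M i k
put-off {p = p} {k} x M i k≢p = cong (if_then x i else M i k) (dec-false (k Fin.≟ p) k≢p)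

put-self : ∀ {n} (p : Fin n) M i k → put p (λ r → M r p) M i k ≡ M i k
put-self p M i k with k Fin.≟ p
... | yes refl = refl
... | no _ = refl

put-cong : ∀ {n} (p : Fin n) {x y : Vector ℚ n} {M N : Matrix ℚ n} → (∀ i → x i ≡ y i) →
  (∀ i k → k ≢ p → M i k ≡ N i k) → ∀ i k → put p x M i k ≡ put p y N i k
put-cong p x≡y M≡N i k with k Fin.≟ p
... | yes _ = x≡y i
... | no k≢p = M≡N i k k≢p

det-put-linear : ∀ {n} (p : Fin n) a b (x y : Vector ℚ n) M →
  detℚ (put p (λ i → a * x i + b * y i) M) ≡ a * detℚ (put p x M) + b * detℚ (put p y M)
det-put-linear p a b x y M = det-linear p a b
  (λ i → trans (put-at p z M i) (cong₂ (λ u v → a * u + b * v) (sym (put-at p x M i)) (sym (put-at p y M i))))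
  (λ i k k≢p → trans (put-off z M i k≢p) (sym (put-off x M i k≢p)))
  (λ i k k≢p → trans (put-off z M i k≢p) (sym (put-off y M i k≢p)))
  where z = λ i → a * x i + b * y i

Alternating : ∀ {n} → Fin n → Fin n → Set
Alternating p q = ∀ M → (∀ i → M i p ≡ M i q) → detℚ M ≡ 0ℚ

-- Polarisation: D (x + y) (x + y), D x x and D y y all vanish. The coefficients `1ℚ` are there to
-- fit the form of `det-put-linear`.
det-put-antisym : ∀ {n} {p q : Fin n} → p ≢ q → Alternating p q → ∀ x y M →
  detℚ (put p x (put q y M)) ≡ - detℚ (put p y (put q x M))
det-put-antisym {n} {p} {q} p≢q alt x y M = from-sum (D x y) (D y x) (begin
    D x y + D y x                               ≡⟨ pad (D x y) (D y x) ⟩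
    1ℚ * (1ℚ * 0ℚ + 1ℚ * D x y) + 1ℚ * (1ℚ * D y x + 1ℚ * 0ℚ)
      ≡⟨ cong₂ (λ a b → 1ℚ * (1ℚ * a + 1ℚ * D x y) + 1ℚ * (1ℚ * D y x + 1ℚ * b)) (diag x) (diag y) ⟨
    1ℚ * (1ℚ * D x x + 1ℚ * D x y) + 1ℚ * (1ℚ * D y x + 1ℚ * D y y)
      ≡⟨ cong₂ (λ a b → 1ℚ * a + 1ℚ * b) (linearʳ x) (linearʳ y) ⟨
    1ℚ * D x s + 1ℚ * D y s                     ≡⟨ det-put-linear p 1ℚ 1ℚ x y (put q s M) ⟨
    D s s                                       ≡⟨ diag s ⟩
    0ℚ                                          ∎)
  where
  open ≡-Reasoning
  D = λ x y → detℚ (put p x (put q y M))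
  s = λ i → 1ℚ * x i + 1ℚ * y i
  pad : ∀ a b → a + b ≡ 1ℚ * (1ℚ * 0ℚ + 1ℚ * a) + 1ℚ * (1ℚ * b + 1ℚ * 0ℚ)
  pad = solve-∀ ringℚ
  from-sum : ∀ a b → a + b ≡ 0ℚ → a ≡ - b
  from-sum a b eq = trans (shift a b) (trans (cong (_- b) eq) (+-identityˡ (- b)))
    where
    shift : ∀ a b → a ≡ (a + b) - b
    shift = solve-∀ ringℚ
  diag : ∀ z → D z z ≡ 0ℚ
  diag z = alt (put p z (put q z M)) λ i → trans (put-at p z (put q z M) i) (sym (trans (put-off z (put q z M) i (p≢q ∘ sym)) (put-at q z M i)))
  exchange : ∀ u v i k → put p u (put q v M) i k ≡ put q v (put p u M) i k
  exchange u v i k with k Fin.≟ p | k Fin.≟ q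
  ... | yes k≡p | yes k≡q = contradiction (trans (sym k≡p) k≡q) p≢q
  ... | yes k≡p | no _ = refl
  ... | no _    | yes _ = refl
  ... | no _    | no _ = refl
  linearʳ : ∀ u → D u s ≡ 1ℚ * D u x + 1ℚ * D u y
  linearʳ u = trans (det-cong (exchange u s)) (trans (det-put-linear q 1ℚ 1ℚ x y (put p u M))
    (cong₂ (λ a b → 1ℚ * a + 1ℚ * b) (sym (det-cong (exchange u x))) (sym (det-cong (exchange u y)))))

det-put-put-self : ∀ {n} (p q : Fin n) M → detℚ (put p (λ i → M i p) (put q (λ i → M i q) M)) ≡ detℚ M
det-put-put-self p q M = det-cong λ i k → trans
  (put-cong p {x = λ i → M i p} {M = put q (λ i → M i q) M} (λ _ → refl) (λ i k _ → put-self q M i k) i k) (put-self p M i k)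

-- Induction on the larger index: exchanging columns q and q + 1 costs a sign and brings the copy of
-- column p to position q, where the induction hypothesis applies.
alternating-< : ∀ {n} (q p : Fin n) → p Fin.< q → Alternating p q
alternating-< {suc n} = <-weakInduction (λ q → ∀ p → p Fin.< q → Alternating p q) (λ p ()) step
  where
  open import Data.Fin.Induction using (<-weakInduction)
  step : ∀ (q : Fin n) → (∀ p → p Fin.< inject₁ q → Alternating p (inject₁ q)) → ∀ p → p Fin.< suc q → Alternating p (suc q)
  step q IH p p<q M eq with p Fin.≟ inject₁ q
  ... | yes refl = det-adjacent q M eq
  ... | no p≢q = begin
    detℚ M                                                ≡⟨ det-put-put-self (inject₁ q) (suc q) M ⟨
    detℚ (put (inject₁ q) u (put (suc q) v M))            ≡⟨ det-put-antisym (inject₁≢suc q) (λ N → det-adjacent q N) u v M ⟩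
    - detℚ (put (inject₁ q) v (put (suc q) u M))          ≡⟨ cong -_ (IH p p<q′ (put (inject₁ q) v (put (suc q) u M)) same) ⟩
    0ℚ                                                    ∎
    where
    open ≡-Reasoning
    u = λ i → M i (inject₁ q)
    v = λ i → M i (suc q)
    p<q′ : p Fin.< inject₁ q
    p<q′ = subst (toℕ p ℕ.<_) (sym (Fin.toℕ-inject₁ q))
      (ℕ.≤∧≢⇒< (ℕ.s≤s⁻¹ p<q) λ eq → p≢q (Fin.toℕ-injective (trans eq (sym (Fin.toℕ-inject₁ q)))))
    same : ∀ i → put (inject₁ q) v (put (suc q) u M) i p ≡ put (inject₁ q) v (put (suc q) u M) i (inject₁ q)
    same i = trans (put-off v N i p≢q) (trans (put-off u M i (λ p≡ → ℕ.<⇒≢ p<q (cong toℕ p≡)))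
      (trans (eq i) (sym (put-at (inject₁ q) v N i))))
      where N = put (suc q) u M

alternating : ∀ {n} {p q : Fin n} → p ≢ q → Alternating p q
alternating {p = p} {q} p≢q M eq with Fin.<-cmp p q
... | tri< p<q _ _ = alternating-< q p p<q M eq
... | tri≈ _ p≡q _ = contradiction p≡q p≢q
... | tri> _ _ q<p = alternating-< p q q<p M (sym ∘ eq)

-- Meant for a plane rotation, whose factor ad - bc is 1. After expanding in both columns the terms
-- with a repeated column drop out and the other two differ by a sign.
det-two-columns : ∀ {n} {p q : Fin n} → p ≢ q → ∀ a b c d (M : Matrix ℚ n) →
  detℚ (put p (λ i → a * M i p + b * M i q) (put q (λ i → c * M i p + d * M i q) M)) ≡ (a * d - b * c) * detℚ M
det-two-columns {n} {p} {q} p≢q a b c d M = begin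
  D (λ i → a * u i + b * v i) w           ≡⟨ det-put-linear p a b u v (put q w M) ⟩
  a * D u w + b * D v w                   ≡⟨ cong₂ (λ x y → a * x + b * y) (second u) (second v) ⟩
  a * (c * D u u + d * D u v) + b * (c * D v u + d * D v v)
    ≡⟨ cong₂ (λ x y → a * (c * x + d * D u v) + b * (c * D v u + d * y)) (diag u) (diag v) ⟩
  a * (c * 0ℚ + d * D u v) + b * (c * D v u + d * 0ℚ)
    ≡⟨ cong (λ x → a * (c * 0ℚ + d * D u v) + b * (c * x + d * 0ℚ)) (det-put-antisym p≢q (alternating p≢q) v u M) ⟩
  a * (c * 0ℚ + d * D u v) + b * (c * - D u v + d * 0ℚ)  ≡⟨ collect a b c d (D u v) ⟩
  (a * d - b * c) * D u v                 ≡⟨ cong ((a * d - b * c) *_) (det-put-put-self p q M) ⟩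
  (a * d - b * c) * detℚ M                ∎
  where
  open ≡-Reasoning
  u = λ i → M i p
  v = λ i → M i q
  w = λ i → c * u i + d * v i
  D = λ x y → detℚ (put p x (put q y M))
  collect : ∀ a b c d e → a * (c * 0ℚ + d * e) + b * (c * - e + d * 0ℚ) ≡ (a * d - b * c) * e
  collect = solve-∀ ringℚ
  diag : ∀ z → D z z ≡ 0ℚ
  diag z = alternating p≢q (put p z (put q z M)) λ i → trans (put-at p z (put q z M) i) (sym (trans (put-off z (put q z M) i (p≢q ∘ sym)) (put-at q z M i)))
  neg-linear : ∀ c d x y → - (c * x + d * y) ≡ c * - x + d * - y
  neg-linear = solve-∀ ringℚ
  antisym = det-put-antisym p≢q (alternating p≢q)
  second : ∀ x → D x w ≡ c * D x u + d * D x v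
  second x = begin
    D x w                                 ≡⟨ antisym x w M ⟩
    - D w x                               ≡⟨ cong -_ (det-put-linear p c d u v (put q x M)) ⟩
    - (c * D u x + d * D v x)             ≡⟨ neg-linear c d (D u x) (D v x) ⟩
    c * - D u x + d * - D v x             ≡⟨ cong₂ (λ y z → c * y + d * z) (antisym x u M) (antisym x v M) ⟨
    c * D x u + d * D x v                 ∎

det-put-sum : ∀ {n} (p : Fin n) {m} (w : Vector ℚ m) (X : Fin m → Vector ℚ n) (M : Matrix ℚ n) →
  detℚ (put p (λ i → sum λ k → w k * X k i) M) ≡ sum λ k → w k * detℚ (put p (X k) M)
det-put-sum p {zero} w X M = trans (det-put-linear-0 (λ i → 0ℚ)) (zero-combination (detℚ (put p (λ _ → 0ℚ) M)))
  where
  zero-combination : ∀ d → 0ℚ * d + 0ℚ * d ≡ 0ℚ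
  zero-combination = solve-∀ ringℚ
  det-put-linear-0 : ∀ (x : Vector ℚ _) → detℚ (put p (λ i → 0ℚ * x i + 0ℚ * x i) M) ≡ 0ℚ * detℚ (put p x M) + 0ℚ * detℚ (put p x M)
  det-put-linear-0 x = det-put-linear p 0ℚ 0ℚ x x M
det-put-sum p {suc m} w X M = begin
  detℚ (put p (λ i → w zero * X zero i + rest i) M)
    ≡⟨ det-cong (put-cong p {M = M} {N = M} (λ i → cong (λ z → w zero * X zero i + z) (sym (*-identityˡ (rest i)))) (λ _ _ _ → refl)) ⟩
  detℚ (put p (λ i → w zero * X zero i + 1ℚ * rest i) M)
    ≡⟨ det-put-linear p (w zero) 1ℚ (X zero) rest M ⟩
  w zero * detℚ (put p (X zero) M) + 1ℚ * detℚ (put p rest M)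
    ≡⟨ cong (λ z → w zero * detℚ (put p (X zero) M) + z) (trans (*-identityˡ _) (det-put-sum p (w ∘ suc) (X ∘ suc) M)) ⟩
  w zero * detℚ (put p (X zero) M) + sum (λ k → w (suc k) * detℚ (put p (X (suc k)) M)) ∎
  where
  open ≡-Reasoning
  rest = λ i → sum λ k → w (suc k) * X (suc k) i

-- The mechanism of Cramer's rule: every summand other than the p-th repeats a column of M.
det-put-combination : ∀ {n} (p : Fin n) (w : Vector ℚ n) M →
  detℚ (put p (λ i → sum λ k → w k * M i k) M) ≡ w p * detℚ M
det-put-combination p w M = trans (det-put-sum p w (λ k i → M i k) M)
  (trans (sum-cong term) (trans (sum-δ p (λ k → w k * detℚ M)) refl))
  where
  term : ∀ k → w k * detℚ (put p (λ i → M i k) M) ≡ δ p k * (w k * detℚ M)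
  term k with k Fin.≟ p
  ... | yes refl = trans (cong (w k *_) (det-cong (put-self k M))) (sym (trans (cong (_* (w k * detℚ M)) (δ-same k)) (*-identityˡ (w k * detℚ M))))
  ... | no k≢p = trans (cong (w k *_) (alternating (k≢p ∘ sym) (put p x M) λ i → trans (put-at p x M i) (sym (put-off x M i k≢p))))
          (trans (*-zeroʳ (w k)) (sym (trans (cong (_* (w k * detℚ M)) (δ-diff (k≢p ∘ sym))) (*-zeroˡ (w k * detℚ M)))))
    where x = λ i → M i k

TransposeInvariant : ℕ → Set
TransposeInvariant n = ∀ (M : Matrix ℚ n) → detℚ M ≡ detℚ (λ i j → M j i)

-- `det` expands along the first row only, while a rotation acts on rows as well as on columns. The
-- double expansion along first row and first column is symmetric; it needs the claim for the two
-- preceding sizes, hence an induction with two base cases.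
det-transpose-step : ∀ m → TransposeInvariant m → TransposeInvariant (suc m) → TransposeInvariant (suc (suc m))
det-transpose-step m transpose transpose′ M = begin
  detℚ M                                            ≡⟨ expansion M ⟩
  double M                                          ≡⟨ cong₂ _+_ (cong (1ℚ * M zero zero *_) (transpose′ (minor M zero))) swapped ⟩
  double (λ i j → M j i)                            ≡⟨ expansion (λ i j → M j i) ⟨
  detℚ (λ i j → M j i)                              ∎
  where
  open ≡-Reasoning
  core : Matrix ℚ (suc (suc m)) → Fin (suc m) → Fin (suc m) → Matrix ℚ m
  core M i j r k = M (suc (punchIn i r)) (suc (punchIn j k))
  cross : Matrix ℚ (suc (suc m)) → Fin (suc m) → Fin (suc m) → ℚ
  cross M i j = - (sgn i * sgn j * (M zero (suc j) * M (suc i) zero) * detℚ (core M i j))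
  -- Expansion along the first row, then of each minor along its first column.
  double : Matrix ℚ (suc (suc m)) → ℚ
  double M = 1ℚ * M zero zero * detℚ (minor M zero) + sum λ j → sum λ i → cross M i j
  expansion : ∀ M → detℚ M ≡ double M
  expansion M = cong (λ z → 1ℚ * M zero zero * detℚ (minor M zero) + z) (sum-cong λ j → begin
    sgn (suc j) * M zero (suc j) * detℚ (minor M (suc j))
      ≡⟨ cong (sgn (suc j) * M zero (suc j) *_) (transpose′ (minor M (suc j))) ⟩
    sgn (suc j) * M zero (suc j) * sum (λ i → sgn i * M (suc i) zero * detℚ (λ r k → core M i j k r))
      ≡⟨ sum-*ˡ (sgn (suc j) * M zero (suc j)) (λ i → sgn i * M (suc i) zero * detℚ (λ r k → core M i j k r)) ⟨
    sum (λ i → sgn (suc j) * M zero (suc j) * (sgn i * M (suc i) zero * detℚ (λ r k → core M i j k r)))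
      ≡⟨ sum-cong (λ i → trans (cong (λ d → sgn (suc j) * M zero (suc j) * (sgn i * M (suc i) zero * d)) (sym (transpose (core M i j))))
           (collect (sgn j) (sgn i) (M zero (suc j)) (M (suc i) zero) (detℚ (core M i j)))) ⟩
    sum (λ i → cross M i j) ∎)
    where
    collect : ∀ s t a b d → - 1ℚ * s * a * (t * b * d) ≡ - (t * s * (a * b) * d)
    collect = solve-∀ ringℚ
  swapped : sum (λ j → sum λ i → cross M i j) ≡ sum (λ j → sum λ i → cross (λ i j → M j i) i j)
  swapped = trans (∑-comm (λ j i → cross M i j)) (sum-cong λ j → sum-cong λ i →
    cong -_ (cong₂ _*_ (cong₂ _*_ (*-comm (sgn j) (sgn i)) (*-comm (M zero (suc i)) (M (suc j) zero))) (transpose (core M j i))))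

det-transpose : ∀ n → TransposeInvariant n
det-transpose zero          = λ M → refl
det-transpose (suc zero)    = λ M → refl
det-transpose (suc (suc m)) = det-transpose-step m (det-transpose m) (det-transpose (suc m))

-- The truncations `W t` bring in the multiples one column at a time. Each step is linear in that
-- column, and the extra determinant has column 0 twice.
det-add-first-column : ∀ {n} (w : Vector ℚ (suc n)) → w zero ≡ 0ℚ → ∀ M →
  detℚ (λ i k → M i k + w k * M i zero) ≡ detℚ M
det-add-first-column {n} w w₀ M =
  trans (det-cong λ i k → cong (λ z → M i k + z * M i zero) (sym (cong (if_then w k else 0ℚ) (dec-true (toℕ k ℕ.<? suc n) (Fin.toℕ<n k)))))
        (partial (suc n))
  where
  W : ℕ → Vector ℚ (suc n)
  W t k = if does (toℕ k ℕ.<? t) then w k else 0ℚ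
  A : ℕ → Matrix ℚ (suc n)
  A t i k = M i k + W t k * M i zero
  pad : ∀ a → a + 0ℚ * a ≡ a
  pad = solve-∀ ringℚ
  W-below : ∀ {t k} → toℕ k ℕ.< t → W t k ≡ w k
  W-below {t} {k} k<t = cong (if_then w k else 0ℚ) (dec-true (toℕ k ℕ.<? t) k<t)
  W-above : ∀ {t k} → ¬ (toℕ k ℕ.< t) → W t k ≡ 0ℚ
  W-above {t} {k} k≮t = cong (if_then w k else 0ℚ) (dec-false (toℕ k ℕ.<? t) k≮t)
  W-zero : ∀ t → W t zero ≡ 0ℚ
  W-zero zero    = refl
  W-zero (suc t) = w₀
  A-zero : ∀ t i → A t i zero ≡ M i zero
  A-zero t i = trans (cong (λ z → M i zero + z * M i zero) (W-zero t)) (pad (M i zero))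
  W-step : ∀ t k → toℕ k ≢ t → W (suc t) k ≡ W t k
  W-step t k k≢t = step (toℕ k ℕ.<? t)
    where
    step : Dec (toℕ k ℕ.< t) → W (suc t) k ≡ W t k
    step (yes k<t) = trans (W-below (ℕ.m<n⇒m<1+n k<t)) (sym (W-below k<t))
    step (no k≮t)  = trans (W-above λ k<1+t → k≮t (ℕ.≤∧≢⇒< (ℕ.s≤s⁻¹ k<1+t) k≢t)) (sym (W-above k≮t))
  step : ∀ t → detℚ (A (suc (suc t))) ≡ detℚ (A (suc t))
  step t with suc t ℕ.<? suc n
  ... | no t≮n = det-cong λ i k → cong (λ z → M i k + z * M i zero)
          (W-step (suc t) k λ k≡ → t≮n (subst (ℕ._< suc n) k≡ (Fin.toℕ<n k)))
  ... | yes t<n = begin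
    detℚ (A (suc (suc t)))                      ≡⟨ det-cong entry ⟩
    detℚ (put j (λ i → 1ℚ * A (suc t) i j + w j * A (suc t) i zero) (A (suc t)))
      ≡⟨ det-put-linear j 1ℚ (w j) (λ i → A (suc t) i j) (λ i → A (suc t) i zero) (A (suc t)) ⟩
    1ℚ * detℚ (put j (λ i → A (suc t) i j) (A (suc t))) + w j * detℚ (put j z (A (suc t)))
      ≡⟨ cong₂ (λ x y → 1ℚ * x + w j * y) (det-cong (put-self j (A (suc t))))
           (alternating {p = zero} {j} j≢0 (put j z (A (suc t))) λ i → trans (put-off z (A (suc t)) i j≢0) (sym (put-at j z (A (suc t)) i))) ⟩
    1ℚ * detℚ (A (suc t)) + w j * 0ℚ            ≡⟨ tidy (detℚ (A (suc t))) (w j) ⟩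
    detℚ (A (suc t))                            ∎
    where
    open ≡-Reasoning
    j = Fin.fromℕ< t<n
    z = λ i → A (suc t) i zero
    toℕ-j : toℕ j ≡ suc t
    toℕ-j = Fin.toℕ-fromℕ< t<n
    j≢0 : zero ≢ j
    j≢0 0≡j with trans (cong toℕ 0≡j) toℕ-j
    ... | ()
    tidy : ∀ d w → 1ℚ * d + w * 0ℚ ≡ d
    tidy = solve-∀ ringℚ
    new : ∀ a b c → a + c * b ≡ 1ℚ * (a + 0ℚ * b) + c * b
    new = solve-∀ ringℚ
    entry : ∀ i k → A (suc (suc t)) i k ≡ put j (λ i → 1ℚ * A (suc t) i j + w j * A (suc t) i zero) (A (suc t)) i k
    entry i k with k Fin.≟ j
    ... | yes refl = trans (cong (λ z → M i j + z * M i zero) (W-below {suc (suc t)} {j} (ℕ.≤-reflexive (cong suc toℕ-j))))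
            (trans (new (M i j) (M i zero) (w j)) (cong₂ (λ x y → 1ℚ * (M i j + x * M i zero) + w j * y)
              (sym (W-above {suc t} {j} λ j<t → ℕ.<-irrefl toℕ-j j<t)) (sym (A-zero (suc t) i))))
    ... | no k≢j = cong (λ z → M i k + z * M i zero) (W-step (suc t) k λ k≡ → k≢j (Fin.toℕ-injective (trans k≡ (sym toℕ-j))))
  partial : ∀ t → detℚ (A t) ≡ detℚ M
  partial zero = det-cong λ i k → trans (cong (λ z → M i k + z) (*-zeroˡ (M i zero))) (+-identityʳ (M i k))
  partial (suc zero) = trans (det-cong {M = A 1} {N = A 0} λ { i zero → cong (λ z → M i zero + z * M i zero) w₀ ; i (suc k) → refl }) (partial zero)
  partial (suc (suc t)) = trans (step t) (partial (suc t))

-- Both sides equal x (x − n) times the determinant of M with its first column replaced by ones.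
det-minus-ones : ∀ {n} (M : Matrix ℚ (suc n)) {x} → (∀ i → sum (M i) ≡ x) →
  x * detℚ (λ i k → M i k - 1ℚ) ≡ (x - ι (suc n)) * detℚ M
det-minus-ones {n} M {x} row = begin
  x * detℚ N                                        ≡⟨ cong (x *_) (factor N (x - ι (suc n)) rowN) ⟩
  x * ((x - ι (suc n)) * detℚ (put zero one N))     ≡⟨ swap x (x - ι (suc n)) (detℚ (put zero one N)) ⟩
  (x - ι (suc n)) * (x * detℚ (put zero one N))     ≡⟨ cong (λ d → (x - ι (suc n)) * (x * d)) same ⟩
  (x - ι (suc n)) * (x * detℚ (put zero one M))     ≡⟨ cong ((x - ι (suc n)) *_) (factor M x row) ⟨
  (x - ι (suc n)) * detℚ M                          ∎
  where
  open ≡-Reasoning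
  N : Matrix ℚ (suc n)
  N i k = M i k - 1ℚ
  one : Vector ℚ (suc n)
  one _ = 1ℚ
  swap : ∀ a b c → a * (b * c) ≡ b * (a * c)
  swap = solve-∀ ringℚ
  rowN : ∀ i → sum (N i) ≡ x - ι (suc n)
  rowN i = trans (sum-+ (M i) (λ _ → - 1ℚ)) (cong₂ _+_ (row i) (trans (sum-const (suc n) (- 1ℚ)) (neg (ι (suc n)))))
    where
    neg : ∀ k → k * - 1ℚ ≡ - k
    neg = solve-∀ ringℚ
  factor : ∀ (A : Matrix ℚ (suc n)) y → (∀ i → sum (A i) ≡ y) → detℚ A ≡ y * detℚ (put zero one A)
  factor A y rowA = begin
    detℚ A                                              ≡⟨ *-identityˡ (detℚ A) ⟨
    1ℚ * detℚ A                                         ≡⟨ det-put-combination zero one A ⟨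
    detℚ (put zero (λ i → sum λ k → 1ℚ * A i k) A)      ≡⟨ det-cong (put-cong zero {M = A} {N = A} (λ i → trans (sum-cong λ k → *-identityˡ (A i k)) (trans (rowA i) (pad y))) (λ _ _ _ → refl)) ⟩
    detℚ (put zero (λ i → y * one i + 0ℚ * one i) A)    ≡⟨ det-put-linear zero y 0ℚ one one A ⟩
    y * detℚ (put zero one A) + 0ℚ * detℚ (put zero one A) ≡⟨ drop y (detℚ (put zero one A)) ⟩
    y * detℚ (put zero one A)                           ∎
    where
    pad : ∀ y → y ≡ y * 1ℚ + 0ℚ * 1ℚ
    pad = solve-∀ ringℚ
    drop : ∀ y d → y * d + 0ℚ * d ≡ y * d
    drop = solve-∀ ringℚ
  w : Vector ℚ (suc n)
  w zero    = 0ℚ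
  w (suc k) = - 1ℚ
  same : detℚ (put zero one N) ≡ detℚ (put zero one M)
  same = trans (det-cong {M = put zero one N} {N = λ i k → put zero one M i k + w k * 1ℚ} λ { i zero → refl ; i (suc k) → refl }) (det-add-first-column w refl (put zero one M))

-- Quadratic forms and estimates of determinants.

infix 8 ∥_∥²

⟨_,_⟩ : ∀ {n} → Vector ℚ n → Vector ℚ n → ℚ
⟨ u , v ⟩ = sum λ i → u i * v i

∥_∥² : ∀ {n} → Vector ℚ n → ℚ
∥ v ∥² = ⟨ v , v ⟩

form : ∀ {n} → Matrix ℚ n → Vector ℚ n → Vector ℚ n → ℚ
form A u v = sum λ i → u i * sum λ j → A i j * v j

0≤∥∥² : ∀ {n} (v : Vector ℚ n) → 0ℚ ≤ ∥ v ∥²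
0≤∥∥² v = sum-nonneg λ i → 0≤sq (v i)

⟨⟩-zeroʳ : ∀ {n} (u : Vector ℚ n) → sum (λ i → u i * 0ℚ) ≡ 0ℚ
⟨⟩-zeroʳ u = sum-zero λ i → *-zeroʳ (u i)

^-pos : ∀ {p} → 0ℚ < p → ∀ n → 0ℚ < p ^ n
^-pos 0<p zero    = positive⁻¹ 1ℚ
^-pos 0<p (suc n) = 0<* 0<p (^-pos 0<p n)

-- Elimination of the first row; the Schur complement inherits the lower bound m on the quadratic form.
det-definite : ∀ n (A : Matrix ℚ n) {m} → (∀ i j → A i j ≡ A j i) → 0ℚ < m →
  (∀ v → m * ∥ v ∥² ≤ form A v v) → m ^ n ≤ detℚ A
det-definite zero    A symA 0<m m≤A = ≤-refl
det-definite (suc n) A {m} symA 0<m m≤A = begin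
  m * m ^ n         ≤⟨ *-mono-≤ (<⇒≤ (^-pos 0<m n)) (<⇒≤ 0<a) m≤a (det-definite n S symS 0<m m≤S) ⟩
  a * detℚ S        ≡⟨ det-A ⟨
  detℚ A            ∎
  where
  open ≤-Reasoning
  a = A zero zero
  b : Vector ℚ n
  b j = A zero (suc j)
  e₀ : Vector ℚ (suc n)
  e₀ zero    = 1ℚ
  e₀ (suc i) = 0ℚ
  m≤a : m ≤ a
  m≤a = begin
    m                 ≡⟨ pad m ⟩
    m * (1ℚ * 1ℚ + 0ℚ)   ≡⟨ cong (λ z → m * (1ℚ * 1ℚ + z)) (sum-zero {n} λ i → refl) ⟨
    m * ∥ e₀ ∥²       ≤⟨ m≤A e₀ ⟩
    form A e₀ e₀      ≡⟨ cong₂ (λ x y → 1ℚ * (a * 1ℚ + x) + y) (⟨⟩-zeroʳ b) (sum-zero λ i → *-zeroˡ (sum λ j → A (suc i) j * e₀ j)) ⟩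
    1ℚ * (a * 1ℚ + 0ℚ) + 0ℚ  ≡⟨ unpad a ⟩
    a                 ∎
    where
    pad : ∀ m → m ≡ m * (1ℚ * 1ℚ + 0ℚ)
    pad = solve-∀ ringℚ
    unpad : ∀ a → 1ℚ * (a * 1ℚ + 0ℚ) + 0ℚ ≡ a
    unpad = solve-∀ ringℚ
  0<a = <-≤-trans 0<m m≤a
  r = recip 0<a
  w : Vector ℚ (suc n)
  w zero    = 0ℚ
  w (suc k) = - (b k * r)
  S : Matrix ℚ n
  S i k = A (suc i) (suc k) + - (b k * r) * A (suc i) zero
  det-A : detℚ A ≡ a * detℚ S
  det-A = begin-equality
    detℚ A            ≡⟨ det-add-first-column w refl A ⟨
    detℚ A′           ≡⟨ cong₂ (λ x y → 1ℚ * (a + 0ℚ * a) * x + y) refl (sum-zero λ k → vanish k) ⟩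
    1ℚ * (a + 0ℚ * a) * detℚ S + 0ℚ ≡⟨ tidy a (detℚ S) ⟩
    a * detℚ S        ∎
    where
    A′ : Matrix ℚ (suc n)
    A′ i k = A i k + w k * A i zero
    tidy : ∀ a d → 1ℚ * (a + 0ℚ * a) * d + 0ℚ ≡ a * d
    tidy = solve-∀ ringℚ
    eliminate : ∀ s b r a d → s * (b + - (b * r) * a) * d ≡ s * b * d * (1ℚ - a * r)
    eliminate = solve-∀ ringℚ
    vanish : ∀ k → sgn (suc k) * A′ zero (suc k) * detℚ (minor A′ (suc k)) ≡ 0ℚ
    vanish k = trans (eliminate (sgn (suc k)) (b k) r a (detℚ (minor A′ (suc k))))
      (trans (cong (λ z → sgn (suc k) * b k * detℚ (minor A′ (suc k)) * (1ℚ - z)) (recip-inverse 0<a)) (*-zeroʳ (sgn (suc k) * b k * detℚ (minor A′ (suc k)))))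
  symS : ∀ i j → S i j ≡ S j i
  symS i j = cong₂ _+_ (symA (suc i) (suc j)) (trans (cong (λ z → - (b j * r) * z) (symA (suc i) zero))
    (trans (swap (b j) r (b i)) (cong (λ z → - (b i * r) * z) (symA zero (suc j)))))
    where
    swap : ∀ x r y → - (x * r) * y ≡ - (y * r) * x
    swap = solve-∀ ringℚ
  m≤S : ∀ v → m * ∥ v ∥² ≤ form S v v
  m≤S v = begin
    m * ∥ v ∥²                ≤⟨ *-monoˡ (<⇒≤ 0<m) (from-diff (0≤sq t) (grow t ∥ v ∥²)) ⟩
    m * ∥ u ∥²                ≤⟨ m≤A u ⟩
    form A u u                ≡⟨ cong (λ z → t * (a * t + β) + z) (trans (sum-cong row) (trans (sum-linear t 1ℚ (λ i → b i * v i) (λ i → v i * C i)) refl)) ⟩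
    t * (a * t + β) + (t * β + 1ℚ * form′)    ≡⟨ complete a r β form′ ⟩
    (form′ - r * β * β) - r * β * β * (1ℚ - a * r) ≡⟨ cong (λ z → (form′ - r * β * β) - r * β * β * (1ℚ - z)) (recip-inverse 0<a) ⟩
    (form′ - r * β * β) - r * β * β * (1ℚ - 1ℚ) ≡⟨ drop (form′ - r * β * β) (r * β * β) ⟩
    form′ - r * β * β         ≡⟨ form-S ⟨
    form S v v                ∎
    where
    β = ⟨ b , v ⟩
    -- The minimiser in the eliminated coordinate: with this value the form of A at u equals the
    -- form of the Schur complement at v.
    t = - (β * r)
    u : Vector ℚ (suc n)
    u zero    = t
    u (suc i) = v i
    C : Vector ℚ n
    C i = sum λ j → A (suc i) (suc j) * v j
    form′ = sum λ i → v i * C i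
    grow : ∀ t N → (t * t + N) - N ≡ t * t
    grow = solve-∀ ringℚ
    expand : ∀ x y t c → x * (y * t + c) ≡ t * (y * x) + 1ℚ * (x * c)
    expand = solve-∀ ringℚ
    row : ∀ i → v i * (A (suc i) zero * t + C i) ≡ t * (b i * v i) + 1ℚ * (v i * C i)
    row i = trans (cong (λ z → v i * (z * t + C i)) (symA (suc i) zero)) (expand (v i) (b i) t (C i))
    complete : ∀ a r β f → - (β * r) * (a * - (β * r) + β) + (- (β * r) * β + 1ℚ * f) ≡ (f - r * β * β) - r * β * β * (1ℚ - a * r)
    complete = solve-∀ ringℚ
    drop : ∀ x y → x - y * (1ℚ - 1ℚ) ≡ x
    drop = solve-∀ ringℚ
    form-S : form S v v ≡ form′ - r * β * β
    form-S = begin-equality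
      form S v v      ≡⟨ sum-cong (λ i → trans (cong (v i *_) (trans (sum-cong λ k → trans (cong (λ z → (A (suc i) (suc k) + - (b k * r) * z) * v k) (symA (suc i) zero)) (entry (A (suc i) (suc k)) (b k) r (b i) (v k)))
                           (sum-linear 1ℚ (- (r * b i)) (λ k → A (suc i) (suc k) * v k) (λ k → b k * v k)))) (outer (v i) (C i) r (b i) β)) ⟩
      sum (λ i → 1ℚ * (v i * C i) + - (r * β) * (b i * v i)) ≡⟨ sum-linear 1ℚ (- (r * β)) (λ i → v i * C i) (λ i → b i * v i) ⟩
      1ℚ * form′ + - (r * β) * β ≡⟨ tidy form′ r β ⟩
      form′ - r * β * β ∎
      where
      entry : ∀ x b r c v → (x + - (b * r) * c) * v ≡ 1ℚ * (x * v) + - (r * c) * (b * v)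
      entry = solve-∀ ringℚ
      outer : ∀ v c r b β → v * (1ℚ * c + - (r * b) * β) ≡ 1ℚ * (v * c) + - (r * β) * (b * v)
      outer = solve-∀ ringℚ
      tidy : ∀ f r β → 1ℚ * f + - (r * β) * β ≡ f - r * β * β
      tidy = solve-∀ ringℚ

∣sgn∣≡1 : ∀ k → ℚ.∣ (- 1ℚ) ^ k ∣ ≡ 1ℚ
∣sgn∣≡1 zero    = refl
∣sgn∣≡1 (suc k) = trans (∣p*q∣≡∣p∣*∣q∣ (- 1ℚ) ((- 1ℚ) ^ k)) (trans (*-identityˡ _) (∣sgn∣≡1 k))

Bounded : ∀ {n} → ℚ → Matrix ℚ n → Set
Bounded B M = ∀ i j → ℚ.∣ M i j ∣ ≤ B

det-bound : ∀ n B → 0ℚ ≤ B → ∃ λ K → 0ℚ ≤ K × (∀ (M : Matrix ℚ n) → Bounded B M → ℚ.∣ detℚ M ∣ ≤ K)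
det-bound zero B 0≤B = 1ℚ , nonNegative⁻¹ 1ℚ , λ M _ → ≤-refl
det-bound (suc n) B 0≤B with det-bound n B 0≤B
... | K , 0≤K , bound = ι (suc n) * (B * K) , 0≤* (0≤ι (suc n)) (0≤* 0≤B 0≤K) , λ M M≤B → begin
  ℚ.∣ detℚ M ∣                                        ≤⟨ abs-sum-≤ (λ j → sgn j * M zero j * detℚ (minor M j)) ⟩
  sum (λ j → ℚ.∣ sgn j * M zero j * detℚ (minor M j) ∣) ≤⟨ sum-mono (λ j → abs*-≤ (entry M M≤B j) (bound (minor M j) λ i k → M≤B (suc i) (punchIn j k))) ⟩
  sum {suc n} (λ j → B * K)                           ≡⟨ sum-const (suc n) (B * K) ⟩
  ι (suc n) * (B * K)                                 ∎
  where
  open ≤-Reasoning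
  entry : ∀ (M : Matrix ℚ (suc n)) → Bounded B M → ∀ j → ℚ.∣ sgn j * M zero j ∣ ≤ B
  entry M M≤B j = ≤-trans (≤-reflexive (trans (∣p*q∣≡∣p∣*∣q∣ (sgn j) (M zero j)) (trans (cong (_* ℚ.∣ M zero j ∣) (∣sgn∣≡1 (toℕ j))) (*-identityˡ _)))) (M≤B zero j)

-- Lipschitz continuity on matrices with bounded entries: the difference of two expansions splits
-- into a change of minor and a change of entry. The constant depends on n and B alone, so one
-- constant serves all stages of the Jacobi iteration.
det-close : ∀ n B → 0ℚ ≤ B → ∃ λ C → 0ℚ ≤ C × (∀ (M N : Matrix ℚ n) {ε} → Bounded B M → Bounded B N →
  (∀ i j → ℚ.∣ M i j - N i j ∣ ≤ ε) → 0ℚ ≤ ε → ℚ.∣ detℚ M - detℚ N ∣ ≤ C * ε)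
det-close zero B 0≤B = 0ℚ , ≤-refl , λ M N {ε} _ _ _ _ → ≤-reflexive (sym (*-zeroˡ ε))
det-close (suc n) B 0≤B with det-close n B 0≤B | det-bound n B 0≤B
... | C , 0≤C , close | K , 0≤K , bound = ι (suc n) * (B * C + K) , 0≤* (0≤ι (suc n)) (0≤+ (0≤* 0≤B 0≤C) 0≤K) ,
  λ M N {ε} M≤B N≤B M~N 0≤ε → begin
    ℚ.∣ detℚ M - detℚ N ∣         ≡⟨ cong ℚ.∣_∣ (trans (cong (λ z → detℚ M + z) (sym (sum-neg (term N)))) (sym (sum-+ (term M) (λ j → - term N j)))) ⟩
    ℚ.∣ sum (λ j → term M j - term N j) ∣  ≤⟨ abs-sum-≤ (λ j → term M j - term N j) ⟩
    sum (λ j → ℚ.∣ term M j - term N j ∣)  ≤⟨ sum-mono (λ j → term-close M N M≤B N≤B M~N j) ⟩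
    sum {suc n} (λ j → B * (C * ε) + K * ε) ≡⟨ sum-const (suc n) (B * (C * ε) + K * ε) ⟩
    ι (suc n) * (B * (C * ε) + K * ε)  ≡⟨ factor (ι (suc n)) B C K ε ⟩
    ι (suc n) * (B * C + K) * ε        ∎
  where
  open ≤-Reasoning
  term : Matrix ℚ (suc n) → Fin (suc n) → ℚ
  term M j = sgn j * M zero j * detℚ (minor M j)
  factor : ∀ k b c d e → k * (b * (c * e) + d * e) ≡ k * (b * c + d) * e
  factor = solve-∀ ringℚ
  split : ∀ s x d y e → s * x * d - s * y * e ≡ s * (x * (d - e) + e * (x - y))
  split = solve-∀ ringℚ
  term-close : ∀ (M N : Matrix ℚ (suc n)) {ε} → Bounded B M → Bounded B N → (∀ i j → ℚ.∣ M i j - N i j ∣ ≤ ε) → ∀ j →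
    ℚ.∣ term M j - term N j ∣ ≤ B * (C * ε) + K * ε
  term-close M N {ε} M≤B N≤B M~N j = begin
    ℚ.∣ term M j - term N j ∣   ≡⟨ cong ℚ.∣_∣ (split (sgn j) (M zero j) d (N zero j) e) ⟩
    ℚ.∣ sgn j * (M zero j * (d - e) + e * (M zero j - N zero j)) ∣ ≡⟨ trans (∣p*q∣≡∣p∣*∣q∣ (sgn j) X) (trans (cong (_* ℚ.∣ X ∣) (∣sgn∣≡1 (toℕ j))) (*-identityˡ _)) ⟩
    ℚ.∣ X ∣               ≤⟨ abs+-≤ (abs*-≤ (M≤B zero j) (close (minor M j) (minor N j) (λ i k → M≤B (suc i) (punchIn j k)) (λ i k → N≤B (suc i) (punchIn j k)) (λ i k → M~N (suc i) (punchIn j k)) 0≤ε))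
                                (abs*-≤ (bound (minor N j) (λ i k → N≤B (suc i) (punchIn j k))) (M~N zero j)) ⟩
    B * (C * ε) + K * ε   ∎
    where
    d = detℚ (minor M j)
    e = detℚ (minor N j)
    X = M zero j * (d - e) + e * (M zero j - N zero j)
    0≤ε = ≤-trans (0≤∣p∣ (M zero j - N zero j)) (M~N zero j)

det-diagonal : ∀ {n} (M : Matrix ℚ n) → (∀ i j → i ≢ j → M i j ≡ 0ℚ) → detℚ M ≡ product (λ i → M i i)
det-diagonal {zero}  M off = refl
det-diagonal {suc n} M off = trans (cong₂ _+_
    (cong₂ _*_ (*-identityˡ (M zero zero)) (det-diagonal (minor M zero) (λ i j i≢j → off (suc i) (suc j) (i≢j ∘ Fin.suc-injective))))
    (sum-zero λ k → trans (cong (λ z → sgn (suc k) * z * detℚ (minor M (suc k))) (off zero (suc k) λ ())) (vanish (sgn (suc k)) (detℚ (minor M (suc k))))))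
  (+-identityʳ _)
  where
  vanish : ∀ s d → s * 0ℚ * d ≡ 0ℚ
  vanish = solve-∀ ringℚ

-- Plane rotations.

argmax : ∀ {n} (f : Vector ℚ (suc n)) → ∃ λ p → ∀ i → f i ≤ f p
argmax {zero}  f = zero , λ { zero → ≤-refl }
argmax {suc n} f with argmax (f ∘ suc)
... | p , f≤fp with ≤-total (f zero) (f (suc p))
...   | inj₁ ≤p = suc p , λ { zero → ≤p ; (suc i) → f≤fp i }
...   | inj₂ p≤ = zero , λ { zero → ≤-refl ; (suc i) → ≤-trans (f≤fp i) p≤ }

sum-two-changed : ∀ {n} {p q : Fin n} → p ≢ q → (f g : Vector ℚ n) → (∀ j → j ≢ p → j ≢ q → f j ≡ g j) →
  sum f ≡ sum g + ((f p - g p) + (f q - g q))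
sum-two-changed {p = p} {q} p≢q f g same = begin
  sum f                                         ≡⟨ sum-cong term ⟩
  sum (λ j → g j + (δ p j * h j + δ q j * h j)) ≡⟨ sum-+ g (λ j → δ p j * h j + δ q j * h j) ⟩
  sum g + sum (λ j → δ p j * h j + δ q j * h j) ≡⟨ cong (λ z → sum g + z) (trans (sum-+ (λ j → δ p j * h j) (λ j → δ q j * h j)) (cong₂ _+_ (sum-δ p h) (sum-δ q h))) ⟩
  sum g + (h p + h q)                           ∎
  where
  open ≡-Reasoning
  h = λ j → f j - g j
  at-p : ∀ f g → f ≡ g + (1ℚ * (f - g) + 0ℚ * (f - g))
  at-p = solve-∀ ringℚ
  at-q : ∀ f g → f ≡ g + (0ℚ * (f - g) + 1ℚ * (f - g))
  at-q = solve-∀ ringℚ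
  off : ∀ f g → f ≡ g + (0ℚ * (f - g) + 0ℚ * (f - g)) + (f - g)
  off = solve-∀ ringℚ
  term : ∀ j → f j ≡ g j + (δ p j * h j + δ q j * h j)
  term j with j Fin.≟ p | j Fin.≟ q
  ... | yes refl | yes j≡q = contradiction j≡q p≢q
  ... | yes refl | no j≢q  = trans (at-p (f j) (g j)) (cong₂ (λ x y → g j + (x * h j + y * h j)) (sym (δ-same j)) (sym (δ-diff (j≢q ∘ sym))))
  ... | no j≢p   | yes refl = trans (at-q (f j) (g j)) (cong₂ (λ x y → g j + (x * h j + y * h j)) (sym (δ-diff (j≢p ∘ sym))) (sym (δ-same j)))
  ... | no j≢p   | no j≢q  = trans (off (f j) (g j)) (trans (cong₂ _+_
        (cong₂ (λ x y → g j + (x * h j + y * h j)) (sym (δ-diff (j≢p ∘ sym))) (sym (δ-diff (j≢q ∘ sym))))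
        (trans (cong (_- g j) (same j j≢p j≢q)) (+-inverseʳ (g j)))) (+-identityʳ _))

combine : ∀ {n} → ℚ → ℚ → Vector ℚ n → Vector ℚ n → Vector ℚ n
combine α β v w i = α * v i + β * w i

form-cong : ∀ {n} (A : Matrix ℚ n) {u v w x : Vector ℚ n} → (∀ i → u i ≡ v i) → (∀ i → w i ≡ x i) → form A u w ≡ form A v x
form-cong A u≡v w≡x = sum-cong λ i → cong₂ _*_ (u≡v i) (sum-cong λ j → cong (A i j *_) (w≡x j))

norm-cong : ∀ {n} {u v : Vector ℚ n} → (∀ i → u i ≡ v i) → ∥ u ∥² ≡ ∥ v ∥²
norm-cong u≡v = sum-cong λ i → cong₂ _*_ (u≡v i) (u≡v i)

-- x I - A, written exactly as the terms of the sequence `charPoly` unfold.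
shift : ∀ {n} → Matrix ℚ n → ℚ → Matrix ℚ n
shift A x i j = (if does (i Fin.≟ j) then x else 0ℚ) + - A i j

-- Orthogonal similarity, recorded only by its consequences: same characteristic polynomial, same
-- Frobenius norm, and for any plane spanned by g and h a plane on which form and norm agree. This
-- way no conjugating matrix has to be carried along.
record Similar {n} (A B : Matrix ℚ n) : Set where
  field
    charpoly : ∀ x → detℚ (shift B x) ≡ detℚ (shift A x)
    planes   : ∀ g h → ∃₂ λ v w → ∀ α β →
      form B (combine α β v w) (combine α β v w) ≡ form A (combine α β g h) (combine α β g h) ×
      ∥ combine α β v w ∥² ≡ ∥ combine α β g h ∥²
    frobenius : sum (λ i → ∥ B i ∥²) ≡ sum (λ i → ∥ A i ∥²)

open Similar

similar-refl : ∀ {n} {A : Matrix ℚ n} → Similar A A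
similar-refl = record { charpoly = λ x → refl ; planes = λ g h → g , h , λ α β → refl , refl ; frobenius = refl }

similar-trans : ∀ {n} {A B C : Matrix ℚ n} → Similar A B → Similar B C → Similar A C
similar-trans AB BC = record
  { charpoly  = λ x → trans (charpoly BC x) (charpoly AB x)
  ; planes    = λ g h → let v , w , eq = planes AB g h ; v′ , w′ , eq′ = planes BC v w in
      v′ , w′ , λ α β → trans (proj₁ (eq′ α β)) (proj₁ (eq α β)) , trans (proj₂ (eq′ α β)) (proj₂ (eq α β))
  ; frobenius = trans (frobenius BC) (frobenius AB)
  }

module Rotation {n} {p q : Fin n} (p≢q : p ≢ q) (c s : ℚ) (unit : c * c + s * s ≡ 1ℚ) where
  open ≡-Reasoning

  mix : Vector ℚ n → Vector ℚ n
  mix v j = if does (j Fin.≟ p) then c * v p + s * v q else if does (j Fin.≟ q) then - s * v p + c * v q else v j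

  mix-p : ∀ v → mix v p ≡ c * v p + s * v q
  mix-p v rewrite dec-true (p Fin.≟ p) refl = refl

  mix-q : ∀ v → mix v q ≡ - s * v p + c * v q
  mix-q v rewrite dec-false (q Fin.≟ p) (p≢q ∘ sym) | dec-true (q Fin.≟ q) refl = refl

  mix-off : ∀ v {j} → j ≢ p → j ≢ q → mix v j ≡ v j
  mix-off v {j} j≢p j≢q rewrite dec-false (j Fin.≟ p) j≢p | dec-false (j Fin.≟ q) j≢q = refl

  data Position (j : Fin n) : Set where
    at-p : j ≡ p → Position j
    at-q : j ≡ q → Position j
    off  : j ≢ p → j ≢ q → Position j

  position : ∀ j → Position j
  position j with j Fin.≟ p | j Fin.≟ q
  ... | yes j≡p | _ = at-p j≡p
  ... | no j≢p | yes j≡q = at-q j≡q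
  ... | no j≢p | no j≢q = off j≢p j≢q

  mix-cong : ∀ {v w : Vector ℚ n} → (∀ i → v i ≡ w i) → ∀ j → mix v j ≡ mix w j
  mix-cong {v} {w} eq j with position j
  ... | at-p refl = trans (mix-p v) (trans (cong₂ (λ x y → c * x + s * y) (eq p) (eq q)) (sym (mix-p w)))
  ... | at-q refl = trans (mix-q v) (trans (cong₂ (λ x y → - s * x + c * y) (eq p) (eq q)) (sym (mix-q w)))
  ... | off j≢p j≢q = trans (mix-off v j≢p j≢q) (trans (eq j) (sym (mix-off w j≢p j≢q)))

  mix-linear : ∀ α β (v w : Vector ℚ n) j → mix (combine α β v w) j ≡ combine α β (mix v) (mix w) j
  mix-linear α β v w j with position j
  ... | at-p refl = trans (mix-p (combine α β v w)) (trans (linear c s α β (v p) (v q) (w p) (w q)) (sym (cong₂ (λ x y → α * x + β * y) (mix-p v) (mix-p w))))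
    where
    linear : ∀ c s α β a b d e → c * (α * a + β * d) + s * (α * b + β * e) ≡ α * (c * a + s * b) + β * (c * d + s * e)
    linear = solve-∀ ringℚ
  ... | at-q refl = trans (mix-q (combine α β v w)) (trans (linear (- s) c α β (v p) (v q) (w p) (w q)) (sym (cong₂ (λ x y → α * x + β * y) (mix-q v) (mix-q w))))
    where
    linear : ∀ c s α β a b d e → c * (α * a + β * d) + s * (α * b + β * e) ≡ α * (c * a + s * b) + β * (c * d + s * e)
    linear = solve-∀ ringℚ
  ... | off j≢p j≢q = trans (mix-off (combine α β v w) j≢p j≢q) (sym (cong₂ (λ x y → α * x + β * y) (mix-off v j≢p j≢q) (mix-off w j≢p j≢q)))

  mix-isometry : ∀ v w → ⟨ mix v , mix w ⟩ ≡ ⟨ v , w ⟩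
  mix-isometry v w = begin
    ⟨ mix v , mix w ⟩   ≡⟨ sum-two-changed p≢q (λ j → mix v j * mix w j) (λ j → v j * w j) (λ j j≢p j≢q → cong₂ _*_ (mix-off v j≢p j≢q) (mix-off w j≢p j≢q)) ⟩
    ⟨ v , w ⟩ + ((mix v p * mix w p - v p * w p) + (mix v q * mix w q - v q * w q))
      ≡⟨ cong (λ z → ⟨ v , w ⟩ + z) (cong₂ (λ x y → (x - v p * w p) + (y - v q * w q)) (cong₂ _*_ (mix-p v) (mix-p w)) (cong₂ _*_ (mix-q v) (mix-q w))) ⟩
    ⟨ v , w ⟩ + (((c * v p + s * v q) * (c * w p + s * w q) - v p * w p) + ((- s * v p + c * v q) * (- s * w p + c * w q) - v q * w q))
      ≡⟨ cong (λ z → ⟨ v , w ⟩ + z) (rotation c s (v p) (v q) (w p) (w q)) ⟩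
    ⟨ v , w ⟩ + (c * c + s * s - 1ℚ) * (v p * w p + v q * w q)
      ≡⟨ cong (λ z → ⟨ v , w ⟩ + (z - 1ℚ) * (v p * w p + v q * w q)) unit ⟩
    ⟨ v , w ⟩ + (1ℚ - 1ℚ) * (v p * w p + v q * w q) ≡⟨ drop ⟨ v , w ⟩ (v p * w p + v q * w q) ⟩
    ⟨ v , w ⟩           ∎
    where
    rotation : ∀ c s a b d e → ((c * a + s * b) * (c * d + s * e) - a * d) + ((- s * a + c * b) * (- s * d + c * e) - b * e) ≡ (c * c + s * s - 1ℚ) * (a * d + b * e)
    rotation = solve-∀ ringℚ
    drop : ∀ x y → x + (1ℚ - 1ℚ) * y ≡ x
    drop = solve-∀ ringℚ

  -- R A Rᵀ, where R turns the coordinates p and q.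
  rotate : Matrix ℚ n → Matrix ℚ n
  rotate A i j = mix (λ r → mix (A r) j) i

  det-mix : ∀ A → detℚ (λ i → mix (A i)) ≡ detℚ A
  det-mix A = trans (det-two-columns p≢q c s (- s) c A) (trans (cong (_* detℚ A) (trans (signs c s) unit)) (*-identityˡ (detℚ A)))
    where
    signs : ∀ c s → c * c - s * - s ≡ c * c + s * s
    signs = solve-∀ ringℚ

  det-rotate : ∀ A → detℚ (rotate A) ≡ detℚ A
  det-rotate A = begin
    detℚ (rotate A)                               ≡⟨ det-transpose n (rotate A) ⟩
    detℚ (λ j → mix (λ r → mix (A r) j))          ≡⟨ det-mix (λ j r → mix (A r) j) ⟩
    detℚ (λ j r → mix (A r) j)                    ≡⟨ det-transpose n (λ r → mix (A r)) ⟨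
    detℚ (λ r → mix (A r))                        ≡⟨ det-mix A ⟩
    detℚ A                                        ∎

  rotate-cong : ∀ {A B : Matrix ℚ n} → (∀ i j → A i j ≡ B i j) → ∀ i j → rotate A i j ≡ rotate B i j
  rotate-cong eq i j = mix-cong (λ r → mix-cong (eq r) j) i

  rotate-linear : ∀ α β (A B : Matrix ℚ n) i j →
    rotate (λ i j → α * A i j + β * B i j) i j ≡ α * rotate A i j + β * rotate B i j
  rotate-linear α β A B i j = trans (mix-cong (λ r → mix-linear α β (A r) (B r) j) i)
    (mix-linear α β (λ r → mix (A r) j) (λ r → mix (B r) j) i)

  rotate-form : ∀ A g h → form (rotate A) (mix g) (mix h) ≡ form A g h
  rotate-form A g h = trans (sum-cong λ i → cong (mix g i *_) (inner i)) (mix-isometry g (λ r → sum λ j → A r j * h j))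
    where
    push : ∀ i → sum (λ j → rotate A i j * mix h j) ≡ mix (λ r → sum λ j → mix (A r) j * mix h j) i
    push i with position i
    ... | at-p refl = trans (sum-cong λ j → trans (cong (_* mix h j) (mix-p (λ r → mix (A r) j))) (distrib c s (mix (A p) j) (mix (A q) j) (mix h j)))
            (trans (sum-linear c s (λ j → mix (A p) j * mix h j) (λ j → mix (A q) j * mix h j)) (sym (mix-p (λ r → sum λ j → mix (A r) j * mix h j))))
      where
      distrib : ∀ c s a b h → (c * a + s * b) * h ≡ c * (a * h) + s * (b * h)
      distrib = solve-∀ ringℚ
    ... | at-q refl = trans (sum-cong λ j → trans (cong (_* mix h j) (mix-q (λ r → mix (A r) j))) (distrib (- s) c (mix (A p) j) (mix (A q) j) (mix h j)))
            (trans (sum-linear (- s) c (λ j → mix (A p) j * mix h j) (λ j → mix (A q) j * mix h j)) (sym (mix-q (λ r → sum λ j → mix (A r) j * mix h j))))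
      where
      distrib : ∀ c s a b h → (c * a + s * b) * h ≡ c * (a * h) + s * (b * h)
      distrib = solve-∀ ringℚ
    ... | off i≢p i≢q = trans (sum-cong λ j → cong (_* mix h j) (mix-off (λ r → mix (A r) j) i≢p i≢q)) (sym (mix-off (λ r → sum λ j → mix (A r) j * mix h j) i≢p i≢q))
    inner : ∀ i → sum (λ j → rotate A i j * mix h j) ≡ mix (λ r → sum λ j → A r j * h j) i
    inner i = trans (push i) (mix-cong (λ r → mix-isometry (A r) h) i)

  rotate-frobenius : ∀ A → sum (λ i → ∥ rotate A i ∥²) ≡ sum (λ i → ∥ A i ∥²)
  rotate-frobenius A = begin
    sum (λ i → sum λ j → rotate A i j * rotate A i j)   ≡⟨ ∑-comm (λ i j → rotate A i j * rotate A i j) ⟩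
    sum (λ j → ∥ mix (λ r → mix (A r) j) ∥²)            ≡⟨ sum-cong (λ j → mix-isometry (λ r → mix (A r) j) (λ r → mix (A r) j)) ⟩
    sum (λ j → sum λ r → mix (A r) j * mix (A r) j)     ≡⟨ ∑-comm (λ j r → mix (A r) j * mix (A r) j) ⟩
    sum (λ r → ∥ mix (A r) ∥²)                          ≡⟨ sum-cong (λ r → mix-isometry (A r) (A r)) ⟩
    sum (λ r → ∥ A r ∥²)                                ∎

  -- Rotating rows and rotating columns commute; applied to a symmetric matrix this gives the
  -- symmetry of `rotate A`.
  mix-interchange : ∀ A i j → rotate A i j ≡ mix (λ k → mix (λ r → A r k) i) j
  mix-interchange A i j with position i
  ... | at-p refl = trans (mix-p (λ r → mix (A r) j)) (trans (sym (mix-linear c s (A p) (A q) j)) (mix-cong (λ k → sym (mix-p (λ r → A r k))) j))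
  ... | at-q refl = trans (mix-q (λ r → mix (A r) j)) (trans (sym (mix-linear (- s) c (A p) (A q) j)) (mix-cong (λ k → sym (mix-q (λ r → A r k))) j))
  ... | off i≢p i≢q = trans (mix-off (λ r → mix (A r) j) i≢p i≢q) (mix-cong (λ k → sym (mix-off (λ r → A r k) i≢p i≢q)) j)

  rotate-symmetric : ∀ A → (∀ i j → A i j ≡ A j i) → ∀ i j → rotate A i j ≡ rotate A j i
  rotate-symmetric A symA i j = trans (mix-interchange A i j) (mix-cong (λ k → mix-cong (λ r → symA r k) i) j)

  rotate-δ : ∀ i j → rotate δ i j ≡ δ i j
  rotate-δ i j with position i | position j
  ... | at-p refl | at-p refl = trans (mix-p (λ r → mix (δ r) j)) (trans (cong₂ (λ x y → c * x + s * y) (mix-p (δ p)) (mix-p (δ q)))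
          (trans (cong₂ (λ x y → c * x + s * y) (cong₂ (λ x y → c * x + s * y) (δ-same p) (δ-diff p≢q)) (cong₂ (λ x y → c * x + s * y) (δ-diff (p≢q ∘ sym)) (δ-same q)))
          (trans (eval c s) (trans unit (sym (δ-same p))))))
    where
    eval : ∀ c s → c * (c * 1ℚ + s * 0ℚ) + s * (c * 0ℚ + s * 1ℚ) ≡ c * c + s * s
    eval = solve-∀ ringℚ
  ... | at-p refl | at-q refl = trans (mix-p (λ r → mix (δ r) j)) (trans (cong₂ (λ x y → c * x + s * y) (mix-q (δ p)) (mix-q (δ q)))
          (trans (cong₂ (λ x y → c * x + s * y) (cong₂ (λ x y → - s * x + c * y) (δ-same p) (δ-diff p≢q)) (cong₂ (λ x y → - s * x + c * y) (δ-diff (p≢q ∘ sym)) (δ-same q)))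
          (trans (eval c s) (sym (δ-diff p≢q)))))
    where
    eval : ∀ c s → c * (- s * 1ℚ + c * 0ℚ) + s * (- s * 0ℚ + c * 1ℚ) ≡ 0ℚ
    eval = solve-∀ ringℚ
  ... | at-q refl | at-p refl = trans (mix-q (λ r → mix (δ r) j)) (trans (cong₂ (λ x y → - s * x + c * y) (mix-p (δ p)) (mix-p (δ q)))
          (trans (cong₂ (λ x y → - s * x + c * y) (cong₂ (λ x y → c * x + s * y) (δ-same p) (δ-diff p≢q)) (cong₂ (λ x y → c * x + s * y) (δ-diff (p≢q ∘ sym)) (δ-same q)))
          (trans (eval c s) (sym (δ-diff (p≢q ∘ sym))))))
    where
    eval : ∀ c s → - s * (c * 1ℚ + s * 0ℚ) + c * (c * 0ℚ + s * 1ℚ) ≡ 0ℚ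
    eval = solve-∀ ringℚ
  ... | at-q refl | at-q refl = trans (mix-q (λ r → mix (δ r) j)) (trans (cong₂ (λ x y → - s * x + c * y) (mix-q (δ p)) (mix-q (δ q)))
          (trans (cong₂ (λ x y → - s * x + c * y) (cong₂ (λ x y → - s * x + c * y) (δ-same p) (δ-diff p≢q)) (cong₂ (λ x y → - s * x + c * y) (δ-diff (p≢q ∘ sym)) (δ-same q)))
          (trans (eval c s) (trans unit (sym (δ-same q))))))
    where
    eval : ∀ c s → - s * (- s * 1ℚ + c * 0ℚ) + c * (- s * 0ℚ + c * 1ℚ) ≡ c * c + s * s
    eval = solve-∀ ringℚ
  ... | at-p refl | off j≢p j≢q = trans (mix-p (λ r → mix (δ r) j)) (trans (cong₂ (λ x y → c * x + s * y)
          (trans (mix-off (δ p) j≢p j≢q) (δ-diff (j≢p ∘ sym))) (trans (mix-off (δ q) j≢p j≢q) (δ-diff (j≢q ∘ sym))))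
          (trans (eval c s) (sym (δ-diff (j≢p ∘ sym)))))
    where
    eval : ∀ c s → c * 0ℚ + s * 0ℚ ≡ 0ℚ
    eval = solve-∀ ringℚ
  ... | at-q refl | off j≢p j≢q = trans (mix-q (λ r → mix (δ r) j)) (trans (cong₂ (λ x y → - s * x + c * y)
          (trans (mix-off (δ p) j≢p j≢q) (δ-diff (j≢p ∘ sym))) (trans (mix-off (δ q) j≢p j≢q) (δ-diff (j≢q ∘ sym))))
          (trans (eval c s) (sym (δ-diff (j≢q ∘ sym)))))
    where
    eval : ∀ c s → - s * 0ℚ + c * 0ℚ ≡ 0ℚ
    eval = solve-∀ ringℚ
  ... | off i≢p i≢q | at-p refl = trans (mix-off (λ r → mix (δ r) j) i≢p i≢q) (trans (mix-p (δ i))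
          (trans (cong₂ (λ x y → c * x + s * y) (δ-diff i≢p) (δ-diff i≢q)) (trans (eval c s) (sym (δ-diff i≢p)))))
    where
    eval : ∀ c s → c * 0ℚ + s * 0ℚ ≡ 0ℚ
    eval = solve-∀ ringℚ
  ... | off i≢p i≢q | at-q refl = trans (mix-off (λ r → mix (δ r) j) i≢p i≢q) (trans (mix-q (δ i))
          (trans (cong₂ (λ x y → - s * x + c * y) (δ-diff i≢p) (δ-diff i≢q)) (trans (eval c s) (sym (δ-diff i≢q)))))
    where
    eval : ∀ c s → - s * 0ℚ + c * 0ℚ ≡ 0ℚ
    eval = solve-∀ ringℚ
  ... | off i≢p i≢q | off j≢p j≢q = trans (mix-off (λ r → mix (δ r) j) i≢p i≢q) (mix-off (δ i) j≢p j≢q)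

  shift-δ : ∀ (A : Matrix ℚ n) x i j → shift A x i j ≡ x * δ i j + - 1ℚ * A i j
  shift-δ A x i j with does (i Fin.≟ j)
  ... | true  = one x (A i j)
    where
    one : ∀ x a → x + - a ≡ x * 1ℚ + - 1ℚ * a
    one = solve-∀ ringℚ
  ... | false = none x (A i j)
    where
    none : ∀ x a → 0ℚ + - a ≡ x * 0ℚ + - 1ℚ * a
    none = solve-∀ ringℚ

  rotate-shift : ∀ A x i j → shift (rotate A) x i j ≡ rotate (shift A x) i j
  rotate-shift A x i j = trans (shift-δ (rotate A) x i j) (trans (cong (λ z → x * z + - 1ℚ * rotate A i j) (sym (rotate-δ i j)))
    (trans (sym (rotate-linear x (- 1ℚ) δ A i j)) (rotate-cong (λ i j → sym (shift-δ A x i j)) i j)))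

  rotate-similar : ∀ A → Similar A (rotate A)
  rotate-similar A = record
    { charpoly  = λ x → trans (det-cong (rotate-shift A x)) (det-rotate (shift A x))
    ; planes    = λ g h → mix g , mix h , λ α β →
        trans (form-cong (rotate A) (λ i → sym (mix-linear α β g h i)) (λ i → sym (mix-linear α β g h i))) (rotate-form A (combine α β g h) (combine α β g h)) ,
        trans (norm-cong (λ i → sym (mix-linear α β g h i))) (mix-isometry (combine α β g h) (combine α β g h))
    ; frobenius = rotate-frobenius A
    }

  module _ (A : Matrix ℚ n) (symA : ∀ i j → A i j ≡ A j i) where

    -- The entry of R A Rᵀ at (p, q). It only has to enter the balance of diagonal squares, so it is
    -- never compared with `rotate A p q`.
    rotated-off : ℚ
    rotated-off = (c * c - s * s) * A p q + c * s * (A q q - A p p)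

    gain : ℚ
    gain = 2ℚ * (c * s) * A p q + s * s * (A q q - A p p)

    rotate-pp : rotate A p p ≡ A p p + gain
    rotate-pp = trans (mix-p (λ r → mix (A r) p)) (trans (cong₂ (λ x y → c * x + s * y) (mix-p (A p)) (trans (mix-p (A q)) (cong (λ z → c * z + s * A q q) (symA q p))))
      (trans (expand c s (A p p) (A p q) (A q q)) (trans (cong (λ u → u * A p p + gain) unit) (cong (_+ gain) (*-identityˡ (A p p))))))
      where
      expand : ∀ c s a b d → c * (c * a + s * b) + s * (c * b + s * d) ≡ (c * c + s * s) * a + (2ℚ * (c * s) * b + s * s * (d - a))
      expand = solve-∀ ringℚ

    rotate-qq : rotate A q q ≡ A q q - gain
    rotate-qq = trans (mix-q (λ r → mix (A r) q)) (trans (cong₂ (λ x y → - s * x + c * y) (trans (mix-q (A p)) refl) (trans (mix-q (A q)) (cong (λ z → - s * z + c * A q q) (symA q p))))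
      (trans (expand c s (A p p) (A p q) (A q q)) (trans (cong (λ u → u * A q q - gain) unit) (cong (_- gain) (*-identityˡ (A q q))))))
      where
      expand : ∀ c s a b d → - s * (- s * a + c * b) + c * (- s * b + c * d) ≡ (c * c + s * s) * d - (2ℚ * (c * s) * b + s * s * (d - a))
      expand = solve-∀ ringℚ

    rotate-diagonal : ∀ i → i ≢ p → i ≢ q → rotate A i i ≡ A i i
    rotate-diagonal i i≢p i≢q = trans (mix-off (λ r → mix (A r) i) i≢p i≢q) (mix-off (A i) i≢p i≢q)

    -- The 2 × 2 block in rows and columns p, q keeps its Frobenius norm, so its diagonal gains what
    -- its two off-diagonal entries lose. The ring identity isolates the factor c² + s² - 1, which
    -- then vanishes.
    diagonal-squares : sum (λ i → rotate A i i * rotate A i i) ≡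
      sum (λ i → A i i * A i i) + (A p q * A p q + A p q * A p q - (rotated-off * rotated-off + rotated-off * rotated-off))
    diagonal-squares = trans (sum-two-changed p≢q (λ i → rotate A i i * rotate A i i) (λ i → A i i * A i i) (λ i i≢p i≢q → cong₂ _*_ (rotate-diagonal i i≢p i≢q) (rotate-diagonal i i≢p i≢q)))
      (cong (λ z → sum (λ i → A i i * A i i) + z) (trans (cong₂ (λ x y → (x * x - A p p * A p p) + (y * y - A q q * A q q)) rotate-pp rotate-qq)
        (block (A p p) (A p q) (A q q))))
      where
      expand : ∀ c s a b d → let g = 2ℚ * (c * s) * b + s * s * (d - a) ; o = (c * c - s * s) * b + c * s * (d - a) in
        ((a + g) * (a + g) - a * a) + ((d - g) * (d - g) - d * d) ≡ (b * b + b * b - (o * o + o * o)) + (c * c + s * s - 1ℚ) * ((1ℚ + 1ℚ) * (b * b * (c * c + s * s + 1ℚ) + s * s * (d - a) * (d - a) + (1ℚ + 1ℚ) * c * s * b * (d - a)))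
      expand = solve-∀ ringℚ
      block : ∀ a b d → let g = 2ℚ * (c * s) * b + s * s * (d - a) ; o = (c * c - s * s) * b + c * s * (d - a) in
        ((a + g) * (a + g) - a * a) + ((d - g) * (d - g) - d * d) ≡ b * b + b * b - (o * o + o * o)
      block a b d = trans (expand c s a b d) (trans (cong (λ u → (b * b + b * b - (o * o + o * o)) + (u - 1ℚ) * R) unit)
        (drop (b * b + b * b - (o * o + o * o)) R))
        where
        o = (c * c - s * s) * b + c * s * (d - a)
        R = (1ℚ + 1ℚ) * (b * b * (c * c + s * s + 1ℚ) + s * s * (d - a) * (d - a) + (1ℚ + 1ℚ) * c * s * b * (d - a))
        drop : ∀ x y → x + (1ℚ - 1ℚ) * y ≡ x
        drop = solve-∀ ringℚ

-- The Jacobi eigenvalue algorithm.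

≤1-square : ∀ {x} → 0ℚ ≤ x → x ≤ 1ℚ → x * x ≤ 1ℚ
≤1-square 0≤x x≤1 = *-mono-≤ 0≤x (nonNegative⁻¹ 1ℚ) x≤1 x≤1

p²≡0⇒p≡0 : ∀ p → p * p ≤ 0ℚ → p ≡ 0ℚ
p²≡0⇒p≡0 p pp≤0 with p ≟ 0ℚ
... | yes p≡0 = p≡0
... | no p≢0 = contradiction (0<sq p≢0) (≤-≮ pp≤0)

-- Here a is the off-diagonal entry and d the difference of the diagonal entries. Annihilating a
-- exactly would need a square root; a fixed factor 3/4 for its square already gives geometric
-- convergence, and the bound 2|a| on the diagonal change makes the diagonals Cauchy.
record GoodRotation (a d : ℚ) : Set where
  field
    c s      : ℚ
    unit     : c * c + s * s ≡ 1ℚ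
    off≤     : 4ℚ * (((c * c - s * s) * a + c * s * d) * ((c * c - s * s) * a + c * s * d)) ≤ 3ℚ * (a * a)
    gain≤    : (2ℚ * (c * s) * a + s * s * d) * (2ℚ * (c * s) * a + s * s * d) ≤ 4ℚ * (a * a)

0<2 : 0ℚ < 2ℚ
0<2 = positive⁻¹ 2ℚ

0<1 : 0ℚ < 1ℚ
0<1 = positive⁻¹ 1ℚ

-- When a is small compared to d, one Newton step u = −a/2d for tan (θ/2) reduces the off-diagonal entry a;
-- otherwise a fixed angle does.
goodRotation : ∀ a d → GoodRotation a d
goodRotation a d with ι 5 * (a * a) ≤? 2ℚ * (d * d)
... | yes small with d * d ≟ 0ℚ
...   | yes dd≡0 = record { c = 1ℚ ; s = 0ℚ ; unit = refl ; off≤ = bound₁ ; gain≤ = bound₂ }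
  where
  a≡0 : a ≡ 0ℚ
  a≡0 = p²≡0⇒p≡0 a (*-cancelˡ (positive⁻¹ (ι 5)) (≤-trans small (≤-reflexive (cong (2ℚ *_) dd≡0))))
  bound₁ : 4ℚ * (((1ℚ * 1ℚ - 0ℚ * 0ℚ) * a + 1ℚ * 0ℚ * d) * ((1ℚ * 1ℚ - 0ℚ * 0ℚ) * a + 1ℚ * 0ℚ * d)) ≤ 3ℚ * (a * a)
  bound₁ rewrite a≡0 = ≤-reflexive (collapse d)
    where
    collapse : ∀ d → 4ℚ * (((1ℚ * 1ℚ - 0ℚ * 0ℚ) * 0ℚ + 1ℚ * 0ℚ * d) * ((1ℚ * 1ℚ - 0ℚ * 0ℚ) * 0ℚ + 1ℚ * 0ℚ * d)) ≡ 3ℚ * (0ℚ * 0ℚ)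
    collapse = solve-∀ ringℚ
  bound₂ : (2ℚ * (1ℚ * 0ℚ) * a + 0ℚ * 0ℚ * d) * (2ℚ * (1ℚ * 0ℚ) * a + 0ℚ * 0ℚ * d) ≤ 4ℚ * (a * a)
  bound₂ rewrite a≡0 = ≤-reflexive (collapse d)
    where
    collapse : ∀ d → (2ℚ * (1ℚ * 0ℚ) * 0ℚ + 0ℚ * 0ℚ * d) * (2ℚ * (1ℚ * 0ℚ) * 0ℚ + 0ℚ * 0ℚ * d) ≡ 4ℚ * (0ℚ * 0ℚ)
    collapse = solve-∀ ringℚ
...   | no dd≢0 = record { c = (1ℚ - v) * κ ; s = 2ℚ * u * κ ; unit = unit ; off≤ = off≤ ; gain≤ = gain≤ }
  where
  open ≤-Reasoning
  0<dd : 0ℚ < d * d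
  0<dd = 0<sq {d} λ d≡0 → dd≢0 (trans (cong₂ _*_ d≡0 d≡0) refl)
  -- This is 1 / d; it goes through d² because `recip` takes a positive argument and the sign of d
  -- is open.
  ρ = d * recip 0<dd
  dρ : d * ρ ≡ 1ℚ
  dρ = trans (sym (*-assoc d d (recip 0<dd))) (recip-inverse 0<dd)
  u = - (½ * a * ρ)
  v = u * u
  0≤v = 0≤sq u
  2ud : 2ℚ * u * d ≡ - a
  2ud = trans (expand a d ρ) (trans (cong (λ z → - a * z) dρ) (*-identityʳ (- a)))
    where
    expand : ∀ a d ρ → 2ℚ * - (½ * a * ρ) * d ≡ - a * (d * ρ)
    expand = solve-∀ ringℚ
  -- The threshold 5a² ≤ 2d² of the case split amounts to u² ≤ 1/10; the new off-diagonal entry is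
  -- then -z a with 2z ≤ 1.
  10v≤1 : ι 10 * v ≤ 1ℚ
  10v≤1 = *-cancelˡ 0<dd (*-cancelˡ 0<2 (begin
    2ℚ * (d * d * (ι 10 * v))   ≡⟨ expand u d ⟩
    ι 5 * ((2ℚ * u * d) * (2ℚ * u * d)) ≡⟨ cong (λ z → ι 5 * (z * z)) 2ud ⟩
    ι 5 * (- a * - a)           ≡⟨ unsign a ⟩
    ι 5 * (a * a)               ≤⟨ small ⟩
    2ℚ * (d * d)                ≡⟨ cong (2ℚ *_) (*-identityʳ (d * d)) ⟨
    2ℚ * (d * d * 1ℚ)           ∎))
    where
    expand : ∀ u d → 2ℚ * (d * d * (ι 10 * (u * u))) ≡ ι 5 * ((2ℚ * u * d) * (2ℚ * u * d))
    expand = solve-∀ ringℚ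
    unsign : ∀ a → ι 5 * (- a * - a) ≡ ι 5 * (a * a)
    unsign = solve-∀ ringℚ
  v≤1 : v ≤ 1ℚ
  v≤1 = ≤-trans (from-diff (0≤* (0≤ι 9) 0≤v) (grow v)) 10v≤1
    where
    grow : ∀ v → ι 10 * v - v ≡ ι 9 * v
    grow = solve-∀ ringℚ
  0<1+v : 0ℚ < 1ℚ + v
  0<1+v = +-mono-<-≤ 0<1 0≤v
  κ = recip 0<1+v
  0≤κ = <⇒≤ (recip-pos 0<1+v)
  κ-def : (1ℚ + v) * κ ≡ 1ℚ
  κ-def = recip-inverse 0<1+v
  κ≤1 : κ ≤ 1ℚ
  κ≤1 = from-diff (0≤* 0≤v 0≤κ) (trans (cong (_- κ) (sym κ-def)) (expand v κ))
    where
    expand : ∀ v κ → (1ℚ + v) * κ - κ ≡ v * κ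
    expand = solve-∀ ringℚ
  κ² = κ * κ
  0≤κ² = 0≤sq κ
  κ²≤1 : κ² ≤ 1ℚ
  κ²≤1 = ≤1-square 0≤κ κ≤1
  unit : (1ℚ - v) * κ * ((1ℚ - v) * κ) + 2ℚ * u * κ * (2ℚ * u * κ) ≡ 1ℚ
  unit = trans (expand u κ) (cong₂ _*_ κ-def κ-def)
    where
    expand : ∀ u κ → (1ℚ - u * u) * κ * ((1ℚ - u * u) * κ) + 2ℚ * u * κ * (2ℚ * u * κ) ≡ (1ℚ + u * u) * κ * ((1ℚ + u * u) * κ)
    expand = solve-∀ ringℚ
  c = (1ℚ - v) * κ
  s = 2ℚ * u * κ
  z = κ² * (v * (ι 5 - v))
  off-value : (c * c - s * s) * a + c * s * d ≡ - (z * a)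
  off-value = trans (expand u κ a d) (trans (cong (λ y → κ * κ * ((1ℚ - ι 6 * (u * u) + u * u * (u * u)) * a + (1ℚ - u * u) * y)) 2ud) (collect u κ a))
    where
    expand : ∀ u κ a d → ((1ℚ - u * u) * κ * ((1ℚ - u * u) * κ) - 2ℚ * u * κ * (2ℚ * u * κ)) * a + (1ℚ - u * u) * κ * (2ℚ * u * κ) * d
      ≡ κ * κ * ((1ℚ - ι 6 * (u * u) + u * u * (u * u)) * a + (1ℚ - u * u) * (2ℚ * u * d))
    expand = solve-∀ ringℚ
    collect : ∀ u κ a → κ * κ * ((1ℚ - ι 6 * (u * u) + u * u * (u * u)) * a + (1ℚ - u * u) * - a) ≡ - (κ * κ * (u * u * (ι 5 - u * u)) * a)
    collect = solve-∀ ringℚ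
  0≤5-v : 0ℚ ≤ ι 5 - v
  0≤5-v = ≤-trans (nonNegative⁻¹ 4ℚ) (from-diff (diff v≤1) (regroup v))
    where
    regroup : ∀ v → (ι 5 - v) - 4ℚ ≡ 1ℚ - v
    regroup = solve-∀ ringℚ
  0≤z = 0≤* 0≤κ² (0≤* 0≤v 0≤5-v)
  2z≤1 : 2ℚ * z ≤ 1ℚ
  2z≤1 = begin
    2ℚ * (κ² * (v * (ι 5 - v)))   ≡⟨ swap κ² (v * (ι 5 - v)) ⟩
    κ² * (2ℚ * (v * (ι 5 - v)))   ≤⟨ *-mono-≤ (0≤* (<⇒≤ 0<2) (0≤* 0≤v 0≤5-v)) (<⇒≤ 0<1) κ²≤1 (≤-trans (from-diff (0≤* (<⇒≤ 0<2) (0≤* 0≤v 0≤v)) (regroup v)) 10v≤1) ⟩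
    1ℚ * 1ℚ                       ≡⟨⟩
    1ℚ                            ∎
    where
    swap : ∀ k w → 2ℚ * (k * w) ≡ k * (2ℚ * w)
    swap = solve-∀ ringℚ
    regroup : ∀ v → ι 10 * v - 2ℚ * (v * (ι 5 - v)) ≡ 2ℚ * (v * v)
    regroup = solve-∀ ringℚ
  off≤ : 4ℚ * (((c * c - s * s) * a + c * s * d) * ((c * c - s * s) * a + c * s * d)) ≤ 3ℚ * (a * a)
  off≤ = begin
    4ℚ * (((c * c - s * s) * a + c * s * d) * ((c * c - s * s) * a + c * s * d))
                                  ≡⟨ cong (λ y → 4ℚ * (y * y)) off-value ⟩
    4ℚ * (- (z * a) * - (z * a))  ≡⟨ collect z a ⟩
    2ℚ * z * (2ℚ * z) * (a * a)   ≤⟨ *-monoʳ-≤-nonNeg (a * a) {{nonNegative (0≤sq a)}} (≤1-square (0≤* (<⇒≤ 0<2) 0≤z) 2z≤1) ⟩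
    1ℚ * (a * a)                  ≤⟨ *-monoʳ-≤-nonNeg (a * a) {{nonNegative (0≤sq a)}} (ι-mono-≤ {1} {3} (s≤s z≤n)) ⟩
    3ℚ * (a * a)                  ∎
    where
    collect : ∀ z a → 4ℚ * (- (z * a) * - (z * a)) ≡ 2ℚ * z * (2ℚ * z) * (a * a)
    collect = solve-∀ ringℚ
  gain-value : 2ℚ * (c * s) * a + s * s * d ≡ 2ℚ * u * κ² * (1ℚ - 2ℚ * v) * a
  gain-value = trans (expand u κ a d) (trans (cong (λ y → κ * κ * (4ℚ * u * (1ℚ - u * u) * a + 2ℚ * u * y)) 2ud) (collect u κ a))
    where
    expand : ∀ u κ a d → 2ℚ * ((1ℚ - u * u) * κ * (2ℚ * u * κ)) * a + 2ℚ * u * κ * (2ℚ * u * κ) * d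
      ≡ κ * κ * (4ℚ * u * (1ℚ - u * u) * a + 2ℚ * u * (2ℚ * u * d))
    expand = solve-∀ ringℚ
    collect : ∀ u κ a → κ * κ * (4ℚ * u * (1ℚ - u * u) * a + 2ℚ * u * - a) ≡ 2ℚ * u * (κ * κ) * (1ℚ - 2ℚ * (u * u)) * a
    collect = solve-∀ ringℚ
  w = 1ℚ - 2ℚ * v
  w≤1 : w ≤ 1ℚ
  w≤1 = from-diff (0≤* (<⇒≤ 0<2) 0≤v) (regroup v)
    where
    regroup : ∀ v → 1ℚ - (1ℚ - 2ℚ * v) ≡ 2ℚ * v
    regroup = solve-∀ ringℚ
  0≤w : 0ℚ ≤ w
  0≤w = diff (≤-trans (from-diff (0≤* (0≤ι 8) 0≤v) (regroup v)) 10v≤1)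
    where
    regroup : ∀ v → ι 10 * v - 2ℚ * v ≡ ι 8 * v
    regroup = solve-∀ ringℚ
  gain≤ : (2ℚ * (c * s) * a + s * s * d) * (2ℚ * (c * s) * a + s * s * d) ≤ 4ℚ * (a * a)
  gain≤ = begin
    (2ℚ * (c * s) * a + s * s * d) * (2ℚ * (c * s) * a + s * s * d) ≡⟨ cong₂ _*_ gain-value gain-value ⟩
    2ℚ * u * κ² * w * a * (2ℚ * u * κ² * w * a)  ≡⟨ collect u κ² w a ⟩
    4ℚ * (a * a) * (v * (κ² * κ² * (w * w))) ≤⟨ *-monoˡ (0≤* (0≤ι 4) (0≤sq a)) (*-mono-≤ (0≤* (0≤sq κ²) (0≤sq w)) (<⇒≤ 0<1) v≤1 (*-mono-≤ (0≤sq w) (<⇒≤ 0<1) (≤1-square 0≤κ² κ²≤1) (≤1-square 0≤w w≤1))) ⟩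
    4ℚ * (a * a) * 1ℚ                       ≡⟨ *-identityʳ (4ℚ * (a * a)) ⟩
    4ℚ * (a * a)                            ∎
    where
    collect : ∀ u k w a → 2ℚ * u * k * w * a * (2ℚ * u * k * w * a) ≡ 4ℚ * (a * a) * (u * u * (k * k * (w * w)))
    collect = solve-∀ ringℚ
goodRotation a d | no large with ≤-total 0ℚ (a * d)
-- The Pythagorean triple (20, 21, 29) gives a rational angle near 45°. The sign of s is chosen
-- against the sign of ad, so that the two terms partly cancel both in the off-diagonal entry and in
-- the gain. The denominator 707281 below is 29⁴.
... | inj₁ 0≤ad = record { c = + 21 / 29 ; s = - (+ 20 / 29) ; unit = refl ; off≤ = off≤ ; gain≤ = gain≤ }
  where
  dd≤ : 0ℚ ≤ ι 5 * (a * a) - 2ℚ * (d * d)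
  dd≤ = diff (<⇒≤ (≰⇒> large))
  off≤ = from-diff (0≤+ (0≤+ (0≤* {+ 352800 / 707281} (nonNegative⁻¹ _) dd≤) (0≤* {+ 137760 / 707281} (nonNegative⁻¹ _) 0≤ad)) (0≤* {+ 351119 / 707281} (nonNegative⁻¹ _) (0≤sq a)))
    (identity a d)
    where
    identity : ∀ a d → 3ℚ * (a * a) - 4ℚ * ((((+ 21 / 29) * (+ 21 / 29) - (- (+ 20 / 29)) * (- (+ 20 / 29))) * a + (+ 21 / 29) * (- (+ 20 / 29)) * d) * (((+ 21 / 29) * (+ 21 / 29) - (- (+ 20 / 29)) * (- (+ 20 / 29))) * a + (+ 21 / 29) * (- (+ 20 / 29)) * d))
      ≡ (+ 352800 / 707281) * (ι 5 * (a * a) - 2ℚ * (d * d)) + (+ 137760 / 707281) * (a * d) + (+ 351119 / 707281) * (a * a)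
    identity = solve-∀ ringℚ
  gain≤ = from-diff (0≤+ (0≤+ (0≤* {+ 80000 / 707281} (nonNegative⁻¹ _) dd≤) (0≤* {+ 672000 / 707281} (nonNegative⁻¹ _) 0≤ad)) (0≤* {+ 1723524 / 707281} (nonNegative⁻¹ _) (0≤sq a)))
    (identity a d)
    where
    identity : ∀ a d → 4ℚ * (a * a) - (2ℚ * ((+ 21 / 29) * (- (+ 20 / 29))) * a + (- (+ 20 / 29)) * (- (+ 20 / 29)) * d) * (2ℚ * ((+ 21 / 29) * (- (+ 20 / 29))) * a + (- (+ 20 / 29)) * (- (+ 20 / 29)) * d)
      ≡ (+ 80000 / 707281) * (ι 5 * (a * a) - 2ℚ * (d * d)) + (+ 672000 / 707281) * (a * d) + (+ 1723524 / 707281) * (a * a)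
    identity = solve-∀ ringℚ
... | inj₂ ad≤0 = record { c = + 21 / 29 ; s = + 20 / 29 ; unit = refl ; off≤ = off≤ ; gain≤ = gain≤ }
  where
  dd≤ : 0ℚ ≤ ι 5 * (a * a) - 2ℚ * (d * d)
  dd≤ = diff (<⇒≤ (≰⇒> large))
  0≤-ad = neg-antimono-≤ ad≤0
  off≤ = from-diff (0≤+ (0≤+ (0≤* {+ 352800 / 707281} (nonNegative⁻¹ _) dd≤) (0≤* {+ 137760 / 707281} (nonNegative⁻¹ _) 0≤-ad)) (0≤* {+ 351119 / 707281} (nonNegative⁻¹ _) (0≤sq a)))
    (identity a d)
    where
    identity : ∀ a d → 3ℚ * (a * a) - 4ℚ * ((((+ 21 / 29) * (+ 21 / 29) - (+ 20 / 29) * (+ 20 / 29)) * a + (+ 21 / 29) * (+ 20 / 29) * d) * (((+ 21 / 29) * (+ 21 / 29) - (+ 20 / 29) * (+ 20 / 29)) * a + (+ 21 / 29) * (+ 20 / 29) * d))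
      ≡ (+ 352800 / 707281) * (ι 5 * (a * a) - 2ℚ * (d * d)) + (+ 137760 / 707281) * - (a * d) + (+ 351119 / 707281) * (a * a)
    identity = solve-∀ ringℚ
  gain≤ = from-diff (0≤+ (0≤+ (0≤* {+ 80000 / 707281} (nonNegative⁻¹ _) dd≤) (0≤* {+ 672000 / 707281} (nonNegative⁻¹ _) 0≤-ad)) (0≤* {+ 1723524 / 707281} (nonNegative⁻¹ _) (0≤sq a)))
    (identity a d)
    where
    identity : ∀ a d → 4ℚ * (a * a) - (2ℚ * ((+ 21 / 29) * (+ 20 / 29)) * a + (+ 20 / 29) * (+ 20 / 29) * d) * (2ℚ * ((+ 21 / 29) * (+ 20 / 29)) * a + (+ 20 / 29) * (+ 20 / 29) * d)
      ≡ (+ 80000 / 707281) * (ι 5 * (a * a) - 2ℚ * (d * d)) + (+ 672000 / 707281) * - (a * d) + (+ 1723524 / 707281) * (a * a)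
    identity = solve-∀ ringℚ

offDiagonal : ∀ {n} → Matrix ℚ n → Matrix ℚ n
offDiagonal A i j = if does (i Fin.≟ j) then 0ℚ else A i j

offNorm : ∀ {n} → Matrix ℚ n → ℚ
offNorm A = sum λ i → ∥ offDiagonal A i ∥²

offDiagonal-diag : ∀ {n} (A : Matrix ℚ n) i → offDiagonal A i i ≡ 0ℚ
offDiagonal-diag A i = cong (if_then 0ℚ else A i i) (dec-true (i Fin.≟ i) refl)

offDiagonal-off : ∀ {n} (A : Matrix ℚ n) {i j} → i ≢ j → offDiagonal A i j ≡ A i j
offDiagonal-off A {i} {j} i≢j = cong (if_then 0ℚ else A i j) (dec-false (i Fin.≟ j) i≢j)

entry-split : ∀ {n} (A : Matrix ℚ n) i j → A i j ≡ offDiagonal A i j + δ i j * A i i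
entry-split A i j with i Fin.≟ j
... | yes refl = sym (trans (+-identityˡ (1ℚ * A i i)) (*-identityˡ (A i i)))
... | no _ = sym (trans (cong (λ z → A i j + z) (*-zeroˡ (A i i))) (+-identityʳ (A i j)))

frobenius-split : ∀ {n} (A : Matrix ℚ n) → sum (λ i → ∥ A i ∥²) ≡ offNorm A + sum (λ i → A i i * A i i)
frobenius-split A = trans (sum-cong row) (sum-+ (λ i → ∥ offDiagonal A i ∥²) (λ i → A i i * A i i))
  where
  row : ∀ i → ∥ A i ∥² ≡ ∥ offDiagonal A i ∥² + A i i * A i i
  row i = trans (sum-cong term) (trans (sum-+ (λ j → offDiagonal A i j * offDiagonal A i j) (λ j → δ i j * (A i j * A i j)))
    (cong (λ z → ∥ offDiagonal A i ∥² + z) (sum-δ i (λ j → A i j * A i j))))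
    where
    term : ∀ j → A i j * A i j ≡ offDiagonal A i j * offDiagonal A i j + δ i j * (A i j * A i j)
    term j with i Fin.≟ j
    ... | yes refl = sym (trans (+-identityˡ (1ℚ * (A i i * A i i))) (*-identityˡ (A i i * A i i)))
    ... | no _ = sym (trans (cong (λ z → A i j * A i j + z) (*-zeroˡ (A i j * A i j))) (+-identityʳ (A i j * A i j)))

offNorm-entry : ∀ {n} (A : Matrix ℚ n) i j → offDiagonal A i j * offDiagonal A i j ≤ offNorm A
offNorm-entry A i j = ≤-trans (entry≤sum (λ j → 0≤sq (offDiagonal A i j)) j) (entry≤sum (λ i → 0≤∥∥² (offDiagonal A i)) i)

module Jacobi {n : ℕ} where

  abstract
    -- The rate of convergence is 1 − ν.
    ν : ℚ
    ν = recip (0<* (0<* (0<ι 3) (0<ι n)) (0<ι n))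

    ν-def : 4ℚ * ι (suc n) * ι (suc n) * ν ≡ 1ℚ
    ν-def = recip-inverse (0<* (0<* (0<ι 3) (0<ι n)) (0<ι n))

    0<ν : 0ℚ < ν
    0<ν = recip-pos (0<* (0<* (0<ι 3) (0<ι n)) (0<ι n))

  rate : ℚ
  rate = 1ℚ - ν

  ν≤1 : ν ≤ 1ℚ
  ν≤1 = begin
    ν                                 ≡⟨ *-identityˡ ν ⟨
    1ℚ * ν                            ≤⟨ *-monoʳ-≤-nonNeg ν {{nonNegative (<⇒≤ 0<ν)}} 1≤ ⟩
    4ℚ * ι (suc n) * ι (suc n) * ν    ≡⟨ ν-def ⟩
    1ℚ                                ∎
    where
    open ≤-Reasoning
    1≤ : 1ℚ ≤ 4ℚ * ι (suc n) * ι (suc n)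
    1≤ = subst (1ℚ ≤_) (trans (ι-* (4 ℕ.* suc n) (suc n)) (cong (_* ι (suc n)) (ι-* 4 (suc n)))) (ι-mono-≤ {1} {4 ℕ.* suc n ℕ.* suc n} (s≤s z≤n))

  0≤rate : 0ℚ ≤ rate
  0≤rate = diff ν≤1

  -- G is a rational bound for the square root of `offNorm`, so that it can be multiplied by `rate`
  -- at each step.
  record Approximation (A : Matrix ℚ (suc n)) (G : ℚ) : Set where
    field
      matrix    : Matrix ℚ (suc n)
      symmetric : ∀ i j → matrix i j ≡ matrix j i
      similar   : Similar A matrix
      small     : offNorm matrix ≤ G * G

  open Approximation public

  -- The sum of the off-diagonal squares drops by 2a² - 2o² ≥ a² / 2. As the pivot is maximal, the
  -- sum is at most N² a² with N the order of the matrix, so the drop is at least the fraction 2ν of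
  -- the sum, and 1 - 2ν ≤ (1 - ν)².
  refine-at : ∀ {A G} → 0ℚ ≤ G → (X : Approximation A G) → ∀ {p q} → p ≢ q →
    offNorm (matrix X) ≤ ι (suc n) * (ι (suc n) * (matrix X p q * matrix X p q)) →
    GoodRotation (matrix X p q) (matrix X q q - matrix X p p) →
    Σ (Approximation A (G * rate)) λ Y → ∀ i → ℚ.∣ matrix Y i i - matrix X i i ∣ ≤ 2ℚ * G
  refine-at {A} {G} 0≤G X {p} {q} p≢q off≤aa rot = record { matrix = rotate B ; symmetric = rotate-symmetric B (symmetric X)
        ; similar = similar-trans (similar X) (rotate-similar B) ; small = small′ } , moved
    where
    open ≤-Reasoning
    open GoodRotation rot
    open Rotation p≢q c s unit
    B = matrix X
    a = B p q
    d = B q q - B p p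
    o = rotated-off B (symmetric X)
    g = gain B (symmetric X)
    off-change : offNorm (rotate B) ≡ offNorm B - (a * a + a * a - (o * o + o * o))
    off-change = begin-equality
      offNorm (rotate B)            ≡⟨ isolate (offNorm (rotate B)) Dr ⟩
      (offNorm (rotate B) + Dr) - Dr  ≡⟨ cong (_- Dr) (trans (sym (frobenius-split (rotate B))) (trans (rotate-frobenius B) (frobenius-split B))) ⟩
      (offNorm B + D) - Dr          ≡⟨ cong (λ z → (offNorm B + D) - z) (diagonal-squares B (symmetric X)) ⟩
      (offNorm B + D) - (D + (a * a + a * a - (o * o + o * o))) ≡⟨ cancel (offNorm B) D (a * a + a * a - (o * o + o * o)) ⟩
      offNorm B - (a * a + a * a - (o * o + o * o)) ∎
      where
      D  = sum (λ i → B i i * B i i)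
      Dr = sum (λ i → rotate B i i * rotate B i i)
      isolate : ∀ x y → x ≡ (x + y) - y
      isolate = solve-∀ ringℚ
      cancel : ∀ x y z → (x + y) - (y + z) ≡ x - z
      cancel = solve-∀ ringℚ
    small′ : offNorm (rotate B) ≤ G * rate * (G * rate)
    small′ = begin
      offNorm (rotate B)            ≡⟨ off-change ⟩
      offNorm B - (a * a + a * a - (o * o + o * o)) ≤⟨ from-diff (0≤* {½} (nonNegative⁻¹ ½) (diff off≤)) (half (offNorm B) a o) ⟩
      offNorm B - ½ * (a * a)       ≤⟨ from-diff (0≤* (0≤* (<⇒≤ 0<2) (<⇒≤ 0<ν)) (diff off≤aa)) (trade (offNorm B) (ι (suc n)) ν a) ⟩
      offNorm B - 2ℚ * ν * offNorm B - ½ * (a * a) * (1ℚ - 4ℚ * ι (suc n) * ι (suc n) * ν) ≡⟨ cong (λ z → offNorm B - 2ℚ * ν * offNorm B - ½ * (a * a) * (1ℚ - z)) ν-def ⟩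
      offNorm B - 2ℚ * ν * offNorm B - ½ * (a * a) * (1ℚ - 1ℚ) ≤⟨ from-diff (0≤* (0≤sq ν) (sum-nonneg λ i → 0≤∥∥² (offDiagonal B i))) (square (offNorm B) ν a) ⟩
      rate * rate * offNorm B       ≤⟨ *-monoˡ (0≤* 0≤rate 0≤rate) (small X) ⟩
      rate * rate * (G * G)         ≡⟨ shuffle rate G ⟩
      G * rate * (G * rate)         ∎
      where
      half : ∀ x a o → (x - ½ * (a * a)) - (x - (a * a + a * a - (o * o + o * o))) ≡ ½ * (3ℚ * (a * a) - 4ℚ * (o * o))
      half = solve-∀ ringℚ
      trade : ∀ x k ν a → (x - 2ℚ * ν * x - ½ * (a * a) * (1ℚ - 4ℚ * k * k * ν)) - (x - ½ * (a * a)) ≡ 2ℚ * ν * (k * (k * (a * a)) - x)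
      trade = solve-∀ ringℚ
      square : ∀ x ν a → (1ℚ - ν) * (1ℚ - ν) * x - (x - 2ℚ * ν * x - ½ * (a * a) * (1ℚ - 1ℚ)) ≡ ν * ν * x
      square = solve-∀ ringℚ
      shuffle : ∀ r G → r * r * (G * G) ≡ G * r * (G * r)
      shuffle = solve-∀ ringℚ
    ∣gain∣≤ : ℚ.∣ g ∣ ≤ 2ℚ * G
    ∣gain∣≤ = abs-sq-≤ (0≤* (<⇒≤ 0<2) 0≤G) (begin
      g * g             ≤⟨ gain≤ ⟩
      4ℚ * (a * a)      ≡⟨ cong (λ z → 4ℚ * (z * z)) (offDiagonal-off B p≢q) ⟨
      4ℚ * (offDiagonal B p q * offDiagonal B p q) ≤⟨ *-monoˡ (0≤ι 4) (≤-trans (offNorm-entry B p q) (small X)) ⟩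
      4ℚ * (G * G)      ≡⟨ square G ⟩
      2ℚ * G * (2ℚ * G) ∎)
      where
      square : ∀ G → 4ℚ * (G * G) ≡ 2ℚ * G * (2ℚ * G)
      square = solve-∀ ringℚ
    moved : ∀ i → ℚ.∣ rotate B i i - B i i ∣ ≤ 2ℚ * G
    moved i with position i
    ... | at-p refl = ≤-trans (≤-reflexive (cong ℚ.∣_∣ (trans (cong (_- B i i) (rotate-pp B (symmetric X))) (cancel (B i i) g)))) ∣gain∣≤
      where
      cancel : ∀ x g → (x + g) - x ≡ g
      cancel = solve-∀ ringℚ
    ... | at-q refl = ≤-trans (≤-reflexive (trans (cong ℚ.∣_∣ (trans (cong (_- B i i) (rotate-qq B (symmetric X))) (cancel (B i i) g))) (∣-p∣≡∣p∣ g))) ∣gain∣≤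
      where
      cancel : ∀ x g → (x - g) - x ≡ - g
      cancel = solve-∀ ringℚ
    ... | off i≢p i≢q = ≤-trans (≤-reflexive (cong ℚ.∣_∣ (trans (cong (_- B i i) (rotate-diagonal B (symmetric X) i i≢p i≢q)) (+-inverseʳ (B i i))))) (0≤* (<⇒≤ 0<2) 0≤G)

  refine : ∀ {A G} → 0ℚ ≤ G → (X : Approximation A G) →
    Σ (Approximation A (G * rate)) λ Y → ∀ i → ℚ.∣ matrix Y i i - matrix X i i ∣ ≤ 2ℚ * G
  refine {A} {G} 0≤G X = by-cases (p Fin.≟ q)
    where
    open ≤-Reasoning
    B = matrix X
    O = offDiagonal B
    rowmax = λ i → argmax (λ j → O i j * O i j)
    colmax = argmax (λ i → O i (proj₁ (rowmax i)) * O i (proj₁ (rowmax i)))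
    p = proj₁ colmax
    q = proj₁ (rowmax p)
    off≤max : offNorm B ≤ ι (suc n) * (ι (suc n) * (O p q * O p q))
    off≤max = begin
      offNorm B                                       ≤⟨ sum-mono (λ i → sum-mono λ j → ≤-trans (proj₂ (rowmax i) j) (proj₂ colmax i)) ⟩
      sum {suc n} (λ i → sum {suc n} λ j → O p q * O p q) ≡⟨ trans (sum-const (suc n) _) (cong (ι (suc n) *_) (sum-const (suc n) (O p q * O p q))) ⟩
      ι (suc n) * (ι (suc n) * (O p q * O p q))                     ∎
    by-cases : Dec (p ≡ q) → Σ (Approximation A (G * rate)) λ Y → ∀ i → ℚ.∣ matrix Y i i - matrix X i i ∣ ≤ 2ℚ * G
    by-cases (no p≢q)  = refine-at 0≤G X p≢q (subst (λ z → offNorm B ≤ ι (suc n) * (ι (suc n) * (z * z))) (offDiagonal-off B p≢q) off≤max)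
      (goodRotation (B p q) (B q q - B p p))
    -- The maximal square sits on the diagonal of `offDiagonal B`, which is zero: B is already
    -- diagonal and nothing has to be turned.
    by-cases (yes p≡q) = record { matrix = B ; symmetric = symmetric X ; similar = similar X ; small = begin
        offNorm B                     ≤⟨ off≤max ⟩
        ι (suc n) * (ι (suc n) * (O p q * O p q))   ≡⟨ cong (λ z → ι (suc n) * (ι (suc n) * (z * z))) (trans (cong (O p) (sym p≡q)) (offDiagonal-diag B p)) ⟩
        ι (suc n) * (ι (suc n) * (0ℚ * 0ℚ)) ≡⟨ vanish (ι (suc n)) ⟩
        0ℚ                            ≤⟨ 0≤sq (G * rate) ⟩
        G * rate * (G * rate)         ∎ } ,
      λ i → ≤-trans (≤-reflexive (cong ℚ.∣_∣ (+-inverseʳ (B i i)))) (0≤* (<⇒≤ 0<2) 0≤G)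
      where
      vanish : ∀ k → k * (k * (0ℚ * 0ℚ)) ≡ 0ℚ
      vanish = solve-∀ ringℚ

-- Sorting.

Sorted : ∀ {n} → Vector ℚ n → Set
Sorted f = ∀ i j → i Fin.≤ j → f i ≤ f j

argmin : ∀ {n} (f : Vector ℚ (suc n)) → ∃ λ p → ∀ i → f p ≤ f i
argmin f with argmax (λ i → - f i)
... | p , maximal = p , λ i → subst₂ _≤_ (neg-involutive (f p)) (neg-involutive (f i)) (neg-antimono-≤ (maximal i))
  where
  neg-involutive : ∀ q → - (- q) ≡ q
  neg-involutive = solve-∀ ringℚ

sort : ∀ {n} (f : Vector ℚ n) → Σ[ σ ∈ Permutation′ n ] Sorted (λ i → f (σ ⟨$⟩ʳ i))
sort {zero}  f = Perm.id , λ ()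
sort {suc n} f = σ , sorted
  where
  m = proj₁ (argmin f)
  minimal = proj₂ (argmin f)
  σ′ = proj₁ (sort (λ i → f (punchIn m i)))
  sorted′ = proj₂ (sort (λ i → f (punchIn m i)))
  σ = Perm.insert zero m σ′
  σ-suc : ∀ i → σ ⟨$⟩ʳ suc i ≡ punchIn m (σ′ ⟨$⟩ʳ i)
  σ-suc = Perm.insert-punchIn zero m σ′
  sorted : Sorted (λ i → f (σ ⟨$⟩ʳ i))
  sorted zero    j       _        = minimal (σ ⟨$⟩ʳ j)
  sorted (suc i) (suc j) (s≤s i≤j) = ≤-trans (≤-reflexive (cong f (σ-suc i))) (≤-trans (sorted′ i j i≤j) (≤-reflexive (cong f (sym (σ-suc j)))))

-- Among τ 0, …, τ i some index is not among the i indices σ 0, …, σ (i − 1).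
sorted-≤ : ∀ {n} (a b : Vector ℚ n) (σ τ : Permutation′ n) {ε} → Sorted (λ i → a (σ ⟨$⟩ʳ i)) → Sorted (λ i → b (τ ⟨$⟩ʳ i)) →
  (∀ i → a i ≤ b i + ε) → ∀ i → a (σ ⟨$⟩ʳ i) ≤ b (τ ⟨$⟩ʳ i) + ε
sorted-≤ {n} a b σ τ {ε} sorted-a sorted-b a≤b i = decide (Fin.any? λ j → (j Fin.≤? i) ×-dec (i Fin.≤? rank j))
  where
  open ≤-Reasoning
  rank : Fin n → Fin n
  rank j = σ ⟨$⟩ˡ (τ ⟨$⟩ʳ j)
  rank-injective : ∀ {j k} → rank j ≡ rank k → j ≡ k
  rank-injective {j} {k} eq = trans (sym (Perm.inverseˡ τ)) (trans (cong (τ ⟨$⟩ˡ_)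
    (trans (sym (Perm.inverseʳ σ)) (trans (cong (σ ⟨$⟩ʳ_) eq) (Perm.inverseʳ σ)))) (Perm.inverseˡ τ))
  decide : Dec (∃ λ j → j Fin.≤ i × i Fin.≤ rank j) → a (σ ⟨$⟩ʳ i) ≤ b (τ ⟨$⟩ʳ i) + ε
  decide (yes (j , j≤i , i≤)) = begin
    a (σ ⟨$⟩ʳ i)            ≤⟨ sorted-a i (rank j) i≤ ⟩
    a (σ ⟨$⟩ʳ rank j)       ≡⟨ cong a (Perm.inverseʳ σ) ⟩
    a (τ ⟨$⟩ʳ j)            ≤⟨ a≤b (τ ⟨$⟩ʳ j) ⟩
    b (τ ⟨$⟩ʳ j) + ε        ≤⟨ +-monoˡ-≤ ε (sorted-b j i j≤i) ⟩
    b (τ ⟨$⟩ʳ i) + ε        ∎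
  decide (no none) with Fin.pigeonhole (ℕ.n<1+n (toℕ i)) below
    where
    inject : Fin (suc (toℕ i)) → Fin n
    inject k = Fin.fromℕ< (ℕ.<-≤-trans (Fin.toℕ<n k) (Fin.toℕ<n i))
    inject≤i : ∀ k → inject k Fin.≤ i
    inject≤i k = subst (ℕ._≤ toℕ i) (sym (Fin.toℕ-fromℕ< _)) (ℕ.s≤s⁻¹ (Fin.toℕ<n k))
    below : Fin (suc (toℕ i)) → Fin (toℕ i)
    below k = Fin.fromℕ< {toℕ (rank (inject k))} (ℕ.≰⇒> λ i≤ → none (inject k , inject≤i k , i≤))
  ... | k , l , k<l , eq = contradiction (trans (sym (Fin.toℕ-fromℕ< _)) (trans (cong toℕ (rank-injective (Fin.toℕ-injective
          (trans (sym (Fin.toℕ-fromℕ< _)) (trans (cong toℕ eq) (Fin.toℕ-fromℕ< _)))))) (Fin.toℕ-fromℕ< _))) (ℕ.<⇒≢ k<l)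

-- Real numbers act through their approximating sequences.

module Evaluation (R : Raw.RawRing 0ℓ 0ℓ) (ev : Raw.RawRing.Carrier R → ℚ)
  (ev-+ : ∀ x y → ev (Raw.RawRing._+_ R x y) ≡ ev x + ev y)
  (ev-* : ∀ x y → ev (Raw.RawRing._*_ R x y) ≡ ev x * ev y)
  (ev-- : ∀ x → ev (Raw.RawRing.-_ R x) ≡ - ev x)
  (ev-0 : ev (Raw.RawRing.0# R) ≡ 0ℚ)
  (ev-1 : ev (Raw.RawRing.1# R) ≡ 1ℚ) where
  open Raw.RawRing R using (Carrier; rawSemiring; 1#) renaming (_*_ to _·_; -_ to ⊖_)
  module R = RawSemiringDefs rawSemiring

  ev-sum : ∀ {n} (f : Vector Carrier n) → ev (R.sum f) ≡ sum (λ i → ev (f i))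
  ev-sum {zero}  f = ev-0
  ev-sum {suc n} f = trans (ev-+ (f zero) (R.sum (f ∘ suc))) (cong (λ z → ev (f zero) + z) (ev-sum (f ∘ suc)))

  ev-product : ∀ {n} (f : Vector Carrier n) → ev (R.product f) ≡ product (λ i → ev (f i))
  ev-product {zero}  f = ev-1
  ev-product {suc n} f = trans (ev-* (f zero) (R.product (f ∘ suc))) (cong (ev (f zero) *_) (ev-product (f ∘ suc)))

  ev-sgn : ∀ m → ev ((⊖ 1#) R.^ m) ≡ (- 1ℚ) ^ m
  ev-sgn zero    = ev-1
  ev-sgn (suc m) = trans (ev-* (⊖ 1#) ((⊖ 1#) R.^ m)) (cong₂ _*_ (trans (ev-- 1#) (cong -_ ev-1)) (ev-sgn m))

  ev-det : ∀ {n} (M : Matrix Carrier n) → ev (det R M) ≡ detℚ (λ i j → ev (M i j))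
  ev-det {zero}  M = ev-1
  ev-det {suc n} M = trans (ev-sum (λ j → ((⊖ 1#) R.^ toℕ j · M zero j) · det R (λ i l → M (suc i) (punchIn j l))))
    (sum-cong λ j → trans (ev-* ((⊖ 1#) R.^ toℕ j · M zero j) (det R (λ i l → M (suc i) (punchIn j l))))
      (cong₂ _*_ (trans (ev-* ((⊖ 1#) R.^ toℕ j) (M zero j)) (cong (_* ev (M zero j)) (ev-sgn (toℕ j)))) (ev-det (λ i l → M (suc i) (punchIn j l)))))

-- Taking the k-th rational of a real commutes with the ring operations by definition, so real
-- determinants and products can be computed term by term over the rationals.
module At (k : ℕ) = Evaluation ℝ-rawRing (λ x → seq x k) (λ _ _ → refl) (λ _ _ → refl) (λ _ → refl) refl refl

open RawSemiringDefs (Raw.RawRing.rawSemiring ℝ-rawRing) using () renaming (product to productᴿ)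

seq-product : ∀ {n} (f : Vector ℝ n) k → seq (productᴿ f) k ≡ product (λ i → seq (f i) k)
seq-product f k = At.ev-product k f

seq-charPoly : ∀ {n} (M : Matrix ℝ n) x k → seq (charPoly M x) k ≡ detℚ (shift (λ i j → seq (M i j) k) (seq x k))
seq-charPoly M x k = trans (At.ev-det k (λ i j → scalar x i j +ᴿ -ᴿ M i j)) (det-cong λ i j → cong (_+ - seq (M i j) k) (seq-if (does (i Fin.≟ j))))
  where
  seq-if : ∀ b → seq (if b then x else 0ᴿ) k ≡ (if b then seq x k else 0ℚ)
  seq-if true  = refl
  seq-if false = refl

eventually-bounded : ∀ x → ∃ λ B → 0ℚ ≤ B × ∃ λ N → ∀ n → N ℕ.≤ n → ℚ.∣ seq x n ∣ ≤ B
eventually-bounded x with cauchy x 1ℚ 0<1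
... | N , close = ℚ.∣ seq x N ∣ + 1ℚ , 0≤+ (0≤∣p∣ (seq x N)) (<⇒≤ 0<1) , N , λ n N≤n →
  ≤-trans (≤-reflexive (cong ℚ.∣_∣ (split (seq x n) (seq x N)))) (≤-trans (∣p+q∣≤∣p∣+∣q∣ (seq x N) (seq x n - seq x N))
    (+-monoʳ-≤ ℚ.∣ seq x N ∣ (close n N N≤n ℕ.≤-refl)))
  where
  split : ∀ p q → p ≡ q + (p - q)
  split = solve-∀ ringℚ

bernoulli-bound : ∀ {X R R₀ N ε} → 0ℚ ≤ X → 0ℚ ≤ N → 0ℚ ≤ ε → R * (1ℚ + N) ≤ R₀ → X * R₀ ≤ ε * N → X * R ≤ ε
bernoulli-bound {X} {R} {R₀} {N} {ε} 0≤X 0≤N 0≤ε R≤ large = *-cancelˡ (+-mono-<-≤ 0<1 0≤N) (begin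
  (1ℚ + N) * (X * R)    ≡⟨ swap (1ℚ + N) X R ⟩
  X * (R * (1ℚ + N))    ≤⟨ *-monoˡ 0≤X R≤ ⟩
  X * R₀                ≤⟨ large ⟩
  ε * N                 ≤⟨ from-diff 0≤ε (expand ε N) ⟩
  (1ℚ + N) * ε          ∎)
  where
  open ≤-Reasoning
  swap : ∀ a b c → a * (b * c) ≡ b * (c * a)
  swap = solve-∀ ringℚ
  expand : ∀ ε N → (1ℚ + N) * ε - ε * N ≡ ε
  expand = solve-∀ ringℚ

module JacobiRadius {n} (A : Matrix ℚ (suc n)) where
  open Jacobi {n}

  radius : ℕ → ℚ
  -- A rational number whose square is at least `offNorm A`.
  radius zero    = offNorm A + 1ℚ
  radius (suc k) = radius k * rate

  0≤offNorm : 0ℚ ≤ offNorm A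
  0≤offNorm = sum-nonneg λ i → 0≤∥∥² (offDiagonal A i)

  0≤radius : ∀ k → 0ℚ ≤ radius k
  0≤radius zero    = 0≤+ 0≤offNorm (<⇒≤ 0<1)
  0≤radius (suc k) = 0≤* (0≤radius k) 0≤rate

  record Run : Set where
    field
      stage : ∀ k → Approximation A (radius k)
      moved : ∀ k i → ℚ.∣ matrix (stage (suc k)) i i - matrix (stage k) i i ∣ ≤ 2ℚ * radius k

  run : (∀ i j → A i j ≡ A j i) → Run
  run symA = record { stage = stage ; moved = λ k → proj₂ (refine (0≤radius k) (stage k)) }
    where
    stage : ∀ k → Approximation A (radius k)
    stage zero    = record { matrix = A ; symmetric = symA ; similar = similar-refl ; small =
      from-diff (0≤+ (0≤+ (0≤sq (offNorm A)) 0≤offNorm) (<⇒≤ 0<1)) (expand (offNorm A)) }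
      where
      expand : ∀ x → (x + 1ℚ) * (x + 1ℚ) - x ≡ x * x + x + 1ℚ
      expand = solve-∀ ringℚ
    stage (suc k) = proj₁ (refine (0≤radius k) (stage k))

module JacobiIteration {n} (A : Matrix ℚ (suc n)) (run : JacobiRadius.Run A) where
  open Jacobi {n}
  open JacobiRadius A hiding (run)
  open Run run

  diagonal : ℕ → Vector ℚ (suc n)
  diagonal k i = matrix (stage k) i i

  -- M = 1 / ν bounds the geometric series.
  M : ℚ
  M = 4ℚ * ι (suc n) * ι (suc n)

  0≤M : 0ℚ ≤ M
  0≤M = 0≤* (0≤* (0≤ι 4) (0≤ι (suc n))) (0≤ι (suc n))

  -- One step moves the diagonal by at most twice the radius, and the radius loses the fraction ν of
  -- itself; since M = 1 / ν the movements telescope.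
  drift : ∀ k j i → ℚ.∣ diagonal (k ℕ.+ j) i - diagonal k i ∣ ≤ 2ℚ * M * (radius k - radius (k ℕ.+ j))
  drift k zero i rewrite ℕ.+-identityʳ k = ≤-trans (≤-reflexive (cong ℚ.∣_∣ (+-inverseʳ (diagonal k i))))
    (≤-reflexive (sym (trans (cong (2ℚ * M *_) (+-inverseʳ (radius k))) (*-zeroʳ (2ℚ * M)))))
  drift k (suc j) i rewrite ℕ.+-suc k j = begin
    ℚ.∣ diagonal (suc l) i - diagonal k i ∣     ≤⟨ abs-triangle (diagonal (suc l) i) (diagonal l i) (diagonal k i) ⟩
    ℚ.∣ diagonal (suc l) i - diagonal l i ∣ + ℚ.∣ diagonal l i - diagonal k i ∣ ≤⟨ +-mono-≤ (moved l i) (drift k j i) ⟩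
    2ℚ * radius l + 2ℚ * M * (radius k - radius l)  ≡⟨ telescope (radius l) (radius k) M ν ⟩
    2ℚ * M * (radius k - radius l * rate) + 2ℚ * radius l * (1ℚ - M * ν) ≡⟨ cong (λ z → 2ℚ * M * (radius k - radius l * rate) + 2ℚ * radius l * (1ℚ - z)) ν-def ⟩
    2ℚ * M * (radius k - radius l * rate) + 2ℚ * radius l * (1ℚ - 1ℚ) ≡⟨ drop (2ℚ * M * (radius k - radius l * rate)) (2ℚ * radius l) ⟩
    2ℚ * M * (radius k - radius (suc l))  ∎
    where
    open ≤-Reasoning
    l = k ℕ.+ j
    telescope : ∀ r s M ν → 2ℚ * r + 2ℚ * M * (s - r) ≡ 2ℚ * M * (s - r * (1ℚ - ν)) + 2ℚ * r * (1ℚ - M * ν)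
    telescope = solve-∀ ringℚ
    drop : ∀ x y → x + y * (1ℚ - 1ℚ) ≡ x
    drop = solve-∀ ringℚ

  radius-drop : ∀ k j → radius k - radius (k ℕ.+ j) ≤ radius k
  radius-drop k j = from-diff {radius k - radius (k ℕ.+ j)} {radius k} {radius (k ℕ.+ j)} (0≤radius (k ℕ.+ j)) (cancel (radius k) (radius (k ℕ.+ j)))
    where
    cancel : ∀ x y → x - (x - y) ≡ y
    cancel = solve-∀ ringℚ

  diagonal-close+ : ∀ k j i → ℚ.∣ diagonal (k ℕ.+ j) i - diagonal k i ∣ ≤ 2ℚ * M * radius k
  diagonal-close+ k j i = ≤-trans (drift k j i) (*-monoˡ {radius k - radius (k ℕ.+ j)} {radius k} {2ℚ * M} (0≤* {2ℚ} {M} (<⇒≤ 0<2) 0≤M) (radius-drop k j))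

  diagonal-close : ∀ k l → k ℕ.≤ l → ∀ i → ℚ.∣ diagonal l i - diagonal k i ∣ ≤ 2ℚ * M * radius k
  diagonal-close k l k≤l i = subst (λ l → ℚ.∣ diagonal l i - diagonal k i ∣ ≤ 2ℚ * M * radius k)
    (proj₂ (ℕ.m≤n⇒∃[o]m+o≡n k≤l)) (diagonal-close+ k (proj₁ (ℕ.m≤n⇒∃[o]m+o≡n k≤l)) i)

  -- Bernoulli's inequality in the form (1 - ν)^k (1 + ν k) ≤ 1, which makes the radius tend to 0 at
  -- an explicit rate.
  bernoulli : ∀ k → radius k * (1ℚ + ν * ι k) ≤ radius 0
  bernoulli zero    = ≤-reflexive (trans (cong (λ z → radius 0 * (1ℚ + z)) (*-zeroʳ ν)) (*-identityʳ (radius 0)))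
  bernoulli (suc k) = ≤-trans (from-diff (0≤* (0≤* (0≤radius k) (0≤sq ν)) (0≤ι (suc k))) (expand (radius k) ν (ι k))) (bernoulli k)
    where
    expand : ∀ r ν k → r * (1ℚ + ν * k) - r * (1ℚ - ν) * (1ℚ + ν * (1ℚ + k)) ≡ r * (ν * ν) * (1ℚ + k)
    expand = solve-∀ ringℚ

  radius-small : ∀ X {ε} → 0ℚ ≤ X → 0ℚ < ε → ∃ λ K → ∀ k → K ℕ.≤ k → X * radius k ≤ ε
  radius-small X {ε} 0≤X 0<ε = proj₁ large , λ k K≤k →
    bernoulli-bound {X} {radius k} {radius 0} {ν * ι k} {ε} 0≤X (0≤* {ν} {ι k} (<⇒≤ 0<ν) (0≤ι k)) (<⇒≤ 0<ε) (bernoulli k)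
      (≤-trans (proj₂ large k K≤k) (≤-reflexive (*-assoc ε ν (ι k))))
    where
    large = eventually-small (X * radius 0) {ε * ν} (0<* {ε} {ν} 0<ε 0<ν)

  order : ℕ → Permutation′ (suc n)
  order k = proj₁ (sort (diagonal k))

  eigenvalue-seq : Fin (suc n) → ℕ → ℚ
  eigenvalue-seq i k = diagonal k (order k ⟨$⟩ʳ i)

  -- By `sorted-≤`, sorting does not increase the largest difference of two vectors. So the sorted
  -- diagonals are Cauchy even if the sorting permutation never settles, as may happen for multiple
  -- eigenvalues.
  eigenvalue-close : ∀ k l ε → (∀ i → ℚ.∣ diagonal k i - diagonal l i ∣ ≤ ε) → ∀ i → ℚ.∣ eigenvalue-seq i k - eigenvalue-seq i l ∣ ≤ ε
  eigenvalue-close k l ε close i = abs-≤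
      (from-diff (diff (sorted-≤ (diagonal k) (diagonal l) (order k) (order l) (proj₂ (sort (diagonal k))) (proj₂ (sort (diagonal l))) k≤l i)) (upper (eigenvalue-seq i k) (eigenvalue-seq i l) ε))
      (from-diff (diff (sorted-≤ (diagonal l) (diagonal k) (order l) (order k) (proj₂ (sort (diagonal l))) (proj₂ (sort (diagonal k))) l≤k i)) (lower (eigenvalue-seq i k) (eigenvalue-seq i l) ε))
    where
    upper : ∀ a b ε → ε - (a - b) ≡ (b + ε) - a
    upper = solve-∀ ringℚ
    lower : ∀ a b ε → (a - b) - (- ε) ≡ (a + ε) - b
    lower = solve-∀ ringℚ
    k≤l : ∀ i → diagonal k i ≤ diagonal l i + ε
    k≤l i = from-diff (diff (≤-trans (p≤∣p∣ (diagonal k i - diagonal l i)) (close i))) (sym (upper (diagonal k i) (diagonal l i) ε))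
    l≤k : ∀ i → diagonal l i ≤ diagonal k i + ε
    l≤k i = from-diff (diff (≤-trans (neg-antimono-≤ (close i)) (-∣p∣≤p (diagonal k i - diagonal l i)))) (sym (lower (diagonal k i) (diagonal l i) ε))

  eigenvalue-cauchy : ∀ i → Cauchy (eigenvalue-seq i)
  eigenvalue-cauchy i ε 0<ε = K , λ k l K≤k K≤l → eigenvalue-close k l ε (close k l K≤k K≤l) i
    where
    open ≤-Reasoning
    tiny = radius-small (4ℚ * M) {ε} (0≤* {4ℚ} {M} (0≤ι 4) 0≤M) 0<ε
    K = proj₁ tiny
    double : ∀ M r → 2ℚ * M * r + 2ℚ * M * r ≡ 4ℚ * M * r
    double = solve-∀ ringℚ
    close : ∀ k l → K ℕ.≤ k → K ℕ.≤ l → ∀ j → ℚ.∣ diagonal k j - diagonal l j ∣ ≤ ε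
    close k l K≤k K≤l j = begin
      ℚ.∣ diagonal k j - diagonal l j ∣ ≤⟨ abs-triangle (diagonal k j) (diagonal K j) (diagonal l j) ⟩
      ℚ.∣ diagonal k j - diagonal K j ∣ + ℚ.∣ diagonal K j - diagonal l j ∣ ≤⟨ +-mono-≤ (diagonal-close K k K≤k j) (≤-trans (≤-reflexive (abs-swap (diagonal K j) (diagonal l j))) (diagonal-close K l K≤l j)) ⟩
      2ℚ * M * radius K + 2ℚ * M * radius K ≡⟨ double M (radius K) ⟩
      4ℚ * M * radius K                 ≤⟨ proj₂ tiny K ℕ.≤-refl ⟩
      ε                                 ∎

  eigenvalue : Vector ℝ (suc n)
  eigenvalue i = mkℝ (eigenvalue-seq i) (eigenvalue-cauchy i)

  entry-bound : ℚ
  entry-bound = sum (λ i → ∥ A i ∥²) + 1ℚ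

  0≤entry-bound : 0ℚ ≤ entry-bound
  0≤entry-bound = 0≤+ (sum-nonneg λ i → 0≤∥∥² (A i)) (<⇒≤ 0<1)

  ∣entry∣≤ : ∀ k i j → ℚ.∣ matrix (stage k) i j ∣ ≤ entry-bound
  ∣entry∣≤ k i j = abs-sq-≤ 0≤entry-bound (begin
    B i j * B i j               ≤⟨ entry≤sum (λ j → 0≤sq (B i j)) j ⟩
    ∥ B i ∥²                    ≤⟨ entry≤sum (λ i → 0≤∥∥² (B i)) i ⟩
    sum (λ i → ∥ B i ∥²)        ≡⟨ frobenius (similar (stage k)) ⟩
    F                           ≤⟨ from-diff (0≤+ (0≤+ (0≤sq F) (sum-nonneg λ i → 0≤∥∥² (A i))) (<⇒≤ 0<1)) (expand F) ⟩
    (F + 1ℚ) * (F + 1ℚ)         ∎)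
    where
    open ≤-Reasoning
    B = matrix (stage k)
    F = sum (λ i → ∥ A i ∥²)
    expand : ∀ x → (x + 1ℚ) * (x + 1ℚ) - x ≡ x * x + x + 1ℚ
    expand = solve-∀ ringℚ

  S D : ℚ → ℕ → Matrix ℚ (suc n)
  S y k = shift (matrix (stage k)) y
  D y k i j = if does (i Fin.≟ j) then S y k i j else 0ℚ
  product-diagonal : ∀ y k → detℚ (D y k) ≡ product (λ i → y - diagonal k i)
  product-diagonal y k = trans (det-diagonal (D y k) (λ i j i≢j → cong (if_then S y k i j else 0ℚ) (dec-false (i Fin.≟ j) i≢j)))
    (product-cong λ i → trans (cong (if_then S y k i i else 0ℚ) (dec-true (i Fin.≟ i) refl))
      (cong (λ b → (if b then y else 0ℚ) + - diagonal k i) (dec-true (i Fin.≟ i) refl)))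
    where
    product-cong : ∀ {m} {f g : Vector ℚ m} → (∀ i → f i ≡ g i) → product f ≡ product g
    product-cong {zero}  eq = refl
    product-cong {suc m} eq = cong₂ _*_ (eq zero) (product-cong (eq ∘ suc))
  S≤ : ∀ {X y} k → 0ℚ ≤ X → ℚ.∣ y ∣ ≤ X → Bounded (X + entry-bound) (S y k)
  S≤ {X} {y} k 0≤X y≤X i j = abs+-≤ (if-bound (does (i Fin.≟ j))) (≤-trans (≤-reflexive (∣-p∣≡∣p∣ (matrix (stage k) i j))) (∣entry∣≤ k i j))
    where
    if-bound : ∀ b → ℚ.∣ if b then y else 0ℚ ∣ ≤ X
    if-bound true  = y≤X
    if-bound false = 0≤X
  D≤ : ∀ {X y} k → 0ℚ ≤ X → ℚ.∣ y ∣ ≤ X → Bounded (X + entry-bound) (D y k)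
  D≤ {X} {y} k 0≤X y≤X i j with i Fin.≟ j
  ... | yes refl = subst (λ b → ℚ.∣ (if b then y else 0ℚ) + - matrix (stage k) i i ∣ ≤ X + entry-bound) (dec-true (i Fin.≟ i) refl) (S≤ k 0≤X y≤X i i)
  ... | no _ = 0≤+ 0≤X 0≤entry-bound
  S~D : ∀ y k i j → ℚ.∣ S y k i j - D y k i j ∣ ≤ radius k
  S~D y k i j with i Fin.≟ j
  ... | yes refl = ≤-trans (≤-reflexive (cong ℚ.∣_∣ (+-inverseʳ (y + - matrix (stage k) i i)))) (0≤radius k)
  ... | no i≢j = ≤-trans (≤-reflexive (trans (cong ℚ.∣_∣ (tidy (matrix (stage k) i j))) (∣-p∣≡∣p∣ (matrix (stage k) i j))))
          (abs-sq-≤ (0≤radius k) (subst (λ z → z * z ≤ radius k * radius k) (offDiagonal-off (matrix (stage k)) i≢j)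
            (≤-trans (offNorm-entry (matrix (stage k)) i j) (small (stage k)))))
    where
    tidy : ∀ b → (0ℚ + - b) - 0ℚ ≡ - b
    tidy = solve-∀ ringℚ

  -- The characteristic polynomial of A is that of stage k. Dropping the off-diagonal entries of the
  -- stage changes the determinant by at most C times the radius and leaves the product over its
  -- diagonal, which does not see the sorting.
  char-close : ∀ X → 0ℚ ≤ X → ∃ λ C → 0ℚ ≤ C × (∀ y k → ℚ.∣ y ∣ ≤ X →
    ℚ.∣ detℚ (shift A y) - product (λ i → y - eigenvalue-seq i k) ∣ ≤ C * radius k)
  char-close X 0≤X = let C , 0≤C , close = det-close (suc n) (X + entry-bound) (0≤+ 0≤X 0≤entry-bound) in
    C , 0≤C , λ y k y≤X → subst (_≤ C * radius k)
    (cong ℚ.∣_∣ (cong₂ _-_ (charpoly (similar (stage k)) y)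
      (trans (product-diagonal y k) (product-permute (λ i → y - diagonal k i) (order k)))))
    (close (S y k) (D y k) (S≤ k 0≤X y≤X) (D≤ k 0≤X y≤X) (S~D y k) (0≤radius k))

  spectrum : (M : Matrix ℝ (suc n)) → (∀ i j k → seq (M i j) k ≡ A i j) → IsSpectrum M eigenvalue
  spectrum M M≡A = ordered , roots
    where
    ordered : ∀ i j → i Fin.≤ j → eigenvalue i ≤ᴿ eigenvalue j
    ordered i j i≤j ε 0<ε = 0 , λ k _ → ≤-trans (proj₂ (sort (diagonal k)) i j i≤j)
      (≤-trans (≤-reflexive (sym (+-identityʳ (eigenvalue-seq j k)))) (+-monoʳ-≤ (eigenvalue-seq j k) (<⇒≤ 0<ε)))
    rational : ∀ (y : ℝ) ε → 0ℚ < ε → ∃ λ N → ∀ k → N ℕ.≤ k →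
      ℚ.∣ detℚ (shift A (seq y k)) - product (λ i → seq y k - eigenvalue-seq i k) ∣ ≤ ε
    rational y ε 0<ε =
      let X , 0≤X , N , bounded = eventually-bounded y
          C , 0≤C , close       = char-close X 0≤X
          K , tiny              = radius-small C 0≤C 0<ε
      in N ℕ.⊔ K , λ k ≤k →
        ≤-trans (close (seq y k) k (bounded k (ℕ.≤-trans (ℕ.m≤m⊔n N K) ≤k))) (tiny k (ℕ.≤-trans (ℕ.m≤n⊔m N K) ≤k))
    roots : ∀ x → charPoly M x ≈ productᴿ (λ i → x +ᴿ -ᴿ eigenvalue i)
    roots x ε 0<ε = proj₁ (rational x ε 0<ε) , λ k N≤k → subst (_≤ ε)
      (sym (cong ℚ.∣_∣ (cong₂ _-_ (trans (seq-charPoly M x k) (det-cong λ i j → cong (λ z → (if does (i Fin.≟ j) then seq x k else 0ℚ) + - z) (M≡A i j k))) (seq-product (λ i → x +ᴿ -ᴿ eigenvalue i) k))))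
      (proj₂ (rational x ε 0<ε) k N≤k)

-- The second eigenvalue from above.

-- An off-diagonal entry is at most r in absolute value, and 2|zᵢ zⱼ| ≤ zᵢ² + zⱼ² sums to the error
-- r n ∥z∥². The hypothesis on d is weighted by zᵢ², so a diagonal entry may lie below d wherever z
-- vanishes.
nearly-diagonal-form : ∀ {n} (B : Matrix ℚ n) {r d} z → 0ℚ ≤ r → offNorm B ≤ r * r →
  (∀ i → d * (z i * z i) ≤ B i i * (z i * z i)) → d * ∥ z ∥² - r * ι n * ∥ z ∥² ≤ form B z z
nearly-diagonal-form {n} B {r} {d} z 0≤r off≤ d≤ = begin
  d * ∥ z ∥² - r * ι n * ∥ z ∥²                          ≡⟨ split d r (ι n) ∥ z ∥² ⟩
  - (½ * r * (ι n * ∥ z ∥² + ι n * ∥ z ∥²)) + d * ∥ z ∥²  ≡⟨ cong₂ _+_ (cong -_ cross-sum) (sum-*ˡ d (λ i → z i * z i)) ⟨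
  - sum (λ i → sum λ j → ½ * r * (z i * z i + z j * z j)) + sum (λ i → d * (z i * z i)) ≤⟨ +-mono-≤ cross (sum-mono d≤) ⟩
  sum (λ i → sum λ j → z i * O i j * z j) + sum (λ i → B i i * (z i * z i))  ≡⟨ form-split ⟨
  form B z z                                             ∎
  where
  open ≤-Reasoning
  O = offDiagonal B
  split : ∀ d r n N → d * N - r * n * N ≡ - (½ * r * (n * N + n * N)) + d * N
  split = solve-∀ ringℚ
  cross-sum : sum (λ i → sum λ j → ½ * r * (z i * z i + z j * z j)) ≡ ½ * r * (ι n * ∥ z ∥² + ι n * ∥ z ∥²)
  cross-sum = trans (sum-cong λ i → trans (sum-*ˡ (½ * r) (λ j → z i * z i + z j * z j)) (cong (½ * r *_)
      (trans (sum-+ (λ j → z i * z i) (λ j → z j * z j)) (cong (_+ ∥ z ∥²) (sum-const n (z i * z i))))))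
    (trans (sum-*ˡ (½ * r) (λ i → ι n * (z i * z i) + ∥ z ∥²)) (cong (½ * r *_)
      (trans (sum-+ (λ i → ι n * (z i * z i)) (λ i → ∥ z ∥²)) (cong₂ _+_ (sum-*ˡ (ι n) (λ i → z i * z i)) (sum-const n ∥ z ∥²)))))
  polarize : ∀ r o a b → a * o * b - - (½ * r * (a * a + b * b)) ≡ ½ * ½ * ((r + o) * ((a + b) * (a + b)) + (r - o) * ((a - b) * (a - b)))
  polarize = solve-∀ ringℚ
  entry : ∀ i j → - (½ * r * (z i * z i + z j * z j)) ≤ z i * O i j * z j
  entry i j = from-diff (0≤* {½ * ½} (nonNegative⁻¹ (½ * ½)) (0≤+ (0≤* r+o (0≤sq (z i + z j))) (0≤* (diff (≤-trans (p≤∣p∣ (O i j)) ∣O∣≤r)) (0≤sq (z i - z j)))))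
    (polarize r (O i j) (z i) (z j))
    where
    ∣O∣≤r : ℚ.∣ O i j ∣ ≤ r
    ∣O∣≤r = abs-sq-≤ 0≤r (≤-trans (offNorm-entry B i j) off≤)
    r+o : 0ℚ ≤ r + O i j
    r+o = ≤-trans (diff (≤-trans (neg-antimono-≤ ∣O∣≤r) (-∣p∣≤p (O i j)))) (≤-reflexive (flip r (O i j)))
      where
      flip : ∀ r o → o - - r ≡ r + o
      flip = solve-∀ ringℚ
  cross : - sum (λ i → sum λ j → ½ * r * (z i * z i + z j * z j)) ≤ sum (λ i → sum λ j → z i * O i j * z j)
  cross = ≤-trans (≤-reflexive (trans (sym (sum-neg (λ i → sum λ j → ½ * r * (z i * z i + z j * z j)))) (sum-cong λ i → sym (sum-neg (λ j → ½ * r * (z i * z i + z j * z j))))))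
    (sum-mono λ i → sum-mono λ j → entry i j)
  form-split : form B z z ≡ sum (λ i → sum λ j → z i * O i j * z j) + sum (λ i → B i i * (z i * z i))
  form-split = trans (sum-cong row) (sum-+ (λ i → sum λ j → z i * O i j * z j) (λ i → B i i * (z i * z i)))
    where
    term : ∀ i j → z i * (B i j * z j) ≡ z i * O i j * z j + δ i j * (B i i * z i * z j)
    term i j = trans (cong (λ b → z i * (b * z j)) (entry-split B i j)) (expand (z i) (O i j) (δ i j) (B i i) (z j))
      where
      expand : ∀ a o e b c → a * ((o + e * b) * c) ≡ a * o * c + e * (b * a * c)
      expand = solve-∀ ringℚ
    row : ∀ i → z i * sum (λ j → B i j * z j) ≡ sum (λ j → z i * O i j * z j) + B i i * (z i * z i)
    row i = trans (sym (sum-*ˡ (z i) (λ j → B i j * z j))) (trans (sum-cong (term i))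
      (trans (sum-+ (λ j → z i * O i j * z j) (λ j → δ i j * (B i i * z i * z j)))
        (cong (λ x → sum (λ j → z i * O i j * z j) + x) (trans (sum-δ i (λ j → B i i * z i * z j)) (*-assoc (B i i) (z i) (z i))))))

-- A certificate in the sense of the Courant-Fischer principle: a plane on which the Rayleigh
-- quotient of A is at most y.
record TestPlane {n} (A : Matrix ℚ n) (y : ℚ) : Set where
  field
    g h      : Vector ℚ n
    rayleigh : ∀ α β → form A (combine α β g h) (combine α β g h) ≤ y * ∥ combine α β g h ∥²
    nonzero  : ∀ α β → α ≢ 0ℚ ⊎ β ≢ 0ℚ → 0ℚ < ∥ combine α β g h ∥²

second-sorted : ∀ {n} (d : Vector ℚ (suc (suc n))) (σ : Permutation′ (suc (suc n))) → Sorted (λ i → d (σ ⟨$⟩ʳ i)) →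
  ∀ i → i ≢ σ ⟨$⟩ʳ zero → d (σ ⟨$⟩ʳ suc zero) ≤ d i
second-sorted {n} d σ sorted i i≢ = ≤-trans (sorted (suc zero) (σ ⟨$⟩ˡ i) (positive-rank (σ ⟨$⟩ˡ i) λ eq → i≢ (trans (sym (Perm.inverseʳ σ)) (cong (σ ⟨$⟩ʳ_) eq))))
  (≤-reflexive (cong d (Perm.inverseʳ σ)))
  where
  positive-rank : ∀ (k : Fin (suc (suc n))) → k ≢ zero → suc {suc n} zero Fin.≤ k
  positive-rank zero    k≢0 = contradiction refl k≢0
  positive-rank (suc k) _   = s≤s z≤n

-- Some nonzero vector of the test plane is orthogonal to the first eigenvector.
plane-bound : ∀ {n} {A : Matrix ℚ (suc (suc n))} {y r} (B : Matrix ℚ (suc (suc n))) (σ : Permutation′ (suc (suc n))) →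
  Similar A B → 0ℚ ≤ r → offNorm B ≤ r * r → Sorted (λ i → B (σ ⟨$⟩ʳ i) (σ ⟨$⟩ʳ i)) → TestPlane A y →
  B (σ ⟨$⟩ʳ suc zero) (σ ⟨$⟩ʳ suc zero) ≤ y + r * ι (suc (suc n))
plane-bound {n} {A} {y} {r} B σ A~B 0≤r off≤ sorted plane = choose (v m ≟ 0ℚ)
  where
  open TestPlane plane
  open ≤-Reasoning
  m = σ ⟨$⟩ʳ zero
  d = B (σ ⟨$⟩ʳ suc zero) (σ ⟨$⟩ʳ suc zero)
  v = proj₁ (planes A~B g h)
  w = proj₁ (proj₂ (planes A~B g h))
  corresponds = proj₂ (proj₂ (planes A~B g h))
  conclude : ∀ d y r N → 0ℚ < N → d * N - r * N ≤ y * N → d ≤ y + r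
  conclude d y r N 0<N le = *-cancelˡ 0<N (from-diff (diff le) (regroup d y r N))
    where
    regroup : ∀ d y r N → N * (y + r) - N * d ≡ y * N - (d * N - r * N)
    regroup = solve-∀ ringℚ
  from : ∀ α β → α ≢ 0ℚ ⊎ β ≢ 0ℚ → α * v m + β * w m ≡ 0ℚ → d ≤ y + r * ι (suc (suc n))
  from α β ≢0 zm≡0 = conclude d y (r * ι (suc (suc n))) ∥ z ∥² (subst (0ℚ <_) (sym (proj₂ (corresponds α β))) (nonzero α β ≢0)) (begin
    d * ∥ z ∥² - r * ι (suc (suc n)) * ∥ z ∥²   ≤⟨ nearly-diagonal-form B {r} {d} z 0≤r off≤ diagonal≤ ⟩
    form B z z                ≡⟨ proj₁ (corresponds α β) ⟩
    form A (combine α β g h) (combine α β g h) ≤⟨ rayleigh α β ⟩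
    y * ∥ combine α β g h ∥²  ≡⟨ cong (y *_) (proj₂ (corresponds α β)) ⟨
    y * ∥ z ∥²                ∎)
    where
    z = combine α β v w
    diagonal≤ : ∀ i → d * (z i * z i) ≤ B i i * (z i * z i)
    diagonal≤ i with i Fin.≟ m
    ... | no i≢m = *-monoʳ-≤-nonNeg (z i * z i) {{nonNegative (0≤sq (z i))}} (second-sorted (λ i → B i i) σ sorted i i≢m)
    ... | yes refl = ≤-reflexive (trans (cong (λ x → d * (x * x)) zm≡0) (trans (both d (B i i)) (cong (λ x → B i i * (x * x)) (sym zm≡0))))
      where
      both : ∀ d b → d * (0ℚ * 0ℚ) ≡ b * (0ℚ * 0ℚ)
      both = solve-∀ ringℚ
  choose : Dec (v m ≡ 0ℚ) → d ≤ y + r * ι (suc (suc n))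
  choose (yes vm≡0) = from 1ℚ 0ℚ (inj₁ λ ()) (trans (cong (λ x → 1ℚ * x + 0ℚ * w m) vm≡0) (vanish (w m)))
    where
    vanish : ∀ w → 1ℚ * 0ℚ + 0ℚ * w ≡ 0ℚ
    vanish = solve-∀ ringℚ
  choose (no vm≢0) = from (w m) (- v m) (inj₂ λ -vm≡0 → vm≢0 (trans (sym (neg-involutive (v m))) (cong -_ -vm≡0))) (cancel (v m) (w m))
    where
    neg-involutive : ∀ x → - - x ≡ x
    neg-involutive = solve-∀ ringℚ
    cancel : ∀ v w → w * v + (- v) * w ≡ 0ℚ
    cancel = solve-∀ ringℚ

-- One Jacobi run serves both claims. For a test plane, stage k gives the bound with an error of n
-- times the radius, which tends to 0.
spectral-theorem : ∀ {n} (M : Matrix ℝ (suc (suc n))) (A : Matrix ℚ (suc (suc n))) → (∀ i j k → seq (M i j) k ≡ A i j) → (∀ i j → A i j ≡ A j i) →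
  Σ[ ev ∈ Vector ℝ (suc (suc n)) ] IsSpectrum M ev × (∀ y → TestPlane A y → ev (suc zero) ≤ᴿ fromℚ y)
spectral-theorem {n} M A M≡A symA = eigenvalue , spectrum M M≡A , λ y plane ε 0<ε →
  proj₁ (tiny ε 0<ε) , λ k K≤k → ≤-trans
    (plane-bound (matrix (stage k)) (order k) (similar (stage k)) (0≤radius k) (small (stage k)) (proj₂ (sort (diagonal k))) plane)
    (+-monoʳ-≤ y (≤-trans (≤-reflexive (*-comm (radius k) (ι (suc (suc n))))) (proj₂ (tiny ε 0<ε) k K≤k)))
  where
  open Jacobi {suc n}
  open JacobiRadius A hiding (run)
  jacobi = JacobiRadius.run A symA
  open JacobiIteration A jacobi hiding (M)
  open Run jacobi
  tiny = λ ε 0<ε → radius-small (ι (suc (suc n))) {ε} (0≤ι (suc (suc n))) 0<ε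

-- Cuts of a linearly ordered cubic graph.

-- Indicators of u ≤ k, u > k and u = k, as numbers because they serve as weights in sums, and by
-- recursion so that they compute under `suc`.
le gt eq : ℕ → ℕ → ℕ
le zero    k       = 1
le (suc u) zero    = 0
le (suc u) (suc k) = le u k
gt zero    k       = 0
gt (suc u) zero    = 1
gt (suc u) (suc k) = gt u k
eq zero    zero    = 1
eq zero    (suc k) = 0
eq (suc u) zero    = 0
eq (suc u) (suc k) = eq u k

le-zero : ∀ u → le u 0 ≡ eq u 0
le-zero zero    = refl
le-zero (suc u) = refl

le-suc : ∀ u k → le u (suc k) ≡ le u k ℕ.+ eq u (suc k)
le-suc zero          k       = refl
le-suc (suc zero)    zero    = refl
le-suc (suc (suc u)) zero    = refl
le-suc (suc u)       (suc k) = le-suc u k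

gt-suc : ∀ u k → gt u k ≡ gt u (suc k) ℕ.+ eq u (suc k)
gt-suc zero          k       = refl
gt-suc (suc zero)    zero    = refl
gt-suc (suc (suc u)) zero    = refl
gt-suc (suc u)       (suc k) = gt-suc u k

le+gt : ∀ u k → le u k ℕ.+ gt u k ≡ 1
le+gt zero    k       = refl
le+gt (suc u) zero    = refl
le+gt (suc u) (suc k) = le+gt u k

le-≤ : ∀ {u k} → u ℕ.≤ k → le u k ≡ 1
le-≤ z≤n       = refl
le-≤ (s≤s u≤k) = le-≤ u≤k

le-> : ∀ {u k} → k ℕ.< u → le u k ≡ 0
le-> {suc u} {zero}  _         = refl
le-> {suc u} {suc k} (s≤s k<u) = le-> k<u

gt-> : ∀ {u k} → k ℕ.< u → gt u k ≡ 1
gt-> {suc u} {zero}  _         = refl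
gt-> {suc u} {suc k} (s≤s k<u) = gt-> k<u

gt-≤ : ∀ {u k} → u ℕ.≤ k → gt u k ≡ 0
gt-≤ z≤n       = refl
gt-≤ (s≤s u≤k) = gt-≤ u≤k

sum-eq : ∀ {n} (w : Fin n) (f : Vector ℕ n) → ℕΣ.sum (λ u → eq (toℕ u) (toℕ w) ℕ.* f u) ≡ f w
sum-eq {suc n} zero    f = trans (cong₂ ℕ._+_ (ℕ.*-identityˡ (f zero)) (ℕΣ.sum-replicate-zero n)) (ℕ.+-identityʳ (f zero))
sum-eq (suc w) f = sum-eq w (f ∘ suc)

odd? : ℕ → Bool
odd? zero    = false
odd? (suc n) = not (odd? n)

odd?-+ : ∀ a b → odd? (a ℕ.+ b) ≡ odd? a xor odd? b
odd?-+ zero    b = refl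
odd?-+ (suc a) b = trans (cong not (odd?-+ a b)) (not-xor (odd? a) (odd? b))
  where
  not-xor : ∀ x y → not (x xor y) ≡ not x xor y
  not-xor true  true  = refl
  not-xor true  false = refl
  not-xor false y     = refl

odd?-double : ∀ s → odd? (3 ℕ.+ 2 ℕ.* s) ≡ true
odd?-double zero    = refl
odd?-double (suc s) = trans (cong odd? (shift-2 s)) (trans (not-not (odd? (3 ℕ.+ 2 ℕ.* s))) (odd?-double s))
  where
  shift-2 : ∀ s → 3 ℕ.+ 2 ℕ.* suc s ≡ 2 ℕ.+ (3 ℕ.+ 2 ℕ.* s)
  shift-2 = solve-ℕ
  not-not : ∀ x → not (not x) ≡ x
  not-not true  = refl
  not-not false = refl

record CubicWeights {n} (a : Fin n → Fin n → ℕ) : Set where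
  field
    symmetric : ∀ u v → a u v ≡ a v u
    loopless  : ∀ u → a u u ≡ 0
    simple    : ∀ u v → a u v ℕ.≤ 1
    cubic     : ∀ u → ℕΣ.sum (a u) ≡ 3

module Cuts {n} {a : Fin n → Fin n → ℕ} (weights : CubicWeights a) where
  open CubicWeights weights
  open ≡-Reasoning

  Below Above : ℕ → Vector ℕ n
  Below k u = le (toℕ u) k
  Above k u = gt (toℕ u) k

  edges : Vector ℕ n → Vector ℕ n → ℕ
  edges p q = ℕΣ.sum λ u → ℕΣ.sum λ v → p u ℕ.* q v ℕ.* a u v

  degreeTo : Fin n → Vector ℕ n → ℕ
  degreeTo w q = ℕΣ.sum λ v → q v ℕ.* a w v

  -- `cut k` counts the edges leaving the vertices 0, ..., k; `span k` counts those among them that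
  -- pass over vertex k + 1.
  cut span : ℕ → ℕ
  cut k  = edges (Below k) (Above k)
  span k = edges (Below k) (Above (suc k))

  degreeTo-+ : ∀ w p q → degreeTo w (λ v → p v ℕ.+ q v) ≡ degreeTo w p ℕ.+ degreeTo w q
  degreeTo-+ w p q = trans (ℕΣ.sum-cong-≗ λ v → ℕ.*-distribʳ-+ (a w v) (p v) (q v)) (ℕΣ.∑-distrib-+ (λ v → p v ℕ.* a w v) (λ v → q v ℕ.* a w v))

  degreeTo-point : ∀ w x → degreeTo w (λ v → eq (toℕ v) (toℕ x)) ≡ a w x
  degreeTo-point w x = sum-eq x (a w)

  degreeTo-all : ∀ w p → (∀ v → p v ≡ 1) → degreeTo w p ≡ 3
  degreeTo-all w p p≡1 = trans (ℕΣ.sum-cong-≗ λ v → trans (cong (ℕ._* a w v) (p≡1 v)) (ℕ.*-identityˡ (a w v))) (cubic w)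

  edges-cong : ∀ {p p′ q q′} → (∀ u → p u ≡ p′ u) → (∀ v → q v ≡ q′ v) → edges p q ≡ edges p′ q′
  edges-cong p≡ q≡ = ℕΣ.sum-cong-≗ λ u → ℕΣ.sum-cong-≗ λ v → cong₂ (λ x y → x ℕ.* y ℕ.* a u v) (p≡ u) (q≡ v)

  edges-+ˡ : ∀ p p′ q → edges (λ u → p u ℕ.+ p′ u) q ≡ edges p q ℕ.+ edges p′ q
  edges-+ˡ p p′ q = trans (ℕΣ.sum-cong-≗ λ u → trans (ℕΣ.sum-cong-≗ λ v → expand (p u) (p′ u) (q v) (a u v))
      (ℕΣ.∑-distrib-+ (λ v → p u ℕ.* q v ℕ.* a u v) (λ v → p′ u ℕ.* q v ℕ.* a u v)))
    (ℕΣ.∑-distrib-+ (λ u → ℕΣ.sum λ v → p u ℕ.* q v ℕ.* a u v) (λ u → ℕΣ.sum λ v → p′ u ℕ.* q v ℕ.* a u v))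
    where
    expand : ∀ p p′ q a → (p ℕ.+ p′) ℕ.* q ℕ.* a ≡ p ℕ.* q ℕ.* a ℕ.+ p′ ℕ.* q ℕ.* a
    expand = solve-ℕ

  edges-+ʳ : ∀ p q q′ → edges p (λ v → q v ℕ.+ q′ v) ≡ edges p q ℕ.+ edges p q′
  edges-+ʳ p q q′ = trans (ℕΣ.sum-cong-≗ λ u → trans (ℕΣ.sum-cong-≗ λ v → expand (p u) (q v) (q′ v) (a u v))
      (ℕΣ.∑-distrib-+ (λ v → p u ℕ.* q v ℕ.* a u v) (λ v → p u ℕ.* q′ v ℕ.* a u v)))
    (ℕΣ.∑-distrib-+ (λ u → ℕΣ.sum λ v → p u ℕ.* q v ℕ.* a u v) (λ u → ℕΣ.sum λ v → p u ℕ.* q′ v ℕ.* a u v))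
    where
    expand : ∀ p q q′ a → p ℕ.* (q ℕ.+ q′) ℕ.* a ≡ p ℕ.* q ℕ.* a ℕ.+ p ℕ.* q′ ℕ.* a
    expand = solve-ℕ

  edges-pointˡ : ∀ w q → edges (λ u → eq (toℕ u) (toℕ w)) q ≡ degreeTo w q
  edges-pointˡ w q = trans (ℕΣ.sum-cong-≗ λ u → trans (ℕΣ.sum-cong-≗ λ v → ℕ.*-assoc (eq (toℕ u) (toℕ w)) (q v) (a u v))
      (sym (ℕΣ.*-distribˡ-sum (eq (toℕ u) (toℕ w)) (λ v → q v ℕ.* a u v))))
    (sum-eq w (λ u → ℕΣ.sum λ v → q v ℕ.* a u v))

  edges-pointʳ : ∀ p w → edges p (λ v → eq (toℕ v) (toℕ w)) ≡ degreeTo w p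
  edges-pointʳ p w = ℕΣ.sum-cong-≗ λ u → trans (ℕΣ.sum-cong-≗ λ v → swap (p u) (eq (toℕ v) (toℕ w)) (a u v))
    (trans (sum-eq w (λ v → p u ℕ.* a u v)) (cong (p u ℕ.*_) (symmetric u w)))
    where
    swap : ∀ p e a → p ℕ.* e ℕ.* a ≡ e ℕ.* (p ℕ.* a)
    swap = solve-ℕ

  Below-suc : ∀ k (w : Fin n) → toℕ w ≡ suc k → ∀ u → Below (suc k) u ≡ Below k u ℕ.+ eq (toℕ u) (toℕ w)
  Below-suc k w w≡ u = trans (le-suc (toℕ u) k) (cong (λ z → le (toℕ u) k ℕ.+ eq (toℕ u) z) (sym w≡))

  Above-suc : ∀ k (w : Fin n) → toℕ w ≡ suc k → ∀ u → Above k u ≡ Above (suc k) u ℕ.+ eq (toℕ u) (toℕ w)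
  Above-suc k w w≡ u = trans (gt-suc (toℕ u) k) (cong (λ z → gt (toℕ u) (suc k) ℕ.+ eq (toℕ u) z) (sym w≡))

  cut-0 : ∀ {w} → toℕ w ≡ 0 → cut 0 ≡ 3
  cut-0 {w} w≡0 = begin
    cut 0                         ≡⟨ edges-cong {Below 0} {λ u → eq (toℕ u) (toℕ w)} {Above 0} {Above 0} (λ u → trans (le-zero (toℕ u)) (cong (eq (toℕ u)) (sym w≡0))) (λ _ → refl) ⟩
    edges (λ u → eq (toℕ u) (toℕ w)) (Above 0) ≡⟨ edges-pointˡ w (Above 0) ⟩
    degreeTo w (Above 0)          ≡⟨ cong (ℕ._+ degreeTo w (Above 0)) (trans (degreeTo-point w w) (loopless w)) ⟨
    degreeTo w (λ v → eq (toℕ v) (toℕ w)) ℕ.+ degreeTo w (Above 0) ≡⟨ degreeTo-+ w (λ v → eq (toℕ v) (toℕ w)) (Above 0) ⟨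
    degreeTo w (λ v → eq (toℕ v) (toℕ w) ℕ.+ Above 0 v) ≡⟨ degreeTo-all w (λ v → eq (toℕ v) (toℕ w) ℕ.+ Above 0 v) (λ v → trans (cong (ℕ._+ Above 0 v) (trans (cong (eq (toℕ v)) w≡0) (sym (le-zero (toℕ v))))) (le+gt (toℕ v) 0)) ⟩
    3                             ∎

  -- Besides the edges passing over w, the first cut contains the edges from w backwards and the
  -- second those from w forwards, three in all. The identity yields the parity of the cuts and also
  -- expresses spans by cuts.
  cut-suc : ∀ k {w} → toℕ w ≡ suc k → cut k ℕ.+ cut (suc k) ≡ 3 ℕ.+ 2 ℕ.* span k
  cut-suc k {w} w≡ = begin
    cut k ℕ.+ cut (suc k)         ≡⟨ cong₂ ℕ._+_
      (trans (edges-cong {Below k} {Below k} {Above k} {λ v → Above (suc k) v ℕ.+ E v} (λ _ → refl) (Above-suc k w w≡)) (trans (edges-+ʳ (Below k) (Above (suc k)) E) (cong (span k ℕ.+_) (edges-pointʳ (Below k) w))))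
      (trans (edges-cong {Below (suc k)} {λ v → Below k v ℕ.+ E v} {Above (suc k)} {Above (suc k)} (Below-suc k w w≡) (λ _ → refl)) (trans (edges-+ˡ (Below k) E (Above (suc k))) (cong (span k ℕ.+_) (edges-pointˡ w (Above (suc k)))))) ⟩
    (span k ℕ.+ degreeTo w (Below k)) ℕ.+ (span k ℕ.+ degreeTo w (Above (suc k))) ≡⟨ regroup (span k) (degreeTo w (Below k)) (degreeTo w (Above (suc k))) ⟩
    (degreeTo w (Below k) ℕ.+ 0 ℕ.+ degreeTo w (Above (suc k))) ℕ.+ 2 ℕ.* span k ≡⟨ cong (ℕ._+ 2 ℕ.* span k) total ⟩
    3 ℕ.+ 2 ℕ.* span k            ∎
    where
    E : Vector ℕ n
    E u = eq (toℕ u) (toℕ w)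
    regroup : ∀ s b f → (s ℕ.+ b) ℕ.+ (s ℕ.+ f) ≡ (b ℕ.+ 0 ℕ.+ f) ℕ.+ 2 ℕ.* s
    regroup = solve-ℕ
    total : degreeTo w (Below k) ℕ.+ 0 ℕ.+ degreeTo w (Above (suc k)) ≡ 3
    total = begin
      degreeTo w (Below k) ℕ.+ 0 ℕ.+ degreeTo w (Above (suc k)) ≡⟨ cong (λ z → degreeTo w (Below k) ℕ.+ z ℕ.+ degreeTo w (Above (suc k))) (trans (degreeTo-point w w) (loopless w)) ⟨
      degreeTo w (Below k) ℕ.+ degreeTo w E ℕ.+ degreeTo w (Above (suc k)) ≡⟨ trans (degreeTo-+ w (λ v → Below k v ℕ.+ E v) (Above (suc k))) (cong (ℕ._+ degreeTo w (Above (suc k))) (degreeTo-+ w (Below k) E)) ⟨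
      degreeTo w (λ v → Below k v ℕ.+ E v ℕ.+ Above (suc k) v) ≡⟨ degreeTo-all w (λ v → Below k v ℕ.+ E v ℕ.+ Above (suc k) v) (λ v → trans (cong (ℕ._+ Above (suc k) v) (sym (Below-suc k w w≡ v))) (le+gt (toℕ v) (suc k))) ⟩
      3                           ∎

  -- The two vertices between the cuts have six edge ends, at most two of which belong to an edge
  -- joining them. Each of the others leads backwards into the first cut or forwards into the
  -- second.
  cut-two : ∀ k {w x} → toℕ w ≡ suc k → toℕ x ≡ suc (suc k) → 4 ℕ.≤ cut k ℕ.+ cut (suc (suc k))
  cut-two k {w} {x} w≡ x≡ = ℕ.+-cancelʳ-≤ 2 4 (cut k ℕ.+ cut (suc (suc k))) (ℕ.≤-trans (ℕ.≤-trans (ℕ.≤-reflexive six) (ℕ.+-monoʳ-≤ S (ℕ.+-mono-≤ (simple w x) (simple x w))))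
      (ℕ.+-monoˡ-≤ 2 (ℕ.≤-trans (ℕ.m≤n+m S (2 ℕ.* m)) (ℕ.≤-reflexive (sym cuts)))))
    where
    L = Below k
    R = Above (suc (suc k))
    Ew Ex : Vector ℕ n
    Ew u = eq (toℕ u) (toℕ w)
    Ex u = eq (toℕ u) (toℕ x)
    m = edges L R
    S = degreeTo w L ℕ.+ degreeTo w R ℕ.+ (degreeTo x L ℕ.+ degreeTo x R)
    total : ∀ y → degreeTo y L ℕ.+ a y w ℕ.+ a y x ℕ.+ degreeTo y R ≡ 3
    total y = begin
      degreeTo y L ℕ.+ a y w ℕ.+ a y x ℕ.+ degreeTo y R ≡⟨ cong₂ (λ p q → degreeTo y L ℕ.+ p ℕ.+ q ℕ.+ degreeTo y R) (degreeTo-point y w) (degreeTo-point y x) ⟨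
      degreeTo y L ℕ.+ degreeTo y Ew ℕ.+ degreeTo y Ex ℕ.+ degreeTo y R
        ≡⟨ trans (degreeTo-+ y (λ v → L v ℕ.+ Ew v ℕ.+ Ex v) R) (cong (ℕ._+ degreeTo y R) (trans (degreeTo-+ y (λ v → L v ℕ.+ Ew v) Ex) (cong (ℕ._+ degreeTo y Ex) (degreeTo-+ y L Ew)))) ⟨
      degreeTo y (λ v → L v ℕ.+ Ew v ℕ.+ Ex v ℕ.+ R v) ≡⟨ degreeTo-all y (λ v → L v ℕ.+ Ew v ℕ.+ Ex v ℕ.+ R v) (λ v → trans (cong (ℕ._+ R v) (trans (cong (ℕ._+ Ex v) (sym (Below-suc k w w≡ v))) (sym (Below-suc (suc k) x x≡ v)))) (le+gt (toℕ v) (suc (suc k)))) ⟩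
      3 ∎
    six : 6 ≡ S ℕ.+ (a w x ℕ.+ a x w)
    six = begin
      6                             ≡⟨ cong₂ ℕ._+_ (total w) (total x) ⟨
      (degreeTo w L ℕ.+ a w w ℕ.+ a w x ℕ.+ degreeTo w R) ℕ.+ (degreeTo x L ℕ.+ a x w ℕ.+ a x x ℕ.+ degreeTo x R)
        ≡⟨ cong₂ (λ p q → (degreeTo w L ℕ.+ p ℕ.+ a w x ℕ.+ degreeTo w R) ℕ.+ (degreeTo x L ℕ.+ a x w ℕ.+ q ℕ.+ degreeTo x R)) (loopless w) (loopless x) ⟩
      (degreeTo w L ℕ.+ 0 ℕ.+ a w x ℕ.+ degreeTo w R) ℕ.+ (degreeTo x L ℕ.+ a x w ℕ.+ 0 ℕ.+ degreeTo x R)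
        ≡⟨ regroup (degreeTo w L) (degreeTo w R) (degreeTo x L) (degreeTo x R) (a w x) (a x w) ⟩
      S ℕ.+ (a w x ℕ.+ a x w) ∎
      where
      regroup : ∀ wL wR xL xR p q → (wL ℕ.+ 0 ℕ.+ p ℕ.+ wR) ℕ.+ (xL ℕ.+ q ℕ.+ 0 ℕ.+ xR) ≡ wL ℕ.+ wR ℕ.+ (xL ℕ.+ xR) ℕ.+ (p ℕ.+ q)
      regroup = solve-ℕ
    cuts : cut k ℕ.+ cut (suc (suc k)) ≡ 2 ℕ.* m ℕ.+ S
    cuts = begin
      cut k ℕ.+ cut (suc (suc k)) ≡⟨ cong₂ ℕ._+_
        (trans (edges-cong {L} {L} {Above k} {λ v → R v ℕ.+ Ex v ℕ.+ Ew v} (λ _ → refl) (λ v → trans (Above-suc k w w≡ v) (cong (ℕ._+ Ew v) (Above-suc (suc k) x x≡ v))))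
          (trans (edges-+ʳ L (λ v → R v ℕ.+ Ex v) Ew) (cong₂ ℕ._+_ (trans (edges-+ʳ L R Ex) (cong (m ℕ.+_) (edges-pointʳ L x))) (edges-pointʳ L w))))
        (trans (edges-cong {Below (suc (suc k))} {λ v → L v ℕ.+ Ew v ℕ.+ Ex v} {R} {R} (λ v → trans (Below-suc (suc k) x x≡ v) (cong (ℕ._+ Ex v) (Below-suc k w w≡ v))) (λ _ → refl))
          (trans (edges-+ˡ (λ v → L v ℕ.+ Ew v) Ex R) (cong₂ ℕ._+_ (trans (edges-+ˡ L Ew R) (cong (m ℕ.+_) (edges-pointˡ w R))) (edges-pointˡ x R)))) ⟩
      (m ℕ.+ degreeTo x L ℕ.+ degreeTo w L) ℕ.+ (m ℕ.+ degreeTo w R ℕ.+ degreeTo x R) ≡⟨ regroup m (degreeTo x L) (degreeTo w L) (degreeTo w R) (degreeTo x R) ⟩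
      2 ℕ.* m ℕ.+ S ∎
      where
      regroup : ∀ m xL wL wR xR → (m ℕ.+ xL ℕ.+ wL) ℕ.+ (m ℕ.+ wR ℕ.+ xR) ≡ 2 ℕ.* m ℕ.+ (wL ℕ.+ wR ℕ.+ (xL ℕ.+ xR))
      regroup = solve-ℕ

  vertex : ∀ {k} → k ℕ.< n → ∃ λ (w : Fin n) → toℕ w ≡ k
  vertex k<n = Fin.fromℕ< k<n , Fin.toℕ-fromℕ< k<n

  cut-parity : ∀ k → k ℕ.< n → odd? (cut k) ≡ not (odd? k)
  cut-parity zero    0<n = cong odd? (cut-0 (proj₂ (vertex 0<n)))
  cut-parity (suc k) k<n = flip (odd? (cut k)) (odd? (cut (suc k))) (odd? k) (cut-parity k (ℕ.<-trans (ℕ.n<1+n k) k<n))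
    (trans (sym (odd?-+ (cut k) (cut (suc k)))) (trans (cong odd? (cut-suc k (proj₂ (vertex k<n)))) (odd?-double (span k))))
    where
    flip : ∀ x y z → x ≡ not z → x xor y ≡ true → y ≡ not (not z)
    flip x true  true  refl _  = refl
    flip x false false refl _  = refl
    flip x true  false refl ()
    flip x false true  refl ()

-- Quadratic forms in the gaps of an increasing sequence.

Σ< : (ℕ → ℚ) → ℕ → ℚ
Σ< f zero    = 0ℚ
Σ< f (suc m) = Σ< f m + f m

Σ<-cong : ∀ {f g} m → (∀ k → k ℕ.< m → f k ≡ g k) → Σ< f m ≡ Σ< g m
Σ<-cong zero    eq = refl
Σ<-cong (suc m) eq = cong₂ _+_ (Σ<-cong m (λ k k<m → eq k (ℕ.m<n⇒m<1+n k<m))) (eq m (ℕ.n<1+n m))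

Σ<-mono : ∀ {f g} m → (∀ k → k ℕ.< m → f k ≤ g k) → Σ< f m ≤ Σ< g m
Σ<-mono zero    f≤g = ≤-refl
Σ<-mono (suc m) f≤g = +-mono-≤ (Σ<-mono m (λ k k<m → f≤g k (ℕ.m<n⇒m<1+n k<m))) (f≤g m (ℕ.n<1+n m))

Σ<-nonneg : ∀ {f} m → (∀ k → 0ℚ ≤ f k) → 0ℚ ≤ Σ< f m
Σ<-nonneg zero    0≤f = ≤-refl
Σ<-nonneg (suc m) 0≤f = 0≤+ (Σ<-nonneg m 0≤f) (0≤f m)

Σ<-+ : ∀ f g m → Σ< (λ k → f k + g k) m ≡ Σ< f m + Σ< g m
Σ<-+ f g zero    = refl
Σ<-+ f g (suc m) = trans (cong (_+ (f m + g m)) (Σ<-+ f g m)) (swap (Σ< f m) (Σ< g m) (f m) (g m))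
  where
  swap : ∀ a b c d → a + b + (c + d) ≡ a + c + (b + d)
  swap = solve-∀ ringℚ

Σ<-* : ∀ c f m → Σ< (λ k → c * f k) m ≡ c * Σ< f m
Σ<-* c f zero    = sym (*-zeroʳ c)
Σ<-* c f (suc m) = trans (cong (_+ c * f m) (Σ<-* c f m)) (sym (*-distribˡ-+ c (Σ< f m) (f m)))

Σ<-head : ∀ f m → f 0 + Σ< (f ∘ suc) m ≡ Σ< f (suc m)
Σ<-head f zero    = +-comm (f 0) 0ℚ
Σ<-head f (suc m) = trans (sym (+-assoc (f 0) (Σ< (f ∘ suc) m) (f (suc m)))) (cong (_+ f (suc m)) (Σ<-head f m))

sum-toℕ : ∀ n (f : ℕ → ℚ) → sum {n} (λ i → f (toℕ i)) ≡ Σ< f n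
sum-toℕ zero    f = refl
sum-toℕ (suc n) f = trans (cong (λ z → f 0 + z) (sum-toℕ n (f ∘ suc))) (Σ<-head f n)

sq : ℚ → ℚ
sq x = x * x

-- Σ c k (d k)² + 2 Σ s k d k d (k + 1). When the squared differences along the edges are expanded
-- in the gaps d, these are the squares and the products of neighbouring gaps; all other products
-- are nonnegative for a sorted function and are given away.
gapForm : (c s d : ℕ → ℚ) → ℕ → ℚ
gapForm c s d zero          = 0ℚ
gapForm c s d (suc zero)    = c 0 * (d 0 * d 0)
gapForm c s d (suc (suc k)) = gapForm c s d (suc k) + (c (suc k) * (d (suc k) * d (suc k)) + 2ℚ * (s k * (d k * d (suc k))))

gapForm-≤-square : ∀ {c s d g} → (∀ k → 0ℚ ≤ g k) → (∀ k → c k * (d k * d k) ≡ g k * g k) →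
  (∀ k → s k * (d k * d (suc k)) ≡ g k * g (suc k)) → ∀ m → gapForm c s d m ≤ Σ< g m * Σ< g m
gapForm-≤-square 0≤g cdd sdd zero = ≤-refl
gapForm-≤-square {g = g} 0≤g cdd sdd (suc zero) = ≤-reflexive (trans (cdd 0) (pad (g 0)))
  where
  pad : ∀ x → x * x ≡ (0ℚ + x) * (0ℚ + x)
  pad = solve-∀ ringℚ
gapForm-≤-square {c} {s} {d} {g} 0≤g cdd sdd (suc (suc k)) = begin
  gapForm c s d (suc k) + (c (suc k) * (d (suc k) * d (suc k)) + 2ℚ * (s k * (d k * d (suc k))))
    ≤⟨ +-monoˡ-≤ _ (gapForm-≤-square {c} {s} {d} {g} 0≤g cdd sdd (suc k)) ⟩
  P * P + (c (suc k) * (d (suc k) * d (suc k)) + 2ℚ * (s k * (d k * d (suc k))))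
    ≡⟨ cong₂ (λ x y → P * P + (x + 2ℚ * y)) (cdd (suc k)) (sdd k) ⟩
  P * P + (g (suc k) * g (suc k) + 2ℚ * (g k * g (suc k)))
    ≤⟨ from-diff (0≤* (<⇒≤ 0<2) (0≤* (Σ<-nonneg k 0≤g) (0≤g (suc k)))) (expand (Σ< g k) (g k) (g (suc k))) ⟩
  (P + g (suc k)) * (P + g (suc k)) ∎
  where
  open ≤-Reasoning
  P = Σ< g (suc k)
  expand : ∀ R x y → (R + x + y) * (R + x + y) - ((R + x) * (R + x) + (y * y + 2ℚ * (x * y))) ≡ 2ℚ * (R * y)
  expand = solve-∀ ringℚ

-- The window inequality: cL, cm, cR are consecutive cut sizes, the outer ones not both equal to 1.
window : ∀ {cL cm cR o e p} → 2ℚ ≤ cm → 1ℚ ≤ cL → 1ℚ ≤ cR → (3ℚ ≤ cL ⊎ 3ℚ ≤ cR) → 0ℚ ≤ o → 0ℚ ≤ e → 0ℚ ≤ p →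
  sq (e + ½ * o + ½ * p) ≤ cm * (e * e) + ½ * (cL * (o * o)) + ½ * (cR * (p * p)) + (cL + cm - 3ℚ) * (o * e) + (cm + cR - 3ℚ) * (e * p)
window {cL} {cm} {cR} {o} {e} {p} 2≤cm 1≤cL 1≤cR either 0≤o 0≤e 0≤p = [ left , right ]′ either
  where
  0≤½ = nonNegative⁻¹ ½
  middle : 0ℚ ≤ (cm - 2ℚ) * (e * e + o * e + e * p)
  middle = 0≤* (diff 2≤cm) (0≤+ (0≤+ (0≤sq e) (0≤* 0≤o 0≤e)) (0≤* 0≤e 0≤p))
  right : 3ℚ ≤ cR → _
  right 3≤cR = from-diff (0≤+ (0≤+ (0≤+ (0≤+ (0≤sq (e - ½ * o + ½ * p)) (0≤sq p)) middle) (0≤* (diff 1≤cL) (0≤+ (0≤* 0≤½ (0≤sq o)) (0≤* 0≤o 0≤e)))) (0≤* (diff 3≤cR) (0≤+ (0≤* 0≤½ (0≤sq p)) (0≤* 0≤e 0≤p))))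
    (identity cL cm cR o e p)
    where
    identity : ∀ cL cm cR o e p → (cm * (e * e) + ½ * (cL * (o * o)) + ½ * (cR * (p * p)) + (cL + cm - 3ℚ) * (o * e) + (cm + cR - 3ℚ) * (e * p)) - (e + ½ * o + ½ * p) * (e + ½ * o + ½ * p)
      ≡ (e - ½ * o + ½ * p) * (e - ½ * o + ½ * p) + p * p + (cm - 2ℚ) * (e * e + o * e + e * p) + (cL - 1ℚ) * (½ * (o * o) + o * e) + (cR - 3ℚ) * (½ * (p * p) + e * p)
    identity = solve-∀ ringℚ
  left : 3ℚ ≤ cL → _
  left 3≤cL = from-diff (0≤+ (0≤+ (0≤+ (0≤+ (0≤sq (e + ½ * o - ½ * p)) (0≤sq o)) middle) (0≤* (diff 3≤cL) (0≤+ (0≤* 0≤½ (0≤sq o)) (0≤* 0≤o 0≤e)))) (0≤* (diff 1≤cR) (0≤+ (0≤* 0≤½ (0≤sq p)) (0≤* 0≤e 0≤p))))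
    (identity cL cm cR o e p)
    where
    identity : ∀ cL cm cR o e p → (cm * (e * e) + ½ * (cL * (o * o)) + ½ * (cR * (p * p)) + (cL + cm - 3ℚ) * (o * e) + (cm + cR - 3ℚ) * (e * p)) - (e + ½ * o + ½ * p) * (e + ½ * o + ½ * p)
      ≡ (e + ½ * o - ½ * p) * (e + ½ * o - ½ * p) + o * o + (cm - 2ℚ) * (e * e + o * e + e * p) + (cL - 3ℚ) * (½ * (o * o) + o * e) + (cR - 1ℚ) * (½ * (p * p) + e * p)
    identity = solve-∀ ringℚ

double : ℕ → ℕ
double zero    = zero
double (suc j) = suc (suc (double j))

module Gaps (F : ℕ → ℚ) where

  gap : ℕ → ℚ
  gap k = F (suc k) - F k

  -- The vertices are paired as (2j, 2j + 1). The cut inside a pair has odd size, which gives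
  -- `oddGap` its name although the index is even; the cut between two pairs has even size.
  mid : ℕ → ℚ
  mid j = ½ * (F (double j) + F (suc (double j)))

  oddGap : ℕ → ℚ
  oddGap j = gap (double j)

  mid-difference : ∀ j → mid (suc j) - mid j ≡ gap (suc (double j)) + ½ * oddGap j + ½ * oddGap (suc j)
  mid-difference j = identity (F (double j)) (F (suc (double j))) (F (suc (suc (double j)))) (F (suc (suc (suc (double j)))))
    where
    identity : ∀ a b c d → ½ * (c + d) - ½ * (a + b) ≡ c - b + ½ * (b - a) + ½ * (d - c)
    identity = solve-∀ ringℚ

  Σ<-pairs : ∀ m → Σ< F (double m) ≡ 2ℚ * Σ< mid m
  Σ<-pairs zero    = refl
  Σ<-pairs (suc m) = trans (cong (λ z → z + F (double m) + F (suc (double m))) (Σ<-pairs m)) (step (Σ< mid m) (F (double m)) (F (suc (double m))))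
    where
    step : ∀ S a b → 2ℚ * S + a + b ≡ 2ℚ * (S + ½ * (a + b))
    step = solve-∀ ringℚ

  Σ<-pair-squares : ∀ m → Σ< (sq ∘ F) (double m) ≡ 2ℚ * Σ< (sq ∘ mid) m + ½ * Σ< (sq ∘ oddGap) m
  Σ<-pair-squares zero    = refl
  Σ<-pair-squares (suc m) = trans (cong (λ z → z + sq (F (double m)) + sq (F (suc (double m)))) (Σ<-pair-squares m))
    (step (Σ< (sq ∘ mid) m) (Σ< (sq ∘ oddGap) m) (F (double m)) (F (suc (double m))))
    where
    step : ∀ S O a b → 2ℚ * S + ½ * O + a * a + b * b ≡ 2ℚ * (S + ½ * (a + b) * (½ * (a + b))) + ½ * (O + (b - a) * (b - a))
    step = solve-∀ ringℚ

  record AdmissibleCuts (c s : ℕ → ℚ) (N : ℕ) : Set where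
    field
      span-def : ∀ k → suc k ℕ.< N → 2ℚ * s k ≡ c k + c (suc k) - 3ℚ
      odd≥1    : ∀ j → double j ℕ.< N → 1ℚ ≤ c (double j)
      even≥2   : ∀ j → suc (double j) ℕ.< N → 2ℚ ≤ c (suc (double j))
      apart    : ∀ j → double (suc j) ℕ.< N → 3ℚ ≤ c (double j) ⊎ 3ℚ ≤ c (double (suc j))

  module _ {c s N} (cuts : AdmissibleCuts c s N) (0≤gap : ∀ k → 0ℚ ≤ gap k) where
    open AdmissibleCuts cuts
    open ≤-Reasoning

    gapForm-step : ∀ j → double (suc j) ℕ.< N → gapForm c s gap (suc (double j)) + sq (mid (suc j) - mid j) +
      ½ * (c (double (suc j)) * sq (oddGap (suc j))) - ½ * (c (double j) * sq (oddGap j)) ≤ gapForm c s gap (suc (double (suc j)))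
    gapForm-step j j<N = begin
      X + sq (mid (suc j) - mid j) + ½ * (cR * sq p) - ½ * (cL * sq o) ≡⟨ cong (λ z → X + sq z + ½ * (cR * sq p) - ½ * (cL * sq o)) (mid-difference j) ⟩
      X + sq (e + ½ * o + ½ * p) + ½ * (cR * sq p) - ½ * (cL * sq o) ≤⟨ from-diff (diff (window (even≥2 j (ℕ.<-trans (ℕ.n<1+n (suc (double j))) j<N)) (odd≥1 j (ℕ.<-trans (ℕ.n<1+n (double j)) (ℕ.<-trans (ℕ.n<1+n (suc (double j))) j<N))) (odd≥1 (suc j) j<N) (apart j j<N) (0≤gap (double j)) (0≤gap (suc (double j))) (0≤gap (double (suc j)))))
          (identity X (sq (e + ½ * o + ½ * p)) cL cm cR o e p) ⟩
      X + (cm * (e * e) + (cL + cm - 3ℚ) * (o * e)) + (cR * (p * p) + (cm + cR - 3ℚ) * (e * p)) ≡⟨ cong₂ (λ u v → X + (cm * (e * e) + u * (o * e)) + (cR * (p * p) + v * (e * p))) (span-def (double j) (ℕ.<-trans (ℕ.n<1+n (suc (double j))) j<N)) (span-def (suc (double j)) j<N) ⟨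
      X + (cm * (e * e) + 2ℚ * sL * (o * e)) + (cR * (p * p) + 2ℚ * sR * (e * p)) ≡⟨ cong₂ (λ u v → X + (cm * (e * e) + u) + (cR * (p * p) + v)) (*-assoc 2ℚ sL (o * e)) (*-assoc 2ℚ sR (e * p)) ⟩
      gapForm c s gap (suc (double (suc j))) ∎
      where
      X  = gapForm c s gap (suc (double j))
      cL = c (double j)
      cm = c (suc (double j))
      cR = c (double (suc j))
      sL = s (double j)
      sR = s (suc (double j))
      o  = oddGap j
      e  = gap (suc (double j))
      p  = oddGap (suc j)
      identity : ∀ X W cL cm cR o e p → (X + (cm * (e * e) + (cL + cm - 3ℚ) * (o * e)) + (cR * (p * p) + (cm + cR - 3ℚ) * (e * p))) - (X + W + ½ * (cR * (p * p)) - ½ * (cL * (o * o)))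
        ≡ (cm * (e * e) + ½ * (cL * (o * o)) + ½ * (cR * (p * p)) + (cL + cm - 3ℚ) * (o * e) + (cm + cR - 3ℚ) * (e * p)) - W
      identity = solve-∀ ringℚ

    -- Each odd cut splits its term in two halves, one for the window on either side. The half kept
    -- on the left-hand side here is what the next window will use.
    gapForm-mid : ∀ j → double j ℕ.< N → Σ< (λ i → sq (mid (suc i) - mid i)) j + ½ * (c (double j) * sq (oddGap j)) ≤ gapForm c s gap (suc (double j))
    gapForm-mid zero 0<N = from-diff (0≤* (0≤* (nonNegative⁻¹ ½) (≤-trans (<⇒≤ 0<1) (odd≥1 0 0<N))) (0≤sq (gap 0))) (identity (c 0) (gap 0))
      where
      identity : ∀ c d → c * (d * d) - (0ℚ + ½ * (c * (d * d))) ≡ ½ * c * (d * d)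
      identity = solve-∀ ringℚ
    gapForm-mid (suc j) j<N = ≤-trans (from-diff (diff (gapForm-mid j (ℕ.<-trans (ℕ.n<1+n (double j)) (ℕ.<-trans (ℕ.n<1+n (suc (double j))) j<N))))
        (identity (Σ< (λ i → sq (mid (suc i) - mid i)) j) (sq (mid (suc j) - mid j)) (½ * (c (double (suc j)) * sq (oddGap (suc j)))) (½ * (c (double j) * sq (oddGap j))) (gapForm c s gap (suc (double j)))))
      (gapForm-step j j<N)
      where
      identity : ∀ S D r l X → (X + D + r - l) - (S + D + r) ≡ X - (S + l)
      identity = solve-∀ ringℚ

    gapForm-odd : ∀ j → double j ℕ.< N → Σ< (sq ∘ oddGap) (suc j) ≤ gapForm c s gap (suc (double j))
    gapForm-odd zero 0<N = from-diff (0≤* (diff (odd≥1 0 0<N)) (0≤sq (gap 0))) (identity (c 0) (gap 0))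
      where
      identity : ∀ c d → c * (d * d) - (0ℚ + d * d) ≡ (c - 1ℚ) * (d * d)
      identity = solve-∀ ringℚ
    gapForm-odd (suc j) j<N = begin
      Σ< (sq ∘ oddGap) (suc j) + sq p   ≤⟨ +-mono-≤ (gapForm-odd j 2j<N) (≤-trans (≤-reflexive (sym (*-identityˡ (p * p)))) (*-monoʳ-≤-nonNeg (p * p) {{nonNegative (0≤sq p)}} (odd≥1 (suc j) j<N))) ⟩
      X + cR * (p * p)                  ≤⟨ from-diff (0≤+ (0≤+ (0≤* (≤-trans (<⇒≤ 0<2) (even≥2 j 2j+1<N)) (0≤sq e)) (0≤* 0≤2sL (0≤* (0≤gap (double j)) (0≤gap (suc (double j)))))) (0≤* 0≤2sR (0≤* (0≤gap (suc (double j))) (0≤gap (double (suc j))))))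
                                             (identity X cm cR sL sR (gap (double j)) e p) ⟩
      gapForm c s gap (suc (double (suc j))) ∎
      where
      2j+1<N = ℕ.<-trans (ℕ.n<1+n (suc (double j))) j<N
      2j<N   = ℕ.<-trans (ℕ.n<1+n (double j)) 2j+1<N
      X  = gapForm c s gap (suc (double j))
      cm = c (suc (double j))
      cR = c (double (suc j))
      sL = s (double j)
      sR = s (suc (double j))
      e  = gap (suc (double j))
      p  = oddGap (suc j)
      3≤ : ∀ {x y} → 1ℚ ≤ x → 2ℚ ≤ y → 0ℚ ≤ x + y - 3ℚ
      3≤ {x} {y} 1≤x 2≤y = ≤-trans (0≤+ (diff 1≤x) (diff 2≤y)) (≤-reflexive (regroup x y))
        where
        regroup : ∀ x y → x - 1ℚ + (y - 2ℚ) ≡ x + y - 3ℚ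
        regroup = solve-∀ ringℚ
      0≤2sL : 0ℚ ≤ 2ℚ * sL
      0≤2sL = subst (0ℚ ≤_) (sym (span-def (double j) 2j+1<N)) (3≤ (odd≥1 j 2j<N) (even≥2 j 2j+1<N))
      0≤2sR : 0ℚ ≤ 2ℚ * sR
      0≤2sR = subst (0ℚ ≤_) (sym (trans (span-def (suc (double j)) j<N) (cong (_- 3ℚ) (+-comm cm cR)))) (3≤ (odd≥1 (suc j) j<N) (even≥2 j 2j+1<N))
      identity : ∀ X cm cR sL sR o e p → (X + (cm * (e * e) + 2ℚ * (sL * (o * e))) + (cR * (p * p) + 2ℚ * (sR * (e * p)))) - (X + cR * (p * p))
        ≡ cm * (e * e) + 2ℚ * sL * (o * e) + 2ℚ * sR * (e * p)
      identity = solve-∀ ringℚ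

-- The Poincaré inequality on a path, from a positive solution of the Dirichlet eigenvalue equation.

record DirichletSolution (ℓ : ℚ) (N : ℕ) : Set where
  field
    s          : ℕ → ℚ
    initial    : s 0 ≡ 0ℚ
    recurrence : ∀ k → s (suc (suc k)) ≡ (2ℚ - ℓ) * s (suc k) - s k
    interior   : ∀ k → 1 ℕ.≤ k → k ℕ.< N → 0ℚ < s k
    final      : 0ℚ ≤ s N

-- A discrete Riccati argument. Let D m be the difference of the two sums up to m; the invariant D m
-- ≥ (T m)² (1 - s (m - 1) / s m) is kept in multiplied form, and the loss in a step is the square
-- of s₂ t - s₁ t′. At the end T vanishes and only the sign of the last s matters.
dirichlet : ∀ {ℓ N} → DirichletSolution ℓ (suc (suc N)) → (T : ℕ → ℚ) → T 0 ≡ 0ℚ → T (suc (suc N)) ≡ 0ℚ →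
  ℓ * Σ< (λ k → sq (T k)) (suc (suc N)) ≤ Σ< (λ k → sq (T (suc k) - T k)) (suc (suc N))
dirichlet {ℓ} {N} solution T T₀ T-end = from-diff (*-cancelˡ (s>0 (suc N) (s≤s z≤n) (ℕ.n<1+n (suc N)))
    (≤-trans (≤-reflexive (*-zeroʳ (s (suc N)))) (≤-trans last (≤-reflexive refl)))) refl
  where
  open DirichletSolution solution renaming (interior to s>0)
  open ≤-Reasoning
  D : ℕ → ℚ
  D m = Σ< (λ k → sq (T (suc k) - T k)) m - ℓ * Σ< (λ k → sq (T k)) m
  D-suc : ∀ m → D (suc m) ≡ D m + sq (T (suc m) - T m) - ℓ * sq (T m)
  D-suc m = identity (Σ< (λ k → sq (T (suc k) - T k)) m) (Σ< (λ k → sq (T k)) m) (sq (T (suc m) - T m)) (sq (T m)) ℓ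
    where
    identity : ∀ A B a b ℓ → A + a - ℓ * (B + b) ≡ A - ℓ * B + a - ℓ * b
    identity = solve-∀ ringℚ
  advance : ∀ m → sq (T (suc m)) * (s (suc m) - s m) ≤ s (suc m) * D (suc m) →
    s (suc (suc m)) * sq (T (suc m)) - 2ℚ * (s (suc m) * (T (suc m) * T (suc (suc m)))) + s (suc m) * sq (T (suc (suc m))) ≤ s (suc m) * D (suc (suc m))
  advance m IH = begin
    s₂ * sq t - 2ℚ * (s₁ * (t * t′)) + s₁ * sq t′   ≡⟨ cong (λ z → z * sq t - 2ℚ * (s₁ * (t * t′)) + s₁ * sq t′) (recurrence m) ⟩
    ((2ℚ - ℓ) * s₁ - s m) * sq t - 2ℚ * (s₁ * (t * t′)) + s₁ * sq t′ ≤⟨ from-diff (diff IH) (identity ℓ (s m) s₁ t t′ (D (suc m))) ⟩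
    s₁ * (D (suc m) + sq (t′ - t) - ℓ * sq t)       ≡⟨ cong (s₁ *_) (D-suc (suc m)) ⟨
    s₁ * D (suc (suc m))                            ∎
    where
    s₁ = s (suc m)
    s₂ = s (suc (suc m))
    t  = T (suc m)
    t′ = T (suc (suc m))
    identity : ∀ ℓ s₀ s₁ t t′ D → s₁ * (D + (t′ - t) * (t′ - t) - ℓ * (t * t)) - (((2ℚ - ℓ) * s₁ - s₀) * (t * t) - 2ℚ * (s₁ * (t * t′)) + s₁ * (t′ * t′))
      ≡ s₁ * D - t * t * (s₁ - s₀)
    identity = solve-∀ ringℚ
  riccati : ∀ m → suc m ℕ.≤ suc N → sq (T (suc m)) * (s (suc m) - s m) ≤ s (suc m) * D (suc m)
  riccati zero _ = ≤-reflexive (trans (cong (λ z → sq (T 1) * (s 1 - z)) initial)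
      (trans (identity (T 1) (s 1) ℓ) (cong (λ z → s 1 * (0ℚ + sq (T 1 - z) - ℓ * (0ℚ + sq z))) (sym T₀))))
    where
    identity : ∀ t s ℓ → t * t * (s - 0ℚ) ≡ s * (0ℚ + (t - 0ℚ) * (t - 0ℚ) - ℓ * (0ℚ + 0ℚ * 0ℚ))
    identity = solve-∀ ringℚ
  riccati (suc m) m<N = *-cancelˡ {sq t′ * (s₂ - s₁)} {s₂ * D (suc (suc m))} {s₁} 0<s₁ (begin
    s₁ * (sq t′ * (s₂ - s₁))      ≤⟨ from-diff (0≤sq (s₂ * t - s₁ * t′)) (identity s₁ s₂ t t′) ⟩
    s₂ * (s₂ * sq t - 2ℚ * (s₁ * (t * t′)) + s₁ * sq t′) ≤⟨ *-monoˡ (<⇒≤ 0<s₂) (advance m (riccati m (ℕ.≤-trans (ℕ.n≤1+n (suc m)) m<N))) ⟩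
    s₂ * (s₁ * D (suc (suc m)))   ≡⟨ swap s₂ s₁ (D (suc (suc m))) ⟩
    s₁ * (s₂ * D (suc (suc m)))   ∎)
    where
    s₁ = s (suc m)
    s₂ = s (suc (suc m))
    t  = T (suc m)
    t′ = T (suc (suc m))
    0<s₁ = s>0 (suc m) (s≤s z≤n) (ℕ.≤-trans m<N (ℕ.n≤1+n (suc N)))
    0<s₂ = s>0 (suc (suc m)) (s≤s z≤n) (s≤s m<N)
    identity : ∀ s₁ s₂ t t′ → s₂ * (s₂ * (t * t) - 2ℚ * (s₁ * (t * t′)) + s₁ * (t′ * t′)) - s₁ * (t′ * t′ * (s₂ - s₁)) ≡ (s₂ * t - s₁ * t′) * (s₂ * t - s₁ * t′)
    identity = solve-∀ ringℚ
    swap : ∀ a b c → a * (b * c) ≡ b * (a * c)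
    swap = solve-∀ ringℚ
  last : 0ℚ ≤ s (suc N) * D (suc (suc N))
  last = begin
    0ℚ                            ≤⟨ 0≤* final (0≤sq (T (suc N))) ⟩
    s (suc (suc N)) * sq (T (suc N)) ≡⟨ identity (s (suc (suc N))) (s (suc N)) (T (suc N)) ⟩
    s (suc (suc N)) * sq (T (suc N)) - 2ℚ * (s (suc N) * (T (suc N) * 0ℚ)) + s (suc N) * sq 0ℚ ≡⟨ cong (λ z → s (suc (suc N)) * sq (T (suc N)) - 2ℚ * (s (suc N) * (T (suc N) * z)) + s (suc N) * sq z) T-end ⟨
    s (suc (suc N)) * sq (T (suc N)) - 2ℚ * (s (suc N) * (T (suc N) * T (suc (suc N)))) + s (suc N) * sq (T (suc (suc N))) ≤⟨ advance N (riccati N ℕ.≤-refl) ⟩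
    s (suc N) * D (suc (suc N))   ∎
    where
    identity : ∀ s₂ s₁ t → s₂ * (t * t) ≡ s₂ * (t * t) - 2ℚ * (s₁ * (t * 0ℚ)) + s₁ * (0ℚ * 0ℚ)
    identity = solve-∀ ringℚ

-- Summation by parts against the partial sums T of x, which vanish at both ends.
path-poincare : ∀ {ℓ N} → DirichletSolution ℓ (suc (suc N)) → 0ℚ < ℓ → (x : ℕ → ℚ) → Σ< x (suc (suc N)) ≡ 0ℚ →
  ℓ * Σ< (sq ∘ x) (suc (suc N)) ≤ Σ< (λ k → sq (x (suc k) - x k)) (suc N)
path-poincare {ℓ} {N} solution 0<ℓ x mean-zero = begin
  -- Doubling leaves room for -2ℓ T g ≤ ℓ² T² + g². Since the increments of T are the values of x,
  -- `dirichlet` bounds ℓ² Σ T² by ℓ A, which the subtracted ℓ A cancels.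
  ℓ * A                           ≡⟨ double-minus ℓ A ⟩
  2ℚ * ℓ * A - ℓ * A              ≡⟨ cong (λ z → 2ℚ * ℓ * z - ℓ * A) parts ⟩
  2ℚ * ℓ * (- Σ< (λ k → T (suc k) * g k) (suc N)) - ℓ * A ≡⟨ cong (_- ℓ * A) (trans (neg-out ℓ (Σ< (λ k → T (suc k) * g k) (suc N))) (sym (Σ<-* (- (2ℚ * ℓ)) (λ k → T (suc k) * g k) (suc N)))) ⟩
  Σ< (λ k → - (2ℚ * ℓ) * (T (suc k) * g k)) (suc N) - ℓ * A ≤⟨ +-monoˡ-≤ (- (ℓ * A)) (Σ<-mono (suc N) (λ k _ → from-diff (0≤sq (ℓ * T (suc k) + g k)) (complete ℓ (T (suc k)) (g k)))) ⟩
  Σ< (λ k → ℓ * ℓ * sq (T (suc k)) + sq (g k)) (suc N) - ℓ * A ≡⟨ cong (_- ℓ * A) (trans (Σ<-+ (λ k → ℓ * ℓ * sq (T (suc k))) (sq ∘ g) (suc N)) (cong (_+ Σ< (sq ∘ g) (suc N)) (trans (Σ<-* (ℓ * ℓ) (sq ∘ T ∘ suc) (suc N)) (cong (ℓ * ℓ *_) head)))) ⟩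
  ℓ * ℓ * Σ< (sq ∘ T) (suc (suc N)) + Σ< (sq ∘ g) (suc N) - ℓ * A ≤⟨ from-diff (0≤* (<⇒≤ 0<ℓ) (diff (dirichlet solution T refl mean-zero))) (regroup ℓ (Σ< (sq ∘ T) (suc (suc N))) (Σ< (sq ∘ g) (suc N)) A′ (ℓ * A)) ⟩
  ℓ * A′ + Σ< (sq ∘ g) (suc N) - ℓ * A ≡⟨ cong (λ z → ℓ * z + Σ< (sq ∘ g) (suc N) - ℓ * A) (Σ<-cong (suc (suc N)) (λ k _ → cong sq (increment (T k) (x k)))) ⟩
  ℓ * A + Σ< (sq ∘ g) (suc N) - ℓ * A ≡⟨ cancel (ℓ * A) (Σ< (sq ∘ g) (suc N)) ⟩
  Σ< (sq ∘ g) (suc N)             ∎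
  where
  open ≤-Reasoning
  T = Σ< x
  g : ℕ → ℚ
  g k = x (suc k) - x k
  A  = Σ< (sq ∘ x) (suc (suc N))
  A′ = Σ< (λ k → sq (T (suc k) - T k)) (suc (suc N))
  double-minus : ∀ ℓ A → ℓ * A ≡ 2ℚ * ℓ * A - ℓ * A
  double-minus = solve-∀ ringℚ
  neg-out : ∀ ℓ z → 2ℚ * ℓ * (- z) ≡ - (2ℚ * ℓ) * z
  neg-out = solve-∀ ringℚ
  complete : ∀ ℓ t g → ℓ * ℓ * (t * t) + g * g - - (2ℚ * ℓ) * (t * g) ≡ (ℓ * t + g) * (ℓ * t + g)
  complete = solve-∀ ringℚ
  regroup : ∀ ℓ S G A B → ℓ * A + G - B - (ℓ * ℓ * S + G - B) ≡ ℓ * (A - ℓ * S)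
  regroup = solve-∀ ringℚ
  increment : ∀ t x → t + x - t ≡ x
  increment = solve-∀ ringℚ
  cancel : ∀ a b → a + b - a ≡ b
  cancel = solve-∀ ringℚ
  abel : ∀ m → Σ< (sq ∘ x) (suc m) ≡ x m * T (suc m) - Σ< (λ k → T (suc k) * g k) m
  abel zero = identity (x 0)
    where
    identity : ∀ x → 0ℚ + x * x ≡ x * (0ℚ + x) - 0ℚ
    identity = solve-∀ ringℚ
  abel (suc m) = trans (cong (_+ sq (x (suc m))) (abel m)) (identity (x m) (x (suc m)) (T (suc m)) (Σ< (λ k → T (suc k) * g k) m))
    where
    identity : ∀ x y t S → x * t - S + y * y ≡ y * (t + y) - (S + t * (y - x))
    identity = solve-∀ ringℚ
  parts : A ≡ - Σ< (λ k → T (suc k) * g k) (suc N)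
  parts = trans (abel (suc N)) (trans (cong (λ z → x (suc N) * z - Σ< (λ k → T (suc k) * g k) (suc N)) mean-zero) (drop (x (suc N)) (Σ< (λ k → T (suc k) * g k) (suc N))))
    where
    drop : ∀ x S → x * 0ℚ - S ≡ - S
    drop = solve-∀ ringℚ
  head : Σ< (sq ∘ T ∘ suc) (suc N) ≡ Σ< (sq ∘ T) (suc (suc N))
  head = trans (sym (+-identityˡ _)) (Σ<-head (sq ∘ T) (suc N))

-- The Laplacian of a cubic graph.

bit : Bool → ℕ
bit b = if b then 1 else 0

∣tabulate∣ : ∀ {n} (p : Fin n → Bool) → ∣ tabulate p ∣ ≡ ℕΣ.sum (bit ∘ p)
∣tabulate∣ {zero}  p = refl
∣tabulate∣ {suc n} p with p zero
... | true  = cong suc (∣tabulate∣ (p ∘ suc))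
... | false = ∣tabulate∣ (p ∘ suc)

ι-sum : ∀ {n} (f : Vector ℕ n) → ι (ℕΣ.sum f) ≡ sum (ι ∘ f)
ι-sum {zero}  f = refl
ι-sum {suc n} f = trans (ι-+ (f zero) (ℕΣ.sum (f ∘ suc))) (cong (λ z → ι (f zero) + z) (ι-sum (f ∘ suc)))

sumℕ≡0 : ∀ {n} (f : Vector ℕ n) → ℕΣ.sum f ≡ 0 → ∀ i → f i ≡ 0
sumℕ≡0 f eq zero    = ℕ.m+n≡0⇒m≡0 (f zero) eq
sumℕ≡0 f eq (suc i) = sumℕ≡0 (f ∘ suc) (ℕ.m+n≡0⇒n≡0 (f zero) eq) i

module Laplacian {n} (G : Graph n) where
  open Graph G using (adjacent; degree; symmetric; loopless)

  weight : Matrix ℚ n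
  weight i j = ι (bit (adjacent i j))

  laplacianℚ : Matrix ℚ n
  laplacianℚ i j = laplacian G i j / 1

  degree-sum : ∀ i → degree i ≡ ℕΣ.sum (λ j → bit (adjacent i j))
  degree-sum i = ∣tabulate∣ (adjacent i)

  laplacian-δ : ∀ i j → laplacianℚ i j ≡ ι (degree i) * δ i j - weight i j
  laplacian-δ i j with i Fin.≟ j
  ... | yes refl rewrite loopless i = trans (cong (_/ 1) (ℤ.+-identityʳ (+ degree i))) (trans (sym (ι≡/ (degree i))) (pad (ι (degree i))))
    where
    pad : ∀ x → x ≡ x * 1ℚ - 0ℚ
    pad = solve-∀ ringℚ
  ... | no _ with adjacent i j
  ...   | true  = sym (cong (_- 1ℚ) (*-zeroʳ (ι (degree i))))
  ...   | false = sym (cong (_- 0ℚ) (*-zeroʳ (ι (degree i))))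

  weight-symmetric : ∀ i j → weight i j ≡ weight j i
  weight-symmetric i j = cong (ι ∘ bit) (symmetric i j)

  laplacian-symmetric : Cubic G → ∀ i j → laplacianℚ i j ≡ laplacianℚ j i
  laplacian-symmetric cubic i j = trans (laplacian-δ i j) (trans (cong₂ _-_ (cong₂ (λ d e → ι d * e) (trans (cubic i) (sym (cubic j))) (δ-symmetric i j)) (weight-symmetric i j)) (sym (laplacian-δ j i)))
    where
    δ-symmetric : ∀ {m} (i j : Fin m) → δ i j ≡ δ j i
    δ-symmetric i j with i Fin.≟ j
    ... | yes refl = sym (δ-same i)
    ... | no i≢j   = sym (δ-diff (i≢j ∘ sym))

  -- The sum runs over ordered pairs, so each edge counts twice; this is the factor 2 in
  -- `energy-form`.
  energy : Vector ℚ n → ℚ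
  energy f = sum λ i → sum λ j → weight i j * sq (f i - f j)

  module _ (cubic : Cubic G) where

    weight-sum : ∀ i → sum (weight i) ≡ 3ℚ
    weight-sum i = trans (sym (ι-sum (λ j → bit (adjacent i j)))) (cong ι (trans (sym (degree-sum i)) (cubic i)))

    energy-form : ∀ f → energy f ≡ 2ℚ * form laplacianℚ f f
    energy-form f = begin
      energy f                    ≡⟨ sum-cong (λ i → trans (sum-cong λ j → expand (weight i j) (f i) (f j)) (trans (sum-+ (λ j → weight i j * sq (f i) + weight i j * sq (f j)) (λ j → - 2ℚ * (f i * (weight i j * f j))))
                                       (cong₂ _+_ (trans (sum-+ (λ j → weight i j * sq (f i)) (λ j → weight i j * sq (f j))) (cong (_+ S i) (trans (sum-*ʳ (sq (f i)) (weight i)) (cong (_* sq (f i)) (weight-sum i)))))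
                                         (trans (sum-*ˡ (- 2ℚ) (λ j → f i * (weight i j * f j))) (cong (- 2ℚ *_) (sum-*ˡ (f i) (λ j → weight i j * f j))))))) ⟩
      sum (λ i → 3ℚ * sq (f i) + S i + - 2ℚ * (f i * X i)) ≡⟨ trans (sum-+ (λ i → 3ℚ * sq (f i) + S i) (λ i → - 2ℚ * (f i * X i))) (cong₂ _+_ (trans (sum-+ (λ i → 3ℚ * sq (f i)) S) (cong₂ _+_ (sum-*ˡ 3ℚ (sq ∘ f)) column)) (sum-*ˡ (- 2ℚ) (λ i → f i * X i))) ⟩
      3ℚ * ∥ f ∥² + 3ℚ * ∥ f ∥² + - 2ℚ * sum (λ i → f i * X i) ≡⟨ collect ∥ f ∥² (sum (λ i → f i * X i)) ⟩
      2ℚ * (3ℚ * ∥ f ∥² + - 1ℚ * sum (λ i → f i * X i)) ≡⟨ cong (2ℚ *_) laplacian-form ⟨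
      2ℚ * form laplacianℚ f f    ∎
      where
      open ≡-Reasoning
      X S : Vector ℚ n
      X i = sum λ j → weight i j * f j
      S i = sum λ j → weight i j * sq (f j)
      expand : ∀ a x y → a * ((x - y) * (x - y)) ≡ a * (x * x) + a * (y * y) + - 2ℚ * (x * (a * y))
      expand = solve-∀ ringℚ
      collect : ∀ N X → 3ℚ * N + 3ℚ * N + - 2ℚ * X ≡ 2ℚ * (3ℚ * N + - 1ℚ * X)
      collect = solve-∀ ringℚ
      column : sum S ≡ 3ℚ * ∥ f ∥²
      column = trans (∑-comm (λ i j → weight i j * sq (f j))) (trans (sum-cong λ j → trans (sum-*ʳ (sq (f j)) (λ i → weight i j))
        (cong (_* sq (f j)) (trans (sum-cong λ i → weight-symmetric i j) (weight-sum j)))) (sum-*ˡ 3ℚ (sq ∘ f)))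
      entry : ∀ i j → laplacianℚ i j * f j ≡ 3ℚ * (δ i j * f j) + - 1ℚ * (weight i j * f j)
      entry i j = trans (cong (_* f j) (trans (laplacian-δ i j) (cong (λ d → ι d * δ i j - weight i j) (cubic i)))) (distribute (δ i j) (weight i j) (f j))
        where
        distribute : ∀ d a x → (3ℚ * d - a) * x ≡ 3ℚ * (d * x) + - 1ℚ * (a * x)
        distribute = solve-∀ ringℚ
      laplacian-form : form laplacianℚ f f ≡ 3ℚ * ∥ f ∥² + - 1ℚ * sum (λ i → f i * X i)
      laplacian-form = trans (sum-cong λ i → trans (cong (f i *_) (trans (sum-cong (entry i)) (trans (sum-linear 3ℚ (- 1ℚ) (λ j → δ i j * f j) (λ j → weight i j * f j)) (cong (λ z → 3ℚ * z + - 1ℚ * X i) (sum-δ i f)))))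
          (distribute (f i) (X i))) (sum-linear 3ℚ (- 1ℚ) (sq ∘ f) (λ i → f i * X i))
        where
        distribute : ∀ x y → x * (3ℚ * x + - 1ℚ * y) ≡ 3ℚ * (x * x) + - 1ℚ * (x * y)
        distribute = solve-∀ ringℚ

-- The energy of a sorted function in terms of its gaps.

extend : ∀ {n} → Vector ℚ (suc n) → ℕ → ℚ
extend         f zero    = f zero
extend {zero}  f (suc k) = f zero
extend {suc n} f (suc k) = extend (f ∘ suc) k

extend-toℕ : ∀ {n} (f : Vector ℚ (suc n)) i → extend f (toℕ i) ≡ f i
extend-toℕ         f zero    = refl
extend-toℕ {suc n} f (suc i) = extend-toℕ (f ∘ suc) i

extend-mono : ∀ {n} (f : Vector ℚ (suc n)) → Sorted f → ∀ k → extend f k ≤ extend f (suc k)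
extend-mono {zero}  f sorted zero    = ≤-refl
extend-mono {zero}  f sorted (suc k) = ≤-refl
extend-mono {suc n} f sorted zero    = sorted zero (suc zero) z≤n
extend-mono {suc n} f sorted (suc k) = extend-mono (f ∘ suc) (λ i j i≤j → sorted (suc i) (suc j) (s≤s i≤j)) k

-- 1 if u ≤ k < v, that is, if an edge going up from u to v crosses gap k. Summed over the edges it
-- is the cut size, and `mask₂`, which asks for the gaps k and k + 1 together, gives the span.
mask : ℕ → ℕ → ℕ → ℚ
mask u v k = ι (le u k ℕ.* gt v k)

mask₂ : ℕ → ℕ → ℕ → ℚ
mask₂ u v k = ι (le u k ℕ.* gt v (suc k))

module Masked (F : ℕ → ℚ) (mono : ∀ k → F k ≤ F (suc k)) where
  open Gaps F using (gap)

  maskedGap : ℕ → ℕ → ℕ → ℚ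
  maskedGap u v k = mask u v k * gap k

  0≤maskedGap : ∀ u v k → 0ℚ ≤ maskedGap u v k
  0≤maskedGap u v k = 0≤* (0≤ι (le u k ℕ.* gt v k)) (diff (mono k))

  mask-square : ∀ u v k → mask u v k * (gap k * gap k) ≡ maskedGap u v k * maskedGap u v k
  mask-square u v k = trans (cong (_* (gap k * gap k)) (trans (cong ι (idempotent u v k)) (ι-* (le u k ℕ.* gt v k) (le u k ℕ.* gt v k)))) (regroup (mask u v k) (gap k))
    where
    regroup : ∀ m g → m * m * (g * g) ≡ m * g * (m * g)
    regroup = solve-∀ ringℚ
    bit-le : ∀ u k → le u k ≡ 0 ⊎ le u k ≡ 1
    bit-le zero    k       = inj₂ refl
    bit-le (suc u) zero    = inj₁ refl
    bit-le (suc u) (suc k) = bit-le u k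
    bit-gt : ∀ u k → gt u k ≡ 0 ⊎ gt u k ≡ 1
    bit-gt zero    k       = inj₁ refl
    bit-gt (suc u) zero    = inj₂ refl
    bit-gt (suc u) (suc k) = bit-gt u k
    idempotent : ∀ u v k → le u k ℕ.* gt v k ≡ le u k ℕ.* gt v k ℕ.* (le u k ℕ.* gt v k)
    idempotent u v k with bit-le u k | bit-gt v k
    ... | inj₁ p | _      rewrite p = refl
    ... | inj₂ p | inj₁ q rewrite p | q = refl
    ... | inj₂ p | inj₂ q rewrite p | q = refl

  mask-cross : ∀ u v k → mask₂ u v k * (gap k * gap (suc k)) ≡ maskedGap u v k * maskedGap u v (suc k)
  mask-cross u v k = trans (cong (_* (gap k * gap (suc k))) (trans (cong ι (sym (trans (swap (le u k) (gt v k) (le u (suc k)) (gt v (suc k))) (cong₂ ℕ._*_ (le-absorb u k) (gt-absorb v k)))))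
      (ι-* (le u k ℕ.* gt v k) (le u (suc k) ℕ.* gt v (suc k))))) (regroup (mask u v k) (mask u v (suc k)) (gap k) (gap (suc k)))
    where
    regroup : ∀ m n g h → m * n * (g * h) ≡ m * g * (n * h)
    regroup = solve-∀ ringℚ
    swap : ∀ a b c d → a ℕ.* b ℕ.* (c ℕ.* d) ≡ a ℕ.* c ℕ.* (b ℕ.* d)
    swap = solve-ℕ
    le-absorb : ∀ u k → le u k ℕ.* le u (suc k) ≡ le u k
    le-absorb zero          k       = refl
    le-absorb (suc u)       zero    = refl
    le-absorb (suc u)       (suc k) = le-absorb u k
    gt-absorb : ∀ v k → gt v k ℕ.* gt v (suc k) ≡ gt v (suc k)
    gt-absorb zero          k       = refl
    gt-absorb (suc zero)    zero    = refl
    gt-absorb (suc (suc v)) zero    = refl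
    gt-absorb (suc v)       (suc k) = gt-absorb v k

  maskedGap-reverse : ∀ {u v} → v ℕ.≤ u → ∀ k → maskedGap u v k ≡ 0ℚ
  maskedGap-reverse {u} {v} v≤u k with v ℕ.≤? k
  ... | yes v≤k = trans (cong (λ z → ι (le u k ℕ.* z) * gap k) (gt-≤ v≤k)) (trans (cong (λ z → ι z * gap k) (ℕ.*-zeroʳ (le u k))) (*-zeroˡ (gap k)))
  ... | no v≰k  = trans (cong (λ z → ι (z ℕ.* gt v k) * gap k) (le-> (ℕ.<-≤-trans (ℕ.≰⇒> v≰k) v≤u))) (*-zeroˡ (gap k))

  Σ-maskedGap-reverse : ∀ {u v} → v ℕ.≤ u → ∀ m → Σ< (maskedGap u v) m ≡ 0ℚ
  Σ-maskedGap-reverse v≤u zero    = refl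
  Σ-maskedGap-reverse v≤u (suc m) = trans (cong₂ _+_ (Σ-maskedGap-reverse v≤u m) (maskedGap-reverse v≤u m)) refl

  -- For u ≤ v the masked gaps telescope to F (min m v) − F (min m u).
  Σ-maskedGap : ∀ {u v} → u ℕ.≤ v → ∀ m → Σ< (maskedGap u v) m ≡ F (m ℕ.⊓ v) - F (m ℕ.⊓ u)
  Σ-maskedGap u≤v zero = sym (+-inverseʳ (F 0))
  Σ-maskedGap {u} {v} u≤v (suc m) = trans (cong (_+ maskedGap u v m) (Σ-maskedGap u≤v m)) (step (m ℕ.<? u) (m ℕ.<? v))
    where
    skip : ∀ a b g → a - b + 0ℚ * g ≡ a - b
    skip = solve-∀ ringℚ
    add : ∀ a b c → a - b + 1ℚ * (c - a) ≡ c - b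
    add = solve-∀ ringℚ
    both : ∀ a b c g → g ≡ 0ℚ → a - a + g ≡ c - c
    both a b c g g≡0 = trans (cong (λ z → a - a + z) g≡0) (trans (vanish a) (sym (+-inverseʳ c)))
      where
      vanish : ∀ a → a - a + 0ℚ ≡ 0ℚ
      vanish = solve-∀ ringℚ
    step : Dec (m ℕ.< u) → Dec (m ℕ.< v) → F (m ℕ.⊓ v) - F (m ℕ.⊓ u) + maskedGap u v m ≡ F (suc m ℕ.⊓ v) - F (suc m ℕ.⊓ u)
    step (yes m<u) _ rewrite ℕ.m≤n⇒m⊓n≡m (ℕ.<⇒≤ m<u) | ℕ.m≤n⇒m⊓n≡m (ℕ.<⇒≤ (ℕ.<-≤-trans m<u u≤v)) | ℕ.m≤n⇒m⊓n≡m m<u | ℕ.m≤n⇒m⊓n≡m (ℕ.<-≤-trans m<u u≤v) =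
      both (F m) 0ℚ (F (suc m)) (maskedGap u v m) (trans (cong (λ z → ι (z ℕ.* gt v m) * gap m) (le-> m<u)) (*-zeroˡ (gap m)))
    step (no m≮u) (yes m<v) rewrite ℕ.m≤n⇒m⊓n≡m (ℕ.<⇒≤ m<v) | ℕ.m≤n⇒m⊓n≡m m<v | ℕ.m≥n⇒m⊓n≡n (ℕ.≮⇒≥ m≮u) | ℕ.m≥n⇒m⊓n≡n (ℕ.≤-trans (ℕ.≮⇒≥ m≮u) (ℕ.n≤1+n m)) =
      trans (cong (λ z → F m - F u + ι z * gap m) (cong₂ ℕ._*_ (le-≤ (ℕ.≮⇒≥ m≮u)) (gt-> m<v))) (add (F m) (F u) (F (suc m)))
    step (no m≮u) (no m≮v) rewrite ℕ.m≥n⇒m⊓n≡n (ℕ.≮⇒≥ m≮v) | ℕ.m≥n⇒m⊓n≡n (ℕ.≤-trans (ℕ.≮⇒≥ m≮v) (ℕ.n≤1+n m)) | ℕ.m≥n⇒m⊓n≡n (ℕ.≮⇒≥ m≮u) | ℕ.m≥n⇒m⊓n≡n (ℕ.≤-trans (ℕ.≮⇒≥ m≮u) (ℕ.n≤1+n m)) =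
      trans (cong (λ z → F v - F u + ι z * gap m) (trans (cong (le u m ℕ.*_) (gt-≤ (ℕ.≮⇒≥ m≮v))) (ℕ.*-zeroʳ (le u m)))) (skip (F v) (F u) (gap m))

  edgeForm : ℕ → ℕ → ℕ → ℚ
  edgeForm u v = gapForm (mask u v) (mask₂ u v) gap

  edgeForm-≤ : ∀ u v m → edgeForm u v m ≤ Σ< (maskedGap u v) m * Σ< (maskedGap u v) m
  edgeForm-≤ u v = gapForm-≤-square {mask u v} {mask₂ u v} {gap} {maskedGap u v} (0≤maskedGap u v) (mask-square u v) (mask-cross u v)

  -- Only the orientation going upwards contributes, since the mask of the other one is empty.
  -- Having both on the left matches the sum over ordered pairs in `energy`.
  edgeForm-both : ∀ u v m → u ℕ.≤ m → v ℕ.≤ m → edgeForm u v m + edgeForm v u m ≤ sq (F u - F v)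
  edgeForm-both u v m u≤m v≤m = ≤-trans (+-mono-≤ (edgeForm-≤ u v m) (edgeForm-≤ v u m)) ([ forward , backward ]′ (ℕ.≤-total u v))
    where
    forward : u ℕ.≤ v → _
    forward u≤v = ≤-reflexive (trans (cong₂ (λ x y → x * x + y * y) (trans (Σ-maskedGap u≤v m) (cong₂ (λ i j → F i - F j) (ℕ.m≥n⇒m⊓n≡n v≤m) (ℕ.m≥n⇒m⊓n≡n u≤m))) (Σ-maskedGap-reverse u≤v m))
      (identity (F u) (F v)))
      where
      identity : ∀ a b → (b - a) * (b - a) + 0ℚ * 0ℚ ≡ (a - b) * (a - b)
      identity = solve-∀ ringℚ
    backward : v ℕ.≤ u → _
    backward v≤u = ≤-reflexive (trans (cong₂ (λ x y → x * x + y * y) (Σ-maskedGap-reverse v≤u m) (trans (Σ-maskedGap v≤u m) (cong₂ (λ i j → F i - F j) (ℕ.m≥n⇒m⊓n≡n u≤m) (ℕ.m≥n⇒m⊓n≡n v≤m))))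
      (identity (F u) (F v)))
      where
      identity : ∀ a b → 0ℚ * 0ℚ + (a - b) * (a - b) ≡ (a - b) * (a - b)
      identity = solve-∀ ringℚ

-- Summing the edge forms turns the masks into cut sizes.
gapForm-sum : ∀ {n} (w : Matrix ℚ n) (c s : Fin n → Fin n → ℕ → ℚ) d m →
  gapForm (λ k → sum λ u → sum λ v → w u v * c u v k) (λ k → sum λ u → sum λ v → w u v * s u v k) d m ≡
  sum λ u → sum λ v → w u v * gapForm (c u v) (s u v) d m
gapForm-sum w c s d zero = sym (sum-zero λ u → sum-zero λ v → *-zeroʳ (w u v))
gapForm-sum w c s d (suc zero) = trans (sym (sum-*ʳ (d 0 * d 0) (λ u → sum λ v → w u v * c u v 0))) (sum-cong λ u → trans (sym (sum-*ʳ (d 0 * d 0) (λ v → w u v * c u v 0))) (sum-cong λ v → *-assoc (w u v) (c u v 0) (d 0 * d 0)))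
gapForm-sum {n} w c s d (suc (suc k)) = begin
  X + (C * sq d′ + 2ℚ * (S * dd))   ≡⟨ cong₂ _+_ (gapForm-sum w c s d (suc k)) (regroup C S (sq d′) dd) ⟩
  sum (λ u → sum λ v → w u v * g u v) + (sq d′ * C + 2ℚ * dd * S)
    ≡⟨ cong (λ z → sum (λ u → sum λ v → w u v * g u v) + z) (trans (sum-linear₂ (sq d′) (2ℚ * dd) (λ u v → w u v * c u v (suc k)) (λ u v → w u v * s u v k)) refl) ⟨
  sum (λ u → sum λ v → w u v * g u v) + sum (λ u → sum λ v → sq d′ * (w u v * c u v (suc k)) + 2ℚ * dd * (w u v * s u v k))
    ≡⟨ trans (sum-+ (λ u → sum λ v → w u v * g u v) (λ u → sum λ v → sq d′ * (w u v * c u v (suc k)) + 2ℚ * dd * (w u v * s u v k))) refl ⟨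
  sum (λ u → sum (λ v → w u v * g u v) + sum (λ v → sq d′ * (w u v * c u v (suc k)) + 2ℚ * dd * (w u v * s u v k)))
    ≡⟨ sum-cong (λ u → trans (sym (sum-+ (λ v → w u v * g u v) (λ v → sq d′ * (w u v * c u v (suc k)) + 2ℚ * dd * (w u v * s u v k)))) (sum-cong λ v → collect (w u v) (g u v) (c u v (suc k)) (s u v k) (sq d′) dd)) ⟩
  sum (λ u → sum λ v → w u v * (g u v + (c u v (suc k) * sq d′ + 2ℚ * (s u v k * dd)))) ∎
  where
  open ≡-Reasoning
  d′ = d (suc k)
  dd = d k * d (suc k)
  g : Matrix ℚ n
  g u v = gapForm (c u v) (s u v) d (suc k)
  C = sum λ u → sum λ v → w u v * c u v (suc k)
  S = sum λ u → sum λ v → w u v * s u v k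
  X = gapForm (λ k → sum λ u → sum λ v → w u v * c u v k) (λ k → sum λ u → sum λ v → w u v * s u v k) d (suc k)
  regroup : ∀ C S q e → C * q + 2ℚ * (S * e) ≡ q * C + 2ℚ * e * S
  regroup = solve-∀ ringℚ
  collect : ∀ w g c s q e → w * g + (q * (w * c) + 2ℚ * e * (w * s)) ≡ w * (g + (c * q + 2ℚ * (s * e)))
  collect = solve-∀ ringℚ
  sum-linear₂ : ∀ a b (f g : Matrix ℚ n) → sum (λ u → sum λ v → a * f u v + b * g u v) ≡ a * sum (λ u → sum (f u)) + b * sum (λ u → sum (g u))
  sum-linear₂ a b f g = trans (sum-cong λ u → sum-linear a b (f u) (g u)) (sum-linear a b (λ u → sum (f u)) (λ u → sum (g u)))

-- The Poincaré inequality of a connected cubic graph.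

odd?-doubled : ∀ j → odd? (double j) ≡ false
odd?-doubled zero    = refl
odd?-doubled (suc j) = trans (not-not (odd? (double j))) (odd?-doubled j)
  where
  not-not : ∀ x → not (not x) ≡ x
  not-not true  = refl
  not-not false = refl

odd≥1-or-3 : ∀ c → odd? c ≡ true → c ≡ 1 ⊎ 3 ℕ.≤ c
odd≥1-or-3 (suc zero)            _ = inj₁ refl
odd≥1-or-3 (suc (suc (suc c)))   _ = inj₂ (s≤s (s≤s (s≤s z≤n)))

even≥2 : ∀ c → odd? c ≡ false → 1 ℕ.≤ c → 2 ℕ.≤ c
even≥2 (suc (suc c)) _ _ = s≤s (s≤s z≤n)

module CubicOrder {N′} (G : Graph (double (suc (suc N′)))) (connected : Connected G) (cubic : Cubic G)
  (f : Vector ℚ (double (suc (suc N′)))) (σ : Permutation′ (double (suc (suc N′)))) (sorted : Sorted (λ i → f (σ ⟨$⟩ʳ i))) where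
  open Graph G using (adjacent)
  open Laplacian G

  n m : ℕ
  n = double (suc (suc N′))
  m = suc (double (suc N′))

  f′ : Vector ℚ n
  f′ i = f (σ ⟨$⟩ʳ i)

  a : Fin n → Fin n → ℕ
  a u v = bit (adjacent (σ ⟨$⟩ʳ u) (σ ⟨$⟩ʳ v))

  weights : CubicWeights a
  weights = record
    { symmetric = λ u v → cong bit (Graph.symmetric G (σ ⟨$⟩ʳ u) (σ ⟨$⟩ʳ v))
    ; loopless  = λ u → cong bit (Graph.loopless G (σ ⟨$⟩ʳ u))
    ; simple    = λ u v → bit≤1 (adjacent (σ ⟨$⟩ʳ u) (σ ⟨$⟩ʳ v))
    ; cubic     = λ u → trans (sym (ℕΣ.sum-permute (λ v → bit (adjacent (σ ⟨$⟩ʳ u) v)) σ)) (trans (sym (degree-sum (σ ⟨$⟩ʳ u))) (cubic (σ ⟨$⟩ʳ u)))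
    }
    where
    bit≤1 : ∀ b → bit b ℕ.≤ 1
    bit≤1 true  = s≤s z≤n
    bit≤1 false = z≤n

  open Cuts weights

  -- With an empty cut, a walk from the first vertex in the order could never leave the first k + 1
  -- of them. This is where connectedness enters the lower bound.
  cut≢0 : ∀ k → suc k ℕ.< n → cut k ≢ 0
  cut≢0 k k<n cut≡0 = ℕ.<⇒≱ (ℕ.n<1+n k) (subst (ℕ._≤ k) (trans (cong toℕ (Perm.inverseˡ σ)) (proj₂ (vertex k<n)))
      (stays (connected (σ ⟨$⟩ʳ zero) (σ ⟨$⟩ʳ w)) (subst (ℕ._≤ k) (sym (cong toℕ (Perm.inverseˡ σ))) z≤n)))
    where
    w = proj₁ (vertex k<n)
    rank : Fin n → ℕ
    rank v = toℕ (σ ⟨$⟩ˡ v)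
    no-edge : ∀ u v → le (toℕ u) k ℕ.* gt (toℕ v) k ℕ.* a u v ≡ 0
    no-edge u v = sumℕ≡0 (λ v → le (toℕ u) k ℕ.* gt (toℕ v) k ℕ.* a u v) (sumℕ≡0 (λ u → ℕΣ.sum λ v → le (toℕ u) k ℕ.* gt (toℕ v) k ℕ.* a u v) cut≡0 u) v
    step : ∀ u v → Bool.T (adjacent u v) → rank u ℕ.≤ k → rank v ℕ.≤ k
    step u v uv u≤k with rank v ℕ.≤? k
    ... | yes v≤k = v≤k
    ... | no v≰k = contradiction (trans (sym (cong₂ ℕ._*_ (cong₂ ℕ._*_ (le-≤ u≤k) (gt-> (ℕ.≰⇒> v≰k))) a≡1)) (no-edge (σ ⟨$⟩ˡ u) (σ ⟨$⟩ˡ v))) λ ()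
      where
      T⇒bit : ∀ b → Bool.T b → bit b ≡ 1
      T⇒bit true _ = refl
      a≡1 : a (σ ⟨$⟩ˡ u) (σ ⟨$⟩ˡ v) ≡ 1
      a≡1 = trans (cong₂ (λ x y → bit (adjacent x y)) (Perm.inverseʳ σ) (Perm.inverseʳ σ)) (T⇒bit (adjacent u v) uv)
    stays : ∀ {u v} → Star (λ u v → Bool.T (adjacent u v)) u v → rank u ℕ.≤ k → rank v ℕ.≤ k
    stays Star.ε          u≤k = u≤k
    stays (uw ◅ rest) u≤k = stays rest (step _ _ uw u≤k)

  F : ℕ → ℚ
  F = extend f′

  F-mono : ∀ k → F k ≤ F (suc k)
  F-mono = extend-mono f′ sorted

  open Gaps F
  open Masked F F-mono

  c s : ℕ → ℚ
  c k = sum λ u → sum λ v → ι (a u v) * mask (toℕ u) (toℕ v) k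
  s k = sum λ u → sum λ v → ι (a u v) * mask₂ (toℕ u) (toℕ v) k

  ι-edges : ∀ (p q : Vector ℕ n) → sum (λ u → sum λ v → ι (a u v) * ι (p u ℕ.* q v)) ≡ ι (edges p q)
  ι-edges p q = sym (trans (ι-sum (λ u → ℕΣ.sum λ v → p u ℕ.* q v ℕ.* a u v)) (sum-cong λ u → trans (ι-sum (λ v → p u ℕ.* q v ℕ.* a u v))
    (sum-cong λ v → trans (ι-* (p u ℕ.* q v) (a u v)) (*-comm (ι (p u ℕ.* q v)) (ι (a u v))))))

  c≡ : ∀ k → c k ≡ ι (cut k)
  c≡ k = ι-edges (Below k) (Above k)

  s≡ : ∀ k → s k ≡ ι (span k)
  s≡ k = ι-edges (Below k) (Above (suc k))

  ι≤c : ∀ k {x} → x ℕ.≤ cut k → ι x ≤ c k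
  ι≤c k {x} x≤ = subst (ι x ≤_) (sym (c≡ k)) (ι-mono-≤ x≤)

  odd-cut : ∀ j → double j ℕ.< n → odd? (cut (double j)) ≡ true
  odd-cut j j<n = trans (cut-parity (double j) j<n) (cong not (odd?-doubled j))

  admissible : AdmissibleCuts c s m
  admissible = record
    { span-def = λ k k<m → trans (cong (2ℚ *_) (s≡ k)) (trans (isolate k (proj₂ (vertex (ℕ.<-trans k<m (ℕ.n<1+n m))))) (sym (cong₂ (λ x y → x + y - 3ℚ) (c≡ k) (c≡ (suc k)))))
    ; odd≥1 = λ j j<m → ι≤c (double j) {1} ([ (λ eq → ℕ.≤-reflexive (sym eq)) , (λ 3≤ → ℕ.≤-trans (s≤s z≤n) 3≤) ]′ (odd≥1-or-3 (cut (double j)) (odd-cut j (ℕ.<-trans j<m (ℕ.n<1+n m)))))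
    ; even≥2 = λ j j<m → ι≤c (suc (double j)) {2} (even≥2 (cut (suc (double j))) (trans (cut-parity (suc (double j)) (ℕ.<-trans j<m (ℕ.n<1+n m))) (cong (not ∘ not) (odd?-doubled j)))
        (ℕ.n≢0⇒n>0 (cut≢0 (suc (double j)) (s≤s j<m))))
    ; apart = λ j j<m → apart′ j j<m (odd≥1-or-3 (cut (double j)) (odd-cut j (ℕ.<-trans (ℕ.<-trans (ℕ.n<1+n (double j)) (ℕ.<-trans (ℕ.n<1+n (suc (double j))) j<m)) (ℕ.n<1+n m))))
    }
    where
    isolate : ∀ k {w : Fin n} → toℕ w ≡ suc k → 2ℚ * ι (span k) ≡ ι (cut k) + ι (cut (suc k)) - 3ℚ
    isolate k w≡ = begin
      2ℚ * ι (span k)                         ≡⟨ pad (ι (span k)) ⟩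
      3ℚ + 2ℚ * ι (span k) - 3ℚ               ≡⟨ cong (_- 3ℚ) (trans (ι-+ 3 (2 ℕ.* span k)) (cong (λ z → 3ℚ + z) (ι-* 2 (span k)))) ⟨
      ι (3 ℕ.+ 2 ℕ.* span k) - 3ℚ             ≡⟨ cong (λ z → ι z - 3ℚ) (cut-suc k w≡) ⟨
      ι (cut k ℕ.+ cut (suc k)) - 3ℚ          ≡⟨ cong (_- 3ℚ) (ι-+ (cut k) (cut (suc k))) ⟩
      ι (cut k) + ι (cut (suc k)) - 3ℚ        ∎
      where
      open ≡-Reasoning
      pad : ∀ x → 2ℚ * x ≡ 3ℚ + 2ℚ * x - 3ℚ
      pad = solve-∀ ringℚ
    apart′ : ∀ j → double (suc j) ℕ.< m → cut (double j) ≡ 1 ⊎ 3 ℕ.≤ cut (double j) → 3ℚ ≤ c (double j) ⊎ 3ℚ ≤ c (double (suc j))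
    apart′ j j<m (inj₂ 3≤) = inj₁ (ι≤c (double j) 3≤)
    apart′ j j<m (inj₁ eq) = inj₂ (ι≤c (double (suc j)) (ℕ.+-cancelˡ-≤ 1 3 (cut (double (suc j))) (subst (λ z → 4 ℕ.≤ z ℕ.+ cut (double (suc j))) eq
      (cut-two (double j) (proj₂ (vertex (ℕ.<-trans (ℕ.<-trans (ℕ.n<1+n (suc (double j))) j<m) (ℕ.n<1+n m)))) (proj₂ (vertex (ℕ.<-trans j<m (ℕ.n<1+n m))))))))

  gapForm≤form : gapForm c s gap m ≤ form laplacianℚ f f
  gapForm≤form = *-cancelˡ {r = 2ℚ} 0<2 (begin
    2ℚ * X                              ≡⟨ two X ⟩
    X + X                               ≡⟨ cong₂ _+_ expansion (trans expansion (trans (∑-comm (λ u v → ι (a u v) * edgeForm (toℕ u) (toℕ v) m)) (sum-cong λ v → sum-cong λ u → cong (λ z → ι z * edgeForm (toℕ u) (toℕ v) m) (CubicWeights.symmetric weights u v)))) ⟩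
    sum (λ u → sum λ v → ι (a u v) * edgeForm (toℕ u) (toℕ v) m) + sum (λ u → sum λ v → ι (a u v) * edgeForm (toℕ v) (toℕ u) m)
      ≡⟨ trans (sum-cong λ u → sum-+ (λ v → ι (a u v) * edgeForm (toℕ u) (toℕ v) m) (λ v → ι (a u v) * edgeForm (toℕ v) (toℕ u) m)) (sum-+ (λ u → sum λ v → ι (a u v) * edgeForm (toℕ u) (toℕ v) m) (λ u → sum λ v → ι (a u v) * edgeForm (toℕ v) (toℕ u) m)) ⟨
    sum (λ u → sum λ v → ι (a u v) * edgeForm (toℕ u) (toℕ v) m + ι (a u v) * edgeForm (toℕ v) (toℕ u) m)
      ≤⟨ sum-mono (λ u → sum-mono λ v → ≤-trans (≤-reflexive (sym (*-distribˡ-+ (ι (a u v)) (edgeForm (toℕ u) (toℕ v) m) (edgeForm (toℕ v) (toℕ u) m))))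
           (*-monoˡ (0≤ι (a u v)) (≤-trans (edgeForm-both (toℕ u) (toℕ v) m (ℕ.s≤s⁻¹ (Fin.toℕ<n u)) (ℕ.s≤s⁻¹ (Fin.toℕ<n v)))
             (≤-reflexive (cong₂ (λ x y → sq (x - y)) (extend-toℕ f′ u) (extend-toℕ f′ v)))))) ⟩
    sum (λ u → sum λ v → ι (a u v) * sq (f′ u - f′ v))
      ≡⟨ trans (sum-permute (λ i → sum λ j → weight i j * sq (f i - f j)) σ) (sum-cong λ u → sum-permute (λ j → weight (σ ⟨$⟩ʳ u) j * sq (f (σ ⟨$⟩ʳ u) - f j)) σ) ⟨
    energy f                            ≡⟨ energy-form cubic f ⟩
    2ℚ * form laplacianℚ f f            ∎)
    where
    open ≤-Reasoning
    X = gapForm c s gap m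
    two : ∀ x → 2ℚ * x ≡ x + x
    two = solve-∀ ringℚ
    expansion : X ≡ sum (λ u → sum λ v → ι (a u v) * edgeForm (toℕ u) (toℕ v) m)
    expansion = gapForm-sum (λ u v → ι (a u v)) (λ u v → mask (toℕ u) (toℕ v)) (λ u v → mask₂ (toℕ u) (toℕ v)) gap m

  Σ-F : ∀ (h : ℚ → ℚ) → sum (λ i → h (f i)) ≡ Σ< (λ k → h (F k)) n
  Σ-F h = trans (sum-permute (λ i → h (f i)) σ) (trans (sum-cong λ i → cong h (sym (extend-toℕ f′ i))) (sum-toℕ n (λ k → h (F k))))

  -- The norm of f is 2 Σ mid² + ½ Σ oddGap². The midpoints obey the path inequality, and the sum of
  -- the squared odd gaps is itself at most the energy; combining the two with weights 4 and ℓ gives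
  -- the constant 4 + ℓ.
  poincare : ∀ {ℓ} → DirichletSolution ℓ (suc (suc N′)) → 0ℚ < ℓ → sum f ≡ 0ℚ → 2ℚ * ℓ * ∥ f ∥² ≤ (4ℚ + ℓ) * form laplacianℚ f f
  poincare {ℓ} solution 0<ℓ mean-zero = begin
    2ℚ * ℓ * ∥ f ∥²                     ≡⟨ cong (2ℚ * ℓ *_) (trans (Σ-F sq) (Σ<-pair-squares (suc (suc N′)))) ⟩
    2ℚ * ℓ * (2ℚ * A + ½ * O)           ≤⟨ from-diff (0≤+ (0≤* {4ℚ} (0≤ι 4) (diff ℓA≤X)) (0≤* (<⇒≤ 0<ℓ) (diff O≤X))) (identity ℓ A O X) ⟩
    (4ℚ + ℓ) * X                        ≤⟨ *-monoˡ (<⇒≤ (+-mono-≤-< {0ℚ} {4ℚ} (0≤ι 4) 0<ℓ)) gapForm≤form ⟩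
    (4ℚ + ℓ) * form laplacianℚ f f      ∎
    where
    open ≤-Reasoning
    A = Σ< (sq ∘ mid) (suc (suc N′))
    O = Σ< (sq ∘ oddGap) (suc (suc N′))
    X = gapForm c s gap m
    0≤gap : ∀ k → 0ℚ ≤ gap k
    0≤gap k = diff (F-mono k)
    mid-mean-zero : Σ< mid (suc (suc N′)) ≡ 0ℚ
    mid-mean-zero = trans (halve (Σ< mid (suc (suc N′)))) (trans (cong (½ *_) (trans (sym (Σ<-pairs (suc (suc N′)))) (trans (sym (Σ-F id)) mean-zero))) refl)
      where
      halve : ∀ x → x ≡ ½ * (2ℚ * x)
      halve = solve-∀ ringℚ
    ℓA≤X : ℓ * A ≤ X
    ℓA≤X = begin
      ℓ * A                             ≤⟨ path-poincare solution 0<ℓ mid mid-mean-zero ⟩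
      Σ< (λ k → sq (mid (suc k) - mid k)) (suc N′) ≤⟨ from-diff (0≤* (nonNegative⁻¹ ½) (0≤* (≤-trans (<⇒≤ 0<1) (AdmissibleCuts.odd≥1 admissible (suc N′) (ℕ.n<1+n _))) (0≤sq (oddGap (suc N′))))) (drop (Σ< (λ k → sq (mid (suc k) - mid k)) (suc N′)) (½ * (c (double (suc N′)) * sq (oddGap (suc N′))))) ⟩
      Σ< (λ k → sq (mid (suc k) - mid k)) (suc N′) + ½ * (c (double (suc N′)) * sq (oddGap (suc N′))) ≤⟨ gapForm-mid admissible 0≤gap (suc N′) (ℕ.n<1+n _) ⟩
      X                                 ∎
      where
      drop : ∀ a b → a + b - a ≡ b
      drop = solve-∀ ringℚ
    O≤X : O ≤ X
    O≤X = gapForm-odd admissible 0≤gap (suc N′) (ℕ.n<1+n _)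
    identity : ∀ ℓ A O X → (4ℚ + ℓ) * X - 2ℚ * ℓ * (2ℚ * A + ½ * O) ≡ 4ℚ * (X - ℓ * A) + ℓ * (X - O)
    identity = solve-∀ ringℚ

cubic-poincare : ∀ {N′} (G : Graph (double (suc (suc N′)))) → Connected G → Cubic G → ∀ {ℓ} → DirichletSolution ℓ (suc (suc N′)) → 0ℚ < ℓ →
  ∀ f → sum f ≡ 0ℚ → 2ℚ * ℓ * ∥ f ∥² ≤ (4ℚ + ℓ) * form (Laplacian.laplacianℚ G) f f
cubic-poincare G connected cubic solution 0<ℓ f = CubicOrder.poincare G connected cubic f (proj₁ (sort f)) (proj₂ (sort f)) solution 0<ℓ

-- A spectral gap bounds the second eigenvalue from below.

det-neg : ∀ {n} (M : Matrix ℚ n) → detℚ (λ i j → - M i j) ≡ (- 1ℚ) ^ n * detℚ M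
det-neg {zero}  M = refl
det-neg {suc n} M = trans (sum-cong λ j → trans (cong (sgn j * - M zero j *_) (det-neg (minor M j))) (pull (sgn j) (M zero j) ((- 1ℚ) ^ n) (detℚ (minor M j))))
  (sum-*ˡ ((- 1ℚ) ^ suc n) (λ j → sgn j * M zero j * detℚ (minor M j)))
  where
  pull : ∀ s m e d → s * - m * (e * d) ≡ - 1ℚ * e * (s * m * d)
  pull = solve-∀ ringℚ

∣det-neg∣ : ∀ {n} (M : Matrix ℚ n) → ℚ.∣ detℚ (λ i j → - M i j) ∣ ≡ ℚ.∣ detℚ M ∣
∣det-neg∣ {n} M = trans (cong ℚ.∣_∣ (det-neg M)) (trans (∣p*q∣≡∣p∣*∣q∣ ((- 1ℚ) ^ n) (detℚ M)) (trans (cong (_* ℚ.∣ detℚ M ∣) (∣sgn∣≡1 n)) (*-identityˡ ℚ.∣ detℚ M ∣)))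

shift-entry : ∀ {n} (A : Matrix ℚ n) x i j → shift A x i j ≡ x * δ i j - A i j
shift-entry A x i j with does (i Fin.≟ j)
... | true  = cong (_- A i j) (sym (*-identityʳ x))
... | false = cong (_- A i j) (sym (*-zeroʳ x))

module SpectralGap {n} (G : Graph (suc n)) (cubic : Cubic G) {c₀} (0<c₀ : 0ℚ < c₀) (c₀≤n : c₀ ≤ ι (suc n))
  (gap : ∀ f → sum f ≡ 0ℚ → c₀ * ∥ f ∥² ≤ form (Laplacian.laplacianℚ G) f f) where
  open Laplacian G
  open ≤-Reasoning

  L : Matrix ℚ (suc n)
  L = laplacianℚ

  size : ℚ
  size = ι (suc n)

  0<size : 0ℚ < size
  0<size = 0<ι n

  row-sum : ∀ x i → sum (shift L x i) ≡ x
  row-sum x i = begin-equality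
    sum (shift L x i)                   ≡⟨ sum-cong (λ j → trans (shift-entry L x i j) (trans (cong (λ l → x * δ i j - l) (trans (laplacian-δ i j) (cong (λ d → ι d * δ i j - weight i j) (cubic i)))) (regroup x (δ i j) (weight i j)))) ⟩
    sum (λ j → (x - 3ℚ) * (δ i j * 1ℚ) + 1ℚ * weight i j) ≡⟨ sum-linear (x - 3ℚ) 1ℚ (λ j → δ i j * 1ℚ) (weight i) ⟩
    (x - 3ℚ) * sum (λ j → δ i j * 1ℚ) + 1ℚ * sum (weight i) ≡⟨ cong₂ (λ y z → (x - 3ℚ) * y + 1ℚ * z) (sum-δ i (λ _ → 1ℚ)) (weight-sum cubic i) ⟩
    (x - 3ℚ) * 1ℚ + 1ℚ * 3ℚ             ≡⟨ cancel x ⟩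
    x                                   ∎
    where
    regroup : ∀ x d a → x * d - (3ℚ * d - a) ≡ (x - 3ℚ) * (d * 1ℚ) + 1ℚ * a
    regroup = solve-∀ ringℚ
    cancel : ∀ x → (x - 3ℚ) * 1ℚ + 1ℚ * 3ℚ ≡ x
    cancel = solve-∀ ringℚ

  -- L + J - x I with J the all-ones matrix, which lifts the eigenvalue 0 of the constant vector to
  -- n.
  P : ℚ → Matrix ℚ (suc n)
  P x i j = - (shift L x i j - 1ℚ)

  P-symmetric : ∀ x i j → P x i j ≡ P x j i
  P-symmetric x i j = cong (λ z → - (z - 1ℚ)) (trans (shift-entry L x i j) (trans (cong₂ (λ d l → x * d - l) (δ-symmetric i j) (laplacian-symmetric cubic i j)) (sym (shift-entry L x j i))))
    where
    δ-symmetric : ∀ (i j : Fin (suc n)) → δ i j ≡ δ j i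
    δ-symmetric i j with i Fin.≟ j
    ... | yes refl = sym (δ-same i)
    ... | no i≢j   = sym (δ-diff (i≢j ∘ sym))

  form-P : ∀ x v → form (P x) v v ≡ form L v v + sq (sum v) - x * ∥ v ∥²
  form-P x v = begin-equality
    form (P x) v v                      ≡⟨ sum-cong (λ i → cong (v i *_) (row i)) ⟩
    sum (λ i → v i * (Lv i + sum v - x * v i)) ≡⟨ sum-cong (λ i → expand (v i) (Lv i) (sum v) x) ⟩
    sum (λ i → 1ℚ * (v i * Lv i) + 1ℚ * (sum v * v i + - x * (v i * v i))) ≡⟨ sum-linear 1ℚ 1ℚ (λ i → v i * Lv i) (λ i → sum v * v i + - x * (v i * v i)) ⟩
    1ℚ * form L v v + 1ℚ * sum (λ i → sum v * v i + - x * (v i * v i)) ≡⟨ cong (λ z → 1ℚ * form L v v + 1ℚ * z) (sum-linear (sum v) (- x) v (λ i → v i * v i)) ⟩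
    1ℚ * form L v v + 1ℚ * (sum v * sum v + - x * ∥ v ∥²) ≡⟨ tidy (form L v v) (sum v) x ∥ v ∥² ⟩
    form L v v + sq (sum v) - x * ∥ v ∥² ∎
    where
    Lv : Vector ℚ (suc n)
    Lv i = sum λ j → L i j * v j
    expand : ∀ v l s x → v * (l + s - x * v) ≡ 1ℚ * (v * l) + 1ℚ * (s * v + - x * (v * v))
    expand = solve-∀ ringℚ
    tidy : ∀ f s x N → 1ℚ * f + 1ℚ * (s * s + - x * N) ≡ f + s * s - x * N
    tidy = solve-∀ ringℚ
    entry : ∀ i j → P x i j * v j ≡ 1ℚ * (L i j * v j + v j) + - x * (δ i j * v j)
    entry i j = trans (cong (λ z → - (z - 1ℚ) * v j) (shift-entry L x i j)) (distribute x (δ i j) (L i j) (v j))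
      where
      distribute : ∀ x d l v → - (x * d - l - 1ℚ) * v ≡ 1ℚ * (l * v + v) + - x * (d * v)
      distribute = solve-∀ ringℚ
    row : ∀ i → sum (λ j → P x i j * v j) ≡ Lv i + sum v - x * v i
    row i = trans (sum-cong (entry i)) (trans (sum-linear 1ℚ (- x) (λ j → L i j * v j + v j) (λ j → δ i j * v j))
      (trans (cong₂ (λ y z → 1ℚ * y + - x * z) (sum-+ (λ j → L i j * v j) v) (sum-δ i v)) (tidy′ (Lv i) (sum v) x (v i))))
      where
      tidy′ : ∀ l s x v → 1ℚ * (l + s) + - x * v ≡ l + s - x * v
      tidy′ = solve-∀ ringℚ

  -- Split v into its mean μ and a part f of mean zero: the gap applies to f, and on constants J
  -- contributes n ≥ c₀.
  P-definite : ∀ x v → (c₀ - x) * ∥ v ∥² ≤ form (P x) v v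
  P-definite x v = begin
    (c₀ - x) * ∥ v ∥²                   ≡⟨ cong ((c₀ - x) *_) norm-split ⟩
    (c₀ - x) * (∥ f ∥² + size * sq μ)   ≤⟨ from-diff (0≤+ (diff (gap f f-mean)) (0≤* (diff c₀≤n) (0≤* (<⇒≤ 0<size) (0≤sq μ)))) (identity c₀ x ∥ f ∥² size μ (form L f f)) ⟩
    form L f f + sq (size * μ) - x * (∥ f ∥² + size * sq μ) ≡⟨ cong₂ (λ y z → form L f f + sq y - x * z) (sym nμ) (sym norm-split) ⟩
    form L f f + sq (sum v) - x * ∥ v ∥² ≡⟨ cong (λ z → z + sq (sum v) - x * ∥ v ∥²) form-shift ⟩
    form L v v + sq (sum v) - x * ∥ v ∥² ≡⟨ form-P x v ⟨
    form (P x) v v                      ∎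
    where
    μ = recip 0<size * sum v
    nμ : sum v ≡ size * μ
    nμ = trans (sym (*-identityˡ (sum v))) (trans (cong (_* sum v) (sym (recip-inverse 0<size))) (*-assoc size (recip 0<size) (sum v)))
    f : Vector ℚ (suc n)
    f i = v i - μ
    f-mean : sum f ≡ 0ℚ
    f-mean = trans (sum-+ v (λ _ → - μ)) (trans (cong₂ _+_ nμ (sum-const (suc n) (- μ))) (cancel size μ))
      where
      cancel : ∀ n μ → n * μ + n * - μ ≡ 0ℚ
      cancel = solve-∀ ringℚ
    norm-split : ∥ v ∥² ≡ ∥ f ∥² + size * sq μ
    norm-split = begin-equality
      ∥ v ∥²                            ≡⟨ sum-cong (λ i → square (v i) μ) ⟩
      sum (λ i → (f i * f i + sq μ) + 2ℚ * μ * f i) ≡⟨ sum-+ (λ i → f i * f i + sq μ) (λ i → 2ℚ * μ * f i) ⟩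
      sum (λ i → f i * f i + sq μ) + sum (λ i → 2ℚ * μ * f i) ≡⟨ cong₂ _+_ (trans (sum-+ (λ i → f i * f i) (λ _ → sq μ)) (cong (λ z → ∥ f ∥² + z) (sum-const (suc n) (sq μ)))) (trans (sum-*ˡ (2ℚ * μ) f) (trans (cong (2ℚ * μ *_) f-mean) (*-zeroʳ (2ℚ * μ)))) ⟩
      (∥ f ∥² + size * sq μ) + 0ℚ       ≡⟨ +-identityʳ _ ⟩
      ∥ f ∥² + size * sq μ              ∎
      where
      square : ∀ v μ → v * v ≡ ((v - μ) * (v - μ) + μ * μ) + 2ℚ * μ * (v - μ)
      square = solve-∀ ringℚ
    form-shift : form L f f ≡ form L v v
    form-shift = halve (form L f f) (form L v v) (trans (sym (energy-form cubic f)) (trans (sum-cong λ i → sum-cong λ j → cong (λ z → weight i j * sq z) (difference (v i) (v j) μ)) (energy-form cubic v)))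
      where
      difference : ∀ a b μ → (a - μ) - (b - μ) ≡ a - b
      difference = solve-∀ ringℚ
      halve : ∀ x y → 2ℚ * x ≡ 2ℚ * y → x ≡ y
      halve x y eq = trans (half x) (trans (cong (½ *_) eq) (sym (half y)))
        where
        half : ∀ x → x ≡ ½ * (2ℚ * x)
        half = solve-∀ ringℚ
    identity : ∀ c x N n μ F → (F + n * μ * (n * μ) - x * (N + n * (μ * μ))) - (c - x) * (N + n * (μ * μ)) ≡ (F - c * N) + (n - c) * (n * (μ * μ))
    identity = solve-∀ ringℚ

  -- Definiteness keeps det (x I - L - J) away from 0, and `det-minus-ones` passes to det (x I - L).
  -- Below the gap the latter can therefore be small only where x is small.
  det-lower : ∀ {x m} → 0ℚ < m → m ≤ c₀ - x → ℚ.∣ x ∣ * m ^ suc n ≤ ℚ.∣ x - size ∣ * ℚ.∣ detℚ (shift L x) ∣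
  det-lower {x} {m} 0<m m≤ = begin
    ℚ.∣ x ∣ * m ^ suc n                 ≤⟨ *-monoˡ (0≤∣p∣ x) (≤-trans definite (p≤∣p∣ (detℚ (P x)))) ⟩
    ℚ.∣ x ∣ * ℚ.∣ detℚ (P x) ∣          ≡⟨ cong (ℚ.∣ x ∣ *_) (∣det-neg∣ (λ i j → shift L x i j - 1ℚ)) ⟩
    ℚ.∣ x ∣ * ℚ.∣ detℚ (λ i j → shift L x i j - 1ℚ) ∣ ≡⟨ ∣p*q∣≡∣p∣*∣q∣ x (detℚ (λ i j → shift L x i j - 1ℚ)) ⟨
    ℚ.∣ x * detℚ (λ i j → shift L x i j - 1ℚ) ∣ ≡⟨ cong ℚ.∣_∣ (det-minus-ones (shift L x) (row-sum x)) ⟩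
    ℚ.∣ (x - size) * detℚ (shift L x) ∣ ≡⟨ ∣p*q∣≡∣p∣*∣q∣ (x - size) (detℚ (shift L x)) ⟩
    ℚ.∣ x - size ∣ * ℚ.∣ detℚ (shift L x) ∣ ∎
    where
    definite : m ^ suc n ≤ detℚ (P x)
    definite = det-definite (suc n) (P x) (P-symmetric x) 0<m
      (λ v → ≤-trans (*-monoʳ-≤-nonNeg ∥ v ∥² {{nonNegative (0≤∥∥² v)}} m≤) (P-definite x v))

product-zero : ∀ {n} (f : Vector ℚ n) i → f i ≡ 0ℚ → product f ≡ 0ℚ
product-zero f zero    eq = trans (cong (_* product (f ∘ suc)) eq) (*-zeroˡ (product (f ∘ suc)))
product-zero f (suc i) eq = trans (cong (f zero *_) (product-zero (f ∘ suc) i eq)) (*-zeroʳ (f zero))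

product-bounded : ∀ {n} (ev : Vector ℝ n) X → 0ℚ ≤ X → ∃ λ R → 0ℚ ≤ R × ∃ λ N → ∀ k → N ℕ.≤ k → ∀ y → ℚ.∣ y ∣ ≤ X →
  ℚ.∣ product (λ i → y - seq (ev i) k) ∣ ≤ R
product-bounded {zero}  ev X 0≤X = 1ℚ , <⇒≤ 0<1 , 0 , λ _ _ _ _ → ≤-refl
product-bounded {suc n} ev X 0≤X =
  let B , 0≤B , M , e≤B    = eventually-bounded (ev zero)
      R , 0≤R , N , rest≤R = product-bounded (ev ∘ suc) X 0≤X
  in (X + B) * R , 0≤* {X + B} {R} (0≤+ 0≤X 0≤B) 0≤R , M ℕ.⊔ N , λ k ≤k y y≤X →
    abs*-≤ {y - seq (ev zero) k} {product (λ i → y - seq (ev (suc i)) k)} {X + B} {R}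
      (abs+-≤ {y} { - seq (ev zero) k} {X} {B} y≤X (≤-trans (≤-reflexive (∣-p∣≡∣p∣ (seq (ev zero) k))) (e≤B k (ℕ.≤-trans (ℕ.m≤m⊔n M N) ≤k))))
      (rest≤R k (ℕ.≤-trans (ℕ.m≤n⊔m M N) ≤k) y y≤X)

module RootAnalysis {n} (ev : Vector ℝ (suc (suc n))) {c₀ size : ℚ} (p : ℕ) (0<c₀ : 0ℚ < c₀) (0<size : 0ℚ < size) (c₀≤n : c₀ ≤ size)
  (D : ℚ → ℚ)
  (roots : ∀ (X : ℝ) ε → 0ℚ < ε → ∃ λ N → ∀ k → N ℕ.≤ k → ℚ.∣ D (seq X k) - product (λ i → seq X k - seq (ev i) k) ∣ ≤ ε)
  (det-lower : ∀ {x m} → 0ℚ < m → m ≤ c₀ - x → ℚ.∣ x ∣ * m ^ p ≤ ℚ.∣ x - size ∣ * ℚ.∣ D x ∣)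
  (increasing : ev zero ≤ᴿ ev (suc zero)) where
  open ≤-Reasoning

  e : Fin (suc (suc n)) → ℕ → ℚ
  e i k = seq (ev i) k

  Below : ℚ → Fin (suc (suc n)) → Set
  Below m i = ∃ λ N → ∀ k → N ℕ.≤ k → m ≤ c₀ - e i k

  -- At x = e i k the product of the root factors is exactly 0, so `D x` is eventually below any
  -- given bound, and `det-lower` then forces x to be small.
  below⇒zero : ∀ {m} → 0ℚ < m → ∀ i → Below m i → ∀ η → 0ℚ < η → ∃ λ N → ∀ k → N ℕ.≤ k → ℚ.∣ e i k ∣ ≤ η
  below⇒zero {m} 0<m i (M , below) η 0<η = N , bound
    where
    X = proj₁ (eventually-bounded (ev i))
    0≤X = proj₁ (proj₂ (eventually-bounded (ev i)))
    bounded = proj₂ (proj₂ (proj₂ (eventually-bounded (ev i))))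
    B = X + size
    0<B : 0ℚ < B
    0<B = +-mono-≤-< 0≤X 0<size
    K = m ^ p
    0<K = ^-pos 0<m p
    ε = η * K * recip 0<B
    0<ε : 0ℚ < ε
    0<ε = 0<* (0<* 0<η 0<K) (recip-pos 0<B)
    Nb = proj₁ (proj₂ (proj₂ (eventually-bounded (ev i))))
    close = roots (ev i) ε 0<ε
    N = M ℕ.⊔ (Nb ℕ.⊔ proj₁ close)
    bound : ∀ k → N ℕ.≤ k → ℚ.∣ e i k ∣ ≤ η
    bound k N≤k = *-cancelˡ 0<K (begin
      K * ℚ.∣ x ∣                       ≡⟨ *-comm K ℚ.∣ x ∣ ⟩
      ℚ.∣ x ∣ * K                       ≤⟨ det-lower 0<m (below k (ℕ.≤-trans (ℕ.m≤m⊔n M _) N≤k)) ⟩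
      ℚ.∣ x - size ∣ * ℚ.∣ D x ∣        ≤⟨ *-mono-≤ (0≤∣p∣ (D x)) (<⇒≤ 0<B) (abs+-≤ (bounded k (ℕ.≤-trans (ℕ.m≤m⊔n Nb _) N₂≤k)) (≤-reflexive (trans (∣-p∣≡∣p∣ size) (0≤p⇒∣p∣≡p (<⇒≤ 0<size)))))
                                             (subst (λ z → ℚ.∣ z ∣ ≤ ε) (trans (cong (λ z → D x - z) product≡0) (minus-zero (D x))) (proj₂ close k (ℕ.≤-trans (ℕ.m≤n⊔m Nb _) N₂≤k))) ⟩
      B * ε                             ≡⟨ regroup B (η * K) (recip 0<B) ⟩
      η * K * (B * recip 0<B)           ≡⟨ cong (η * K *_) (recip-inverse 0<B) ⟩
      η * K * 1ℚ                        ≡⟨ tidy η K ⟩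
      K * η                             ∎)
      where
      x = e i k
      N₂≤k = ℕ.≤-trans (ℕ.m≤n⊔m M _) N≤k
      product≡0 : product (λ j → x - e j k) ≡ 0ℚ
      product≡0 = product-zero (λ j → x - e j k) i (+-inverseʳ x)
      minus-zero : ∀ d → d - 0ℚ ≡ d
      minus-zero = solve-∀ ringℚ
      regroup : ∀ b a r → b * (a * r) ≡ a * (b * r)
      regroup = solve-∀ ringℚ
      tidy : ∀ a b → a * b * 1ℚ ≡ b * a
      tidy = solve-∀ ringℚ

  below-both : ∀ a b → 0ℚ < a → 0ℚ < b → ∃ λ x → 0ℚ < x × x ≤ a × x ≤ b
  below-both a b 0<a 0<b with ≤-total a b
  ... | inj₁ a≤b = a , 0<a , ≤-refl , a≤b
  ... | inj₂ b≤a = b , 0<b , b≤a , ≤-refl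

  0<½c₀ : 0ℚ < ½ * c₀
  0<½c₀ = 0<* {½} {c₀} (positive⁻¹ ½) 0<c₀

  -- If two eigenvalues were 0, then x det (xI − L − J) = (x − n) det (xI − L) would vanish to second order at x = 0.
  no-double-zero : ∀ (x R ε K : ℚ) k → 0ℚ < x → x ≤ ½ * c₀ → 0ℚ ≤ R → 0ℚ < K → K ≤ (½ * c₀) ^ p →
    ι 32 * size * (R + 1ℚ) * x ≤ K → 4ℚ * size * ε ≤ x * K → ℚ.∣ e zero k ∣ ≤ x → ℚ.∣ e (suc zero) k ∣ ≤ x →
    ℚ.∣ product (λ i → x - e (suc (suc i)) k) ∣ ≤ R → ℚ.∣ D x - product (λ i → x - e i k) ∣ ≤ ε → ⊥
  no-double-zero x R ε K k 0<x x≤c 0≤R 0<K K≤ Wx≤K 4sizeε e₀≤x e₁≤x rest≤R close = ≤-≮ impossible (0<* {x} {K} 0<x 0<K)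
    where
    ∣x∣≡x : ℚ.∣ x ∣ ≡ x
    ∣x∣≡x = 0≤p⇒∣p∣≡p (<⇒≤ 0<x)
    small : ∀ a → ℚ.∣ a ∣ ≤ x → ℚ.∣ x - a ∣ ≤ 2ℚ * x
    small a a≤x = ≤-trans (abs+-≤ {x} { - a} (≤-reflexive ∣x∣≡x) (≤-trans (≤-reflexive (∣-p∣≡∣p∣ a)) a≤x)) (≤-reflexive (twice x))
      where
      twice : ∀ x → x + x ≡ 2ℚ * x
      twice = solve-∀ ringℚ
    Π₂ Π : ℚ
    Π₂ = product (λ i → x - e (suc (suc i)) k)
    Π  = (x - e zero k) * ((x - e (suc zero) k) * Π₂)
    Π≤ : ℚ.∣ Π ∣ ≤ 2ℚ * x * (2ℚ * x * R)
    Π≤ = abs*-≤ {x - e zero k} {(x - e (suc zero) k) * Π₂} {2ℚ * x} {2ℚ * x * R} (small (e zero k) e₀≤x)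
      (abs*-≤ {x - e (suc zero) k} {Π₂} {2ℚ * x} {R} (small (e (suc zero) k) e₁≤x) rest≤R)
    bound : ∀ d p {q} → ℚ.∣ d - p ∣ ≤ ε → ℚ.∣ p ∣ ≤ q → ℚ.∣ d ∣ ≤ ε + q
    bound d p d~p p≤q = ≤-trans (≤-reflexive (cong ℚ.∣_∣ (split d p))) (abs+-≤ {d - p} {p} d~p p≤q)
      where
      split : ∀ d p → d ≡ d - p + p
      split = solve-∀ ringℚ
    D≤ : ℚ.∣ D x ∣ ≤ ε + 2ℚ * x * (2ℚ * x * R)
    D≤ = bound (D x) Π close Π≤
    x≤size : x ≤ size
    x≤size = ≤-trans x≤c (≤-trans (from-diff {½ * c₀} {c₀} (<⇒≤ 0<½c₀) (halves c₀)) c₀≤n)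
      where
      halves : ∀ c → c - ½ * c ≡ ½ * c
      halves = solve-∀ ringℚ
    near : ∀ s → x ≤ s → 0ℚ < s → ℚ.∣ x - s ∣ ≤ s
    near s x≤s 0<s = abs-≤ (from-diff (0≤+ (diff x≤s) (<⇒≤ 0<s)) (upper x s)) (from-diff (<⇒≤ 0<x) (lower x s))
      where
      upper : ∀ x s → s - (x - s) ≡ s - x + s
      upper = solve-∀ ringℚ
      lower : ∀ x s → x - s - - s ≡ x
      lower = solve-∀ ringℚ
    main : x * K ≤ size * (ε + 2ℚ * x * (2ℚ * x * R))
    main = begin
      x * K                             ≤⟨ *-monoˡ (<⇒≤ 0<x) K≤ ⟩
      x * (½ * c₀) ^ p        ≡⟨ cong (_* (½ * c₀) ^ p) ∣x∣≡x ⟨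
      ℚ.∣ x ∣ * (½ * c₀) ^ p  ≤⟨ det-lower 0<½c₀ (from-diff (diff x≤c) (halves c₀ x)) ⟩
      ℚ.∣ x - size ∣ * ℚ.∣ D x ∣        ≤⟨ *-mono-≤ (0≤∣p∣ (D x)) (<⇒≤ 0<size) (near size x≤size 0<size) D≤ ⟩
      size * (ε + 2ℚ * x * (2ℚ * x * R)) ∎
      where
      halves : ∀ c x → c - x - ½ * c ≡ ½ * c - x
      halves = solve-∀ ringℚ
    -- 4 x K ≤ 4 n (ε + 4 x² R) ≤ x K + x K / 2
    bound-xK : ∀ s → 0ℚ < s → ι 32 * s * (R + 1ℚ) * x ≤ K → 4ℚ * s * ε ≤ x * K → x * K ≤ s * (ε + 2ℚ * x * (2ℚ * x * R)) → x * K ≤ 0ℚ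
    bound-xK s 0<s Wx≤K 4sε main = *-cancelˡ {x * K} {0ℚ} {½ * ι 5} (positive⁻¹ (½ * ι 5)) (from-diff (0≤+ (0≤+ (0≤+ (0≤* (0≤ι 4) (diff main)) (0≤* {½} (nonNegative⁻¹ ½) (0≤* (<⇒≤ 0<x) (diff Wx≤K))))
        (0≤* (0≤ι 16) (0≤* (<⇒≤ 0<s) (0≤sq x)))) (diff 4sε))
      (identity x K s ε R))
      where
      identity : ∀ x K s ε R → ½ * ι 5 * 0ℚ - ½ * ι 5 * (x * K) ≡
        4ℚ * (s * (ε + 2ℚ * x * (2ℚ * x * R)) - x * K) + ½ * (x * (K - ι 32 * s * (R + 1ℚ) * x)) + ι 16 * (s * (x * x)) + (x * K - 4ℚ * s * ε)
      identity = solve-∀ ringℚ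
    impossible : x * K ≤ 0ℚ
    impossible = bound-xK size 0<size Wx≤K 4sizeε main

  not-both-below : ∀ {m} → 0ℚ < m → Below m zero → Below m (suc zero) → ⊥
  not-both-below {m} 0<m below₀ below₁ =
    let R , 0≤R , N₂ , rest≤R  = product-bounded (λ i → ev (suc (suc i))) (½ * c₀) (<⇒≤ 0<½c₀)
        -- x ≤ K / W makes the second-order term small against x K, and the tolerance x K / V does
        -- the same for the error at the root.
        x , 0<x , x≤c , x≤K/W  = below-both (½ * c₀) (K * recip (0<W 0≤R)) 0<½c₀ (0<* {K} {recip (0<W 0≤R)} 0<K (recip-pos (0<W 0≤R)))
        0<ε                    = 0<* {x * K} {recip 0<V} (0<* {x} {K} 0<x 0<K) (recip-pos 0<V)
        N₃ , close             = roots (fromℚ x) (x * K * recip 0<V) 0<ε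
        N₀ , zero₀             = below⇒zero 0<m zero below₀ x 0<x
        N₁ , zero₁             = below⇒zero 0<m (suc zero) below₁ x 0<x
        k                      = N₀ ℕ.⊔ (N₁ ℕ.⊔ (N₂ ℕ.⊔ N₃))
        k₁                     = ℕ.m≤n⊔m N₀ (N₁ ℕ.⊔ (N₂ ℕ.⊔ N₃))
        k₂                     = ℕ.≤-trans (ℕ.m≤n⊔m N₁ (N₂ ℕ.⊔ N₃)) k₁
    in no-double-zero x R (x * K * recip 0<V) K k 0<x x≤c 0≤R 0<K ≤-refl
         (clear (ι 32 * size * (R + 1ℚ)) x K (0<W 0≤R) x≤K/W)
         (≤-reflexive (scale V (x * K) 0<V))
         (zero₀ k (ℕ.m≤m⊔n N₀ (N₁ ℕ.⊔ (N₂ ℕ.⊔ N₃)))) (zero₁ k (ℕ.≤-trans (ℕ.m≤m⊔n N₁ (N₂ ℕ.⊔ N₃)) k₁))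
         (rest≤R k (ℕ.≤-trans (ℕ.m≤m⊔n N₂ N₃) k₂) x (≤-trans (≤-reflexive (0≤p⇒∣p∣≡p (<⇒≤ 0<x))) x≤c))
         (close k (ℕ.≤-trans (ℕ.m≤n⊔m N₂ N₃) k₂))
    where
    K V : ℚ
    K = (½ * c₀) ^ p
    V = 4ℚ * size
    0<K : 0ℚ < K
    0<K = ^-pos 0<½c₀ p
    0<V : 0ℚ < V
    0<V = 0<* {4ℚ} {size} (0<ι 3) 0<size
    0<W : ∀ {R} → 0ℚ ≤ R → 0ℚ < ι 32 * size * (R + 1ℚ)
    0<W {R} 0≤R = 0<* {ι 32 * size} {R + 1ℚ} (0<* {ι 32} {size} (0<ι 31) 0<size) (+-mono-≤-< 0≤R 0<1)
    scale : ∀ V y (0<V : 0ℚ < V) → V * (y * recip 0<V) ≡ y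
    scale V y 0<V = trans (regroup V y (recip 0<V)) (trans (cong (y *_) (recip-inverse 0<V)) (*-identityʳ y))
      where
      regroup : ∀ a b r → a * (b * r) ≡ b * (a * r)
      regroup = solve-∀ ringℚ
    clear : ∀ W x K (0<W : 0ℚ < W) → x ≤ K * recip 0<W → W * x ≤ K
    clear W x K 0<W x≤ = ≤-trans (*-monoˡ (<⇒≤ 0<W) x≤) (≤-reflexive (scale W K 0<W))

  -- Reals cannot be compared, but with the slack ε it is enough to compare c₀ with one rational
  -- approximation. If that fails, the eigenvalue stays below c₀ by a fixed amount, and so does the
  -- first one by monotonicity.
  second-root-lower : fromℚ c₀ ≤ᴿ ev (suc zero)
  second-root-lower ε 0<ε = decide (c₀ ≤? e (suc zero) N₀ + ½ * ε)
    where
    η = ½ * ½ * ε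
    0<η : 0ℚ < η
    0<η = 0<* {½ * ½} (positive⁻¹ (½ * ½)) 0<ε
    N₀ = proj₁ (cauchy (ev (suc zero)) η 0<η)
    near = proj₂ (cauchy (ev (suc zero)) η 0<η)
    decide : Dec (c₀ ≤ e (suc zero) N₀ + ½ * ε) → ∃ λ N → ∀ k → N ℕ.≤ k → c₀ ≤ e (suc zero) k + ε
    decide (yes c₀≤) = N₀ , λ k N₀≤k → from-diff (0≤+ (0≤+ (diff c₀≤) (diff (≤-trans (neg-antimono-≤ (near k N₀ N₀≤k ℕ.≤-refl)) (-∣p∣≤p (e (suc zero) k - e (suc zero) N₀))))) (<⇒≤ 0<η))
      (identity c₀ (e (suc zero) N₀) (e (suc zero) k) ε)
      where
      identity : ∀ c a b ε → b + ε - c ≡ (a + ½ * ε - c) + (b - a - - (½ * ½ * ε)) + ½ * ½ * ε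
      identity = solve-∀ ringℚ
    decide (no c₀≰) = ⊥-elim (not-both-below {½ * η} 0<½η
        (N₀ ℕ.⊔ proj₁ ordered , λ k ≤k → below₀ k (ℕ.≤-trans (ℕ.m≤m⊔n N₀ _) ≤k) (ℕ.≤-trans (ℕ.m≤n⊔m N₀ _) ≤k))
        (N₀ , λ k N₀≤k → ≤-trans (from-diff (<⇒≤ 0<½η) (halves η)) (below₁ k N₀≤k)))
      where
      0<½η = 0<* {½} {η} (positive⁻¹ ½) 0<η
      halves : ∀ η → η - ½ * η ≡ ½ * η
      halves = solve-∀ ringℚ
      ordered = increasing (½ * η) 0<½η
      below₁ : ∀ k → N₀ ℕ.≤ k → η ≤ c₀ - e (suc zero) k
      below₁ k N₀≤k = from-diff (0≤+ (diff (<⇒≤ (≰⇒> c₀≰))) (diff (≤-trans (p≤∣p∣ (e (suc zero) k - e (suc zero) N₀)) (near k N₀ N₀≤k ℕ.≤-refl))))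
        (identity c₀ (e (suc zero) N₀) (e (suc zero) k) ε)
        where
        identity : ∀ c a b ε → c - b - ½ * ½ * ε ≡ (c - (a + ½ * ε)) + (½ * ½ * ε - (b - a))
        identity = solve-∀ ringℚ
      below₀ : ∀ k → N₀ ℕ.≤ k → proj₁ ordered ℕ.≤ k → ½ * η ≤ c₀ - e zero k
      below₀ k N₀≤k ≤k = from-diff (0≤+ (diff (below₁ k N₀≤k)) (diff (proj₂ ordered k ≤k))) (identity c₀ (e zero k) (e (suc zero) k) η)
        where
        identity : ∀ c a b η → c - a - ½ * η ≡ (c - b - η) + (b + ½ * η - a)
        identity = solve-∀ ringℚ

second-eigenvalue-lower : ∀ {n} (G : Graph (suc (suc n))) → Cubic G → ∀ {c₀} → 0ℚ < c₀ → c₀ ≤ ι (suc (suc n)) →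
  (∀ (f : Vector ℚ (suc (suc n))) → sum f ≡ 0ℚ → c₀ * ∥ f ∥² ≤ form (Laplacian.laplacianℚ G) f f) →
  (ev : Vector ℝ (suc (suc n))) → IsSpectrum (λ i j → fromℤ (laplacian G i j)) ev → fromℚ c₀ ≤ᴿ ev (suc zero)
second-eigenvalue-lower {n} G cubic {c₀} 0<c₀ c₀≤n gap ev spectrum =
  RootAnalysis.second-root-lower ev (suc (suc n)) 0<c₀ (0<ι (suc n)) c₀≤n (λ x → detℚ (shift (Laplacian.laplacianℚ G) x)) roots
    (SpectralGap.det-lower G cubic 0<c₀ c₀≤n gap) (proj₁ spectrum zero (suc zero) z≤n)
  where
  roots : ∀ (X : ℝ) ε → 0ℚ < ε → ∃ λ N → ∀ k → N ℕ.≤ k →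
    ℚ.∣ detℚ (shift (Laplacian.laplacianℚ G) (seq X k)) - product (λ i → seq X k - seq (ev i) k) ∣ ≤ ε
  roots X ε 0<ε = proj₁ (proj₂ spectrum X ε 0<ε) , λ k N≤k → subst (_≤ ε)
    (cong ℚ.∣_∣ (cong₂ _-_ (seq-charPoly (λ i j → fromℤ (laplacian G i j)) X k) (seq-product (λ i → X +ᴿ -ᴿ ev i) k)))
    (proj₂ (proj₂ spectrum X ε 0<ε) k N≤k)

-- Inserting a diamond (K₄ minus an edge) into an edge of a cubic graph.

δℕ : ∀ {n} → Fin n → Fin n → ℕ
δℕ i j = bit (does (i Fin.≟ j))

sum-δℕ : ∀ {n} (i : Fin n) (f : Vector ℕ n) → ℕΣ.sum (λ j → δℕ i j ℕ.* f j) ≡ f i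
sum-δℕ {suc n} zero f = trans (cong₂ ℕ._+_ (ℕ.*-identityˡ (f zero)) (ℕΣ.sum-replicate-zero n)) (ℕ.+-identityʳ (f zero))
sum-δℕ (suc i) f = sum-δℕ i (f ∘ suc)

ι-δℕ : ∀ {n} (i j : Fin n) → ι (δℕ i j) ≡ δ i j
ι-δℕ i j with does (i Fin.≟ j)
... | true  = refl
... | false = refl

record Bridged (n : ℕ) : Set where
  field
    graph     : Graph n
    connected : Connected graph
    cubic     : Cubic graph
    u v       : Fin n
    edge      : Graph.adjacent graph u v ≡ true

module Insertion {n} (B : Bridged n) where
  open Bridged B
  open Graph graph using (adjacent; symmetric; loopless; degree)
  open Data.Bool using (_∧_; _∨_)

  u≢v : u ≢ v
  u≢v u≡v with trans (sym edge) (trans (cong (λ w → adjacent w v) u≡v) (loopless v))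
  ... | ()

  removed : Fin n → Fin n → Bool
  removed i j = (does (u Fin.≟ i) ∧ does (v Fin.≟ j)) ∨ (does (v Fin.≟ i) ∧ does (u Fin.≟ j))

  kept : Fin n → Fin n → Bool
  kept i j = adjacent i j ∧ not (removed i j)

  removed-symmetric : ∀ i j → removed i j ≡ removed j i
  removed-symmetric i j = trans (∨-comm (does (u Fin.≟ i) ∧ does (v Fin.≟ j)) (does (v Fin.≟ i) ∧ does (u Fin.≟ j)))
    (cong₂ _∨_ (∧-comm (does (v Fin.≟ i)) (does (u Fin.≟ j))) (∧-comm (does (u Fin.≟ i)) (does (v Fin.≟ j))))
    where open import Data.Bool.Properties using (∧-comm; ∨-comm)

  bit-keep : ∀ b → bit b ≡ bit (b ∧ true) ℕ.+ 0
  bit-keep true  = refl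
  bit-keep false = refl

  split-adjacent : ∀ i j → bit (adjacent i j) ≡ bit (kept i j) ℕ.+ (δℕ u i ℕ.* δℕ v j ℕ.+ δℕ v i ℕ.* δℕ u j)
  split-adjacent i j with u Fin.≟ i | v Fin.≟ j | v Fin.≟ i | u Fin.≟ j
  ... | yes u≡i | _        | yes v≡i | _       = contradiction (trans u≡i (sym v≡i)) u≢v
  ... | _       | yes v≡j  | _       | yes u≡j = contradiction (trans u≡j (sym v≡j)) u≢v
  ... | yes refl | yes refl | no _    | no _     rewrite edge = refl
  ... | no _    | no _     | yes refl | yes refl rewrite trans (symmetric v u) edge = refl
  ... | yes _   | no _     | no _    | yes _   = bit-keep (adjacent i j)
  ... | yes _   | no _     | no _    | no _    = bit-keep (adjacent i j)
  ... | no _    | yes _    | yes _   | no _    = bit-keep (adjacent i j)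
  ... | no _    | yes _    | no _    | no _    = bit-keep (adjacent i j)
  ... | no _    | no _     | yes _   | no _    = bit-keep (adjacent i j)
  ... | no _    | no _     | no _    | yes _   = bit-keep (adjacent i j)
  ... | no _    | no _     | no _    | no _    = bit-keep (adjacent i j)

  pattern A   = zero
  pattern B′  = suc zero
  pattern C   = suc (suc zero)
  pattern D   = suc (suc (suc zero))
  pattern old i = suc (suc (suc (suc i)))

  -- The path u – v becomes u – A – {B, C} – D – v.
  adjacent′ : Fin (4 ℕ.+ n) → Fin (4 ℕ.+ n) → Bool
  adjacent′ A A = false
  adjacent′ A B′ = true
  adjacent′ A C = true
  adjacent′ A D = false
  adjacent′ A (old j) = does (u Fin.≟ j)
  adjacent′ B′ A = true
  adjacent′ B′ B′ = false
  adjacent′ B′ C = true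
  adjacent′ B′ D = true
  adjacent′ B′ (old j) = false
  adjacent′ C A = true
  adjacent′ C B′ = true
  adjacent′ C C = false
  adjacent′ C D = true
  adjacent′ C (old j) = false
  adjacent′ D A = false
  adjacent′ D B′ = true
  adjacent′ D C = true
  adjacent′ D D = false
  adjacent′ D (old j) = does (v Fin.≟ j)
  adjacent′ (old i) A = does (u Fin.≟ i)
  adjacent′ (old i) B′ = false
  adjacent′ (old i) C = false
  adjacent′ (old i) D = does (v Fin.≟ i)
  adjacent′ (old i) (old j) = kept i j

  symmetric′ : ∀ i j → adjacent′ i j ≡ adjacent′ j i
  symmetric′ A A = refl
  symmetric′ A B′ = refl
  symmetric′ A C = refl
  symmetric′ A D = refl
  symmetric′ A (old j) = refl
  symmetric′ B′ A = refl
  symmetric′ B′ B′ = refl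
  symmetric′ B′ C = refl
  symmetric′ B′ D = refl
  symmetric′ B′ (old j) = refl
  symmetric′ C A = refl
  symmetric′ C B′ = refl
  symmetric′ C C = refl
  symmetric′ C D = refl
  symmetric′ C (old j) = refl
  symmetric′ D A = refl
  symmetric′ D B′ = refl
  symmetric′ D C = refl
  symmetric′ D D = refl
  symmetric′ D (old j) = refl
  symmetric′ (old i) A = refl
  symmetric′ (old i) B′ = refl
  symmetric′ (old i) C = refl
  symmetric′ (old i) D = refl
  symmetric′ (old i) (old j) = cong₂ (λ x y → x ∧ not y) (symmetric i j) (removed-symmetric i j)

  loopless′ : ∀ i → adjacent′ i i ≡ false
  loopless′ A = refl
  loopless′ B′ = refl
  loopless′ C = refl
  loopless′ D = refl
  loopless′ (old i) = cong (_∧ not (removed i i)) (loopless i)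

  graph′ : Graph (4 ℕ.+ n)
  graph′ = record { adjacent = adjacent′ ; symmetric = symmetric′ ; loopless = loopless′ }

  sum-point : ∀ (w : Fin n) → ℕΣ.sum (δℕ w) ≡ 1
  sum-point w = trans (ℕΣ.sum-cong-≗ λ j → sym (ℕ.*-identityʳ (δℕ w j))) (sum-δℕ w (λ _ → 1))

  cubic′ : Cubic graph′
  cubic′ i = trans (∣tabulate∣ (adjacent′ i)) (degree′ i)
    where
    degree′ : ∀ i → ℕΣ.sum (λ j → bit (adjacent′ i j)) ≡ 3
    degree′ A = cong (2 ℕ.+_) (sum-point u)
    degree′ B′ = cong (3 ℕ.+_) (ℕΣ.sum-replicate-zero n)
    degree′ C = cong (3 ℕ.+_) (ℕΣ.sum-replicate-zero n)
    degree′ D = cong (2 ℕ.+_) (sum-point v)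
    degree′ (old i) = begin
      δℕ u i ℕ.+ (δℕ v i ℕ.+ S)               ≡⟨ regroup (δℕ u i) (δℕ v i) S ⟩
      S ℕ.+ (δℕ u i ℕ.* 1 ℕ.+ δℕ v i ℕ.* 1)   ≡⟨ cong (S ℕ.+_) (cong₂ (λ x y → δℕ u i ℕ.* x ℕ.+ δℕ v i ℕ.* y) (sum-point v) (sum-point u)) ⟨
      S ℕ.+ (δℕ u i ℕ.* ℕΣ.sum (δℕ v) ℕ.+ δℕ v i ℕ.* ℕΣ.sum (δℕ u)) ≡⟨ cong (S ℕ.+_) (trans (cong₂ ℕ._+_ (ℕΣ.*-distribˡ-sum (δℕ u i) (δℕ v)) (ℕΣ.*-distribˡ-sum (δℕ v i) (δℕ u))) (sym (ℕΣ.∑-distrib-+ (λ j → δℕ u i ℕ.* δℕ v j) (λ j → δℕ v i ℕ.* δℕ u j)))) ⟩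
      S ℕ.+ ℕΣ.sum (λ j → δℕ u i ℕ.* δℕ v j ℕ.+ δℕ v i ℕ.* δℕ u j) ≡⟨ trans (ℕΣ.sum-cong-≗ (split-adjacent i)) (ℕΣ.∑-distrib-+ (λ j → bit (kept i j)) (λ j → δℕ u i ℕ.* δℕ v j ℕ.+ δℕ v i ℕ.* δℕ u j)) ⟨
      ℕΣ.sum (λ j → bit (adjacent i j))       ≡⟨ ∣tabulate∣ (adjacent i) ⟨
      degree i                                ≡⟨ cubic i ⟩
      3                                       ∎
      where
      open ≡-Reasoning
      S = ℕΣ.sum (λ j → bit (kept i j))
      regroup : ∀ a b s → a ℕ.+ (b ℕ.+ s) ≡ s ℕ.+ (a ℕ.* 1 ℕ.+ b ℕ.* 1)
      regroup = solve-ℕ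

  Edge′ : Fin (4 ℕ.+ n) → Fin (4 ℕ.+ n) → Set
  Edge′ i j = Bool.T (adjacent′ i j)

  T-true : ∀ {b} → b ≡ true → Bool.T b
  T-true refl = tt

  reverse-edge : ∀ {i j} → Edge′ i j → Edge′ j i
  reverse-edge {i} {j} = subst Bool.T (symmetric′ i j)

  A–u : Edge′ A (old u)
  A–u = T-true (dec-true (u Fin.≟ u) refl)

  D–v : Edge′ D (old v)
  D–v = T-true (dec-true (v Fin.≟ v) refl)

  hop : ∀ i j {k} → Edge′ i j → Star Edge′ j k → Star Edge′ i k
  hop i j ij rest = ij ◅ rest

  detour : Star Edge′ (old u) (old v)
  detour = hop (old u) A A–u (hop A B′ tt (hop B′ D tt (hop D (old v) D–v Star.ε)))

  lift-edge : ∀ {i j} → Bool.T (adjacent i j) → Star Edge′ (old i) (old j)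
  lift-edge {i} {j} ij with u Fin.≟ i | v Fin.≟ j | v Fin.≟ i | u Fin.≟ j | direct {i} {j} ij
    where
    direct : ∀ {i j} → Bool.T (adjacent i j) → removed i j ≡ false → Star Edge′ (old i) (old j)
    direct {i} {j} ij kept = T-true (cong₂ (λ x y → x ∧ not y) (T⇒true ij) kept) ◅ Star.ε
      where
      T⇒true : ∀ {b} → Bool.T b → b ≡ true
      T⇒true {true} _ = refl
  ... | yes refl | yes refl | _ | _ | _ = detour
  ... | _ | _ | yes refl | yes refl | _ = Star.reverse (λ {i} {j} → reverse-edge {i} {j}) detour
  ... | yes _ | no _ | no _  | _     | go = go refl
  ... | yes _ | no _ | yes _ | no _  | go = go refl
  ... | no _  | _    | no _  | _     | go = go refl
  ... | no _  | _    | yes _ | no _  | go = go refl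

  lift : ∀ {i j} → Star (λ i j → Bool.T (adjacent i j)) i j → Star Edge′ (old i) (old j)
  lift Star.ε      = Star.ε
  lift (ij ◅ rest) = lift-edge ij ◅◅ lift rest

  to-u : ∀ i → Star Edge′ i (old u)
  to-u A = hop A (old u) A–u Star.ε
  to-u B′ = hop B′ A tt (to-u A)
  to-u C = hop C A tt (to-u A)
  to-u D = hop D B′ tt (hop B′ A tt (hop A (old u) A–u Star.ε))
  to-u (old i) = lift (connected i u)

  connected′ : Connected graph′
  connected′ i j = to-u i ◅◅ Star.reverse (λ {i} {j} → reverse-edge {i} {j}) (to-u j)

  -- Marking the edge from D to v puts the next diamond between this one and the end containing v,
  -- so that repeated insertion yields a chain.
  bridged : Bridged (4 ℕ.+ n)
  bridged = record { graph = graph′ ; connected = connected′ ; cubic = cubic′ ; u = D ; v = old v ; edge = dec-true (v Fin.≟ v) refl }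

module InsertionEnergy {n} (B : Bridged n) where
  open Bridged B
  open Insertion B
  open ≡-Reasoning

  -- With the mean of a and d on both middle vertices, four edges of difference (a - d) / 2 cost (a
  -- - d)² together, as much as a single edge, and the edge between B and C costs nothing.
  diamond : ℚ → ℚ → Vector ℚ n → Vector ℚ (4 ℕ.+ n)
  diamond a d f A       = a
  diamond a d f B′      = ½ * (a + d)
  diamond a d f C       = ½ * (a + d)
  diamond a d f D       = d
  diamond a d f (old i) = f i

  sum-point-weight : ∀ w (g : Vector ℚ n) → sum (λ j → ι (δℕ w j) * g j) ≡ g w
  sum-point-weight w g = trans (sum-cong λ j → cong (_* g j) (ι-δℕ w j)) (sum-δ w g)

  energy-diamond : ∀ a d f → Laplacian.energy graph′ (diamond a d f) ≡
    Laplacian.energy graph f + 2ℚ * (sq (a - d) + sq (a - f u) + sq (d - f v) - sq (f u - f v))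
  energy-diamond a d f = begin
    Laplacian.energy graph′ (diamond a d f)
      ≡⟨ cong₂ _+_ (cong (λ z → 0ℚ * sq (a - a) + (1ℚ * sq (a - m) + (1ℚ * sq (a - m) + (0ℚ * sq (a - d) + z)))) (sum-point-weight u (λ j → sq (a - f j))))
        (cong₂ _+_ (cong (λ z → 1ℚ * sq (m - a) + (0ℚ * sq (m - m) + (1ℚ * sq (m - m) + (1ℚ * sq (m - d) + z)))) (sum-zero λ j → *-zeroˡ (sq (m - f j))))
        (cong₂ _+_ (cong (λ z → 1ℚ * sq (m - a) + (1ℚ * sq (m - m) + (0ℚ * sq (m - m) + (1ℚ * sq (m - d) + z)))) (sum-zero λ j → *-zeroˡ (sq (m - f j))))
        (cong₂ _+_ (cong (λ z → 0ℚ * sq (d - a) + (1ℚ * sq (d - m) + (1ℚ * sq (d - m) + (0ℚ * sq (d - d) + z)))) (sum-point-weight v (λ j → sq (d - f j))))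
          old-rows))) ⟩
    (0ℚ * sq (a - a) + (1ℚ * sq (a - m) + (1ℚ * sq (a - m) + (0ℚ * sq (a - d) + sq (a - f u))))) +
      ((1ℚ * sq (m - a) + (0ℚ * sq (m - m) + (1ℚ * sq (m - m) + (1ℚ * sq (m - d) + 0ℚ)))) +
      ((1ℚ * sq (m - a) + (1ℚ * sq (m - m) + (0ℚ * sq (m - m) + (1ℚ * sq (m - d) + 0ℚ)))) +
      ((0ℚ * sq (d - a) + (1ℚ * sq (d - m) + (1ℚ * sq (d - m) + (0ℚ * sq (d - d) + sq (d - f v))))) +
      (1ℚ * sq (f u - a) + 1ℚ * (1ℚ * sq (f v - d) + 1ℚ * K)))))   ≡⟨ collect a d (f u) (f v) K ⟩
    (K + 2ℚ * sq (f u - f v)) + 2ℚ * (sq (a - d) + sq (a - f u) + sq (d - f v) - sq (f u - f v))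
      ≡⟨ cong (_+ 2ℚ * (sq (a - d) + sq (a - f u) + sq (d - f v) - sq (f u - f v))) energy-split ⟨
    Laplacian.energy graph f + 2ℚ * (sq (a - d) + sq (a - f u) + sq (d - f v) - sq (f u - f v)) ∎
    where
    m = ½ * (a + d)
    Krow : Fin n → ℚ
    Krow i = sum λ j → ι (bit (kept i j)) * sq (f i - f j)
    K = sum Krow
    collect : ∀ a d x y K →
      (0ℚ * ((a - a) * (a - a)) + (1ℚ * ((a - ½ * (a + d)) * (a - ½ * (a + d))) + (1ℚ * ((a - ½ * (a + d)) * (a - ½ * (a + d))) + (0ℚ * ((a - d) * (a - d)) + (a - x) * (a - x))))) +
      ((1ℚ * ((½ * (a + d) - a) * (½ * (a + d) - a)) + (0ℚ * ((½ * (a + d) - ½ * (a + d)) * (½ * (a + d) - ½ * (a + d))) + (1ℚ * ((½ * (a + d) - ½ * (a + d)) * (½ * (a + d) - ½ * (a + d))) + (1ℚ * ((½ * (a + d) - d) * (½ * (a + d) - d)) + 0ℚ)))) +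
      ((1ℚ * ((½ * (a + d) - a) * (½ * (a + d) - a)) + (1ℚ * ((½ * (a + d) - ½ * (a + d)) * (½ * (a + d) - ½ * (a + d))) + (0ℚ * ((½ * (a + d) - ½ * (a + d)) * (½ * (a + d) - ½ * (a + d))) + (1ℚ * ((½ * (a + d) - d) * (½ * (a + d) - d)) + 0ℚ)))) +
      ((0ℚ * ((d - a) * (d - a)) + (1ℚ * ((d - ½ * (a + d)) * (d - ½ * (a + d))) + (1ℚ * ((d - ½ * (a + d)) * (d - ½ * (a + d))) + (0ℚ * ((d - d) * (d - d)) + (d - y) * (d - y))))) +
      (1ℚ * ((x - a) * (x - a)) + 1ℚ * (1ℚ * ((y - d) * (y - d)) + 1ℚ * K)))))
      ≡ (K + 2ℚ * ((x - y) * (x - y))) + 2ℚ * ((a - d) * (a - d) + (a - x) * (a - x) + (d - y) * (d - y) - (x - y) * (x - y))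
    collect = solve-∀ ringℚ
    drop-zeros : ∀ x p q y k → x + (0ℚ * p + (0ℚ * q + (y + k))) ≡ 1ℚ * x + 1ℚ * (1ℚ * y + 1ℚ * k)
    drop-zeros = solve-∀ ringℚ
    old-rows : sum (λ i → ι (δℕ u i) * sq (f i - a) + (0ℚ * sq (f i - m) + (0ℚ * sq (f i - m) + (ι (δℕ v i) * sq (f i - d) + Krow i))))
      ≡ 1ℚ * sq (f u - a) + 1ℚ * (1ℚ * sq (f v - d) + 1ℚ * K)
    old-rows = trans (sum-cong λ i → drop-zeros (ι (δℕ u i) * sq (f i - a)) (sq (f i - m)) (sq (f i - m)) (ι (δℕ v i) * sq (f i - d)) (Krow i))
      (trans (sum-linear 1ℚ 1ℚ (λ i → ι (δℕ u i) * sq (f i - a)) (λ i → 1ℚ * (ι (δℕ v i) * sq (f i - d)) + 1ℚ * Krow i))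
        (cong₂ (λ x y → 1ℚ * x + 1ℚ * y) (sum-point-weight u (λ i → sq (f i - a)))
          (trans (sum-linear 1ℚ 1ℚ (λ i → ι (δℕ v i) * sq (f i - d)) Krow) (cong (λ x → 1ℚ * x + 1ℚ * K) (sum-point-weight v (λ i → sq (f i - d)))))))
    E : Fin n → Fin n → ℚ
    E i j = sq (f i - f j)
    expand : ∀ i j → Laplacian.weight graph i j * E i j ≡ ι (bit (kept i j)) * E i j + (ι (δℕ u i) * (ι (δℕ v j) * E i j) + ι (δℕ v i) * (ι (δℕ u j) * E i j))
    expand i j = trans (cong (_* E i j) (trans (cong ι (split-adjacent i j)) (trans (ι-+ (bit (kept i j)) (δℕ u i ℕ.* δℕ v j ℕ.+ δℕ v i ℕ.* δℕ u j))
        (cong (λ z → ι (bit (kept i j)) + z) (trans (ι-+ (δℕ u i ℕ.* δℕ v j) (δℕ v i ℕ.* δℕ u j)) (cong₂ _+_ (ι-* (δℕ u i) (δℕ v j)) (ι-* (δℕ v i) (δℕ u j))))))))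
      (distribute (ι (bit (kept i j))) (ι (δℕ u i)) (ι (δℕ v j)) (ι (δℕ v i)) (ι (δℕ u j)) (E i j))
      where
      distribute : ∀ k a b c d e → (k + (a * b + c * d)) * e ≡ k * e + (a * (b * e) + c * (d * e))
      distribute = solve-∀ ringℚ
    energy-split : Laplacian.energy graph f ≡ K + 2ℚ * sq (f u - f v)
    energy-split = begin
      Laplacian.energy graph f    ≡⟨ sum-cong (λ i → trans (sum-cong (expand i)) (trans (sum-+ (λ j → ι (bit (kept i j)) * E i j) (λ j → ι (δℕ u i) * (ι (δℕ v j) * E i j) + ι (δℕ v i) * (ι (δℕ u j) * E i j)))
                                       (cong (λ z → Krow i + z) (trans (sum-linear (ι (δℕ u i)) (ι (δℕ v i)) (λ j → ι (δℕ v j) * E i j) (λ j → ι (δℕ u j) * E i j))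
                                         (cong₂ (λ x y → ι (δℕ u i) * x + ι (δℕ v i) * y) (sum-point-weight v (E i)) (sum-point-weight u (E i))))))) ⟩
      sum (λ i → Krow i + (ι (δℕ u i) * E i v + ι (δℕ v i) * E i u)) ≡⟨ trans (sum-+ Krow (λ i → ι (δℕ u i) * E i v + ι (δℕ v i) * E i u)) (cong (λ z → K + z) (trans (sum-+ (λ i → ι (δℕ u i) * E i v) (λ i → ι (δℕ v i) * E i u)) (cong₂ _+_ (sum-point-weight u (λ i → E i v)) (sum-point-weight v (λ i → E i u))))) ⟩
      K + (sq (f u - f v) + sq (f v - f u)) ≡⟨ cong (λ z → K + z) (both (f u) (f v)) ⟩
      K + 2ℚ * sq (f u - f v)     ∎
      where
      both : ∀ x y → (x - y) * (x - y) + (y - x) * (y - x) ≡ 2ℚ * ((x - y) * (x - y))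
      both = solve-∀ ringℚ

  norm-diamond : ∀ a d f → ∥ diamond a d f ∥² ≡ ∥ f ∥² + 2ℚ * (sq a + sq d) - ½ * sq (a - d)
  norm-diamond a d f = collect a d ∥ f ∥²
    where
    collect : ∀ a d N → a * a + (½ * (a + d) * (½ * (a + d)) + (½ * (a + d) * (½ * (a + d)) + (d * d + N))) ≡ N + 2ℚ * (a * a + d * d) - ½ * ((a - d) * (a - d))
    collect = solve-∀ ringℚ

-- Two ends joined by one edge; f₀ is constant on each end.
record Ends (n : ℕ) : Set where
  field
    bridged : Bridged n
    left    : Fin n → Bool

  open Bridged bridged public

  f₀ : ℚ → ℚ → Vector ℚ n
  f₀ α ω i = if left i then α else ω

  field
    left-u   : left u ≡ true
    right-v  : left v ≡ false
    energy₀  : ∀ α ω → Laplacian.energy graph (f₀ α ω) ≡ 2ℚ * sq (α - ω)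
    norm₀    : ∀ α ω → 2ℚ * sq α + 2ℚ * sq ω ≤ ∥ f₀ α ω ∥²

module Chain {n₀} (ends : Ends n₀) where
  open Ends ends using (f₀)

  order-of : ℕ → ℕ
  order-of zero    = n₀
  order-of (suc M) = 4 ℕ.+ order-of M

  chain : ∀ M → Bridged (order-of M)
  chain zero    = Ends.bridged ends
  chain (suc M) = Insertion.bridged (chain M)

  -- y is read along the path u₀, A₁, D₁, A₂, D₂, …, the remaining end gets the value ω.
  assign : ∀ M → (ℕ → ℚ) → ℚ → Vector ℚ (order-of M)
  assign zero    y ω = f₀ (y 0) ω
  assign (suc M) y ω = InsertionEnergy.diamond (chain M) (y (suc (double M))) (y (double (suc M))) (assign M y ω)

  assign-u : ∀ M y ω → assign M y ω (Bridged.u (chain M)) ≡ y (double M)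
  assign-u zero    y ω = cong (if_then y 0 else ω) (Ends.left-u ends)
  assign-u (suc M) y ω = refl

  assign-v : ∀ M y ω → assign M y ω (Bridged.v (chain M)) ≡ ω
  assign-v zero    y ω = cong (if_then y 0 else ω) (Ends.right-v ends)
  assign-v (suc M) y ω = assign-v M y ω

  increments : (ℕ → ℚ) → ℕ → ℚ
  increments y = Σ< (λ i → sq (y (suc i) - y i))

  assign-energy : ∀ M y ω → Laplacian.energy (Bridged.graph (chain M)) (assign M y ω) ≡ 2ℚ * (increments y (double M) + sq (y (double M) - ω))
  assign-energy zero    y ω = trans (Ends.energy₀ ends (y 0) ω) (cong (2ℚ *_) (sym (+-identityˡ (sq (y 0 - ω)))))
  assign-energy (suc M) y ω = trans (InsertionEnergy.energy-diamond (chain M) a d (assign M y ω))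
    (trans (cong₂ (λ e p → e + 2ℚ * p) (assign-energy M y ω) (cong₂ (λ x z → sq (a - d) + sq (a - x) + sq (d - z) - sq (x - z)) (assign-u M y ω) (assign-v M y ω)))
      (collect (increments y (double M)) (y (double M)) a d ω))
    where
    a = y (suc (double M))
    d = y (double (suc M))
    collect : ∀ S b a d ω → 2ℚ * (S + (b - ω) * (b - ω)) + 2ℚ * ((a - d) * (a - d) + (a - b) * (a - b) + (d - ω) * (d - ω) - (b - ω) * (b - ω))
      ≡ 2ℚ * (S + (a - b) * (a - b) + (d - a) * (d - a) + (d - ω) * (d - ω))
    collect = solve-∀ ringℚ

  -- Each vertex of the path counts with weight 2, since a diamond carries two further vertices.
  -- Averaging there loses half of the squared increment, which the right-hand side makes up for.
  assign-norm : ∀ M y ω → 2ℚ * Σ< (sq ∘ y) (suc (double M)) + 2ℚ * sq ω ≤ ∥ assign M y ω ∥² + ½ * increments y (double M)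
  assign-norm zero    y ω = ≤-trans (≤-reflexive (cong (λ z → 2ℚ * z + 2ℚ * sq ω) (+-identityˡ (sq (y 0)))))
    (≤-trans (Ends.norm₀ ends (y 0) ω) (≤-reflexive (sym (trans (cong (λ z → ∥ f₀ (y 0) ω ∥² + z) (*-zeroʳ ½)) (+-identityʳ ∥ f₀ (y 0) ω ∥²)))))
  assign-norm (suc M) y ω = begin
    2ℚ * (S + sq a + sq d) + 2ℚ * sq ω    ≡⟨ regroup S a d ω ⟩
    (2ℚ * S + 2ℚ * sq ω) + 2ℚ * (sq a + sq d) ≤⟨ +-monoˡ-≤ (2ℚ * (sq a + sq d)) (assign-norm M y ω) ⟩
    (N + ½ * I) + 2ℚ * (sq a + sq d)      ≤⟨ from-diff (0≤* {½} (nonNegative⁻¹ ½) (0≤sq (a - b))) (collect N I a b d) ⟩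
    (N + 2ℚ * (sq a + sq d) - ½ * sq (a - d)) + ½ * (I + sq (a - b) + sq (d - a)) ≡⟨ cong (_+ ½ * (I + sq (a - b) + sq (d - a))) (InsertionEnergy.norm-diamond (chain M) a d (assign M y ω)) ⟨
    ∥ assign (suc M) y ω ∥² + ½ * increments y (double (suc M)) ∎
    where
    open ≤-Reasoning
    a = y (suc (double M))
    b = y (double M)
    d = y (double (suc M))
    S = Σ< (sq ∘ y) (suc (double M))
    I = increments y (double M)
    N = ∥ assign M y ω ∥²
    regroup : ∀ S a d ω → 2ℚ * (S + a * a + d * d) + 2ℚ * (ω * ω) ≡ (2ℚ * S + 2ℚ * (ω * ω)) + 2ℚ * (a * a + d * d)
    regroup = solve-∀ ringℚ
    collect : ∀ N I a b d → (N + 2ℚ * (a * a + d * d) - ½ * ((a - d) * (a - d))) + ½ * (I + (a - b) * (a - b) + (d - a) * (d - a)) - ((N + ½ * I) + 2ℚ * (a * a + d * d)) ≡ ½ * ((a - b) * (a - b))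
    collect = solve-∀ ringℚ

  assign-combine : ∀ M α β y z ω ζ i → assign M (λ k → α * y k + β * z k) (α * ω + β * ζ) i ≡ combine α β (assign M y ω) (assign M z ζ) i
  assign-combine zero α β y z ω ζ i with Ends.left ends i
  ... | true  = refl
  ... | false = refl
  assign-combine (suc M) α β y z ω ζ zero = refl
  assign-combine (suc M) α β y z ω ζ (suc zero) = middle α β (y (suc (double M))) (y (double (suc M))) (z (suc (double M))) (z (double (suc M)))
    where
    middle : ∀ α β a b c d → ½ * ((α * a + β * c) + (α * b + β * d)) ≡ α * (½ * (a + b)) + β * (½ * (c + d))
    middle = solve-∀ ringℚ
  assign-combine (suc M) α β y z ω ζ (suc (suc zero)) = assign-combine (suc M) α β y z ω ζ (suc zero)
  assign-combine (suc M) α β y z ω ζ (suc (suc (suc zero))) = refl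
  assign-combine (suc M) α β y z ω ζ (suc (suc (suc (suc i)))) = assign-combine M α β y z ω ζ i

-- The test functions: two bumps of shape s at the two ends of the path.

-- A quarter period of a sine: it starts at 0 and has stopped growing at h. Therefore the peak can
-- sit at an end of the path without raising the Rayleigh quotient above ℓ.
record PeakedSolution (ℓ : ℚ) (h : ℕ) : Set where
  field
    s          : ℕ → ℚ
    initial    : s 0 ≡ 0ℚ
    recurrence : ∀ k → s (suc (suc k)) ≡ (2ℚ - ℓ) * s (suc k) - s k
    peak       : s (suc h) ≤ s h
    height     : 0ℚ < s h

summation-by-parts : ∀ (y : ℕ → ℚ) m → Σ< (λ i → sq (y (suc i) - y i)) (suc m) ≡
  y 0 * (y 0 - y 1) + Σ< (λ i → y (suc i) * (2ℚ * y (suc i) - y i - y (suc (suc i)))) m + y (suc m) * (y (suc m) - y m)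
summation-by-parts y zero = identity (y 0) (y 1)
  where
  identity : ∀ a b → 0ℚ + (b - a) * (b - a) ≡ a * (a - b) + 0ℚ + b * (b - a)
  identity = solve-∀ ringℚ
summation-by-parts y (suc m) = trans (cong (_+ sq (y (suc (suc m)) - y (suc m))) (summation-by-parts y m))
  (identity (y 0 * (y 0 - y 1)) (Σ< (λ i → y (suc i) * (2ℚ * y (suc i) - y i - y (suc (suc i)))) m) (y m) (y (suc m)) (y (suc (suc m))))
  where
  identity : ∀ A S a b c → A + S + b * (b - a) + (c - b) * (c - b) ≡ A + (S + b * (2ℚ * b - a - c)) + c * (c - b)
  identity = solve-∀ ringℚ

module Bumps {ℓ h} (solution : PeakedSolution ℓ (suc h)) (d : ℕ) where
  open PeakedSolution solution
  open ≤-Reasoning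

  -- The path has vertices 0, …, K, and the two bumps are separated by d edges.
  K : ℕ
  K = suc h ℕ.+ (d ℕ.+ suc h)

  K-h : ℕ
  K-h = suc h ℕ.+ d

  leftBump rightBump : ℕ → ℚ
  leftBump i  = s (suc h ℕ.∸ i)
  rightBump i = s (i ℕ.∸ K-h)

  leftBump-zero : ∀ {i} → suc h ℕ.≤ i → leftBump i ≡ 0ℚ
  leftBump-zero h≤i = trans (cong s (ℕ.m≤n⇒m∸n≡0 h≤i)) initial

  rightBump-zero : ∀ {i} → i ℕ.≤ K-h → rightBump i ≡ 0ℚ
  rightBump-zero i≤ = trans (cong s (ℕ.m≤n⇒m∸n≡0 i≤)) initial

  module _ (α β : ℚ) where

    y : ℕ → ℚ
    y i = α * leftBump i + β * rightBump i

    y-left : ∀ {i} → i ℕ.≤ K-h → y i ≡ α * leftBump i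
    y-left {i} i≤ = trans (cong (λ z → α * leftBump i + β * z) (rightBump-zero i≤)) (drop (α * leftBump i) β)
      where
      drop : ∀ a b → a + b * 0ℚ ≡ a
      drop = solve-∀ ringℚ

    y-right : ∀ {i} → suc h ℕ.≤ i → y i ≡ β * rightBump i
    y-right {i} h≤ = trans (cong (λ z → α * z + β * rightBump i) (leftBump-zero h≤)) (drop α (β * rightBump i))
      where
      drop : ∀ a b → a * 0ℚ + b ≡ b
      drop = solve-∀ ringℚ

    eigen : ∀ γ k → γ * s (suc k) * (2ℚ * (γ * s (suc k)) - γ * s (suc (suc k)) - γ * s k) ≡ ℓ * sq (γ * s (suc k))
    eigen γ k = trans (cong (λ z → γ * s (suc k) * (2ℚ * (γ * s (suc k)) - γ * z - γ * s k)) (recurrence k)) (identity γ (s (suc k)) (s k) ℓ)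
      where
      identity : ∀ γ a b ℓ → γ * a * (2ℚ * (γ * a) - γ * ((2ℚ - ℓ) * a - b) - γ * b) ≡ ℓ * (γ * a * (γ * a))
      identity = solve-∀ ringℚ

    -- Inside a bump this is an equality by the recurrence, and outside both bumps `y (suc i)` is 0.
    -- The supports are disjoint, so the claim holds for all combinations of the two bumps.
    interior : ∀ i → y (suc i) * (2ℚ * y (suc i) - y i - y (suc (suc i))) ≤ ℓ * sq (y (suc i))
    interior i with suc (suc i) ℕ.≤? suc h | suc i ℕ.≤? K-h
    ... | yes i+2≤h | _ = ≤-reflexive (on-left (proj₁ (ℕ.m≤n⇒∃[o]m+o≡n i+2≤h)) (proj₂ (ℕ.m≤n⇒∃[o]m+o≡n i+2≤h)))
      where
      i+2≤ : suc (suc i) ℕ.≤ K-h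
      i+2≤ = ℕ.≤-trans i+2≤h (ℕ.m≤m+n (suc h) d)
      i+1≤ = ℕ.≤-trans (ℕ.n≤1+n (suc i)) i+2≤
      i≤ = ℕ.≤-trans (ℕ.n≤1+n i) i+1≤
      on-left : ∀ o → suc (suc i) ℕ.+ o ≡ suc h → y (suc i) * (2ℚ * y (suc i) - y i - y (suc (suc i))) ≡ ℓ * sq (y (suc i))
      on-left o eq = trans (cong₂ (λ p q → p * (2ℚ * p - q - y (suc (suc i)))) y₁ y₀) (trans (cong (λ r → α * s (suc o) * (2ℚ * (α * s (suc o)) - α * s (suc (suc o)) - r)) y₂)
          (trans (eigen α o) (cong (λ z → ℓ * sq z) (sym y₁))))
        where
        index : ∀ j k → j ℕ.+ k ≡ suc h → leftBump j ≡ s k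
        index j k eq = cong s (trans (cong (ℕ._∸ j) (sym eq)) (ℕ.m+n∸m≡n j k))
        y₀ : y i ≡ α * s (suc (suc o))
        y₀ = trans (y-left i≤) (cong (α *_) (index i (suc (suc o)) (trans (trans (ℕ.+-suc i (suc o)) (cong suc (ℕ.+-suc i o))) eq)))
        y₁ : y (suc i) ≡ α * s (suc o)
        y₁ = trans (y-left i+1≤) (cong (α *_) (index (suc i) (suc o) (trans (cong suc (ℕ.+-suc i o)) eq)))
        y₂ : y (suc (suc i)) ≡ α * s o
        y₂ = trans (y-left i+2≤) (cong (α *_) (index (suc (suc i)) o eq))
    ... | no i+2≰h | yes i+1≤ = ≤-reflexive (trans (cong₂ (λ p q → p * q) y₁ refl) (trans (vanish (2ℚ * y (suc i) - y i - y (suc (suc i))) ℓ) (cong (λ z → ℓ * sq z) (sym y₁))))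
      where
      y₁ : y (suc i) ≡ 0ℚ
      y₁ = trans (y-left i+1≤) (trans (cong (α *_) (leftBump-zero (ℕ.s≤s⁻¹ (ℕ.≰⇒> i+2≰h)))) (*-zeroʳ α))
      vanish : ∀ q ℓ → 0ℚ * q ≡ ℓ * (0ℚ * 0ℚ)
      vanish = solve-∀ ringℚ
    ... | no i+2≰h | no i+1≰ = ≤-reflexive (on-right (proj₁ (ℕ.m≤n⇒∃[o]m+o≡n K-h≤i)) (proj₂ (ℕ.m≤n⇒∃[o]m+o≡n K-h≤i)))
      where
      K-h≤i : K-h ℕ.≤ i
      K-h≤i = ℕ.s≤s⁻¹ (ℕ.≰⇒> i+1≰)
      h≤i : suc h ℕ.≤ i
      h≤i = ℕ.≤-trans (ℕ.m≤m+n (suc h) d) K-h≤i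
      on-right : ∀ o → K-h ℕ.+ o ≡ i → y (suc i) * (2ℚ * y (suc i) - y i - y (suc (suc i))) ≡ ℓ * sq (y (suc i))
      on-right o eq = trans (cong₂ (λ p q → p * (2ℚ * p - q - y (suc (suc i)))) y₁ y₀) (trans (cong (λ r → β * s (suc o) * (2ℚ * (β * s (suc o)) - β * s o - r)) y₂)
          (trans (cong (β * s (suc o) *_) (swap (2ℚ * (β * s (suc o))) (β * s o) (β * s (suc (suc o))))) (trans (eigen β o) (cong (λ z → ℓ * sq z) (sym y₁)))))
        where
        swap : ∀ a b c → a - b - c ≡ a - c - b
        swap = solve-∀ ringℚ
        index : ∀ j k → K-h ℕ.+ k ≡ j → rightBump j ≡ s k
        index j k eq = cong s (trans (cong (ℕ._∸ K-h) (sym eq)) (ℕ.m+n∸m≡n K-h k))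
        y₀ : y i ≡ β * s o
        y₀ = trans (y-right h≤i) (cong (β *_) (index i o eq))
        y₁ : y (suc i) ≡ β * s (suc o)
        y₁ = trans (y-right (ℕ.≤-trans h≤i (ℕ.n≤1+n i))) (cong (β *_) (index (suc i) (suc o) (trans (ℕ.+-suc K-h o) (cong suc eq))))
        y₂ : y (suc (suc i)) ≡ β * s (suc (suc o))
        y₂ = trans (y-right (ℕ.≤-trans h≤i (ℕ.≤-trans (ℕ.n≤1+n i) (ℕ.n≤1+n (suc i))))) (cong (β *_) (index (suc (suc i)) (suc (suc o)) (trans (trans (ℕ.+-suc K-h (suc o)) (cong suc (ℕ.+-suc K-h o))) (cong (λ z → suc (suc z)) eq))))

    peak-bound : ∀ γ → γ * s (suc h) * (γ * s (suc h) - γ * s h) ≤ ℓ * sq (γ * s (suc h))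
    peak-bound γ = from-diff (0≤* (0≤* (0≤sq γ) (<⇒≤ height)) (diff (subst (_≤ s (suc h)) (recurrence h) peak))) (identity γ (s (suc h)) (s h) ℓ)
      where
      identity : ∀ γ a b ℓ → ℓ * (γ * a * (γ * a)) - γ * a * (γ * a - γ * b) ≡ γ * γ * a * (a - ((2ℚ - ℓ) * a - b))
      identity = solve-∀ ringℚ

    y-first : y 0 ≡ α * s (suc h)
    y-first = y-left z≤n

    y-last : y K ≡ β * s (suc h)
    y-last = trans (y-right (ℕ.m≤m+n (suc h) (d ℕ.+ suc h))) (cong (λ z → β * s z) (trans (cong (ℕ._∸ K-h) (sym (ℕ.+-assoc (suc h) d (suc h)))) (ℕ.m+n∸m≡n K-h (suc h))))

    first-bound : y 0 * (y 0 - y 1) ≤ ℓ * sq (y 0)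
    first-bound = subst₂ (λ p q → p * (p - q) ≤ ℓ * sq p) (sym y-first) (sym (y-left (s≤s z≤n))) (peak-bound α)

    K′ : ℕ
    K′ = h ℕ.+ (d ℕ.+ suc h)

    last-bound : y K * (y K - y K′) ≤ ℓ * sq (y K)
    last-bound = subst₂ (λ p q → p * (p - q) ≤ ℓ * sq p) (sym y-last) (sym before) (peak-bound β)
      where
      K′≡ : K′ ≡ K-h ℕ.+ h
      K′≡ = trans (cong (h ℕ.+_) (ℕ.+-suc d h)) (trans (ℕ.+-suc h (d ℕ.+ h)) (cong suc (sym (ℕ.+-assoc h d h))))
      before : y K′ ≡ β * s h
      before = trans (y-right (subst (suc h ℕ.≤_) (sym K′≡) (ℕ.≤-trans (ℕ.m≤m+n (suc h) d) (ℕ.m≤m+n K-h h)))) (cong (λ z → β * s z) (trans (cong (ℕ._∸ K-h) K′≡) (ℕ.m+n∸m≡n K-h h)))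

    bumps-rayleigh : Σ< (λ i → sq (y (suc i) - y i)) K ≤ ℓ * Σ< (sq ∘ y) (suc K)
    bumps-rayleigh = begin
      Σ< (λ i → sq (y (suc i) - y i)) K     ≡⟨ summation-by-parts y K′ ⟩
      y 0 * (y 0 - y 1) + Σ< (λ i → y (suc i) * (2ℚ * y (suc i) - y i - y (suc (suc i)))) K′ + y K * (y K - y K′)
        ≤⟨ +-mono-≤ (+-mono-≤ first-bound (≤-trans (Σ<-mono K′ (λ i _ → interior i)) (≤-reflexive (Σ<-* ℓ (λ i → sq (y (suc i))) K′)))) last-bound ⟩
      ℓ * sq (y 0) + ℓ * Σ< (λ i → sq (y (suc i))) K′ + ℓ * sq (y K) ≡⟨ factor ℓ (sq (y 0)) (Σ< (λ i → sq (y (suc i))) K′) (sq (y K)) ⟩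
      ℓ * (sq (y 0) + Σ< (λ i → sq (y (suc i))) K′ + sq (y K)) ≡⟨ cong (λ z → ℓ * (z + sq (y K))) (Σ<-head (sq ∘ y) K′) ⟩
      ℓ * Σ< (sq ∘ y) (suc K)               ∎
      where
      factor : ∀ ℓ a b c → ℓ * a + ℓ * b + ℓ * c ≡ ℓ * (a + b + c)
      factor = solve-∀ ringℚ

-- Rayleigh quotients on a chain of diamonds.

double≡+ : ∀ n → double n ≡ n ℕ.+ n
double≡+ zero    = refl
double≡+ (suc n) = cong suc (trans (cong suc (double≡+ n)) (sym (ℕ.+-suc n n)))

bump-length : ∀ h e → double (h ℕ.+ e) ≡ h ℕ.+ (double e ℕ.+ h)
bump-length h e = trans (double≡+ (h ℕ.+ e)) (trans (regroup h e) (cong (λ z → h ℕ.+ (z ℕ.+ h)) (sym (double≡+ e))))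
  where
  regroup : ∀ a b → (a ℕ.+ b) ℕ.+ (a ℕ.+ b) ≡ a ℕ.+ ((b ℕ.+ b) ℕ.+ a)
  regroup = solve-ℕ

module ChainTest {n₀} (ends : Ends n₀) {ℓ h} (solution : PeakedSolution ℓ (suc h)) (d M : ℕ) (2M≡K : double M ≡ suc h ℕ.+ (d ℕ.+ suc h))
  (0<4-ℓ : 0ℚ < 4ℚ - ℓ) where
  open Chain ends
  open Bumps solution d
  open ≤-Reasoning

  B = chain M
  G = Bridged.graph B
  open Laplacian G

  module _ (α β : ℚ) where

    -- The far end repeats the last value of the path, so the edge leading to it costs nothing.
    ω : ℚ
    ω = y α β (double M)

    F : Vector ℚ (order-of M)
    F = assign M (y α β) ω

    I S N : ℚ
    I = increments (y α β) (double M)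
    S = Σ< (sq ∘ y α β) (suc (double M))
    N = ∥ F ∥²

    form-F : form laplacianℚ F F ≡ I
    form-F = halve (form laplacianℚ F F) I (trans (sym (energy-form (Bridged.cubic B) F)) (trans (assign-energy M (y α β) ω) (drop I ω)))
      where
      drop : ∀ I ω → 2ℚ * (I + (ω - ω) * (ω - ω)) ≡ 2ℚ * I
      drop = solve-∀ ringℚ
      halve : ∀ x z → 2ℚ * x ≡ 2ℚ * z → x ≡ z
      halve x z eq = trans (half x) (trans (cong (½ *_) eq) (sym (half z)))
        where
        half : ∀ x → x ≡ ½ * (2ℚ * x)
        half = solve-∀ ringℚ

    I≤ℓS : I ≤ ℓ * S
    I≤ℓS = subst (λ k → increments (y α β) k ≤ ℓ * Σ< (sq ∘ y α β) (suc k)) (sym 2M≡K) (bumps-rayleigh α β)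

    norm-F : 2ℚ * S + 2ℚ * sq ω ≤ N + ½ * I
    norm-F = assign-norm M (y α β) ω

    -- From I ≤ ℓ S and 2 S ≤ N + I / 2. The loss I / 2 of the averaging turns the expected quotient
    -- ℓ / 2 into 2 ℓ / (4 - ℓ).
    rayleigh-F : 0ℚ ≤ ℓ → (4ℚ - ℓ) * I ≤ 2ℚ * ℓ * N
    rayleigh-F 0≤ℓ = from-diff (0≤+ (0≤+ (0≤* (0≤ι 4) (diff I≤ℓS)) (0≤* (0≤* (0≤ι 2) 0≤ℓ) (diff norm-F))) (0≤* (0≤* (0≤ι 4) 0≤ℓ) (0≤sq ω)))
      (identity ℓ I S N (sq ω))
      where
      identity : ∀ ℓ I S N w → 2ℚ * ℓ * N - (4ℚ - ℓ) * I ≡ 4ℚ * (ℓ * S - I) + 2ℚ * ℓ * (N + ½ * I - (2ℚ * S + 2ℚ * w)) + 4ℚ * ℓ * w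
      identity = solve-∀ ringℚ

    norm-lower : (4ℚ - ℓ) * S + 4ℚ * sq ω ≤ 2ℚ * N
    norm-lower = from-diff (0≤+ (0≤* (0≤ι 2) (diff norm-F)) (diff I≤ℓS)) (identity ℓ I S N (sq ω))
      where
      identity : ∀ ℓ I S N w → 2ℚ * N - ((4ℚ - ℓ) * S + 4ℚ * w) ≡ 2ℚ * (N + ½ * I - (2ℚ * S + 2ℚ * w)) + (ℓ * S - I)
      identity = solve-∀ ringℚ

    0≤S : 0ℚ ≤ S
    0≤S = Σ<-nonneg (suc (double M)) (λ k → 0≤sq (y α β k))

    positive-norm : α ≢ 0ℚ ⊎ β ≢ 0ℚ → 0ℚ < N
    positive-norm nonzero = *-cancelˡ-<-nonNeg 2ℚ {{nonNegative (0≤ι 2)}} (≤-<-trans (≤-reflexive (*-zeroʳ 2ℚ)) (<-≤-trans (positive′ nonzero) norm-lower))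
      where
      s>0 = PeakedSolution.height solution
      γs≢0 : ∀ γ → γ ≢ 0ℚ → 0ℚ < sq (γ * PeakedSolution.s solution (suc h))
      γs≢0 γ γ≢0 = subst (0ℚ <_) (square γ (PeakedSolution.s solution (suc h))) (0<* (0<sq {γ} γ≢0) (0<* s>0 s>0))
        where
        square : ∀ γ s → γ * γ * (s * s) ≡ γ * s * (γ * s)
        square = solve-∀ ringℚ
      positive′ : α ≢ 0ℚ ⊎ β ≢ 0ℚ → 0ℚ < (4ℚ - ℓ) * S + 4ℚ * sq ω
      positive′ (inj₁ α≢0) = +-mono-<-≤ (0<* 0<4-ℓ (<-≤-trans (subst (λ z → 0ℚ < sq z) (sym (y-first α β)) (γs≢0 α α≢0))
        (≤-trans (≤-trans (≤-reflexive (sym (+-identityʳ (sq (y α β 0))))) (+-monoʳ-≤ (sq (y α β 0)) (Σ<-nonneg (double M) (λ k → 0≤sq (y α β (suc k))))))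
          (≤-reflexive (Σ<-head (sq ∘ y α β) (double M)))))) (0≤* (0≤ι 4) (0≤sq ω))
      positive′ (inj₂ β≢0) = +-mono-≤-< (0≤* (<⇒≤ 0<4-ℓ) 0≤S) (0<* {4ℚ} (0<ι 3) (subst (λ k → 0ℚ < sq (y α β k)) (sym 2M≡K) (subst (λ z → 0ℚ < sq z) (sym (y-last α β)) (γs≢0 β β≢0))))

  test-plane : ∀ {Y} → 0ℚ ≤ ℓ → 2ℚ * ℓ ≡ (4ℚ - ℓ) * Y → TestPlane laplacianℚ Y
  test-plane {Y} 0≤ℓ Y-def = record
    { g = g ; h = g′
    ; rayleigh = λ α β → *-cancelˡ 0<4-ℓ (begin
        (4ℚ - ℓ) * form laplacianℚ (combine α β g g′) (combine α β g g′) ≡⟨ cong ((4ℚ - ℓ) *_) (trans (sym (form-cong laplacianℚ (linear α β) (linear α β))) (form-F α β)) ⟩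
        (4ℚ - ℓ) * I α β              ≤⟨ rayleigh-F α β 0≤ℓ ⟩
        2ℚ * ℓ * N α β                ≡⟨ cong₂ _*_ Y-def (norm-cong (linear α β)) ⟩
        (4ℚ - ℓ) * Y * ∥ combine α β g g′ ∥² ≡⟨ *-assoc (4ℚ - ℓ) Y ∥ combine α β g g′ ∥² ⟩
        (4ℚ - ℓ) * (Y * ∥ combine α β g g′ ∥²) ∎)
    ; nonzero = λ α β nonzero → subst (0ℚ <_) (norm-cong (linear α β)) (positive-norm α β nonzero)
    }
    where
    g g′ : Vector ℚ (order-of M)
    g  = assign M leftBump (leftBump (double M))
    g′ = assign M rightBump (rightBump (double M))
    linear : ∀ α β i → F α β i ≡ combine α β g g′ i
    linear α β i = assign-combine M α β leftBump rightBump (leftBump (double M)) (rightBump (double M)) i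

connectivity-upper : ∀ {N n} → N ≡ suc (suc n) → (G : Graph N) → Connected G → Cubic G → ∀ {Y} → TestPlane (Laplacian.laplacianℚ G) Y →
  Σ[ μ ∈ ℝ ] CubicConnectivity N μ × μ ≤ᴿ fromℚ Y
connectivity-upper refl G connected cubic {Y} plane = attach (spectral-theorem (λ i j → fromℤ (laplacian G i j)) (Laplacian.laplacianℚ G) (λ _ _ _ → refl) (Laplacian.laplacian-symmetric G cubic))
  where
  ≈-refl : ∀ x → x ≈ x
  ≈-refl x ε 0<ε = 0 , λ k _ → ≤-trans (≤-reflexive (cong ℚ.∣_∣ (+-inverseʳ (seq x k)))) (<⇒≤ 0<ε)
  attach : Σ[ ev ∈ Vector ℝ _ ] IsSpectrum (λ i j → fromℤ (laplacian G i j)) ev × (∀ y → TestPlane (Laplacian.laplacianℚ G) y → ev (suc zero) ≤ᴿ fromℚ y) →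
    Σ[ μ ∈ ℝ ] CubicConnectivity _ μ × μ ≤ᴿ fromℚ Y
  attach (ev , spectrum , bound) = ev (suc zero) , (G , connected , cubic , ev , spectrum , suc zero , refl , ≈-refl (ev (suc zero))) , bound Y plane

chain-connectivity : ∀ {n₀} (ends : Ends n₀) {ℓ h} → PeakedSolution ℓ (suc h) → ∀ e → 0ℚ ≤ ℓ → 0ℚ < 4ℚ - ℓ → ∀ {Y} → 2ℚ * ℓ ≡ (4ℚ - ℓ) * Y →
  Σ[ μ ∈ ℝ ] CubicConnectivity (Chain.order-of ends (suc h ℕ.+ e)) μ × μ ≤ᴿ fromℚ Y
chain-connectivity ends {ℓ} {h} solution e 0≤ℓ 0<4-ℓ {Y} Y-def = at (suc h ℕ.+ e) (bump-length (suc h) e) refl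
  where
  at : ∀ M → double M ≡ suc h ℕ.+ (double e ℕ.+ suc h) → ∀ {n} → Chain.order-of ends M ≡ suc (suc n) →
    Σ[ μ ∈ ℝ ] CubicConnectivity (Chain.order-of ends M) μ × μ ≤ᴿ fromℚ Y
  at M 2M≡K size = connectivity-upper size (Bridged.graph B) (Bridged.connected B) (Bridged.cubic B)
    (ChainTest.test-plane ends solution (double e) M 2M≡K 0<4-ℓ 0≤ℓ Y-def)
    where B = Chain.chain ends M

-- The ends: two five-vertex ends, or a five- and a seven-vertex end.

module FromTable {n} (table : Vec (Vec ℕ 3) (suc n)) where
  open Data.Bool using (_∨_)

  adjacent : Fin (suc n) → Fin (suc n) → Bool
  adjacent i j = let row = lookup table i in
    (lookup row zero ℕ.≡ᵇ toℕ j) ∨ ((lookup row (suc zero) ℕ.≡ᵇ toℕ j) ∨ (lookup row (suc (suc zero)) ℕ.≡ᵇ toℕ j))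

  left : Fin (suc n) → Bool
  left i = toℕ i ℕ.<ᵇ 5

  -- Ordered pairs again, so the total 2 required by `Build` means that one edge joins the two ends.
  crossing : Fin (suc n) → Fin (suc n) → ℕ
  crossing i j = bit (adjacent i j) ℕ.* bit (left i xor left j)

  -- Every vertex but the first has a smaller neighbour, hence the graph is connected.
  module Build
    (symmetric : ∀ i j → adjacent i j ≡ adjacent j i)
    (loopless  : ∀ i → adjacent i i ≡ false)
    (cubic     : ∀ i → ∣ tabulate (adjacent i) ∣ ≡ 3)
    (smaller   : ∀ i → ∃ λ j → adjacent (suc i) j ≡ true × toℕ j ℕ.≤ toℕ i)
    (cross     : ℕΣ.sum (λ i → ℕΣ.sum (crossing i)) ≡ 2)
    (left-many : 2 ℕ.≤ ℕΣ.sum (bit ∘ left))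
    (right-many : 2 ℕ.≤ ℕΣ.sum (bit ∘ not ∘ left))
    (v : Fin (suc n)) (edge : adjacent zero v ≡ true) (right-v : left v ≡ false) where

    graph : Graph (suc n)
    graph = record { adjacent = adjacent ; symmetric = symmetric ; loopless = loopless }

    to-zero : ∀ k i → toℕ i ℕ.≤ k → Star (λ i j → Bool.T (adjacent i j)) i zero
    to-zero k       zero    _         = Star.ε
    to-zero (suc k) (suc i) (s≤s i≤k) = let j , ij , j≤i = smaller i in
      subst Bool.T (sym ij) tt ◅ to-zero k j (ℕ.≤-trans j≤i i≤k)

    connected : Connected graph
    connected i j = to-zero (toℕ i) i ℕ.≤-refl ◅◅ Star.reverse (λ {i} {j} → subst Bool.T (symmetric i j)) (to-zero (toℕ j) j ℕ.≤-refl)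

    value : ℚ → ℚ → Fin (suc n) → ℚ
    value α ω i = if left i then α else ω

    value-energy : ∀ α ω → Laplacian.energy graph (value α ω) ≡ 2ℚ * sq (α - ω)
    value-energy α ω = begin
      Laplacian.energy graph (value α ω)    ≡⟨ sum-cong (λ i → trans (sum-cong λ j → term (bit (adjacent i j)) (left i) (left j)) (trans (sum-*ʳ (sq (α - ω)) (ι ∘ crossing i)) (cong (_* sq (α - ω)) (sym (ι-sum (crossing i)))))) ⟩
      sum (λ i → ι (ℕΣ.sum (crossing i)) * sq (α - ω)) ≡⟨ trans (sum-*ʳ (sq (α - ω)) (λ i → ι (ℕΣ.sum (crossing i)))) (cong (_* sq (α - ω)) (sym (ι-sum (λ i → ℕΣ.sum (crossing i))))) ⟩
      ι (ℕΣ.sum (λ i → ℕΣ.sum (crossing i))) * sq (α - ω) ≡⟨ cong (λ z → ι z * sq (α - ω)) cross ⟩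
      2ℚ * sq (α - ω)                       ∎
      where
      open ≡-Reasoning
      same : ∀ w x a → w * ((x - x) * (x - x)) ≡ w * 0ℚ * a
      same = solve-∀ ringℚ
      swap : ∀ w α ω → w * ((ω - α) * (ω - α)) ≡ w * 1ℚ * ((α - ω) * (α - ω))
      swap = solve-∀ ringℚ
      term : ∀ w p q → ι w * sq ((if p then α else ω) - (if q then α else ω)) ≡ ι (w ℕ.* bit (p xor q)) * sq (α - ω)
      term w p q = trans (cases p q) (cong (_* sq (α - ω)) (sym (ι-* w (bit (p xor q)))))
        where
        cases : ∀ p q → ι w * sq ((if p then α else ω) - (if q then α else ω)) ≡ ι w * ι (bit (p xor q)) * sq (α - ω)
        cases true  true  = same (ι w) α (sq (α - ω))
        cases true  false = cong (_* sq (α - ω)) (sym (*-identityʳ (ι w)))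
        cases false true  = swap (ι w) α ω
        cases false false = same (ι w) ω (sq (α - ω))

    value-norm : ∀ α ω → 2ℚ * sq α + 2ℚ * sq ω ≤ ∥ value α ω ∥²
    value-norm α ω = ≤-trans (+-mono-≤ (*-monoʳ-≤-nonNeg (sq α) {{nonNegative (0≤sq α)}} (ι-mono-≤ left-many)) (*-monoʳ-≤-nonNeg (sq ω) {{nonNegative (0≤sq ω)}} (ι-mono-≤ right-many)))
      (≤-reflexive (trans (cong₂ (λ x z → x * sq α + z * sq ω) (ι-sum (bit ∘ left)) (ι-sum (bit ∘ not ∘ left)))
        (trans (sym (cong₂ _+_ (sum-*ʳ (sq α) (ι ∘ bit ∘ left)) (sum-*ʳ (sq ω) (ι ∘ bit ∘ not ∘ left))))
          (trans (sym (sum-+ (λ i → ι (bit (left i)) * sq α) (λ i → ι (bit (not (left i))) * sq ω))) (sum-cong λ i → term (left i))))))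
      where
      term : ∀ p → ι (bit p) * sq α + ι (bit (not p)) * sq ω ≡ sq (if p then α else ω)
      term true  = first (sq α) (sq ω)
        where
        first : ∀ a b → 1ℚ * a + 0ℚ * b ≡ a
        first = solve-∀ ringℚ
      term false = second (sq α) (sq ω)
        where
        second : ∀ a b → 0ℚ * a + 1ℚ * b ≡ b
        second = solve-∀ ringℚ

    ends : Ends (suc n)
    ends = record
      { bridged = record { graph = graph ; connected = connected ; cubic = cubic ; u = zero ; v = v ; edge = edge }
      ; left = left ; left-u = refl ; right-v = right-v ; energy₀ = value-energy ; norm₀ = value-norm }

-- Row i lists the neighbours of i; the ends are joined by the edge from 0 to 5. A diamond adds four
-- vertices, so starting from 10 and from 12 vertices reaches both even residues modulo 4.
table₁₀ : Vec (Vec ℕ 3) 10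
table₁₀ = (1 ∷ 2 ∷ 5 ∷ []) ∷ (0 ∷ 3 ∷ 4 ∷ []) ∷ (0 ∷ 3 ∷ 4 ∷ []) ∷ (1 ∷ 2 ∷ 4 ∷ []) ∷ (1 ∷ 2 ∷ 3 ∷ [])
        ∷ (0 ∷ 6 ∷ 7 ∷ []) ∷ (5 ∷ 8 ∷ 9 ∷ []) ∷ (5 ∷ 8 ∷ 9 ∷ []) ∷ (6 ∷ 7 ∷ 9 ∷ []) ∷ (6 ∷ 7 ∷ 8 ∷ []) ∷ []

table₁₂ : Vec (Vec ℕ 3) 12
table₁₂ = (1 ∷ 2 ∷ 5 ∷ []) ∷ (0 ∷ 3 ∷ 4 ∷ []) ∷ (0 ∷ 3 ∷ 4 ∷ []) ∷ (1 ∷ 2 ∷ 4 ∷ []) ∷ (1 ∷ 2 ∷ 3 ∷ [])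
        ∷ (0 ∷ 6 ∷ 7 ∷ []) ∷ (5 ∷ 8 ∷ 9 ∷ []) ∷ (5 ∷ 10 ∷ 11 ∷ []) ∷ (6 ∷ 10 ∷ 11 ∷ []) ∷ (6 ∷ 10 ∷ 11 ∷ []) ∷ (7 ∷ 8 ∷ 9 ∷ []) ∷ (7 ∷ 8 ∷ 9 ∷ []) ∷ []

ends₁₀ : Ends 10
ends₁₀ = FromTable.Build.ends table₁₀
  (toWitness {a? = Fin.all? λ i → Fin.all? λ j → adjacent i j ≟ᵇ adjacent j i} tt)
  (toWitness {a? = Fin.all? λ i → adjacent i i ≟ᵇ false} tt)
  (toWitness {a? = Fin.all? λ i → ∣ tabulate (adjacent i) ∣ ℕ.≟ 3} tt)
  (toWitness {a? = Fin.all? λ i → Fin.any? λ j → (adjacent (suc i) j ≟ᵇ true) ×-dec (toℕ j ℕ.≤? toℕ i)} tt)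
  refl (s≤s (s≤s z≤n)) (s≤s (s≤s z≤n)) (Fin.fromℕ< {5} (s≤s (s≤s (s≤s (s≤s (s≤s (s≤s z≤n))))))) refl refl
  where
  open FromTable table₁₀ using (adjacent)

ends₁₂ : Ends 12
ends₁₂ = FromTable.Build.ends table₁₂
  (toWitness {a? = Fin.all? λ i → Fin.all? λ j → adjacent i j ≟ᵇ adjacent j i} tt)
  (toWitness {a? = Fin.all? λ i → adjacent i i ≟ᵇ false} tt)
  (toWitness {a? = Fin.all? λ i → ∣ tabulate (adjacent i) ∣ ℕ.≟ 3} tt)
  (toWitness {a? = Fin.all? λ i → Fin.any? λ j → (adjacent (suc i) j ≟ᵇ true) ×-dec (toℕ j ℕ.≤? toℕ i)} tt)
  refl (s≤s (s≤s z≤n)) (s≤s (s≤s z≤n)) (Fin.fromℕ< {5} (s≤s (s≤s (s≤s (s≤s (s≤s (s≤s z≤n))))))) refl refl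
  where
  open FromTable table₁₂ using (adjacent)

-- The partial sums of the Leibniz series as a discrete arctangent.

/-cancel : ∀ a b → (+ a / suc b) * ι (suc b) ≡ ι a
/-cancel a b = toℚᵘ-injective (ℚᵘ.≃-trans (toℚᵘ-homo-* (+ a / suc b) (ι (suc b)))
  (ℚᵘ.≃-trans (ℚᵘ.*-cong (toℚᵘ-fromℚᵘ (ℚᵘ.mkℚᵘ (+ a) b)) (ι-toℚᵘ (suc b)))
  (ℚᵘ.≃-trans (ℚᵘ.*≡* (trans (ℤ.*-identityʳ (+ a ℤ.* + suc b)) (cong (λ z → + a ℤ.* + z) (sym (ℕ.*-identityʳ (suc b))))))
  (ℚᵘ.≃-sym (ι-toℚᵘ a)))))

1^n≡1 : ∀ n → 1ℚ ^ n ≡ 1ℚ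
1^n≡1 zero    = refl
1^n≡1 (suc n) = trans (*-identityˡ (1ℚ ^ n)) (1^n≡1 n)

^-nonneg : ∀ {x} → 0ℚ ≤ x → ∀ n → 0ℚ ≤ x ^ n
^-nonneg 0≤x zero    = <⇒≤ 0<1
^-nonneg 0≤x (suc n) = 0≤* 0≤x (^-nonneg 0≤x n)

^-≤1 : ∀ {x} → 0ℚ ≤ x → x ≤ 1ℚ → ∀ n → x ^ n ≤ 1ℚ
^-≤1 0≤x x≤1 zero    = ≤-refl
^-≤1 0≤x x≤1 (suc n) = *-mono-≤ (^-nonneg 0≤x n) (<⇒≤ 0<1) x≤1 (^-≤1 0≤x x≤1 n)

triangular : ℕ → ℚ
triangular zero    = 0ℚ
triangular (suc q) = triangular q + ι (suc q)

0≤triangular : ∀ q → 0ℚ ≤ triangular q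
0≤triangular zero    = ≤-refl
0≤triangular (suc q) = 0≤+ (0≤triangular q) (0≤ι (suc q))

-- Taylor's formula to first order: `triangular q` is q (q + 1) / 2, half the largest second
-- derivative of the (q + 1)-st power on [0, 1].
power-remainder : ∀ {x y} → 0ℚ ≤ x → x ≤ y → y ≤ 1ℚ → ∀ q →
  let R = y ^ suc q - x ^ suc q - ι (suc q) * (y - x) * x ^ q in 0ℚ ≤ R × R ≤ triangular q * sq (y - x)
power-remainder {x} {y} 0≤x x≤y y≤1 zero = ≤-reflexive (sym (vanish x y)) , ≤-reflexive (trans (vanish x y) (sym (*-zeroˡ (sq (y - x)))))
  where
  vanish : ∀ x y → y * 1ℚ - x * 1ℚ - ι 1 * (y - x) * 1ℚ ≡ 0ℚ
  vanish = solve-∀ ringℚ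
power-remainder {x} {y} 0≤x x≤y y≤1 (suc q) with power-remainder 0≤x x≤y y≤1 q
... | 0≤R , R≤ = subst (λ z → 0ℚ ≤ z × z ≤ triangular (suc q) * sq (y - x)) (sym (step x y (x ^ q) (y ^ q) (ι (suc q))))
    ( 0≤+ (0≤* 0≤y 0≤R) (0≤* (0≤* (0≤ι (suc q)) (0≤sq (y - x))) (^-nonneg 0≤x q))
    , (begin
      y * R + ι (suc q) * sq (y - x) * x ^ q  ≤⟨ +-mono-≤ (*-mono-≤ 0≤R (<⇒≤ 0<1) y≤1 R≤) (*-monoˡ (0≤* (0≤ι (suc q)) (0≤sq (y - x))) (^-≤1 0≤x (≤-trans x≤y y≤1) q)) ⟩
      1ℚ * (triangular q * sq (y - x)) + ι (suc q) * sq (y - x) * 1ℚ ≡⟨ collect (triangular q) (ι (suc q)) (sq (y - x)) ⟩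
      triangular (suc q) * sq (y - x)         ∎))
  where
  open ≤-Reasoning
  0≤y = ≤-trans 0≤x x≤y
  R = y ^ suc q - x ^ suc q - ι (suc q) * (y - x) * x ^ q
  step : ∀ x y X Y n → y * (y * Y) - x * (x * X) - (1ℚ + n) * (y - x) * (x * X) ≡ y * (y * Y - x * X - n * (y - x) * X) + n * ((y - x) * (y - x)) * X
  step = solve-∀ ringℚ
  collect : ∀ t n s → 1ℚ * (t * s) + n * s * 1ℚ ≡ (t + n) * s
  collect = solve-∀ ringℚ

-- A partial sum of the power series of 4 arctan x. The factor 4 is already in `leibnizTerm`, and at
-- x = 1 the sum is `leibnizSum`.
arctan₄ : ℕ → ℚ → ℚ
arctan₄ zero    x = 0ℚ
arctan₄ (suc m) x = arctan₄ m x + leibnizSign m * leibnizTerm m * x ^ suc (double m)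

arctan₄-1 : ∀ K → arctan₄ K 1ℚ ≡ leibnizSum K
arctan₄-1 zero    = refl
arctan₄-1 (suc m) = cong₂ _+_ (arctan₄-1 m) (trans (cong (leibnizSign m * leibnizTerm m *_) (1^n≡1 (suc (double m)))) (*-identityʳ _))

arctan₄-0 : ∀ K → arctan₄ K 0ℚ ≡ 0ℚ
arctan₄-0 zero    = refl
arctan₄-0 (suc m) = trans (cong₂ _+_ (arctan₄-0 m) (trans (cong (leibnizSign m * leibnizTerm m *_) (*-zeroˡ (0ℚ ^ double m))) (*-zeroʳ (leibnizSign m * leibnizTerm m)))) refl

geometric : ℕ → ℚ → ℚ
geometric zero    x = 0ℚ
geometric (suc m) x = geometric m x + leibnizSign m * x ^ double m

geometric-sum : ∀ K x → (1ℚ + x * x) * geometric K x ≡ 1ℚ - leibnizSign K * x ^ double K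
geometric-sum zero    x = vanish x
  where
  vanish : ∀ x → (1ℚ + x * x) * 0ℚ ≡ 1ℚ - 1ℚ * 1ℚ
  vanish = solve-∀ ringℚ
geometric-sum (suc m) x = trans (distribute x (geometric m x) (leibnizSign m) (x ^ double m)) (trans (cong (λ z → z + (1ℚ + x * x) * (leibnizSign m * x ^ double m)) (geometric-sum m x)) (step x (leibnizSign m) (x ^ double m)))
  where
  distribute : ∀ x g s X → (1ℚ + x * x) * (g + s * X) ≡ (1ℚ + x * x) * g + (1ℚ + x * x) * (s * X)
  distribute = solve-∀ ringℚ
  step : ∀ x s X → 1ℚ - s * X + (1ℚ + x * x) * (s * X) ≡ 1ℚ - (- s) * (x * (x * X))
  step = solve-∀ ringℚ

2*≡double : ∀ m → 2 ℕ.* m ≡ double m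
2*≡double zero    = refl
2*≡double (suc m) = trans (shift-2 m) (cong (λ z → suc (suc z)) (2*≡double m))
  where
  shift-2 : ∀ m → 2 ℕ.* suc m ≡ suc (suc (2 ℕ.* m))
  shift-2 = solve-ℕ

leibnizTerm-def : ∀ m → leibnizTerm m * ι (suc (double m)) ≡ 4ℚ
leibnizTerm-def m = trans (cong (λ z → leibnizTerm m * ι (suc z)) (sym (2*≡double m))) (/-cancel 4 (2 ℕ.* m))

0≤leibnizTerm : ∀ m → 0ℚ ≤ leibnizTerm m
0≤leibnizTerm m = *-cancelˡ (0<ι (double m)) (≤-trans (≤-reflexive (*-zeroʳ (ι (suc (double m))))) (≤-trans (0≤ι 4) (≤-reflexive (trans (sym (leibnizTerm-def m)) (*-comm (leibnizTerm m) (ι (suc (double m))))))))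

leibnizTerm≤4 : ∀ m → leibnizTerm m ≤ 4ℚ
leibnizTerm≤4 m = ≤-trans (≤-trans (≤-reflexive (sym (*-identityʳ (leibnizTerm m)))) (*-monoˡ (0≤leibnizTerm m) (ι-mono-≤ {1} {suc (double m)} (s≤s z≤n)))) (≤-reflexive (leibnizTerm-def m))

∣leibnizSign∣≡1 : ∀ m → ℚ.∣ leibnizSign m ∣ ≡ 1ℚ
∣leibnizSign∣≡1 zero    = refl
∣leibnizSign∣≡1 (suc m) = trans (∣-p∣≡∣p∣ (leibnizSign m)) (∣leibnizSign∣≡1 m)

curvature : ℕ → ℚ
curvature zero    = 0ℚ
curvature (suc m) = curvature m + 4ℚ * triangular (double m)

0≤curvature : ∀ K → 0ℚ ≤ curvature K
0≤curvature zero    = ≤-refl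
0≤curvature (suc m) = 0≤+ (0≤curvature m) (0≤* (0≤ι 4) (0≤triangular (double m)))

taylor-step : ∀ {A B s a Y X n d g p κ t} → a * n ≡ 4ℚ → ℚ.∣ s ∣ ≡ 1ℚ → 0ℚ ≤ a → a ≤ 4ℚ →
  0ℚ ≤ Y - X - n * d * p → Y - X - n * d * p ≤ t * sq d → ℚ.∣ A - B - 4ℚ * d * g ∣ ≤ κ * sq d →
  ℚ.∣ (A + s * a * Y) - (B + s * a * X) - 4ℚ * d * (g + s * p) ∣ ≤ (κ + 4ℚ * t) * sq d
taylor-step {A} {B} {s} {a} {Y} {X} {n} {d} {g} {p} {κ} {t} an≡4 ∣s∣≡1 0≤a a≤4 0≤R R≤ IH = begin
  ℚ.∣ (A + s * a * Y) - (B + s * a * X) - 4ℚ * d * (g + s * p) ∣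
    ≡⟨ cong ℚ.∣_∣ (trans (cong (λ z → (A + s * a * Y) - (B + s * a * X) - z * d * (g + s * p)) (sym an≡4))
         (trans (regroup A B s a Y X n d g p) (cong (λ z → A - B - z * d * g + s * (a * R)) an≡4))) ⟩
  ℚ.∣ (A - B - 4ℚ * d * g) + s * (a * R) ∣
    ≤⟨ abs+-≤ {A - B - 4ℚ * d * g} {s * (a * R)} IH (≤-trans (≤-reflexive ∣saR∣) (*-mono-≤ 0≤R (0≤ι 4) a≤4 R≤)) ⟩
  κ * sq d + 4ℚ * (t * sq d) ≡⟨ collect κ t (sq d) ⟩
  (κ + 4ℚ * t) * sq d ∎
  where
  open ≤-Reasoning
  R = Y - X - n * d * p
  ∣saR∣ : ℚ.∣ s * (a * R) ∣ ≡ a * R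
  ∣saR∣ = trans (∣p*q∣≡∣p∣*∣q∣ s (a * R)) (trans (cong (_* ℚ.∣ a * R ∣) ∣s∣≡1) (trans (*-identityˡ ℚ.∣ a * R ∣) (0≤p⇒∣p∣≡p (0≤* 0≤a 0≤R))))
  regroup : ∀ A B s a Y X n d g p → (A + s * a * Y) - (B + s * a * X) - a * n * d * (g + s * p) ≡ A - B - a * n * d * g + s * (a * (Y - X - n * d * p))
  regroup = solve-∀ ringℚ
  collect : ∀ c t s → c * s + 4ℚ * (t * s) ≡ (c + 4ℚ * t) * s
  collect = solve-∀ ringℚ

-- The derivative of arctan₄ K is 4 geometric K.
arctan₄-taylor : ∀ K {x y} → 0ℚ ≤ x → x ≤ y → y ≤ 1ℚ →
  ℚ.∣ arctan₄ K y - arctan₄ K x - 4ℚ * (y - x) * geometric K x ∣ ≤ curvature K * sq (y - x)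
arctan₄-taylor zero {x} {y} 0≤x x≤y y≤1 = ≤-reflexive (trans (cong ℚ.∣_∣ (vanish (y - x))) (sym (*-zeroˡ (sq (y - x)))))
  where
  vanish : ∀ d → 0ℚ - 0ℚ - 4ℚ * d * 0ℚ ≡ 0ℚ
  vanish = solve-∀ ringℚ
arctan₄-taylor (suc m) {x} {y} 0≤x x≤y y≤1 =
  taylor-step {arctan₄ m y} {arctan₄ m x} {leibnizSign m} {leibnizTerm m} {y ^ suc (double m)} {x ^ suc (double m)} {ι (suc (double m))} {y - x}
    {geometric m x} {x ^ double m} {curvature m} {triangular (double m)}
    (leibnizTerm-def m) (∣leibnizSign∣≡1 m) (0≤leibnizTerm m) (leibnizTerm≤4 m)
    (proj₁ (power-remainder 0≤x x≤y y≤1 (double m))) (proj₂ (power-remainder 0≤x x≤y y≤1 (double m))) (arctan₄-taylor m 0≤x x≤y y≤1)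

sign-even : ∀ j → leibnizSign (double j) ≡ 1ℚ
sign-even zero    = refl
sign-even (suc j) = trans (involutive (leibnizSign (double j))) (sign-even j)
  where
  involutive : ∀ x → - - x ≡ x
  involutive = solve-∀ ringℚ

-- The last hypothesis is the addition law of the tangent without division: if x is the tangent of
-- an angle, then y is the tangent of that angle plus arctan T.
module RotationStep {x y T : ℚ} (0≤x : 0ℚ ≤ x) (x≤y : x ≤ y) (y≤1 : y ≤ 1ℚ) (0≤T : 0ℚ ≤ T) (y-x : y - x ≡ T * (1ℚ + x * y)) where
  open ≤-Reasoning

  x≤1 : x ≤ 1ℚ
  x≤1 = ≤-trans x≤y y≤1

  difference-≤ : y - x ≤ 2ℚ * T
  difference-≤ = begin
    y - x               ≡⟨ y-x ⟩
    T * (1ℚ + x * y)    ≤⟨ *-monoˡ 0≤T (+-monoʳ-≤ 1ℚ (*-mono-≤ (≤-trans 0≤x x≤y) (<⇒≤ 0<1) x≤1 y≤1)) ⟩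
    T * (1ℚ + 1ℚ * 1ℚ)  ≡⟨ *-comm T (1ℚ + 1ℚ * 1ℚ) ⟩
    2ℚ * T              ∎

  difference-sq-≤ : sq (y - x) ≤ 4ℚ * (T * T)
  difference-sq-≤ = ≤-trans (*-mono-≤ (diff x≤y) (0≤* (0≤ι 2) 0≤T) difference-≤ difference-≤) (≤-reflexive (square T))
    where
    square : ∀ T → 2ℚ * T * (2ℚ * T) ≡ 4ℚ * (T * T)
    square = solve-∀ ringℚ

  difference-split : ∀ g → (y - x) * g ≡ T * ((1ℚ + x * x) * g) + T * (x * (y - x) * g)
  difference-split g = trans (cong (_* g) y-x) (expand x y T g)
    where
    expand : ∀ x y T g → T * (1ℚ + x * y) * g ≡ T * ((1ℚ + x * x) * g) + T * (x * (y - x) * g)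
    expand = solve-∀ ringℚ

  slope-≤ : ∀ g → 0ℚ ≤ g → g ≤ 1ℚ → (1ℚ + x * x) * g ≤ 1ℚ → (y - x) * g ≤ T + 2ℚ * (T * T)
  slope-≤ g 0≤g g≤1 ≤1 = begin
    (y - x) * g                                       ≡⟨ difference-split g ⟩
    T * ((1ℚ + x * x) * g) + T * (x * (y - x) * g)    ≤⟨ +-mono-≤ (*-monoˡ 0≤T ≤1) (*-monoˡ 0≤T (*-mono-≤ 0≤g (0≤* (<⇒≤ 0<1) (0≤* (0≤ι 2) 0≤T)) (*-mono-≤ (diff x≤y) (<⇒≤ 0<1) x≤1 difference-≤) g≤1)) ⟩
    T * 1ℚ + T * (1ℚ * (2ℚ * T) * 1ℚ)                 ≡⟨ tidy T ⟩
    T + 2ℚ * (T * T)                                  ∎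
    where
    tidy : ∀ T → T * 1ℚ + T * (1ℚ * (2ℚ * T) * 1ℚ) ≡ T + 2ℚ * (T * T)
    tidy = solve-∀ ringℚ

  slope-≥ : ∀ g → 0ℚ ≤ g → 1ℚ ≤ (1ℚ + x * x) * g → T ≤ (y - x) * g
  slope-≥ g 0≤g ≥1 = begin
    T                                                 ≡⟨ tidy T ⟩
    T * 1ℚ + 0ℚ                                       ≤⟨ +-mono-≤ (*-monoˡ 0≤T ≥1) (0≤* 0≤T (0≤* (0≤* 0≤x (diff x≤y)) 0≤g)) ⟩
    T * ((1ℚ + x * x) * g) + T * (x * (y - x) * g)    ≡⟨ difference-split g ⟨
    (y - x) * g                                       ∎
    where
    tidy : ∀ T → T ≡ T * 1ℚ + 0ℚ
    tidy = solve-∀ ringℚ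

0<1+x² : ∀ x → 0ℚ < 1ℚ + x * x
0<1+x² x = +-mono-<-≤ 0<1 (0≤sq x)

-- Even partial sums of the Leibniz series underestimate the arctangent.
module EvenSum (K : ℕ) (sign : leibnizSign K ≡ 1ℚ) where

  A : ℚ → ℚ
  A = arctan₄ K

  E : ℚ
  E = ι 8 + 4ℚ * curvature K

  0≤E : 0ℚ ≤ E
  0≤E = 0≤+ (0≤ι 8) (0≤* (0≤ι 4) (0≤curvature K))

  g : ℚ → ℚ
  g = geometric K

  module _ (x : ℚ) (0≤x : 0ℚ ≤ x) (x≤1 : x ≤ 1ℚ) where

    value : (1ℚ + x * x) * g x ≡ 1ℚ - 1ℚ * x ^ double K
    value = trans (geometric-sum K x) (cong (λ s → 1ℚ - s * x ^ double K) sign)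

    0≤g : 0ℚ ≤ g x
    0≤g = *-cancelˡ (0<1+x² x) (≤-trans (≤-reflexive (*-zeroʳ (1ℚ + x * x))) (≤-trans (diff (≤-trans (≤-reflexive (*-identityˡ _)) (^-≤1 0≤x x≤1 (double K)))) (≤-reflexive (sym value))))

    [1+x²]g≤1 : (1ℚ + x * x) * g x ≤ 1ℚ
    [1+x²]g≤1 = ≤-trans (≤-reflexive value) (from-diff (^-nonneg 0≤x (double K)) (cancel (x ^ double K)))
      where
      cancel : ∀ X → 1ℚ - (1ℚ - 1ℚ * X) ≡ X
      cancel = solve-∀ ringℚ

    g≤1 : g x ≤ 1ℚ
    g≤1 = ≤-trans (from-diff (0≤* (0≤sq x) 0≤g) (expand x (g x))) [1+x²]g≤1
      where
      expand : ∀ x g → (1ℚ + x * x) * g - g ≡ x * x * g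
      expand = solve-∀ ringℚ

  upper : ∀ {x y} → 0ℚ ≤ x → x ≤ y → y ≤ 1ℚ → A y ≤ A x + 4ℚ * ((y - x) * g x) + curvature K * sq (y - x)
  upper {x} {y} 0≤x x≤y y≤1 = from-diff (diff (≤-trans (p≤∣p∣ _) (arctan₄-taylor K 0≤x x≤y y≤1))) (regroup (A x) (A y) (y - x) (g x) (curvature K * sq (y - x)))
    where
    regroup : ∀ a b d g c → a + 4ℚ * (d * g) + c - b ≡ c - (b - a - 4ℚ * d * g)
    regroup = solve-∀ ringℚ

  -- For an even sum (1 + x²) g x ≤ 1, and y - x is close to T (1 + x²). So a rotation by arctan T
  -- raises A by at most 4 T, up to a multiple of T².
  step : ∀ {x y T} → 0ℚ ≤ x → x ≤ y → y ≤ 1ℚ → 0ℚ ≤ T → y - x ≡ T * (1ℚ + x * y) → A y ≤ A x + (4ℚ * T + E * (T * T))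
  step {x} {y} {T} 0≤x x≤y y≤1 0≤T y-x = begin
    A y                                               ≤⟨ upper 0≤x x≤y y≤1 ⟩
    A x + 4ℚ * ((y - x) * g x) + curvature K * sq (y - x)
      ≤⟨ +-mono-≤ (+-monoʳ-≤ (A x) (*-monoˡ (0≤ι 4) (slope-≤ (g x) (0≤g x 0≤x x≤1) (g≤1 x 0≤x x≤1) ([1+x²]g≤1 x 0≤x x≤1)))) (*-monoˡ (0≤curvature K) difference-sq-≤) ⟩
    A x + 4ℚ * (T + 2ℚ * (T * T)) + curvature K * (4ℚ * (T * T)) ≡⟨ collect (A x) T (curvature K) ⟩
    A x + (4ℚ * T + E * (T * T))                      ∎
    where
    open ≤-Reasoning
    open RotationStep 0≤x x≤y y≤1 0≤T y-x
    collect : ∀ a T c → a + 4ℚ * (T + 2ℚ * (T * T)) + c * (4ℚ * (T * T)) ≡ a + (4ℚ * T + (ι 8 + 4ℚ * c) * (T * T))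
    collect = solve-∀ ringℚ

  to-one : ∀ {x T} → 0ℚ ≤ x → x ≤ 1ℚ → 0ℚ ≤ T → T ≤ 1ℚ → 1ℚ - x ≤ 2ℚ * T → A 1ℚ ≤ A x + E * T
  to-one {x} {T} 0≤x x≤1 0≤T T≤1 near = begin
    A 1ℚ                                              ≤⟨ upper 0≤x x≤1 ≤-refl ⟩
    A x + 4ℚ * ((1ℚ - x) * g x) + curvature K * sq (1ℚ - x)
      ≤⟨ +-mono-≤ (+-monoʳ-≤ (A x) (*-monoˡ (0≤ι 4) (*-mono-≤ (0≤g x 0≤x x≤1) (0≤* (0≤ι 2) 0≤T) near (g≤1 x 0≤x x≤1)))) (*-monoˡ (0≤curvature K) (*-mono-≤ (diff x≤1) (0≤* (0≤ι 2) 0≤T) near near)) ⟩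
    A x + 4ℚ * (2ℚ * T * 1ℚ) + curvature K * (2ℚ * T * (2ℚ * T)) ≤⟨ from-diff (0≤* (0≤* (0≤* (0≤ι 4) (0≤curvature K)) 0≤T) (diff T≤1)) (collect (A x) T (curvature K)) ⟩
    A x + E * T                                       ∎
    where
    open ≤-Reasoning
    collect : ∀ a T c → a + (ι 8 + 4ℚ * c) * T - (a + 4ℚ * (2ℚ * T * 1ℚ) + c * (2ℚ * T * (2ℚ * T))) ≡ 4ℚ * c * T * (1ℚ - T)
    collect = solve-∀ ringℚ

-- Odd partial sums overestimate it.
module OddSum (K : ℕ) (sign : leibnizSign K ≡ - 1ℚ) where

  A : ℚ → ℚ
  A = arctan₄ K

  E : ℚ
  E = 4ℚ * curvature K

  0≤E : 0ℚ ≤ E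
  0≤E = 0≤* (0≤ι 4) (0≤curvature K)

  g : ℚ → ℚ
  g = geometric K

  module _ (x : ℚ) (0≤x : 0ℚ ≤ x) where

    1≤[1+x²]g : 1ℚ ≤ (1ℚ + x * x) * g x
    1≤[1+x²]g = ≤-trans (from-diff (^-nonneg 0≤x (double K)) (cancel (x ^ double K))) (≤-reflexive (sym (trans (geometric-sum K x) (cong (λ s → 1ℚ - s * x ^ double K) sign))))
      where
      cancel : ∀ X → 1ℚ - (- 1ℚ) * X - 1ℚ ≡ X
      cancel = solve-∀ ringℚ

    0≤g : 0ℚ ≤ g x
    0≤g = *-cancelˡ (0<1+x² x) (≤-trans (≤-reflexive (*-zeroʳ (1ℚ + x * x))) (≤-trans (<⇒≤ 0<1) 1≤[1+x²]g))

  lower : ∀ {x y} → 0ℚ ≤ x → x ≤ y → y ≤ 1ℚ → A x + 4ℚ * ((y - x) * g x) - curvature K * sq (y - x) ≤ A y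
  lower {x} {y} 0≤x x≤y y≤1 = from-diff (diff (≤-trans (neg-antimono-≤ (arctan₄-taylor K 0≤x x≤y y≤1)) (-∣p∣≤p _))) (regroup (A x) (A y) (y - x) (g x) (curvature K * sq (y - x)))
    where
    regroup : ∀ a b d g c → b - (a + 4ℚ * (d * g) - c) ≡ b - a - 4ℚ * d * g - - c
    regroup = solve-∀ ringℚ

  step : ∀ {x y T} → 0ℚ ≤ x → x ≤ y → y ≤ 1ℚ → 0ℚ ≤ T → y - x ≡ T * (1ℚ + x * y) → A x + (4ℚ * T - E * (T * T)) ≤ A y
  step {x} {y} {T} 0≤x x≤y y≤1 0≤T y-x = begin
    A x + (4ℚ * T - E * (T * T))                      ≡⟨ collect (A x) T (curvature K) ⟩
    A x + 4ℚ * T - curvature K * (4ℚ * (T * T))       ≤⟨ +-mono-≤ (+-monoʳ-≤ (A x) (*-monoˡ (0≤ι 4) (slope-≥ (g x) (0≤g x 0≤x) (1≤[1+x²]g x 0≤x)))) (neg-antimono-≤ (*-monoˡ (0≤curvature K) difference-sq-≤)) ⟩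
    A x + 4ℚ * ((y - x) * g x) - curvature K * sq (y - x) ≤⟨ lower 0≤x x≤y y≤1 ⟩
    A y                                               ∎
    where
    open ≤-Reasoning
    open RotationStep 0≤x x≤y y≤1 0≤T y-x
    collect : ∀ a T c → a + (4ℚ * T - 4ℚ * c * (T * T)) ≡ a + 4ℚ * T - c * (4ℚ * (T * T))
    collect = solve-∀ ringℚ

  short-step : ∀ {x y} → 0ℚ ≤ x → x ≤ y → y ≤ 1ℚ → curvature K * (y - x) ≤ 2ℚ → A x ≤ A y
  short-step {x} {y} 0≤x x≤y y≤1 short = ≤-trans (from-diff (0≤* (diff x≤y) (0≤+ (diff 2≤4g) (diff short))) (regroup (A x) (y - x) (g x) (curvature K))) (lower 0≤x x≤y y≤1)
    where
    regroup : ∀ a d g c → a + 4ℚ * (d * g) - c * (d * d) - a ≡ d * ((4ℚ * g - 2ℚ) + (2ℚ - c * d))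
    regroup = solve-∀ ringℚ
    2≤4g : 2ℚ ≤ 4ℚ * g x
    2≤4g = ≤-trans (*-monoˡ (0≤ι 2) (1≤[1+x²]g x 0≤x)) (from-diff (0≤* (0≤* (0≤ι 2) (0≤g x 0≤x)) (diff (*-mono-≤ 0≤x (<⇒≤ 0<1) (≤-trans x≤y y≤1) (≤-trans x≤y y≤1)))) (expand x (g x)))
      where
      expand : ∀ x g → 4ℚ * g - 2ℚ * ((1ℚ + x * x) * g) ≡ 2ℚ * g * (1ℚ * 1ℚ - x * x)
      expand = solve-∀ ringℚ

  -- Reach 1 from x in n short steps.
  ≤A1 : ∀ {x} → 0ℚ ≤ x → x ≤ 1ℚ → A x ≤ A 1ℚ
  ≤A1 {x} 0≤x x≤1 = ≤-trans (walk (suc n) ℕ.≤-refl) (≤-reflexive (cong A arrive))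
    where
    n = proj₁ (archimedean (curvature K))
    κ≤n : curvature K ≤ ι (suc n)
    κ≤n = ≤-trans (proj₂ (archimedean (curvature K))) (ι-mono-≤ (ℕ.n≤1+n n))
    r = recip (0<ι n)
    h = (1ℚ - x) * r
    0≤h : 0ℚ ≤ h
    0≤h = 0≤* (diff x≤1) (<⇒≤ (recip-pos (0<ι n)))
    nr≡1 : ι (suc n) * r ≡ 1ℚ
    nr≡1 = recip-inverse (0<ι n)
    arrive : x + ι (suc n) * h ≡ 1ℚ
    arrive = trans (regroup x (ι (suc n)) r) (trans (cong (λ z → x + (1ℚ - x) * z) nr≡1) (cancel x))
      where
      regroup : ∀ x n r → x + n * ((1ℚ - x) * r) ≡ x + (1ℚ - x) * (n * r)
      regroup = solve-∀ ringℚ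
      cancel : ∀ x → x + (1ℚ - x) * 1ℚ ≡ 1ℚ
      cancel = solve-∀ ringℚ
    short : curvature K * h ≤ 2ℚ
    short = begin
      curvature K * h                 ≤⟨ *-monoʳ-≤-nonNeg h {{nonNegative 0≤h}} κ≤n ⟩
      ι (suc n) * h                   ≡⟨ regroup (ι (suc n)) x r ⟩
      (1ℚ - x) * (ι (suc n) * r)      ≡⟨ cong ((1ℚ - x) *_) nr≡1 ⟩
      (1ℚ - x) * 1ℚ                   ≤⟨ from-diff (0≤+ (<⇒≤ 0<1) 0≤x) (expand x) ⟩
      2ℚ                              ∎
      where
      open ≤-Reasoning
      regroup : ∀ n x r → n * ((1ℚ - x) * r) ≡ (1ℚ - x) * (n * r)
      regroup = solve-∀ ringℚ
      expand : ∀ x → 2ℚ - (1ℚ - x) * 1ℚ ≡ 1ℚ + x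
      expand = solve-∀ ringℚ
    point : ℕ → ℚ
    point i = x + ι i * h
    point≤1 : ∀ i → i ℕ.≤ suc n → point i ≤ 1ℚ
    point≤1 i i≤ = ≤-trans (+-monoʳ-≤ x (*-monoʳ-≤-nonNeg h {{nonNegative 0≤h}} (ι-mono-≤ i≤))) (≤-reflexive arrive)
    spacing : ∀ i → point (suc i) - point i ≡ h
    spacing i = cancel x (ι i) h
      where
      cancel : ∀ x k h → x + (1ℚ + k) * h - (x + k * h) ≡ h
      cancel = solve-∀ ringℚ
    walk : ∀ i → i ℕ.≤ suc n → A x ≤ A (point i)
    walk zero    _  = ≤-reflexive (cong A (sym (trans (cong (λ z → x + z) (*-zeroˡ h)) (+-identityʳ x))))
    walk (suc i) i≤ = ≤-trans (walk i (ℕ.≤-trans (ℕ.n≤1+n i) i≤)) (short-step (0≤+ 0≤x (0≤* (0≤ι i) 0≤h)) (from-diff 0≤h (spacing i)) (point≤1 (suc i) i≤)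
      (subst (λ z → curvature K * z ≤ 2ℚ) (sym (spacing i)) short))

-- The points (C k, S k) obtained by repeated rotation by the angle arctan T.
module Turn {c σ T : ℚ} (unit : c * c + σ * σ ≡ 1ℚ) (0<c : 0ℚ < c) (σ≡Tc : σ ≡ T * c) (0<T : 0ℚ < T) (T≤½ : T ≤ ½) where
  open ≤-Reasoning

  C S : ℕ → ℚ
  C zero    = 1ℚ
  C (suc k) = c * C k - σ * S k
  S zero    = 0ℚ
  S (suc k) = σ * C k + c * S k

  0≤T = <⇒≤ 0<T

  0<σ : 0ℚ < σ
  0<σ = subst (0ℚ <_) (sym σ≡Tc) (0<* 0<T 0<c)

  S-recurrence : ∀ k → S (suc (suc k)) ≡ (2ℚ - (2ℚ - 2ℚ * c)) * S (suc k) - S k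
  S-recurrence k = trans (expand c σ (C k) (S k)) (trans (cong (λ z → 2ℚ * c * (σ * C k + c * S k) - z * S k) unit) (tidy c (σ * C k + c * S k) (S k)))
    where
    expand : ∀ c σ x y → σ * (c * x - σ * y) + c * (σ * x + c * y) ≡ 2ℚ * c * (σ * x + c * y) - (c * c + σ * σ) * y
    expand = solve-∀ ringℚ
    tidy : ∀ c u y → 2ℚ * c * u - 1ℚ * y ≡ (2ℚ - (2ℚ - 2ℚ * c)) * u - y
    tidy = solve-∀ ringℚ

  addition : ∀ a b → C (a ℕ.+ b) ≡ C a * C b - S a * S b × S (a ℕ.+ b) ≡ S a * C b + C a * S b
  addition zero    b = pad₁ (C b) (S b) , pad₂ (C b) (S b)
    where
    pad₁ : ∀ x y → x ≡ 1ℚ * x - 0ℚ * y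
    pad₁ = solve-∀ ringℚ
    pad₂ : ∀ x y → y ≡ 0ℚ * x + 1ℚ * y
    pad₂ = solve-∀ ringℚ
  addition (suc a) b = trans (cong₂ (λ x y → c * x - σ * y) (proj₁ IH) (proj₂ IH)) (step₁ c σ (C a) (S a) (C b) (S b)) ,
    trans (cong₂ (λ x y → σ * x + c * y) (proj₁ IH) (proj₂ IH)) (step₂ c σ (C a) (S a) (C b) (S b))
    where
    IH = addition a b
    step₁ : ∀ c σ x y u v → c * (x * u - y * v) - σ * (y * u + x * v) ≡ (c * x - σ * y) * u - (σ * x + c * y) * v
    step₁ = solve-∀ ringℚ
    step₂ : ∀ c σ x y u v → σ * (x * u - y * v) + c * (y * u + x * v) ≡ (σ * x + c * y) * u + (c * x - σ * y) * v
    step₂ = solve-∀ ringℚ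

  -- τ is the tangent S k / C k, carried as a witness together with the positivity of C k.
  record Slope (k : ℕ) : Set where
    field
      τ     : ℚ
      0<C   : 0ℚ < C k
      0≤τ   : 0ℚ ≤ τ
      S≡τC  : S k ≡ τ * C k

  open Slope

  slope-0 : Slope 0
  slope-0 = record { τ = 0ℚ ; 0<C = 0<1 ; 0≤τ = ≤-refl ; S≡τC = refl }

  -- The new tangent is (T + τ) / (1 - T τ), with positive denominator because T ≤ ½ and τ < 1. The
  -- last component says that a step reaching 1 must start within 2 T of it.
  next : ∀ {k} (P : Slope k) → τ P < 1ℚ → Σ[ Q ∈ Slope (suc k) ] τ Q - τ P ≡ T * (1ℚ + τ P * τ Q) × τ P ≤ τ Q × (1ℚ ≤ τ Q → 1ℚ - τ P ≤ 2ℚ * T)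
  next {k} P τ<1 = record { τ = τ′ ; 0<C = subst (0ℚ <_) (sym C-suc) (0<* (0<* 0<c (0<C P)) 0<d) ; 0≤τ = 0≤τ′ ; S≡τC = S-suc } , increment , x≤τ′ , near
    where
    x = τ P
    d = 1ℚ - T * x
    0<d : 0ℚ < d
    0<d = diff-< (≤-<-trans (*-mono-≤ (0≤τ P) (nonNegative⁻¹ ½) T≤½ (<⇒≤ τ<1)) (positive⁻¹-½))
      where
      positive⁻¹-½ : ½ * 1ℚ < 1ℚ
      positive⁻¹-½ = from-diff-< {r = ½} (positive⁻¹ ½) refl
    r = recip 0<d
    dr : d * r ≡ 1ℚ
    dr = recip-inverse 0<d
    τ′ = (T + x) * r
    0≤τ′ : 0ℚ ≤ τ′
    0≤τ′ = 0≤* (0≤+ 0≤T (0≤τ P)) (<⇒≤ (recip-pos 0<d))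
    τ′d : τ′ * d ≡ T + x
    τ′d = trans (regroup (T + x) r d) (trans (cong ((T + x) *_) dr) (*-identityʳ (T + x)))
      where
      regroup : ∀ a r d → a * r * d ≡ a * (d * r)
      regroup = solve-∀ ringℚ
    C-suc : C (suc k) ≡ c * C k * d
    C-suc = trans (cong₂ (λ s y → c * C k - s * y) σ≡Tc (S≡τC P)) (factor c T x (C k))
      where
      factor : ∀ c T x C → c * C - T * c * (x * C) ≡ c * C * (1ℚ - T * x)
      factor = solve-∀ ringℚ
    S-suc : S (suc k) ≡ τ′ * C (suc k)
    S-suc = trans (cong₂ (λ s y → s * C k + c * y) σ≡Tc (S≡τC P)) (trans (factor c T x (C k)) (trans (cong (c * C k *_) (sym τ′d)) (trans (regroup (c * C k) τ′ d) (cong (τ′ *_) (sym C-suc)))))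
      where
      factor : ∀ c T x C → T * c * C + c * (x * C) ≡ c * C * (T + x)
      factor = solve-∀ ringℚ
      regroup : ∀ a t d → a * (t * d) ≡ t * (a * d)
      regroup = solve-∀ ringℚ
    increment : τ′ - x ≡ T * (1ℚ + x * τ′)
    increment = trans (split τ′ T x) (trans (cong (λ z → z + T * x * τ′ - x) τ′d) (tidy T x τ′))
      where
      split : ∀ t T x → t - x ≡ t * (1ℚ - T * x) + T * x * t - x
      split = solve-∀ ringℚ
      tidy : ∀ T x t → T + x + T * x * t - x ≡ T * (1ℚ + x * t)
      tidy = solve-∀ ringℚ
    x≤τ′ : x ≤ τ′
    x≤τ′ = from-diff (0≤* 0≤T (0≤+ (<⇒≤ 0<1) (0≤* (0≤τ P) 0≤τ′))) increment
    near : 1ℚ ≤ τ′ → 1ℚ - x ≤ 2ℚ * T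
    near 1≤τ′ = from-diff (0≤+ (diff (subst (d ≤_) τ′d (≤-trans (≤-reflexive (sym (*-identityˡ d))) (*-monoʳ-≤-nonNeg d {{nonNegative (<⇒≤ 0<d)}} 1≤τ′)))) (0≤* 0≤T (diff (<⇒≤ τ<1))))
      (identity T x)
      where
      identity : ∀ T x → 2ℚ * T - (1ℚ - x) ≡ (T + x - (1ℚ - T * x)) + T * (1ℚ - x)
      identity = solve-∀ ringℚ

  T≤1 : T ≤ 1ℚ
  T≤1 = ≤-trans T≤½ (from-diff {r = ½} (nonNegative⁻¹ ½) refl)

  module Slow (K : ℕ) (sign : leibnizSign K ≡ 1ℚ) where
    open EvenSum K sign

    q : ℚ
    q = 4ℚ * T + E * (T * T)

    0≤q : 0ℚ ≤ q
    0≤q = 0≤+ (0≤* (0≤ι 4) 0≤T) (0≤* 0≤E (0≤sq T))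

    -- As long as k steps cannot exhaust the partial sum, the slope stays below 1.
    slope<1 : ∀ k → ι k * q + E * T < A 1ℚ → Σ[ P ∈ Slope k ] τ P < 1ℚ × A (τ P) ≤ ι k * q
    slope<1 zero    small = slope-0 , 0<1 , ≤-reflexive (trans (arctan₄-0 K) (sym (*-zeroˡ q)))
    slope<1 (suc k) small = advance (slope<1 k (≤-<-trans (+-monoˡ-≤ (E * T) k≤) small))
      where
      k≤ : ι k * q ≤ ι (suc k) * q
      k≤ = *-monoʳ-≤-nonNeg q {{nonNegative 0≤q}} (ι-mono-≤ (ℕ.n≤1+n k))
      collect : ∀ k q → k * q + q ≡ (1ℚ + k) * q
      collect = solve-∀ ringℚ
      decide : (P : Slope k) (Q : Slope (suc k)) → τ P < 1ℚ → A (τ P) ≤ ι k * q → τ Q - τ P ≡ T * (1ℚ + τ P * τ Q) → τ P ≤ τ Q → (1ℚ ≤ τ Q → 1ℚ - τ P ≤ 2ℚ * T) →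
        Dec (τ Q < 1ℚ) → Σ[ P ∈ Slope (suc k) ] τ P < 1ℚ × A (τ P) ≤ ι (suc k) * q
      decide P Q τ<1 A≤ increment τ≤ near (yes τ′<1) = Q , τ′<1 , (begin
        A (τ Q)             ≤⟨ step (0≤τ P) τ≤ (<⇒≤ τ′<1) 0≤T increment ⟩
        A (τ P) + q         ≤⟨ +-monoˡ-≤ q A≤ ⟩
        ι k * q + q         ≡⟨ collect (ι k) q ⟩
        ι (suc k) * q       ∎)
      decide P Q τ<1 A≤ increment τ≤ near (no τ′≮1) = contradiction small (≤-≮ (begin
        A 1ℚ                ≤⟨ to-one (0≤τ P) (<⇒≤ τ<1) 0≤T T≤1 (near (≮⇒≥ τ′≮1)) ⟩
        A (τ P) + E * T     ≤⟨ +-monoˡ-≤ (E * T) (≤-trans A≤ k≤) ⟩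
        ι (suc k) * q + E * T ∎))
      advance : (Σ[ P ∈ Slope k ] τ P < 1ℚ × A (τ P) ≤ ι k * q) → Σ[ P ∈ Slope (suc k) ] τ P < 1ℚ × A (τ P) ≤ ι (suc k) * q
      advance (P , τ<1 , A≤) = let Q , increment , τ≤ , near = next P τ<1 in decide P Q τ<1 A≤ increment τ≤ near (τ Q <? 1ℚ)

  module Fast (K : ℕ) (sign : leibnizSign K ≡ - 1ℚ) where
    open OddSum K sign

    q : ℚ
    q = 4ℚ * T - E * (T * T)

    Crossing : ℕ → Set
    Crossing k = ∃ λ j → j ℕ.< k × 0ℚ < C (suc j) × C (suc j) ≤ S (suc j)

    -- Either the tangent has reached 1 at some step, or each step so far has raised A by at least
    -- q. In `crosses` the second case is impossible, because A is at most A 1 on [0, 1].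
    cross : ∀ k → Crossing k ⊎ (Σ[ P ∈ Slope k ] τ P < 1ℚ × ι k * q ≤ A (τ P))
    cross zero    = inj₂ (slope-0 , 0<1 , ≤-reflexive (trans (*-zeroˡ q) (sym (arctan₄-0 K))))
    cross (suc k) = [ (λ (j , j<k , rest) → inj₁ (j , ℕ.m<n⇒m<1+n j<k , rest)) , advance ]′ (cross k)
      where
      collect : ∀ k q → (1ℚ + k) * q ≡ k * q + q
      collect = solve-∀ ringℚ
      decide : (P : Slope k) (Q : Slope (suc k)) → ι k * q ≤ A (τ P) → τ Q - τ P ≡ T * (1ℚ + τ P * τ Q) → τ P ≤ τ Q →
        Dec (τ Q < 1ℚ) → Crossing (suc k) ⊎ (Σ[ P ∈ Slope (suc k) ] τ P < 1ℚ × ι (suc k) * q ≤ A (τ P))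
      decide P Q ≤A increment τ≤ (yes τ′<1) = inj₂ (Q , τ′<1 , (begin
        ι (suc k) * q       ≡⟨ collect (ι k) q ⟩
        ι k * q + q         ≤⟨ +-monoˡ-≤ q ≤A ⟩
        A (τ P) + q         ≤⟨ step (0≤τ P) τ≤ (<⇒≤ τ′<1) 0≤T increment ⟩
        A (τ Q)             ∎))
      decide P Q ≤A increment τ≤ (no τ′≮1) = inj₁ (k , ℕ.n<1+n k , 0<C Q , (begin
        C (suc k)           ≡⟨ *-identityˡ (C (suc k)) ⟨
        1ℚ * C (suc k)      ≤⟨ *-monoʳ-≤-nonNeg (C (suc k)) {{nonNegative (<⇒≤ (0<C Q))}} (≮⇒≥ τ′≮1) ⟩
        τ Q * C (suc k)     ≡⟨ S≡τC Q ⟨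
        S (suc k)           ∎))
      advance : (Σ[ P ∈ Slope k ] τ P < 1ℚ × ι k * q ≤ A (τ P)) → Crossing (suc k) ⊎ (Σ[ P ∈ Slope (suc k) ] τ P < 1ℚ × ι (suc k) * q ≤ A (τ P))
      advance (P , τ<1 , ≤A) = let Q , increment , τ≤ , _ = next P τ<1 in decide P Q ≤A increment τ≤ (τ Q <? 1ℚ)

    crosses : ∀ k → A 1ℚ < ι k * q → Crossing k
    crosses k large = [ id , (λ (P , τ<1 , ≤A) → contradiction (<-≤-trans large (≤-trans ≤A (≤A1 (0≤τ P) (<⇒≤ τ<1)))) (<-irrefl refl)) ]′ (cross k)

  ℓ : ℚ
  ℓ = 2ℚ - 2ℚ * c

  c≤1 : c ≤ 1ℚ
  c≤1 = sq-cancel-≤ (<⇒≤ 0<1) (from-diff (0≤sq σ) (trans (cong (_- c * c) (sym unit)) (cancel c σ)))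
    where
    cancel : ∀ c σ → c * c + σ * σ - c * c ≡ σ * σ
    cancel = solve-∀ ringℚ

  -- Doubling the angle of a point on or above the diagonal reaches the vertical axis, where S is maximal.
  peaked : ∀ j → 0ℚ < C (suc j) → C (suc j) ≤ S (suc j) → PeakedSolution ℓ (suc j ℕ.+ suc j)
  peaked j 0<Cj Cj≤Sj = record
    { s = S ; initial = refl ; recurrence = S-recurrence
    ; peak = begin
        σ * C h + c * S h     ≤⟨ +-mono-≤ {σ * C h} {0ℚ} {c * S h} {1ℚ * S h} (from-diff (0≤* (<⇒≤ 0<σ) 0≤-Ch) (expand σ (C h))) (*-monoʳ-≤-nonNeg (S h) {{nonNegative (<⇒≤ 0<Sh)}} c≤1) ⟩
        0ℚ + 1ℚ * S h         ≡⟨ tidy (S h) ⟩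
        S h                   ∎
    ; height = 0<Sh }
    where
    h = suc j ℕ.+ suc j
    x = C (suc j)
    y = S (suc j)
    0<y = <-≤-trans 0<Cj Cj≤Sj
    0<Sh : 0ℚ < S h
    0<Sh = subst (0ℚ <_) (sym (proj₂ (addition (suc j) (suc j)))) (+-mono-< (0<* 0<y 0<Cj) (0<* 0<Cj 0<y))
    0≤-Ch : 0ℚ ≤ - C h
    0≤-Ch = subst (λ z → 0ℚ ≤ - z) (sym (proj₁ (addition (suc j) (suc j)))) (≤-trans (diff (*-mono-≤ (<⇒≤ 0<Cj) (<⇒≤ 0<y) Cj≤Sj Cj≤Sj)) (≤-reflexive (flip x y)))
      where
      flip : ∀ x y → y * y - x * x ≡ - (x * x - y * y)
      flip = solve-∀ ringℚ
    expand : ∀ σ C → 0ℚ - σ * C ≡ σ * - C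
    expand = solve-∀ ringℚ
    tidy : ∀ x → 0ℚ + 1ℚ * x ≡ x
    tidy = solve-∀ ringℚ

  -- Slopes below 1 up to k steps keep S positive up to 4 k steps.
  module Positive (k : ℕ) (0<k : 1 ℕ.≤ k) (below : ∀ j → j ℕ.≤ k → 0ℚ < C j × 0ℚ ≤ S j × S j < C j) (S>0 : ∀ j → 1 ℕ.≤ j → j ℕ.≤ k → 0ℚ < S j) where

    upTo : ∀ m n → m ℕ.≤ n ℕ.+ n → m ℕ.≤ n ⊎ (∃ λ b → b ℕ.≤ n × n ℕ.+ b ≡ m)
    upTo m n m≤ with ℕ.≤-total m n
    ... | inj₁ m≤n = inj₁ m≤n
    ... | inj₂ n≤m = inj₂ (m ℕ.∸ n , ℕ.≤-trans (ℕ.∸-monoˡ-≤ n m≤) (ℕ.≤-reflexive (ℕ.m+n∸m≡n n n)) , ℕ.m+[n∸m]≡n n≤m)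

    half : ∀ j → j ℕ.≤ k ℕ.+ k → 0ℚ < C j × 0ℚ ≤ S j × (1 ℕ.≤ j → 0ℚ < S j)
    half j j≤ = [ (λ j≤k → proj₁ (below j j≤k) , proj₁ (proj₂ (below j j≤k)) , λ 1≤j → S>0 j 1≤j j≤k) , (λ (b , b≤k , eq) → subst (λ j → 0ℚ < C j × 0ℚ ≤ S j × (1 ℕ.≤ j → 0ℚ < S j)) eq (sum-case b b≤k)) ]′ (upTo j k j≤)
      where
      sum-case : ∀ b → b ℕ.≤ k → 0ℚ < C (k ℕ.+ b) × 0ℚ ≤ S (k ℕ.+ b) × (1 ℕ.≤ k ℕ.+ b → 0ℚ < S (k ℕ.+ b))
      sum-case b b≤k = subst (0ℚ <_) (sym (proj₁ (addition k b))) positive-C , <⇒≤ 0<Skb , λ _ → 0<Skb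
        where
        Ck = proj₁ (below k ℕ.≤-refl)
        Sk = S>0 k 0<k ℕ.≤-refl
        0≤Sb = proj₁ (proj₂ (below b b≤k))
        Cb = proj₁ (below b b≤k)
        0<Skb : 0ℚ < S (k ℕ.+ b)
        0<Skb = subst (0ℚ <_) (sym (proj₂ (addition k b))) (+-mono-<-≤ (0<* Sk Cb) (0≤* (<⇒≤ Ck) 0≤Sb))
        positive-C : 0ℚ < C k * C b - S k * S b
        positive-C = subst (0ℚ <_) (expand (C k) (S k) (C b) (S b)) (+-mono-<-≤ (0<* (diff-< (proj₂ (proj₂ (below k ℕ.≤-refl)))) Cb) (0≤* (<⇒≤ Sk) (diff (<⇒≤ (proj₂ (proj₂ (below b b≤k)))))))
          where
          expand : ∀ x y u v → (x - y) * u + y * (u - v) ≡ x * u - y * v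
          expand = solve-∀ ringℚ

    full : ∀ j → 1 ℕ.≤ j → j ℕ.≤ (k ℕ.+ k) ℕ.+ (k ℕ.+ k) → 0ℚ < S j
    full j 1≤j j≤ = [ (λ j≤2k → proj₂ (proj₂ (half j j≤2k)) 1≤j) , (λ (b , b≤2k , eq) → subst (λ j → 0ℚ < S j) eq (sum-case b b≤2k)) ]′ (upTo j (k ℕ.+ k) j≤)
      where
      sum-case : ∀ b → b ℕ.≤ k ℕ.+ k → 0ℚ < S ((k ℕ.+ k) ℕ.+ b)
      sum-case b b≤2k = subst (0ℚ <_) (sym (proj₂ (addition (k ℕ.+ k) b)))
        (+-mono-<-≤ (0<* (proj₂ (proj₂ (half (k ℕ.+ k) ℕ.≤-refl)) (ℕ.≤-trans 0<k (ℕ.m≤m+n k k))) (proj₁ (half b b≤2k))) (0≤* (<⇒≤ (proj₁ (half (k ℕ.+ k) ℕ.≤-refl))) (proj₁ (proj₂ (half b b≤2k)))))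

    dirichlet-solution : ∀ N → 1 ℕ.≤ N → N ℕ.≤ (k ℕ.+ k) ℕ.+ (k ℕ.+ k) → DirichletSolution ℓ N
    dirichlet-solution N 1≤N N≤ = record
      { s = S ; initial = refl ; recurrence = S-recurrence
      ; interior = λ j 1≤j j<N → full j 1≤j (ℕ.≤-trans (ℕ.<⇒≤ j<N) N≤)
      ; final = <⇒≤ (full N 1≤N N≤) }

  slow-solution : ∀ K → leibnizSign K ≡ 1ℚ → ∀ k N → 1 ℕ.≤ k → 1 ℕ.≤ N → N ℕ.≤ (k ℕ.+ k) ℕ.+ (k ℕ.+ k) →
    ι k * (4ℚ * T + (ι 8 + 4ℚ * curvature K) * (T * T)) + (ι 8 + 4ℚ * curvature K) * T < arctan₄ K 1ℚ → DirichletSolution ℓ N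
  slow-solution K sign k N 1≤k 1≤N N≤ small = Positive.dirichlet-solution k 1≤k below S>0 N 1≤N N≤
    where
    open EvenSum K sign using (E)
    open Slow K sign
    at : ∀ j → j ℕ.≤ k → Σ[ P ∈ Slope j ] τ P < 1ℚ × arctan₄ K (τ P) ≤ ι j * q
    at j j≤k = slope<1 j (≤-<-trans (+-monoˡ-≤ (E * T) (*-monoʳ-≤-nonNeg q {{nonNegative 0≤q}} (ι-mono-≤ j≤k))) small)
    below : ∀ j → j ℕ.≤ k → 0ℚ < C j × 0ℚ ≤ S j × S j < C j
    below j j≤k = 0<C P , subst (0ℚ ≤_) (sym (S≡τC P)) (0≤* (0≤τ P) (<⇒≤ (0<C P))) ,
      subst (_< C j) (sym (S≡τC P)) (<-≤-trans (*-monoˡ-<-pos (C j) {{positive (0<C P)}} (proj₁ (proj₂ (at j j≤k)))) (≤-reflexive (*-identityˡ (C j))))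
      where P = proj₁ (at j j≤k)
    S>0 : ∀ j → 1 ℕ.≤ j → j ℕ.≤ k → 0ℚ < S j
    S>0 (suc j) _ j<k = +-mono-<-≤ (0<* 0<σ (proj₁ (below j j≤k))) (0≤* (<⇒≤ 0<c) (proj₁ (proj₂ (below j j≤k))))
      where j≤k = ℕ.≤-trans (ℕ.n≤1+n j) j<k

  fast-solution : ∀ K → leibnizSign K ≡ - 1ℚ → ∀ k → arctan₄ K 1ℚ < ι k * (4ℚ * T - 4ℚ * curvature K * (T * T)) →
    ∃ λ j → j ℕ.< k × PeakedSolution ℓ (suc j ℕ.+ suc j)
  fast-solution K sign k large = let j , j<k , 0<Cj , Cj≤Sj = Fast.crosses K sign k large in j , j<k , peaked j 0<Cj Cj≤Sj

-- Rotations with a rational half-angle tangent.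

-- Small enough for T = 2t / (1 - t²) ≤ ½; t will be r / n, so the condition holds for large n.
⅕ : ℚ
⅕ = + 1 / 5

1-t²-pos : ∀ {t} → 0ℚ ≤ t → t ≤ ⅕ → 0ℚ < 1ℚ - t * t
1-t²-pos {t} 0≤t t≤⅕ = diff-< (≤-<-trans (*-mono-≤ 0≤t (nonNegative⁻¹ ⅕) t≤⅕ t≤⅕) (from-diff-< {r = + 24 / 25} (positive⁻¹ (+ 24 / 25)) refl))

-- The rotation by 2 arctan t.
module HalfAngle {t : ℚ} (0<t : 0ℚ < t) (t≤⅕ : t ≤ ⅕) where
  0≤t : 0ℚ ≤ t
  0≤t = <⇒≤ 0<t

  t≤1 : t ≤ 1ℚ
  t≤1 = ≤-trans t≤⅕ (from-diff {r = + 4 / 5} (nonNegative⁻¹ (+ 4 / 5)) refl)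

  0<1-t² : 0ℚ < 1ℚ - t * t
  0<1-t² = 1-t²-pos 0≤t t≤⅕

  κ ρ c σ T ℓ : ℚ
  κ = recip (0<1+x² t)
  ρ = recip 0<1-t²
  c = (1ℚ - t * t) * κ
  σ = 2ℚ * t * κ
  T = 2ℚ * t * ρ
  ℓ = 2ℚ - 2ℚ * c

  [1+t²]κ≡1 : (1ℚ + t * t) * κ ≡ 1ℚ
  [1+t²]κ≡1 = recip-inverse (0<1+x² t)

  [1-t²]ρ≡1 : (1ℚ - t * t) * ρ ≡ 1ℚ
  [1-t²]ρ≡1 = recip-inverse 0<1-t²

  unit : c * c + σ * σ ≡ 1ℚ
  unit = trans (square t κ) (cong sq [1+t²]κ≡1)
    where
    square : ∀ t k → (1ℚ - t * t) * k * ((1ℚ - t * t) * k) + 2ℚ * t * k * (2ℚ * t * k) ≡ (1ℚ + t * t) * k * ((1ℚ + t * t) * k)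
    square = solve-∀ ringℚ

  0<c : 0ℚ < c
  0<c = 0<* 0<1-t² (recip-pos (0<1+x² t))

  σ≡Tc : σ ≡ T * c
  σ≡Tc = trans (sym (*-identityˡ σ)) (trans (cong (_* σ) (sym [1-t²]ρ≡1)) (regroup t ρ κ))
    where
    regroup : ∀ t r k → (1ℚ - t * t) * r * (2ℚ * t * k) ≡ 2ℚ * t * r * ((1ℚ - t * t) * k)
    regroup = solve-∀ ringℚ

  0<T : 0ℚ < T
  0<T = 0<* (0<* (0<ι 1) 0<t) (recip-pos 0<1-t²)

  T-equation : T ≡ 2ℚ * t + t * t * T
  T-equation = trans (split t ρ) (cong (λ z → z + t * t * T) (trans (cong (2ℚ * t *_) [1-t²]ρ≡1) (*-identityʳ (2ℚ * t))))
    where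
    split : ∀ t r → 2ℚ * t * r ≡ 2ℚ * t * ((1ℚ - t * t) * r) + t * t * (2ℚ * t * r)
    split = solve-∀ ringℚ

  2t≤T : 2ℚ * t ≤ T
  2t≤T = from-diff (0≤* (0≤sq t) (<⇒≤ 0<T)) (trans (cong (_- 2ℚ * t) T-equation) (cancel (2ℚ * t) (t * t * T)))
    where
    cancel : ∀ a b → a + b - a ≡ b
    cancel = solve-∀ ringℚ

  T≤½ : T ≤ ½
  T≤½ = *-cancelˡ 0<1-t² (from-diff (0≤+ (diff (*-monoˡ (0≤ι 2) t≤⅕)) (0≤+ (*-monoˡ (nonNegative⁻¹ ½) (diff (*-mono-≤ 0≤t (nonNegative⁻¹ ⅕) t≤⅕ t≤⅕))) (nonNegative⁻¹ (+ 2 / 25))))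
    (trans (cong (λ z → (1ℚ - t * t) * ½ - z) (trans (regroup t ρ) (trans (cong (2ℚ * t *_) [1-t²]ρ≡1) (*-identityʳ (2ℚ * t))))) (identity t)))
    where
    regroup : ∀ t r → (1ℚ - t * t) * (2ℚ * t * r) ≡ 2ℚ * t * ((1ℚ - t * t) * r)
    regroup = solve-∀ ringℚ
    identity : ∀ t → (1ℚ - t * t) * ½ - 2ℚ * t ≡ (2ℚ * ⅕ - 2ℚ * t) + (½ * (⅕ * ⅕ - t * t) + (+ 2 / 25))
    identity = solve-∀ ringℚ

  T≤2t+t² : T ≤ 2ℚ * t + t * t
  T≤2t+t² = ≤-trans (≤-reflexive T-equation) (+-monoʳ-≤ (2ℚ * t) (≤-trans (*-monoˡ (0≤sq t) (≤-trans T≤½ (from-diff {r = ½} (nonNegative⁻¹ ½) refl))) (≤-reflexive (*-identityʳ (t * t)))))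

  T≤3t : T ≤ 3ℚ * t
  T≤3t = ≤-trans T≤2t+t² (from-diff (0≤* 0≤t (diff t≤1)) (identity t))
    where
    identity : ∀ t → 3ℚ * t - (2ℚ * t + t * t) ≡ t * (1ℚ - t)
    identity = solve-∀ ringℚ

  ℓ[1+t²]≡4t² : (1ℚ + t * t) * ℓ ≡ 4ℚ * (t * t)
  ℓ[1+t²]≡4t² = trans (expand t κ) (trans (cong (λ z → 2ℚ * (1ℚ + t * t) - 2ℚ * (1ℚ - t * t) * z) [1+t²]κ≡1) (collect t))
    where
    expand : ∀ t k → (1ℚ + t * t) * (2ℚ - 2ℚ * ((1ℚ - t * t) * k)) ≡ 2ℚ * (1ℚ + t * t) - 2ℚ * (1ℚ - t * t) * ((1ℚ + t * t) * k)
    expand = solve-∀ ringℚ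
    collect : ∀ t → 2ℚ * (1ℚ + t * t) - 2ℚ * (1ℚ - t * t) * 1ℚ ≡ 4ℚ * (t * t)
    collect = solve-∀ ringℚ

  0<ℓ : 0ℚ < ℓ
  0<ℓ = *-cancelˡ-< (≤-<-trans (≤-reflexive (*-zeroʳ (1ℚ + t * t))) (<-≤-trans (0<* (0<ι 3) (0<* 0<t 0<t)) (≤-reflexive (sym ℓ[1+t²]≡4t²))))
    where
    *-cancelˡ-< : (1ℚ + t * t) * 0ℚ < (1ℚ + t * t) * ℓ → 0ℚ < ℓ
    *-cancelˡ-< = *-cancelˡ-<-nonNeg (1ℚ + t * t) {{nonNegative (<⇒≤ (0<1+x² t))}}

  0<4-ℓ : 0ℚ < 4ℚ - ℓ
  0<4-ℓ = subst (0ℚ <_) (identity c) (+-mono-< (0<ι 1) (0<* (0<ι 1) 0<c))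
    where
    identity : ∀ c → 2ℚ + 2ℚ * c ≡ 4ℚ - (2ℚ - 2ℚ * c)
    identity = solve-∀ ringℚ

  0≤T : 0ℚ ≤ T
  0≤T = <⇒≤ 0<T

  T²≤9t² : T * T ≤ ι 9 * (t * t)
  T²≤9t² = ≤-trans (*-mono-≤ 0≤T (0≤* (0≤ι 3) 0≤t) T≤3t T≤3t) (≤-reflexive (square t))
    where
    square : ∀ t → 3ℚ * t * (3ℚ * t) ≡ ι 9 * (t * t)
    square = solve-∀ ringℚ

  -- The reason for parametrising by t: the upper bound 2 ℓ / (4 - ℓ) is exactly 2t², and by the
  -- next identity the lower bound 2 ℓ / (4 + ℓ) is 2t² / (1 + 2t²).
  2ℓ≡[4-ℓ]2t² : 2ℚ * ℓ ≡ (4ℚ - ℓ) * (2ℚ * (t * t))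
  2ℓ≡[4-ℓ]2t² = trans (split ℓ t) (trans (cong (λ z → 2ℚ * z - 2ℚ * (t * t) * ℓ) ℓ[1+t²]≡4t²) (collect ℓ t))
    where
    split : ∀ l t → 2ℚ * l ≡ 2ℚ * ((1ℚ + t * t) * l) - 2ℚ * (t * t) * l
    split = solve-∀ ringℚ
    collect : ∀ l t → 2ℚ * (4ℚ * (t * t)) - 2ℚ * (t * t) * l ≡ (4ℚ - l) * (2ℚ * (t * t))
    collect = solve-∀ ringℚ

  2ℓ[1+2t²]≡[4+ℓ]2t² : 2ℚ * ℓ * (1ℚ + 2ℚ * (t * t)) ≡ (4ℚ + ℓ) * (2ℚ * (t * t))
  2ℓ[1+2t²]≡[4+ℓ]2t² = trans (split ℓ t) (trans (cong (λ z → 2ℚ * z + 2ℚ * (t * t) * ℓ) ℓ[1+t²]≡4t²) (collect ℓ t))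
    where
    split : ∀ l t → 2ℚ * l * (1ℚ + 2ℚ * (t * t)) ≡ 2ℚ * ((1ℚ + t * t) * l) + 2ℚ * (t * t) * l
    split = solve-∀ ringℚ
    collect : ∀ l t → 2ℚ * (4ℚ * (t * t)) + 2ℚ * (t * t) * l ≡ (4ℚ + l) * (2ℚ * (t * t))
    collect = solve-∀ ringℚ

  -- The main term is 4 T k, close to 8 t k and hence to n t = r. Everything else is at most a
  -- constant, depending on r and E only, times t.
  total-≤ : ∀ {k n r E} → 0ℚ ≤ E → 0ℚ ≤ n → ι 8 * k ≤ n + ι 8 → n * t ≡ r →
    k * (4ℚ * T + E * (T * T)) + E * T ≤ r + (ι 12 + r + 2ℚ * E * r + ι 12 * E) * t
  total-≤ {k} {n} {_} {E} 0≤E 0≤n 8k≤ refl = begin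
    k * (4ℚ * T + E * (T * T)) + E * T
      ≡⟨ eighth k T E ⟩
    ι 8 * k * (½ * T + ⅛ * E * (T * T)) + E * T
      ≤⟨ +-mono-≤ (*-mono-≤ (0≤+ (0≤* (nonNegative⁻¹ ½) 0≤T) (0≤* (0≤* (nonNegative⁻¹ ⅛) 0≤E) (0≤sq T))) (0≤+ 0≤n (0≤ι 8)) 8k≤
           (+-mono-≤ (*-monoˡ (nonNegative⁻¹ ½) T≤2t+t²) (*-monoˡ (0≤* (nonNegative⁻¹ ⅛) 0≤E) T²≤9t²))) (*-monoˡ 0≤E T≤3t) ⟩
    (n + ι 8) * (½ * (2ℚ * t + t * t) + ⅛ * E * (ι 9 * (t * t))) + E * (3ℚ * t)
      ≤⟨ from-diff (0≤+ (0≤+ (0≤+ (0≤* (0≤* (0≤ι 4) 0≤t) (diff t≤1)) (0≤* (nonNegative⁻¹ ½) (0≤* 0≤n (0≤sq t)))) (0≤* (nonNegative⁻¹ (+ 7 / 8)) (0≤* 0≤E (0≤* 0≤n (0≤sq t))))) (0≤* (0≤* (0≤* (0≤ι 9) 0≤E) 0≤t) (diff t≤1)))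
           (surplus n t E) ⟩
    n * t + (ι 12 + n * t + 2ℚ * E * (n * t) + ι 12 * E) * t ∎
    where
    open ≤-Reasoning
    ⅛ = + 1 / 8
    eighth : ∀ k T E → k * (4ℚ * T + E * (T * T)) + E * T ≡ ι 8 * k * (½ * T + (+ 1 / 8) * E * (T * T)) + E * T
    eighth = solve-∀ ringℚ
    surplus : ∀ n t E → n * t + (ι 12 + n * t + 2ℚ * E * (n * t) + ι 12 * E) * t - ((n + ι 8) * (½ * (2ℚ * t + t * t) + (+ 1 / 8) * E * (ι 9 * (t * t))) + E * (3ℚ * t)) ≡
      4ℚ * t * (1ℚ - t) + ½ * (n * (t * t)) + (+ 7 / 8) * (E * (n * (t * t))) + ι 9 * E * t * (1ℚ - t)
    surplus = solve-∀ ringℚ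

  total-≥ : ∀ {k n r E} → 0ℚ ≤ E → 0ℚ ≤ k → 0ℚ ≤ n → ι 8 * k ≤ n → n ≤ ι 8 * k + ι 24 → n * t ≡ r →
    r - (ι 24 + 2ℚ * E * r) * t ≤ k * (4ℚ * T - E * (T * T))
  total-≥ {k} {n} {_} {E} 0≤E 0≤k 0≤n 8k≤n n≤ refl = begin
    n * t - (ι 24 + 2ℚ * E * (n * t)) * t
      ≤⟨ from-diff (0≤+ (0≤+ (0≤* 0≤t (diff n≤)) (0≤* (nonNegative⁻¹ (+ 9 / 8)) (0≤* (0≤* 0≤E (diff 8k≤n)) (0≤sq t)))) (0≤* (nonNegative⁻¹ (+ 7 / 8)) (0≤* (0≤* 0≤E 0≤n) (0≤sq t)))) (surplus k n t E) ⟩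
    k * (ι 8 * t - E * (ι 9 * (t * t)))
      ≤⟨ *-monoˡ 0≤k (+-mono-≤ (≤-trans (≤-reflexive (double-4 t)) (*-monoˡ (0≤ι 4) 2t≤T)) (neg-antimono-≤ (*-monoˡ 0≤E T²≤9t²))) ⟩
    k * (4ℚ * T - E * (T * T)) ∎
    where
    open ≤-Reasoning
    double-4 : ∀ t → ι 8 * t ≡ 4ℚ * (2ℚ * t)
    double-4 = solve-∀ ringℚ
    surplus : ∀ k n t E → k * (ι 8 * t - E * (ι 9 * (t * t))) - (n * t - (ι 24 + 2ℚ * E * (n * t)) * t) ≡
      t * (ι 8 * k + ι 24 - n) + (+ 9 / 8) * (E * (n - ι 8 * k) * (t * t)) + (+ 7 / 8) * (E * n * (t * t))
    surplus = solve-∀ ringℚ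

  open Turn {c} {σ} {T} unit 0<c σ≡Tc 0<T T≤½ public using (slow-solution; fast-solution)

-- The lower bound for all connected cubic graphs.

≤ᴿ-respʳ-≈ : ∀ {x y z} → x ≤ᴿ y → z ≈ y → x ≤ᴿ z
≤ᴿ-respʳ-≈ {x} {y} {z} x≤y z≈y ε 0<ε = M ℕ.⊔ N , λ n ≤n → begin
  seq x n                         ≤⟨ proj₂ (x≤y (ε * ½) 0<ε/2) n (ℕ.≤-trans (ℕ.m≤m⊔n M N) ≤n) ⟩
  seq y n + ε * ½                 ≤⟨ +-monoˡ-≤ (ε * ½) {seq y n} {seq z n + ε * ½} (from-diff (diff (≤-trans (neg-antimono-≤ (proj₂ (z≈y (ε * ½) 0<ε/2) n (ℕ.≤-trans (ℕ.m≤n⊔m M N) ≤n))) (-∣p∣≤p (seq z n - seq y n)))) (regroup (seq z n) (seq y n) (ε * ½))) ⟩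
  seq z n + ε * ½ + ε * ½         ≡⟨ halves (seq z n) ε ⟩
  seq z n + ε                     ∎
  where
  open ≤-Reasoning
  0<ε/2 = 0<* 0<ε (positive⁻¹ ½)
  M = proj₁ (x≤y (ε * ½) 0<ε/2)
  N = proj₁ (z≈y (ε * ½) 0<ε/2)
  regroup : ∀ z y h → z + h - y ≡ z - y - (- h)
  regroup = solve-∀ ringℚ
  halves : ∀ z ε → z + ε * ½ + ε * ½ ≡ z + ε
  halves = solve-∀ ringℚ

≤ᴿ-trans : ∀ {x y z} → x ≤ᴿ y → y ≤ᴿ z → x ≤ᴿ z
≤ᴿ-trans {x} {y} {z} x≤y y≤z ε 0<ε = M ℕ.⊔ N , λ n ≤n → begin
  seq x n                         ≤⟨ proj₂ (x≤y (ε * ½) 0<ε/2) n (ℕ.≤-trans (ℕ.m≤m⊔n M N) ≤n) ⟩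
  seq y n + ε * ½                 ≤⟨ +-monoˡ-≤ (ε * ½) (proj₂ (y≤z (ε * ½) 0<ε/2) n (ℕ.≤-trans (ℕ.m≤n⊔m M N) ≤n)) ⟩
  seq z n + ε * ½ + ε * ½         ≡⟨ halves (seq z n) ε ⟩
  seq z n + ε                     ∎
  where
  open ≤-Reasoning
  0<ε/2 = 0<* 0<ε (positive⁻¹ ½)
  M = proj₁ (x≤y (ε * ½) 0<ε/2)
  N = proj₁ (y≤z (ε * ½) 0<ε/2)
  halves : ∀ z ε → z + ε * ½ + ε * ½ ≡ z + ε
  halves = solve-∀ ringℚ

fromℚ-mono : ∀ {p q} → p ≤ q → fromℚ p ≤ᴿ fromℚ q
fromℚ-mono {p} {q} p≤q ε 0<ε = 0 , λ _ _ → ≤-trans p≤q (≤-trans (≤-reflexive (sym (+-identityʳ q))) (+-monoʳ-≤ q (<⇒≤ 0<ε)))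

algebraic-connectivity-lower : ∀ {n} (G : Graph (suc (suc n))) {x μ} → (∀ ev → IsSpectrum (λ i j → fromℤ (laplacian G i j)) ev → x ≤ᴿ ev (suc zero)) →
  IsAlgebraicConnectivity G μ → x ≤ᴿ μ
algebraic-connectivity-lower G {x} {μ} bound (ev , spectrum , suc zero , refl , μ≈) = ≤ᴿ-respʳ-≈ {x} {ev (suc zero)} {μ} (bound ev spectrum) μ≈
algebraic-connectivity-lower G bound (ev , spectrum , zero , () , μ≈)
algebraic-connectivity-lower G bound (ev , spectrum , suc (suc i) , () , μ≈)

-- N / 4 rounded up: if k steps stay below an eighth of a turn, the sine stays positive for 4 k ≥ N
-- steps. The last component is the price of rounding, n + 8 for n = 2 N.
quarter : ∀ N → ∃ λ k → 1 ℕ.≤ k × N ℕ.≤ (k ℕ.+ k) ℕ.+ (k ℕ.+ k) × 8 ℕ.* k ℕ.≤ double N ℕ.+ 8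
quarter zero                      = 1 , s≤s z≤n , z≤n , ℕ.≤-refl
quarter (suc zero)                = 1 , s≤s z≤n , s≤s z≤n , ℕ.m≤n+m 8 2
quarter (suc (suc zero))          = 1 , s≤s z≤n , s≤s (s≤s z≤n) , ℕ.m≤n+m 8 4
quarter (suc (suc (suc zero)))    = 1 , s≤s z≤n , s≤s (s≤s (s≤s z≤n)) , ℕ.m≤n+m 8 6
quarter (suc (suc (suc (suc N)))) = let k , _ , N≤ , ≤n = quarter N in
  suc k , s≤s z≤n , ℕ.≤-trans (ℕ.+-monoʳ-≤ 4 N≤) (ℕ.≤-reflexive (four k)) , ℕ.≤-trans (ℕ.≤-reflexive (ℕ.*-suc 8 k)) (ℕ.+-monoʳ-≤ 8 ≤n)
  where
  four : ∀ k → 4 ℕ.+ ((k ℕ.+ k) ℕ.+ (k ℕ.+ k)) ≡ (suc k ℕ.+ suc k) ℕ.+ (suc k ℕ.+ suc k)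
  four = solve-ℕ

poincare-constant : ∀ {ℓ s c₀ F q} → 0ℚ < 1ℚ + 2ℚ * s → 0ℚ < ℓ → 2ℚ * ℓ * (1ℚ + 2ℚ * s) ≡ (4ℚ + ℓ) * (2ℚ * s) → c₀ * (1ℚ + 2ℚ * s) ≡ 2ℚ * s →
  2ℚ * ℓ * F ≤ (4ℚ + ℓ) * q → c₀ * F ≤ q
poincare-constant {ℓ} {s} {c₀} {F} {q} 0<d 0<ℓ ℓ-eq c₀-eq bound = *-cancelˡ (0<* 0<4+ℓ 0<d) (begin
  (4ℚ + ℓ) * (1ℚ + 2ℚ * s) * (c₀ * F)      ≡⟨ regroup₁ (4ℚ + ℓ) (1ℚ + 2ℚ * s) c₀ F ⟩
  (4ℚ + ℓ) * (c₀ * (1ℚ + 2ℚ * s)) * F      ≡⟨ cong (λ z → (4ℚ + ℓ) * z * F) c₀-eq ⟩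
  (4ℚ + ℓ) * (2ℚ * s) * F                  ≡⟨ cong (_* F) ℓ-eq ⟨
  2ℚ * ℓ * (1ℚ + 2ℚ * s) * F               ≡⟨ regroup₂ (2ℚ * ℓ) (1ℚ + 2ℚ * s) F ⟩
  (1ℚ + 2ℚ * s) * (2ℚ * ℓ * F)             ≤⟨ *-monoˡ (<⇒≤ 0<d) bound ⟩
  (1ℚ + 2ℚ * s) * ((4ℚ + ℓ) * q)           ≡⟨ regroup₃ (1ℚ + 2ℚ * s) (4ℚ + ℓ) q ⟩
  (4ℚ + ℓ) * (1ℚ + 2ℚ * s) * q             ∎)
  where
  open ≤-Reasoning
  0<4+ℓ : 0ℚ < 4ℚ + ℓ
  0<4+ℓ = +-mono-< (0<ι 3) 0<ℓ
  regroup₁ : ∀ a b c F → a * b * (c * F) ≡ a * (c * b) * F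
  regroup₁ = solve-∀ ringℚ
  regroup₂ : ∀ a b F → a * b * F ≡ b * (a * F)
  regroup₂ = solve-∀ ringℚ
  regroup₃ : ∀ b a q → b * (a * q) ≡ a * b * q
  regroup₃ = solve-∀ ringℚ

slow-enough : ∀ K → leibnizSign K ≡ 1ℚ → ∀ {t r} (0<t : 0ℚ < t) (t≤⅕ : t ≤ ⅕) → ∀ N → 1 ℕ.≤ N → ι (double N) * t ≡ r →
  (let E = ι 8 + 4ℚ * curvature K in r + (ι 12 + r + 2ℚ * E * r + ι 12 * E) * t < leibnizSum K) → DirichletSolution (HalfAngle.ℓ 0<t t≤⅕) N
slow-enough K sign {t} {r} 0<t t≤⅕ N 1≤N nt≡r small = slow-solution K sign k N (proj₁ (proj₂ (quarter N))) 1≤N (proj₁ (proj₂ (proj₂ (quarter N))))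
    (subst (ι k * (4ℚ * T + E * (T * T)) + E * T <_) (sym (arctan₄-1 K)) (≤-<-trans (total-≤ {ι k} {ι (double N)} {r} {E} 0≤E (0≤ι (double N)) 8k≤ nt≡r) small))
  where
  open HalfAngle 0<t t≤⅕
  E = ι 8 + 4ℚ * curvature K
  0≤E : 0ℚ ≤ E
  0≤E = 0≤+ (0≤ι 8) (0≤* (0≤ι 4) (0≤curvature K))
  k = proj₁ (quarter N)
  8k≤ : ι 8 * ι k ≤ ι (double N) + ι 8
  8k≤ = ≤-trans (≤-reflexive (sym (ι-* 8 k))) (≤-trans (ι-mono-≤ (proj₂ (proj₂ (proj₂ (quarter N))))) (≤-reflexive (ι-+ (double N) 8)))

dirichlet-gap : ∀ {n N′} → n ≡ double (suc (suc N′)) → (G : Graph n) → Connected G → Cubic G → ∀ {ℓ s c₀} → DirichletSolution ℓ (suc (suc N′)) → 0ℚ < ℓ → 0ℚ < 1ℚ + 2ℚ * s →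
  2ℚ * ℓ * (1ℚ + 2ℚ * s) ≡ (4ℚ + ℓ) * (2ℚ * s) → c₀ * (1ℚ + 2ℚ * s) ≡ 2ℚ * s →
  ∀ f → sum f ≡ 0ℚ → c₀ * ∥ f ∥² ≤ form (Laplacian.laplacianℚ G) f f
dirichlet-gap {N′ = N′} refl G connected cubic {ℓ} {s} {c₀} solution 0<ℓ 0<d ℓ-eq c₀-eq f Σf≡0 =
  poincare-constant {ℓ} {s} {c₀} {∥ f ∥²} {form (Laplacian.laplacianℚ G) f f} 0<d 0<ℓ ℓ-eq c₀-eq (cubic-poincare {N′} G connected cubic {ℓ} solution 0<ℓ f Σf≡0)

constant-bounds : ∀ {s c₀} → 0ℚ < s → c₀ * (1ℚ + 2ℚ * s) ≡ 2ℚ * s → ∀ n → 0ℚ < c₀ × c₀ ≤ ι (suc n)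
constant-bounds {s} {c₀} 0<s c₀-eq n =
  *-cancelˡ-<-nonNeg d {{nonNegative (<⇒≤ 0<d)}} (≤-<-trans (≤-reflexive (*-zeroʳ d)) (<-≤-trans (0<* (0<ι 1) 0<s) (≤-reflexive (sym dc₀)))) ,
  ≤-trans (*-cancelˡ {c₀} {1ℚ} {d} 0<d (≤-trans (≤-reflexive dc₀) (from-diff {2ℚ * s} {d * 1ℚ} {1ℚ} (<⇒≤ 0<1) (excess s)))) (ι-mono-≤ {1} {suc n} (s≤s z≤n))
  where
  d = 1ℚ + 2ℚ * s
  0<d : 0ℚ < d
  0<d = +-mono-<-≤ 0<1 (0≤* (0≤ι 2) (<⇒≤ 0<s))
  dc₀ : d * c₀ ≡ 2ℚ * s
  dc₀ = trans (*-comm d c₀) c₀-eq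
  excess : ∀ s → (1ℚ + 2ℚ * s) * 1ℚ - 2ℚ * s ≡ 1ℚ
  excess = solve-∀ ringℚ

-- The order is kept as suc (suc n), related to double N by an equation, so that determinants of size n are never unfolded.
connectivity-lower : ∀ K → leibnizSign K ≡ 1ℚ → ∀ {t r} → 0ℚ < t → t ≤ ⅕ → ∀ {n N′} → suc (suc n) ≡ double (suc (suc N′)) → ι (suc (suc n)) * t ≡ r →
  (let E = ι 8 + 4ℚ * curvature K in r + (ι 12 + r + 2ℚ * E * r + ι 12 * E) * t < leibnizSum K) →
  ∀ {c₀} → c₀ * (1ℚ + 2ℚ * (t * t)) ≡ 2ℚ * (t * t) → ∀ {μ} → CubicConnectivity (suc (suc n)) μ → fromℚ c₀ ≤ᴿ μ
connectivity-lower K sign {t} {r} 0<t t≤⅕ {n} {N′} size nt≡r small {c₀} c₀-eq {μ} (G , connected , cubic , connectivity) =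
  algebraic-connectivity-lower {n} G {fromℚ c₀} {μ} (second-eigenvalue-lower {n} G cubic {c₀} (proj₁ bounds) (proj₂ bounds) gap) connectivity
  where
  solution : DirichletSolution (HalfAngle.ℓ 0<t t≤⅕) (suc (suc N′))
  solution = slow-enough K sign 0<t t≤⅕ (suc (suc N′)) (s≤s z≤n) (trans (cong (λ m → ι m * t) (sym size)) nt≡r) small
  bounds : 0ℚ < c₀ × c₀ ≤ ι (suc (suc n))
  bounds = constant-bounds {t * t} {c₀} (0<* 0<t 0<t) c₀-eq (suc n)
  gap : ∀ f → sum f ≡ 0ℚ → c₀ * ∥ f ∥² ≤ form (Laplacian.laplacianℚ G) f f
  gap = dirichlet-gap {suc (suc n)} {N′} size G connected cubic {HalfAngle.ℓ 0<t t≤⅕} {t * t} {c₀} solution (HalfAngle.0<ℓ 0<t t≤⅕) (+-mono-<-≤ 0<1 (0≤* (0≤ι 2) (0≤sq t)))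
    (HalfAngle.2ℓ[1+2t²]≡[4+ℓ]2t² 0<t t≤⅕) c₀-eq

module _ {n : ℕ} {u : ℚ} (nu≡1 : ι (suc n) * u ≡ 1ℚ) where

  inverse-pos : 0ℚ < u
  inverse-pos = *-cancelˡ-<-nonNeg (ι (suc n)) {{nonNegative (0≤ι (suc n))}} (≤-<-trans (≤-reflexive (*-zeroʳ (ι (suc n)))) (<-≤-trans 0<1 (≤-reflexive (sym nu≡1))))

  inverse≤1 : u ≤ 1ℚ
  inverse≤1 = begin
    u                   ≡⟨ *-identityˡ u ⟨
    1ℚ * u              ≤⟨ *-monoʳ-≤-nonNeg u {{nonNegative (<⇒≤ inverse-pos)}} (ι-mono-≤ {1} {suc n} (s≤s z≤n)) ⟩
    ι (suc n) * u       ≡⟨ nu≡1 ⟩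
    1ℚ                  ∎
    where open ≤-Reasoning

  divide-through : ∀ {a b} → a ≤ b * ι (suc n) → a * u ≤ b
  divide-through {a} {b} a≤ = begin
    a * u               ≤⟨ *-monoʳ-≤-nonNeg u {{nonNegative (<⇒≤ inverse-pos)}} a≤ ⟩
    b * ι (suc n) * u   ≡⟨ *-assoc b (ι (suc n)) u ⟩
    b * (ι (suc n) * u) ≡⟨ cong (b *_) nu≡1 ⟩
    b * 1ℚ              ≡⟨ *-identityʳ b ⟩
    b                   ∎
    where open ≤-Reasoning

  scale-back : ∀ r → ι (suc n) * (r * u) ≡ r
  scale-back r = trans (regroup (ι (suc n)) r u) (trans (cong (r *_) nu≡1) (*-identityʳ r))
    where
    regroup : ∀ n r u → n * (r * u) ≡ r * (n * u)
    regroup = solve-∀ ringℚ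

-- Put t = r / n. As r is strictly below the partial sum, the correction of order t in the
-- hypothesis of `connectivity-lower` fits in between for large n; η absorbs the denominator 1 +
-- 2t².
connectivity-lower-eventually : ∀ K → leibnizSign K ≡ 1ℚ → ∀ {r η} → 0ℚ < r → r < leibnizSum K → 0ℚ < η →
  ∃ λ n₀ → ∀ n q → n ≡ double q → n₀ ℕ.≤ n → ∀ {u} → ι n * u ≡ 1ℚ → ∀ {μ} → CubicConnectivity n μ → fromℚ (2ℚ * (r * r - η) * (u * u)) ≤ᴿ μ
connectivity-lower-eventually K sign {r} {η} 0<r r<S 0<η = 4 ℕ.⊔ n₁₂₃ , bound
  where
  S = leibnizSum K
  E = ι 8 + 4ℚ * curvature K
  B = ι 12 + r + 2ℚ * E * r + ι 12 * E
  d = ½ * (S - r)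
  0<d : 0ℚ < d
  0<d = 0<* (positive⁻¹ ½) (diff-< r<S)
  n₁ = proj₁ (eventually-small r (positive⁻¹ ⅕))
  n₂ = proj₁ (eventually-small (B * r) 0<d)
  n₃ = proj₁ (eventually-small (2ℚ * (r * r * (r * r))) 0<η)
  n₁₂₃ = n₁ ℕ.⊔ (n₂ ℕ.⊔ n₃)
  bound : ∀ n q → n ≡ double q → 4 ℕ.⊔ n₁₂₃ ℕ.≤ n → ∀ {u} → ι n * u ≡ 1ℚ → ∀ {μ} → CubicConnectivity n μ → fromℚ (2ℚ * (r * r - η) * (u * u)) ≤ᴿ μ
  bound zero          q             size ≤n = contradiction (ℕ.≤-trans (ℕ.m≤m⊔n 4 n₁₂₃) ≤n) λ ()
  bound (suc zero)    q             size ≤n = contradiction (ℕ.≤-trans (ℕ.m≤m⊔n 4 n₁₂₃) ≤n) λ { (s≤s ()) }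
  bound (suc (suc m)) zero          size ≤n = contradiction size λ ()
  bound (suc (suc m)) (suc zero)    size ≤n = contradiction (subst (4 ℕ.≤_) size (ℕ.≤-trans (ℕ.m≤m⊔n 4 n₁₂₃) ≤n)) λ { (s≤s (s≤s ())) }
  bound (suc (suc m)) (suc (suc N)) size ≤n {u} nu≡1 {μ} C = ≤ᴿ-trans {fromℚ (2ℚ * (r * r - η) * (u * u))} {fromℚ c₀} {μ} (fromℚ-mono c₀-≥)
    (connectivity-lower K sign 0<t t≤⅕ {m} {N} size (scale-back {suc m} nu≡1 r) small c₀-eq {μ} C)
    where
    open ≤-Reasoning
    n = suc m
    rest≤n : n₁₂₃ ℕ.≤ suc n
    rest≤n = ℕ.≤-trans (ℕ.m≤n⊔m 4 n₁₂₃) ≤n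
    t = r * u
    0<u = inverse-pos {n} nu≡1
    0<t : 0ℚ < t
    0<t = 0<* 0<r 0<u
    t≤⅕ : t ≤ ⅕
    t≤⅕ = divide-through {n} nu≡1 (proj₂ (eventually-small r (positive⁻¹ ⅕)) (suc n) (ℕ.≤-trans (ℕ.m≤m⊔n n₁ (n₂ ℕ.⊔ n₃)) rest≤n))
    Bt≤d : B * t ≤ d
    Bt≤d = ≤-trans (≤-reflexive (sym (*-assoc B r u)))
      (divide-through {n} nu≡1 (proj₂ (eventually-small (B * r) 0<d) (suc n) (ℕ.≤-trans (ℕ.≤-trans (ℕ.m≤m⊔n n₂ n₃) (ℕ.m≤n⊔m n₁ (n₂ ℕ.⊔ n₃))) rest≤n)))
    small : r + B * t < S
    small = ≤-<-trans (+-monoʳ-≤ r Bt≤d) (from-diff-< 0<d (halves S r))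
      where
      halves : ∀ S r → S - (r + ½ * (S - r)) ≡ ½ * (S - r)
      halves = solve-∀ ringℚ
    quartic : 2ℚ * (r * r * (r * r)) * u ≤ η
    quartic = divide-through {n} nu≡1 (proj₂ (eventually-small (2ℚ * (r * r * (r * r))) 0<η) (suc n) (ℕ.≤-trans (ℕ.≤-trans (ℕ.m≤n⊔m n₂ n₃) (ℕ.m≤n⊔m n₁ (n₂ ℕ.⊔ n₃))) rest≤n))
    D = 1ℚ + 2ℚ * (t * t)
    0<D : 0ℚ < D
    0<D = +-mono-<-≤ 0<1 (0≤* (0≤ι 2) (0≤sq t))
    c₀ = 2ℚ * (t * t) * recip 0<D
    c₀-eq : c₀ * D ≡ 2ℚ * (t * t)
    c₀-eq = trans (regroup (2ℚ * (t * t)) (recip 0<D) D) (trans (cong (2ℚ * (t * t) *_) (recip-inverse 0<D)) (*-identityʳ _))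
      where
      regroup : ∀ a r D → a * r * D ≡ a * (D * r)
      regroup = solve-∀ ringℚ
    r⁴u²≤η : 2ℚ * (r * r * (r * r)) * (u * u) ≤ η
    r⁴u²≤η = begin
      2ℚ * (r * r * (r * r)) * (u * u)   ≡⟨ *-assoc (2ℚ * (r * r * (r * r))) u u ⟨
      2ℚ * (r * r * (r * r)) * u * u     ≤⟨ *-mono-≤ (<⇒≤ 0<u) (<⇒≤ 0<η) quartic (inverse≤1 {n} nu≡1) ⟩
      η * 1ℚ                             ≡⟨ *-identityʳ η ⟩
      η                                  ∎
    c₀-≥ : 2ℚ * (r * r - η) * (u * u) ≤ c₀
    c₀-≥ = *-cancelˡ 0<D (from-diff (0≤* (0≤* (0≤ι 2) (0≤sq u)) (0≤+ (diff r⁴u²≤η) (0≤* (0≤* (0≤ι 2) (<⇒≤ 0<η)) (0≤sq t))))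
      (trans (cong (_- D * (2ℚ * (r * r - η) * (u * u))) (trans (*-comm D c₀) c₀-eq)) (excess r η u)))
      where
      excess : ∀ r η u → 2ℚ * (r * u * (r * u)) - (1ℚ + 2ℚ * (r * u * (r * u))) * (2ℚ * (r * r - η) * (u * u)) ≡
        2ℚ * (u * u) * ((η - 2ℚ * (r * r * (r * r)) * (u * u)) + 2ℚ * η * (r * u * (r * u)))
      excess = solve-∀ ringℚ

-- The upper bound from chains of diamonds.

order-of-length : ∀ {n₀} (ends : Ends n₀) M → Chain.order-of ends M ≡ n₀ ℕ.+ 4 ℕ.* M
order-of-length {n₀} ends zero    = sym (trans (cong (n₀ ℕ.+_) (ℕ.*-zeroʳ 4)) (ℕ.+-identityʳ n₀))
order-of-length {n₀} ends (suc M) = trans (cong (4 ℕ.+_) (order-of-length ends M)) (step n₀ M)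
  where
  step : ∀ n M → 4 ℕ.+ (n ℕ.+ 4 ℕ.* M) ≡ n ℕ.+ 4 ℕ.* suc M
  step = solve-ℕ

parity : ∀ M → ∃ λ k → M ≡ double k ⊎ M ≡ suc (double k)
parity zero          = 0 , inj₁ refl
parity (suc zero)    = 0 , inj₂ refl
parity (suc (suc M)) = let k , M≡ = parity M in suc k , [ inj₁ ∘ cong (2 ℕ.+_) , inj₂ ∘ cong (2 ℕ.+_) ]′ M≡

halve : ∀ M → ∃ λ k → double k ℕ.≤ M × M ℕ.≤ suc (double k)
halve M = let k , M≡ = parity M in k , [ (λ eq → ℕ.≤-reflexive (sym eq) , ℕ.≤-trans (ℕ.≤-reflexive eq) (ℕ.n≤1+n _)) , (λ eq → ℕ.≤-trans (ℕ.n≤1+n _) (ℕ.≤-reflexive (sym eq)) , ℕ.≤-reflexive eq) ]′ M≡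

-- The peak may come early: only `suc j ℕ.+ suc j` ≤ M is required, and the remaining length of the
-- chain separates the two bumps.
peak-connectivity : ∀ {n₀} (ends : Ends n₀) {ℓ Y} → 0ℚ ≤ ℓ → 0ℚ < 4ℚ - ℓ → 2ℚ * ℓ ≡ (4ℚ - ℓ) * Y → ∀ {k} M → double k ℕ.≤ M → (∃ λ j → j ℕ.< k × PeakedSolution ℓ (suc j ℕ.+ suc j)) →
  Σ[ μ ∈ ℝ ] CubicConnectivity (Chain.order-of ends M) μ × μ ≤ᴿ fromℚ Y
peak-connectivity ends {ℓ} {Y} 0≤ℓ 0<4-ℓ Y-def {k} M 2k≤M (j , j<k , solution) = transport M (ℕ.m+[n∸m]≡n short)
  where
  short : suc j ℕ.+ suc j ℕ.≤ M
  short = ℕ.≤-trans (ℕ.≤-trans (ℕ.+-mono-≤ j<k j<k) (ℕ.≤-reflexive (sym (double≡+ k)))) 2k≤M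
  transport : ∀ m → suc (j ℕ.+ suc j) ℕ.+ (M ℕ.∸ (suc j ℕ.+ suc j)) ≡ m → Σ[ μ ∈ ℝ ] CubicConnectivity (Chain.order-of ends m) μ × μ ≤ᴿ fromℚ Y
  transport m refl = chain-connectivity ends {ℓ} {j ℕ.+ suc j} solution (M ℕ.∸ (suc j ℕ.+ suc j)) 0≤ℓ 0<4-ℓ {Y} Y-def

chain-upper : ∀ K → leibnizSign K ≡ - 1ℚ → ∀ {n₀} (ends : Ends n₀) → n₀ ℕ.≤ 12 → ∀ M {t r} → 0ℚ < t → t ≤ ⅕ → ι (Chain.order-of ends M) * t ≡ r →
  (let E = 4ℚ * curvature K in leibnizSum K < r - (ι 24 + 2ℚ * E * r) * t) →
  Σ[ μ ∈ ℝ ] CubicConnectivity (Chain.order-of ends M) μ × μ ≤ᴿ fromℚ (2ℚ * (t * t))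
chain-upper K sign {n₀} ends n₀≤12 M {t} {r} 0<t t≤⅕ nt≡r large =
  peak-connectivity ends {ℓ} {2ℚ * (t * t)} (<⇒≤ 0<ℓ) 0<4-ℓ 2ℓ≡[4-ℓ]2t² {k} M (proj₁ (proj₂ (halve M))) peak
  where
  open HalfAngle 0<t t≤⅕
  E = 4ℚ * curvature K
  0≤E : 0ℚ ≤ E
  0≤E = 0≤* (0≤ι 4) (0≤curvature K)
  n = Chain.order-of ends M
  k = proj₁ (halve M)
  8k≤n : 8 ℕ.* k ℕ.≤ n
  8k≤n = ℕ.≤-trans (ℕ.≤-trans (ℕ.≤-reflexive (trans (regroup k) (cong (4 ℕ.*_) (sym (double≡+ k))))) (ℕ.*-monoʳ-≤ 4 (proj₁ (proj₂ (halve M)))))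
    (ℕ.≤-trans (ℕ.m≤n+m (4 ℕ.* M) n₀) (ℕ.≤-reflexive (sym (order-of-length ends M))))
    where
    regroup : ∀ k → 8 ℕ.* k ≡ 4 ℕ.* (k ℕ.+ k)
    regroup = solve-ℕ
  n≤8k+24 : n ℕ.≤ 8 ℕ.* k ℕ.+ 24
  n≤8k+24 = ℕ.≤-trans (ℕ.≤-reflexive (order-of-length ends M)) (ℕ.≤-trans (ℕ.+-mono-≤ n₀≤12 (ℕ.*-monoʳ-≤ 4 (proj₂ (proj₂ (halve M)))))
    (ℕ.≤-trans (ℕ.≤-reflexive (trans (cong (λ z → 12 ℕ.+ 4 ℕ.* suc z) (double≡+ k)) (regroup k))) (ℕ.+-monoʳ-≤ (8 ℕ.* k) (ℕ.m≤m+n 16 8))))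
    where
    regroup : ∀ k → 12 ℕ.+ 4 ℕ.* suc (k ℕ.+ k) ≡ 8 ℕ.* k ℕ.+ 16
    regroup = solve-ℕ
  peak : ∃ λ j → j ℕ.< k × PeakedSolution ℓ (suc j ℕ.+ suc j)
  peak = fast-solution K sign k (<-≤-trans (subst (_< r - (ι 24 + 2ℚ * E * r) * t) (sym (arctan₄-1 K)) large)
    (total-≥ {ι k} {ι n} {r} {E} 0≤E (0≤ι k) (0≤ι n) (≤-trans (≤-reflexive (sym (ι-* 8 k))) (ι-mono-≤ 8k≤n))
      (≤-trans (ι-mono-≤ n≤8k+24) (≤-reflexive (trans (ι-+ (8 ℕ.* k) 24) (cong (_+ ι 24) (ι-* 8 k))))) nt≡r))

chain-order : ∀ q → 5 ℕ.≤ q → (∃ λ M → Chain.order-of ends₁₀ M ≡ double q) ⊎ (∃ λ M → Chain.order-of ends₁₂ M ≡ double q)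
chain-order q 5≤q = by-parity (ℕ.m+[n∸m]≡n 5≤q) (proj₂ (parity (q ℕ.∸ 5)))
  where
  M = proj₁ (parity (q ℕ.∸ 5))
  even-case : ∀ M → 10 ℕ.+ 4 ℕ.* M ≡ (5 ℕ.+ (M ℕ.+ M)) ℕ.+ (5 ℕ.+ (M ℕ.+ M))
  even-case = solve-ℕ
  odd-case : ∀ M → 12 ℕ.+ 4 ℕ.* M ≡ (5 ℕ.+ suc (M ℕ.+ M)) ℕ.+ (5 ℕ.+ suc (M ℕ.+ M))
  odd-case = solve-ℕ
  double-cong : ∀ {p p′} → p ≡ p′ → p′ ≡ q → p ℕ.+ p ≡ double q
  double-cong p≡p′ p′≡q = trans (cong (λ z → z ℕ.+ z) (trans p≡p′ p′≡q)) (sym (double≡+ q))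
  by-parity : 5 ℕ.+ (q ℕ.∸ 5) ≡ q → (q ℕ.∸ 5 ≡ double M ⊎ q ℕ.∸ 5 ≡ suc (double M)) →
    (∃ λ M → Chain.order-of ends₁₀ M ≡ double q) ⊎ (∃ λ M → Chain.order-of ends₁₂ M ≡ double q)
  by-parity back (inj₁ eq) = inj₁ (M , trans (order-of-length ends₁₀ M) (trans (even-case M) (double-cong (cong (5 ℕ.+_) (trans (sym (double≡+ M)) (sym eq))) back)))
  by-parity back (inj₂ eq) = inj₂ (M , trans (order-of-length ends₁₂ M) (trans (odd-case M) (double-cong (cong (5 ℕ.+_) (trans (cong suc (sym (double≡+ M))) (sym eq))) back)))

connectivity-upper-eventually : ∀ K → leibnizSign K ≡ - 1ℚ → ∀ {r} → 0ℚ < r → leibnizSum K < r →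
  ∃ λ n₀ → ∀ n q → n ≡ double q → n₀ ℕ.≤ n → ∀ {u} → ι n * u ≡ 1ℚ → Σ[ μ ∈ ℝ ] CubicConnectivity n μ × μ ≤ᴿ fromℚ (2ℚ * (r * u * (r * u)))
connectivity-upper-eventually K sign {r} 0<r S<r = 10 ℕ.⊔ (n₁ ℕ.⊔ n₂) , bound
  where
  S = leibnizSum K
  E = 4ℚ * curvature K
  B = ι 24 + 2ℚ * E * r
  d = ½ * (r - S)
  0<d : 0ℚ < d
  0<d = 0<* (positive⁻¹ ½) (diff-< S<r)
  n₁ = proj₁ (eventually-small r (positive⁻¹ ⅕))
  n₂ = proj₁ (eventually-small (B * r) 0<d)
  Target : ℕ → ℚ → Set
  Target n t = Σ[ μ ∈ ℝ ] CubicConnectivity n μ × μ ≤ᴿ fromℚ (2ℚ * (t * t))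
  10≤⇒5≤ : ∀ q → 10 ℕ.≤ double q → 5 ℕ.≤ q
  10≤⇒5≤ q 10≤ = ℕ.*-cancelˡ-≤ {5} {q} 2 (ℕ.≤-trans 10≤ (ℕ.≤-reflexive (sym (2*≡double q))))
  bound : ∀ n q → n ≡ double q → 10 ℕ.⊔ (n₁ ℕ.⊔ n₂) ℕ.≤ n → ∀ {u} → ι n * u ≡ 1ℚ → Target n (r * u)
  bound zero    q size ≤n = contradiction (ℕ.≤-trans (ℕ.m≤m⊔n 10 (n₁ ℕ.⊔ n₂)) ≤n) λ ()
  bound (suc n) q size ≤n {u} nu≡1 = [ (λ (M , eq) → at ends₁₀ (ℕ.m≤m+n 10 2) M (trans eq (sym size))) , (λ (M , eq) → at ends₁₂ ℕ.≤-refl M (trans eq (sym size))) ]′ (chain-order q (10≤⇒5≤ q (subst (10 ℕ.≤_) size (ℕ.≤-trans (ℕ.m≤m⊔n 10 (n₁ ℕ.⊔ n₂)) ≤n))))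
    where
    rest≤n : n₁ ℕ.⊔ n₂ ℕ.≤ suc n
    rest≤n = ℕ.≤-trans (ℕ.m≤n⊔m 10 (n₁ ℕ.⊔ n₂)) ≤n
    t = r * u
    0<t : 0ℚ < t
    0<t = 0<* 0<r (inverse-pos {n} nu≡1)
    t≤⅕ : t ≤ ⅕
    t≤⅕ = divide-through {n} nu≡1 (proj₂ (eventually-small r (positive⁻¹ ⅕)) (suc n) (ℕ.≤-trans (ℕ.m≤m⊔n n₁ n₂) rest≤n))
    Bt≤d : B * t ≤ d
    Bt≤d = ≤-trans (≤-reflexive (sym (*-assoc B r u)))
      (divide-through {n} nu≡1 (proj₂ (eventually-small (B * r) 0<d) (suc n) (ℕ.≤-trans (ℕ.m≤n⊔m n₁ n₂) rest≤n)))
    large : S < r - B * t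
    large = <-≤-trans (from-diff-< 0<d (halves S r)) (+-monoʳ-≤ r (neg-antimono-≤ Bt≤d))
      where
      halves : ∀ S r → r - ½ * (r - S) - S ≡ ½ * (r - S)
      halves = solve-∀ ringℚ
    at : ∀ {n₀} (ends : Ends n₀) → n₀ ℕ.≤ 12 → ∀ M → Chain.order-of ends M ≡ suc n → Target (suc n) t
    at ends n₀≤12 M eq = subst (λ m → Target m t) eq
      (chain-upper K sign ends n₀≤12 M 0<t t≤⅕ (trans (cong (λ m → ι m * t) eq) (scale-back {n} nu≡1 r)) large)

-- The reciprocal of π and the relative deviation.

leibnizTerm-antitone : ∀ m → leibnizTerm (suc m) ≤ leibnizTerm m
leibnizTerm-antitone m = from-equal-products {leibnizTerm (suc m)} {leibnizTerm m} (0≤leibnizTerm (suc m)) (0<ι (double m)) (from-diff (0≤ι 2) (two (ι (suc (double m)))))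
  (trans (leibnizTerm-def (suc m)) (sym (leibnizTerm-def m)))
  where
  two : ∀ x → 1ℚ + (1ℚ + x) - x ≡ 2ℚ
  two = solve-∀ ringℚ
  from-equal-products : ∀ {a b x y} → 0ℚ ≤ a → 0ℚ < x → x ≤ y → a * y ≡ b * x → a ≤ b
  from-equal-products {a} {b} {x} {y} 0≤a 0<x x≤y eq = *-cancelˡ 0<x (≤-trans (≤-reflexive (*-comm x a)) (≤-trans (*-monoˡ 0≤a x≤y) (≤-reflexive (trans eq (*-comm b x)))))

-- The first pair of terms gives 8/3 and every later pair is nonnegative. The bound is crude but
-- keeps the reciprocals of the partial sums at most ½.
leibnizSum-even≥2 : ∀ i → 2ℚ ≤ leibnizSum (double (suc i))
leibnizSum-even≥2 zero    = from-diff {2ℚ} {leibnizSum 2} {+ 2 / 3} (nonNegative⁻¹ (+ 2 / 3)) refl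
leibnizSum-even≥2 (suc i) = ≤-trans (leibnizSum-even≥2 i) (pair-step (sign-even (suc i)) (leibnizTerm-antitone (double (suc i))))
  where
  pair-step : ∀ {S s a b} → s ≡ 1ℚ → b ≤ a → S ≤ S + s * a + - s * b
  pair-step {S} {_} {a} {b} refl b≤a = from-diff (diff b≤a) (identity S a b)
    where
    identity : ∀ S a b → S + 1ℚ * a + - 1ℚ * b - S ≡ a - b
    identity = solve-∀ ringℚ

leibnizSum≥2 : ∀ j → 2ℚ ≤ leibnizSum (suc j)
leibnizSum≥2 j = by-parity (proj₁ (parity j)) (proj₂ (parity j))
  where
  odd-step : ∀ {S s a} → s ≡ 1ℚ → 0ℚ ≤ a → 2ℚ ≤ S → 2ℚ ≤ S + s * a
  odd-step {S} {_} {a} refl 0≤a 2≤S = ≤-trans 2≤S (from-diff 0≤a (identity S a))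
    where
    identity : ∀ S a → S + 1ℚ * a - S ≡ a
    identity = solve-∀ ringℚ
  odd-sum : ∀ k → 2ℚ ≤ leibnizSum (suc (double k))
  odd-sum zero    = from-diff {2ℚ} {leibnizSum 1} {2ℚ} (0≤ι 2) refl
  odd-sum (suc i) = odd-step (sign-even (suc i)) (0≤leibnizTerm (double (suc i))) (leibnizSum-even≥2 i)
  by-parity : ∀ k → j ≡ double k ⊎ j ≡ suc (double k) → 2ℚ ≤ leibnizSum (suc j)
  by-parity k (inj₁ eq) = subst (λ j → 2ℚ ≤ leibnizSum (suc j)) (sym eq) (odd-sum k)
  by-parity k (inj₂ eq) = subst (λ j → 2ℚ ≤ leibnizSum (suc j)) (sym eq) (leibnizSum-even≥2 k)

0<leibnizSum : ∀ j → 0ℚ < leibnizSum (suc j)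
0<leibnizSum j = <-≤-trans (0<ι 1) (leibnizSum≥2 j)

-- The value at 0 is arbitrary, since leibnizSum 0 = 0.
1/leibnizSum : ℕ → ℚ
1/leibnizSum zero    = 0ℚ
1/leibnizSum (suc j) = recip (0<leibnizSum j)

record IsReciprocal (x S : ℚ) : Set where
  field
    product≡1 : x * S ≡ 1ℚ
    nonneg    : 0ℚ ≤ x
    small     : x ≤ ½

reciprocal : ∀ {S} → 2ℚ ≤ S → (0<S : 0ℚ < S) → IsReciprocal (recip 0<S) S
reciprocal {S} 2≤S 0<S = record
  { product≡1 = trans (*-comm (recip 0<S) S) (recip-inverse 0<S)
  ; nonneg    = <⇒≤ (recip-pos 0<S)
  ; small     = *-cancelˡ 0<S (≤-trans (≤-reflexive (recip-inverse 0<S)) (*-monoʳ-≤-nonNeg ½ 2≤S)) }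

1/leibnizSum-reciprocal : ∀ j → 1 ℕ.≤ j → IsReciprocal (1/leibnizSum j) (leibnizSum j)
1/leibnizSum-reciprocal (suc j) _ = reciprocal (leibnizSum≥2 j) (0<leibnizSum j)

reciprocal-close : ∀ {x S y S′ ε} → IsReciprocal x S → IsReciprocal y S′ → 0ℚ ≤ ε → ℚ.∣ S′ - S ∣ ≤ ε → ℚ.∣ x - y ∣ ≤ ε
reciprocal-close {x} {S} {y} {S′} {ε} X Y 0≤ε close = begin
  ℚ.∣ x - y ∣                       ≡⟨ cong ℚ.∣_∣ (cross-multiply (product≡1 X) (product≡1 Y)) ⟩
  ℚ.∣ x * y * (S′ - S) ∣            ≤⟨ abs*-≤ {x * y} {S′ - S} (≤-trans (≤-reflexive (0≤p⇒∣p∣≡p (0≤* (nonneg X) (nonneg Y)))) (*-mono-≤ (nonneg Y) (<⇒≤ 0<1) (≤-trans (small X) ½≤1) (≤-trans (small Y) ½≤1))) close ⟩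
  1ℚ * 1ℚ * ε                       ≡⟨ *-identityˡ ε ⟩
  ε                                 ∎
  where
  open ≤-Reasoning
  open IsReciprocal
  ½≤1 : ½ ≤ 1ℚ
  ½≤1 = from-diff {r = ½} (nonNegative⁻¹ ½) refl
  cross-multiply : x * S ≡ 1ℚ → y * S′ ≡ 1ℚ → x - y ≡ x * y * (S′ - S)
  cross-multiply xS yS′ = sym (trans (expand x y S S′) (trans (cong₂ (λ p q → x * q - y * p) xS yS′) (cong₂ _-_ (*-identityʳ x) (*-identityʳ y))))
    where
    expand : ∀ x y S S′ → x * y * (S′ - S) ≡ x * (y * S′) - y * (x * S)
    expand = solve-∀ ringℚ

1/π : ℝ
1/π = mkℝ 1/leibnizSum λ ε 0<ε → let N , close = cauchy π ε 0<ε in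
  suc N , λ m n N<m N<n → reciprocal-close (1/leibnizSum-reciprocal m (ℕ.≤-trans (s≤s z≤n) N<m)) (1/leibnizSum-reciprocal n (ℕ.≤-trans (s≤s z≤n) N<n)) (<⇒≤ 0<ε)
    (close n m (ℕ.≤-trans (ℕ.n≤1+n N) N<n) (ℕ.≤-trans (ℕ.n≤1+n N) N<m))

-- The relative deviation of μ from 2 π² / n².
deviation : ℝ → ℕ → ℝ
deviation μ n = (μ *ᴿ fromℚ (½ * (ι n * ι n))) *ᴿ (1/π *ᴿ 1/π) +ᴿ -ᴿ 1ᴿ

-- From ρ ≤ ½ and r ≥ S - 2b follows r ρ ≥ 1 - b, so (r ρ)² ≥ 1 - 2b; the subtracted b ρ² costs at
-- most another b.
reciprocal-lower : ∀ {ρ S r b} → IsReciprocal ρ S → 0ℚ ≤ b → S - 2ℚ * b ≤ r → 1ℚ - 3ℚ * b ≤ (r * r - b) * (ρ * ρ)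
reciprocal-lower {ρ} {S} {r} {b} R 0≤b near = from-diff
  (0≤+ (0≤+ (0≤sq (r * ρ - 1ℚ)) (0≤* (0≤ι 2) 0≤rρ-1+b)) (0≤* 0≤b (diff (≤-trans (*-mono-≤ nonneg (nonNegative⁻¹ ½) small small) (from-diff {r = + 3 / 4} (nonNegative⁻¹ (+ 3 / 4)) refl)))))
  (identity r ρ b)
  where
  open IsReciprocal R
  identity : ∀ r x b → (r * r - b) * (x * x) - (1ℚ - 3ℚ * b) ≡ (r * x - 1ℚ) * (r * x - 1ℚ) + 2ℚ * (r * x - 1ℚ + b) + b * (1ℚ - x * x)
  identity = solve-∀ ringℚ
  0≤rρ-1+b : 0ℚ ≤ r * ρ - 1ℚ + b
  0≤rρ-1+b = subst (0ℚ ≤_) (trans (expand r ρ S b) (cong (λ z → r * ρ - z + b) product≡1)) (0≤+ (0≤* nonneg (diff near)) (0≤* 0≤b (0≤* (0≤ι 2) (diff small))))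
    where
    expand : ∀ r x S b → x * (r - (S - 2ℚ * b)) + b * (2ℚ * (½ - x)) ≡ r * x - x * S + b
    expand = solve-∀ ringℚ

reciprocal-upper : ∀ {ρ S r b} → IsReciprocal ρ S → 0ℚ ≤ b → b ≤ 1ℚ → 0ℚ ≤ r → r ≤ S + 2ℚ * b → r * r * (ρ * ρ) ≤ 1ℚ + 3ℚ * b
reciprocal-upper {ρ} {S} {r} {b} R 0≤b b≤1 0≤r near = begin
  r * r * (ρ * ρ)             ≡⟨ regroup r ρ ⟩
  r * ρ * (r * ρ)             ≤⟨ *-mono-≤ (0≤* 0≤r nonneg) (0≤+ (<⇒≤ 0<1) 0≤b) rρ≤ rρ≤ ⟩
  (1ℚ + b) * (1ℚ + b)         ≤⟨ from-diff (0≤* 0≤b (diff b≤1)) (excess b) ⟩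
  1ℚ + 3ℚ * b                 ∎
  where
  open ≤-Reasoning
  open IsReciprocal R
  regroup : ∀ r x → r * r * (x * x) ≡ r * x * (r * x)
  regroup = solve-∀ ringℚ
  excess : ∀ b → 1ℚ + 3ℚ * b - (1ℚ + b) * (1ℚ + b) ≡ b * (1ℚ - b)
  excess = solve-∀ ringℚ
  rρ≤ : r * ρ ≤ 1ℚ + b
  rρ≤ = from-diff (0≤+ (0≤* nonneg (diff near)) (0≤* 0≤b (0≤* (0≤ι 2) (diff small)))) (trans (cong (λ z → z + b - r * ρ) (sym product≡1)) (sym (expand r ρ S b)))
    where
    expand : ∀ r x S b → x * (S + 2ℚ * b - r) + b * (2ℚ * (½ - x)) ≡ x * S + b - r * x
    expand = solve-∀ ringℚ

rescale : ∀ {n u} → n * u ≡ 1ℚ → ∀ x y → 2ℚ * x * (u * u) * (½ * (n * n)) * y ≡ x * y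
rescale {n} {u} nu≡1 x y = trans (regroup n u x y) (trans (cong (λ z → z * z * (x * y)) nu≡1) (*-identityˡ (x * y)))
  where
  regroup : ∀ n u x y → 2ℚ * x * (u * u) * (½ * (n * n)) * y ≡ n * u * (n * u) * (x * y)
  regroup = solve-∀ ringℚ

½δ≤δ : ∀ {δ ρ S} → IsReciprocal ρ S → 0ℚ ≤ δ → ½ * δ * (ρ * ρ) ≤ δ
½δ≤δ {δ} {ρ} R 0≤δ = ≤-trans (*-monoˡ (0≤* (nonNegative⁻¹ ½) 0≤δ) (*-mono-≤ nonneg (nonNegative⁻¹ ½) small small)) (from-diff (0≤* (nonNegative⁻¹ (+ 7 / 8)) 0≤δ) (identity δ))
  where
  open IsReciprocal R
  identity : ∀ d → d - ½ * d * (½ * ½) ≡ (+ 7 / 8) * d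
  identity = solve-∀ ringℚ

scaled-lower : ∀ {n u ρ S μ v δ} → n * u ≡ 1ℚ → IsReciprocal ρ S → 0ℚ ≤ δ → 2ℚ * v * (u * u) ≤ μ + δ * (u * u) → v * (ρ * ρ) ≤ μ * (½ * (n * n)) * (ρ * ρ) + δ
scaled-lower {n} {u} {ρ} {S} {μ} {v} {δ} nu≡1 R 0≤δ bound = begin
  v * (ρ * ρ)                                                 ≡⟨ rescale {n} {u} nu≡1 v (ρ * ρ) ⟨
  2ℚ * v * (u * u) * (½ * (n * n)) * (ρ * ρ)                  ≤⟨ *-monoʳ-≤-nonNeg (ρ * ρ) {{nonNegative (0≤sq ρ)}} (*-monoʳ-≤-nonNeg (½ * (n * n)) {{nonNegative (0≤* (nonNegative⁻¹ ½) (0≤sq n))}} bound) ⟩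
  (μ + δ * (u * u)) * (½ * (n * n)) * (ρ * ρ)                 ≡⟨ expand μ δ u (½ * (n * n)) ρ ⟩
  μ * (½ * (n * n)) * (ρ * ρ) + 2ℚ * (½ * δ) * (u * u) * (½ * (n * n)) * (ρ * ρ) ≡⟨ cong (λ z → μ * (½ * (n * n)) * (ρ * ρ) + z) (rescale {n} {u} nu≡1 (½ * δ) (ρ * ρ)) ⟩
  μ * (½ * (n * n)) * (ρ * ρ) + ½ * δ * (ρ * ρ)               ≤⟨ +-monoʳ-≤ (μ * (½ * (n * n)) * (ρ * ρ)) (½δ≤δ R 0≤δ) ⟩
  μ * (½ * (n * n)) * (ρ * ρ) + δ                             ∎
  where
  open ≤-Reasoning
  expand : ∀ m d u q x → (m + d * (u * u)) * q * (x * x) ≡ m * q * (x * x) + 2ℚ * (½ * d) * (u * u) * q * (x * x)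
  expand = solve-∀ ringℚ

scaled-upper : ∀ {n u ρ S μ v δ} → n * u ≡ 1ℚ → IsReciprocal ρ S → 0ℚ ≤ δ → μ ≤ 2ℚ * v * (u * u) + δ * (u * u) → μ * (½ * (n * n)) * (ρ * ρ) ≤ v * (ρ * ρ) + δ
scaled-upper {n} {u} {ρ} {S} {μ} {v} {δ} nu≡1 R 0≤δ bound = begin
  μ * (½ * (n * n)) * (ρ * ρ)                                 ≤⟨ *-monoʳ-≤-nonNeg (ρ * ρ) {{nonNegative (0≤sq ρ)}} (*-monoʳ-≤-nonNeg (½ * (n * n)) {{nonNegative (0≤* (nonNegative⁻¹ ½) (0≤sq n))}} bound) ⟩
  (2ℚ * v * (u * u) + δ * (u * u)) * (½ * (n * n)) * (ρ * ρ)  ≡⟨ expand v δ u (½ * (n * n)) ρ ⟩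
  2ℚ * (v + ½ * δ) * (u * u) * (½ * (n * n)) * (ρ * ρ)        ≡⟨ rescale {n} {u} nu≡1 (v + ½ * δ) (ρ * ρ) ⟩
  (v + ½ * δ) * (ρ * ρ)                                       ≡⟨ *-distribʳ-+ (ρ * ρ) v (½ * δ) ⟩
  v * (ρ * ρ) + ½ * δ * (ρ * ρ)                               ≤⟨ +-monoʳ-≤ (v * (ρ * ρ)) (½δ≤δ R 0≤δ) ⟩
  v * (ρ * ρ) + δ                                             ∎
  where
  open ≤-Reasoning
  expand : ∀ v d u q x → (2ℚ * v * (u * u) + d * (u * u)) * q * (x * x) ≡ 2ℚ * (v + ½ * d) * (u * u) * q * (x * x)
  expand = solve-∀ ringℚ

-- Even sums serve the lower bound and odd sums the upper one. The margin b supplies the strict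
-- inequalities with r that both bounds demand, and the Cauchy property keeps the two choices of r
-- within 2b of all later sums.
leibniz-sandwich : ∀ b → 0ℚ < b → b ≤ 1ℚ → ∃ λ K → leibnizSign K ≡ 1ℚ × 0ℚ < leibnizSum K - b × 0ℚ < leibnizSum (suc K) + b ×
  ∃ λ N → ∀ j → N ℕ.≤ j → leibnizSum j - 2ℚ * b ≤ leibnizSum K - b × leibnizSum (suc K) + b ≤ leibnizSum j + 2ℚ * b
leibniz-sandwich b 0<b b≤1 = K , sign-even (suc N) , diff-< (≤-<-trans b≤1 (<-≤-trans (from-diff-< {r = 1ℚ} 0<1 refl) (leibnizSum-even≥2 N))) , +-mono-<-≤ (0<leibnizSum K) (<⇒≤ 0<b) , N ,
  λ j N≤j → from-diff (diff (≤-trans (p≤∣p∣ (leibnizSum j - leibnizSum K)) (close j K N≤j N≤K))) (below (leibnizSum j) (leibnizSum K) b) ,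
            from-diff (diff (≤-trans (p≤∣p∣ (leibnizSum (suc K) - leibnizSum j)) (close (suc K) j (ℕ.≤-trans N≤K (ℕ.n≤1+n K)) N≤j))) (above (leibnizSum j) (leibnizSum (suc K)) b)
  where
  N = proj₁ (cauchy π b 0<b)
  close = proj₂ (cauchy π b 0<b)
  K = double (suc N)
  N≤K : N ℕ.≤ K
  N≤K = ℕ.≤-trans (ℕ.n≤1+n N) (ℕ.≤-trans (ℕ.m≤m+n (suc N) (suc N)) (ℕ.≤-reflexive (sym (double≡+ (suc N)))))
  below : ∀ x y b → y - b - (x - 2ℚ * b) ≡ b - (x - y)
  below = solve-∀ ringℚ
  above : ∀ x y b → x + 2ℚ * b - (y + b) ≡ b - (y - x)
  above = solve-∀ ringℚ

module Deviation {n : ℕ} {u : ℚ} (nu≡1 : ι n * u ≡ 1ℚ) (0<u : 0ℚ < u) {b : ℚ} (0<b : 0ℚ < b) {N : ℕ} where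
  open ≤-Reasoning

  deviation-lower : ∀ {r μ ε} → (∀ j → N ℕ.≤ j → leibnizSum j - 2ℚ * b ≤ r) → 3ℚ * b ≤ ε → fromℚ (2ℚ * (r * r - b) * (u * u)) ≤ᴿ μ → fromℚ (- ε) ≤ᴿ deviation μ n
  deviation-lower {r} {μ} {ε} near 3b≤ε bound ε₁ 0<ε₁ = suc N ℕ.⊔ M , λ j ≤j →
    let N<j = ℕ.≤-trans (ℕ.m≤m⊔n (suc N) M) ≤j
        R   = 1/leibnizSum-reciprocal j (ℕ.≤-trans (s≤s z≤n) N<j)
    in conclude {(r * r - b) * (1/leibnizSum j * 1/leibnizSum j)} {seq μ j * (½ * (ι n * ι n)) * (1/leibnizSum j * 1/leibnizSum j)} (reciprocal-lower R (<⇒≤ 0<b) (near j (ℕ.≤-trans (ℕ.n≤1+n N) N<j)))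
         (scaled-lower {ι n} {u} {1/leibnizSum j} {leibnizSum j} {seq μ j} {r * r - b} {ε₁} nu≡1 R (<⇒≤ 0<ε₁) (proj₂ (bound (ε₁ * (u * u)) 0<ε₁u²) j (ℕ.≤-trans (ℕ.m≤n⊔m (suc N) M) ≤j)))
    where
    -- The deviation multiplies μ by n² / 2, so μ is needed with an accuracy of order 1 / n².
    0<ε₁u² : 0ℚ < ε₁ * (u * u)
    0<ε₁u² = 0<* 0<ε₁ (0<* 0<u 0<u)
    M = proj₁ (bound (ε₁ * (u * u)) 0<ε₁u²)
    conclude : ∀ {x y} → 1ℚ - 3ℚ * b ≤ x → x ≤ y + ε₁ → - ε ≤ y + - 1ℚ + ε₁
    conclude {x} {y} 1-3b≤x x≤ = from-diff (0≤+ (diff 3b≤ε) (0≤+ (diff 1-3b≤x) (diff x≤))) (identity x y ε ε₁ b)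
      where
      identity : ∀ x y e d b → y + - 1ℚ + d - (- e) ≡ (e - 3ℚ * b) + ((x - (1ℚ - 3ℚ * b)) + (y + d - x))
      identity = solve-∀ ringℚ

  deviation-upper : ∀ {r μ ε} → b ≤ 1ℚ → 0ℚ ≤ r → (∀ j → N ℕ.≤ j → r ≤ leibnizSum j + 2ℚ * b) → 3ℚ * b ≤ ε → μ ≤ᴿ fromℚ (2ℚ * (r * u * (r * u))) → deviation μ n ≤ᴿ fromℚ ε
  deviation-upper {r} {μ} {ε} b≤1 0≤r near 3b≤ε bound ε₁ 0<ε₁ = suc N ℕ.⊔ M , λ j ≤j →
    let N<j = ℕ.≤-trans (ℕ.m≤m⊔n (suc N) M) ≤j
        R   = 1/leibnizSum-reciprocal j (ℕ.≤-trans (s≤s z≤n) N<j)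
    in conclude {r * r * (1/leibnizSum j * 1/leibnizSum j)} {seq μ j * (½ * (ι n * ι n)) * (1/leibnizSum j * 1/leibnizSum j)} (reciprocal-upper R (<⇒≤ 0<b) b≤1 0≤r (near j (ℕ.≤-trans (ℕ.n≤1+n N) N<j)))
         (scaled-upper {ι n} {u} {1/leibnizSum j} {leibnizSum j} {seq μ j} {r * r} {ε₁} nu≡1 R (<⇒≤ 0<ε₁)
           (≤-trans (proj₂ (bound (ε₁ * (u * u)) 0<ε₁u²) j (ℕ.≤-trans (ℕ.m≤n⊔m (suc N) M) ≤j)) (≤-reflexive (cong (_+ ε₁ * (u * u)) (regroup r u)))))
    where
    0<ε₁u² : 0ℚ < ε₁ * (u * u)
    0<ε₁u² = 0<* 0<ε₁ (0<* 0<u 0<u)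
    M = proj₁ (bound (ε₁ * (u * u)) 0<ε₁u²)
    regroup : ∀ r u → 2ℚ * (r * u * (r * u)) ≡ 2ℚ * (r * r) * (u * u)
    regroup = solve-∀ ringℚ
    conclude : ∀ {x y} → x ≤ 1ℚ + 3ℚ * b → y ≤ x + ε₁ → y + - 1ℚ ≤ ε + ε₁
    conclude {x} {y} x≤ y≤ = from-diff (0≤+ (diff 3b≤ε) (0≤+ (diff x≤) (diff y≤))) (identity x y ε ε₁ b)
      where
      identity : ∀ x y e d b → e + d - (y + - 1ℚ) ≡ (e - 3ℚ * b) + ((1ℚ + 3ℚ * b - x) + (x + d - y))
      identity = solve-∀ ringℚ

-- From index 1 on, `1/leibnizSum j` is the exact inverse of `leibnizSum j`, so the two sequences
-- agree term by term and no limit is involved.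
deviation-equation : ∀ μ n .{{_ : NonZero n}} → μ ≈ (1ᴿ +ᴿ deviation μ n) *ᴿ 2π²/[ n ]²
deviation-equation μ (suc m) ε 0<ε = 1 , λ j 1≤j →
  ≤-trans (≤-reflexive (cong ℚ.∣_∣ (cancel {seq μ j} {½ * (ι n * ι n)} {+ 2 / (n ℕ.* n)} {1/leibnizSum j} {leibnizSum j} (IsReciprocal.product≡1 (1/leibnizSum-reciprocal j 1≤j)) scale))) (<⇒≤ 0<ε)
  where
  n = suc m
  scale : ½ * (ι n * ι n) * (+ 2 / (n ℕ.* n)) ≡ 1ℚ
  scale = trans (regroup (ι n * ι n) (+ 2 / (n ℕ.* n))) (trans (cong (λ z → ½ * (+ 2 / (n ℕ.* n) * z)) (sym (ι-* n n))) (trans (cong (½ *_) (/-cancel 2 (m ℕ.+ m ℕ.* suc m))) refl))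
    where
    regroup : ∀ s w → ½ * s * w ≡ ½ * (w * s)
    regroup = solve-∀ ringℚ
  cancel : ∀ {x q w ρ S} → ρ * S ≡ 1ℚ → q * w ≡ 1ℚ → x - (1ℚ + (x * q * (ρ * ρ) + - 1ℚ)) * (w * (S * S)) ≡ 0ℚ
  cancel {x} {q} {w} {ρ} {S} ρS qw = trans (regroup x q w ρ S) (trans (cong₂ (λ y z → x - x * z * (y * y)) ρS qw) (vanish x))
    where
    regroup : ∀ x q w r S → x - (1ℚ + (x * q * (r * r) + - 1ℚ)) * (w * (S * S)) ≡ x - x * (q * w) * (r * S * (r * S))
    regroup = solve-∀ ringℚ
    vanish : ∀ x → x - x * 1ℚ * (1ℚ * 1ℚ) ≡ 0ℚ
    vanish = solve-∀ ringℚ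

tolerance : ∀ {ε} → 0ℚ < ε → ∃ λ b → 0ℚ < b × b ≤ 1ℚ × 3ℚ * b ≤ ε
tolerance {ε} 0<ε with ≤-total ε 1ℚ
... | inj₁ ε≤1 = ⅓ * ε , 0<* (positive⁻¹ ⅓) 0<ε , ≤-trans (*-monoˡ (nonNegative⁻¹ ⅓) ε≤1) (from-diff {r = + 2 / 3} (nonNegative⁻¹ (+ 2 / 3)) refl) , ≤-reflexive (triple ε)
  where
  ⅓ = + 1 / 3
  triple : ∀ e → 3ℚ * ((+ 1 / 3) * e) ≡ e
  triple = solve-∀ ringℚ
... | inj₂ 1≤ε = + 1 / 3 , positive⁻¹ (+ 1 / 3) , from-diff {r = + 2 / 3} (nonNegative⁻¹ (+ 2 / 3)) refl , 1≤ε

-- The minimum is itself the connectivity of some graph, so the lower bound applies to it;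
-- minimality compares it with the chain of diamonds of the same order.
deviation-vanishes : (μmin : ℕ → ℝ) → (∀ n → 2 ∣ n → 4 ℕ.≤ n → IsMinimum (CubicConnectivity n) (μmin n)) → VanishesAlongEven (λ n → deviation (μmin n) n)
deviation-vanishes μmin minimal ε 0<ε = 4 ℕ.⊔ (proj₁ lower ℕ.⊔ proj₁ upper) , bounds
  where
  b = proj₁ (tolerance 0<ε)
  0<b = proj₁ (proj₂ (tolerance 0<ε))
  b≤1 = proj₁ (proj₂ (proj₂ (tolerance 0<ε)))
  3b≤ε = proj₂ (proj₂ (proj₂ (tolerance 0<ε)))
  sandwich = leibniz-sandwich b 0<b b≤1
  K = proj₁ sandwich
  sign = proj₁ (proj₂ sandwich)
  r r′ : ℚ
  r  = leibnizSum K - b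
  r′ = leibnizSum (suc K) + b
  0<r : 0ℚ < r
  0<r = proj₁ (proj₂ (proj₂ sandwich))
  0<r′ : 0ℚ < r′
  0<r′ = proj₁ (proj₂ (proj₂ (proj₂ sandwich)))
  N = proj₁ (proj₂ (proj₂ (proj₂ (proj₂ sandwich))))
  near : ∀ j → N ℕ.≤ j → leibnizSum j - 2ℚ * b ≤ r × r′ ≤ leibnizSum j + 2ℚ * b
  near = proj₂ (proj₂ (proj₂ (proj₂ (proj₂ sandwich))))
  lower = connectivity-lower-eventually K sign {r} {b} 0<r (from-diff-< 0<b (cancel (leibnizSum K) b)) 0<b
    where
    cancel : ∀ S b → S - (S - b) ≡ b
    cancel = solve-∀ ringℚ
  upper = connectivity-upper-eventually (suc K) (cong -_ sign) {r′} 0<r′ (from-diff-< 0<b (cancel (leibnizSum (suc K)) b))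
    where
    cancel : ∀ S b → S + b - S ≡ b
    cancel = solve-∀ ringℚ
  bounds : ∀ n → 2 ∣ n → 4 ℕ.⊔ (proj₁ lower ℕ.⊔ proj₁ upper) ℕ.≤ n → fromℚ (- ε) ≤ᴿ deviation (μmin n) n × deviation (μmin n) n ≤ᴿ fromℚ ε
  bounds zero    2∣n ≤n = contradiction (ℕ.≤-trans (ℕ.m≤m⊔n 4 (proj₁ lower ℕ.⊔ proj₁ upper)) ≤n) λ ()
  bounds (suc m) 2∣n@(divides q eq) ≤n =
    deviation-lower {r} {μmin n} {ε} (λ j N≤j → proj₁ (near j N≤j)) 3b≤ε (proj₂ lower n q size lower≤n nu≡1 {μmin n} (proj₁ minimum)) ,
    deviation-upper {r′} {μmin n} {ε} b≤1 (<⇒≤ 0<r′) (λ j N≤j → proj₂ (near j N≤j)) 3b≤ε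
      (≤ᴿ-trans {μmin n} {proj₁ chain} {fromℚ (2ℚ * (r′ * u * (r′ * u)))} (proj₂ minimum (proj₁ chain) (proj₁ (proj₂ chain))) (proj₂ (proj₂ chain)))
    where
    n = suc m
    minimum : IsMinimum (CubicConnectivity n) (μmin n)
    minimum = minimal n 2∣n (ℕ.≤-trans (ℕ.m≤m⊔n 4 (proj₁ lower ℕ.⊔ proj₁ upper)) ≤n)
    size : n ≡ double q
    size = trans eq (trans (ℕ.*-comm q 2) (2*≡double q))
    rest≤n : proj₁ lower ℕ.⊔ proj₁ upper ℕ.≤ n
    rest≤n = ℕ.≤-trans (ℕ.m≤n⊔m 4 (proj₁ lower ℕ.⊔ proj₁ upper)) ≤n
    lower≤n : proj₁ lower ℕ.≤ n
    lower≤n = ℕ.≤-trans (ℕ.m≤m⊔n (proj₁ lower) (proj₁ upper)) rest≤n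
    u = recip (0<ι m)
    nu≡1 : ι n * u ≡ 1ℚ
    nu≡1 = recip-inverse (0<ι m)
    chain : Σ[ μ ∈ ℝ ] CubicConnectivity n μ × μ ≤ᴿ fromℚ (2ℚ * (r′ * u * (r′ * u)))
    chain = proj₂ upper n q size (ℕ.≤-trans (ℕ.m≤n⊔m (proj₁ lower) (proj₁ upper)) rest≤n) nu≡1
    open Deviation {n} {u} nu≡1 (recip-pos (0<ι m)) {b} 0<b {N}

theorem2p2 :
  (μmin : ℕ → ℝ) →
  (∀ n → 2 ∣ n → 4 ℕ.≤ n → IsMinimum (CubicConnectivity n) (μmin n)) →
  Σ[ o ∈ (ℕ → ℝ) ]
    VanishesAlongEven o ×
    (∀ n → .{{_ : NonZero n}} → 2 ∣ n → 4 ℕ.≤ n →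
      μmin n ≈ (1ᴿ +ᴿ o n) *ᴿ 2π²/[ n ]²)
theorem2p2 μmin minimal = (λ n → deviation (μmin n) n) , deviation-vanishes μmin minimal , λ n _ _ → deviation-equation (μmin n) n
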